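{- Let $\lambda/\mu$ and $\nu/\rho$ be any two skew shapes. Then $$s_{\lfloor\frac{\lambda+\nu}{2}\rfloor/\lfloor\frac{\mu+\rho}{2}\rfloor}\; s_{\lceil\frac{\lambda+\nu}{2}\rceil/\lceil\frac{\mu+\rho}{2}\rceil} - s_{\lambda/\mu}\, s_{\nu/\rho}$$ is Schur nonnegative.
   Context: Partitions are padded with zeros; the operations $\lambda+\nu$, division by $2$, $\lfloor\cdot\rfloor$ and $\lceil\cdot\rceil$ are performed coordinatewise. A skew shape $\lambda/\mu$ is a pair of partitions with $\mu_i\le\lambda_i$ for all $i$; $s_{\lambda/\mu}$ is the skew Schur function. A symmetric function is Schur nonnegative if it is a nonnegative linear combination of Schur functions. -}

module Defs where

open import Data.Nat using (ℕ; zero; suc; _+_; _∸_; _≤_; _⊔_; _≤ᵇ_; _≡ᵇ_; ⌊_/2⌋; ⌈_/2⌉)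
open import Data.Bool using (Bool; true; false; _∧_; if_then_else_)
open import Data.List using (List; []; _∷_; map; concatMap; upTo; filterᵇ; length; zipWith; foldr)
open import Data.Nat.ListAction using (sum)
open import Data.List using (all)
open import Data.List.Relation.Unary.All using (All)
open import Data.Product using (Σ; _×_; _,_; proj₁)
open import Data.Integer as ℤ using (ℤ; +_)
open import Relation.Binary.PropositionalEquality using (_≡_)

-- Partitions / weak compositions are lists of naturals, implicitly padded with zeros.
at : List ℕ → ℕ → ℕ
at [] _ = 0
at (x ∷ _) zero = x
at (_ ∷ xs) (suc i) = at xs i

IsPartition : List ℕ → Set
IsPartition p = ∀ i → at p (suc i) ≤ at p i

Contained : List ℕ → List ℕ → Set
Contained mu la = ∀ i → at mu i ≤ at la i

addPad : List ℕ → List ℕ → List ℕ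
addPad [] ys = ys
addPad (x ∷ xs) [] = x ∷ xs
addPad (x ∷ xs) (y ∷ ys) = (x + y) ∷ addPad xs ys

floorHalf : List ℕ → List ℕ → List ℕ
floorHalf a b = map ⌊_/2⌋ (addPad a b)

ceilHalf : List ℕ → List ℕ → List ℕ
ceilHalf a b = map ⌈_/2⌉ (addPad a b)

box : List ℕ → List (List ℕ)
box [] = [] ∷ []
box (u ∷ us) = concatMap (λ x → map (x ∷_) (box us)) (upTo (suc u))

isHStrip : List ℕ → List ℕ → Bool
isHStrip nu mu =
  all (λ j → (at mu j ≤ᵇ at nu j) ∧ (at nu (suc j) ≤ᵇ at mu j))
      (upTo (suc (length nu ⊔ length mu)))

padEq : List ℕ → List ℕ → Bool
padEq a b = all (λ j → at a j ≡ᵇ at b j) (upTo (length a ⊔ length b))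

strips : List ℕ → List ℕ → ℕ → List (List ℕ)
strips la mu k = filterᵇ (λ nu → isHStrip nu mu ∧ (sum nu ≡ᵇ (sum mu + k))) (box la)

-- number of semistandard Young tableaux of shape la/mu with content α
-- (a SSYT = chain mu = ν⁰ ⊆ ν¹ ⊆ … ⊆ νᵏ = la of horizontal strips, |νⁱ/νⁱ⁻¹| = αᵢ)
sstCount : List ℕ → List ℕ → List ℕ → ℕ
sstCount la mu [] = if padEq la mu then 1 else 0
sstCount la mu (a ∷ α) = sum (map (λ nu → sstCount la nu α) (strips la mu a))

-- A symmetric function (in x₁, x₂, …) is represented by its coefficient function:
-- α ↦ coefficient of the monomial x^α, α a finite weak composition.
SymFun : Set
SymFun = List ℕ → ℤ

skewSchur : List ℕ → List ℕ → SymFun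
skewSchur la mu α = + sstCount la mu α

schur : List ℕ → SymFun
schur ka = skewSchur ka []

_*ˢ_ : SymFun → SymFun → SymFun
(f *ˢ g) α = foldr ℤ._+_ (+ 0) (map (λ β → f β ℤ.* g (zipWith _∸_ α β)) (box α))

_-ˢ_ : SymFun → SymFun → SymFun
(f -ˢ g) α = f α ℤ.- g α

SchurNonneg : SymFun → Set
SchurNonneg F =
  Σ (List (List ℕ × ℕ)) λ L →
    All (λ p → IsPartition (proj₁ p)) L ×
    (∀ α → F α ≡ foldr ℤ._+_ (+ 0) (map (λ { (ka , c) → + c ℤ.* schur ka α }) L))

{-# OPTIONS --safe #-}
module Submission where

-- A pair of tableaux is a chain of merged rows whose even entries belong to the first tableau and
-- whose odd entries belong to the second; the letters are the steps of the chain.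
--
-- Reduction.  Shifting ν / ρ by a constant c does not change its Schur function.  Take c to be half the
-- largest difference between λ and ν and replace the two shapes by their entrywise maximum and minimum:
-- this halves the difference, and once it is at most 1 the shapes are the ceiling and the floor of the
-- half sum, up to a shift.  So it suffices that passing to maximum and minimum adds something Schur
-- nonnegative.
--
-- Maximum and minimum.  Join the pairs of corresponding entries of consecutive rows that can only be
-- exchanged simultaneously.  If no component of this graph forces a contradiction between the two ends,
-- exchanging along a 0/1 labelling of the components is a bijection between pairs of tableaux of the given
-- shapes and the separable pairs of the sorted shapes; so the difference counts the nonseparable pairs.
--
-- Positivity.  For one row between two fixed neighbours, separability depends only on which of a few links
-- between its entries are locked, and a lock shrinks two of the intervals in which the entries range
-- without moving the centre of their product.  By inclusion and exclusion reversing the row sum about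
-- the centre preserves the numbers of nonseparable pairs.  Applied to the whole row this proves symmetry in
-- the weight; applied to the left of the first violation of the lattice condition it cancels all
-- violating pairs after antisymmetrization.  Hence the coefficient of a Schur function in the difference
-- is the number of nonseparable pairs satisfying the lattice condition.

-- Reflecting the entries of a row in their intervals reverses the row sum but need not keep a
-- locked link locked, so nonseparable pairs are counted rather than matched. For this reason a link
-- is a pair of one-sided bounds with a prescribed total: the sum over all rows with a given pattern
-- of locks is then reversible, although no map respecting the pattern is constructed.
--
-- The two tableaux are read simultaneously, by columns from right to left. A full round of
-- positions then contains a given letter at most once per tableau; this confines the letters around
-- a first violation so strongly that the cut leaves each link either untouched or already decided.
--
-- Coefficients of Schur functions are extracted by testing against functions antisymmetric under
-- the dot action, in place of multiplying by the Vandermonde determinant. For a straight shape the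
-- lattice condition leaves a single tableau. The tests determine a symmetric function because its
-- pairing with alternants is unitriangular with respect to the sum of squares of the exponents.

open import Defs
open import Data.Nat using (_≤ᵇ_; _≡ᵇ_; ℕ; zero; suc; _+_; _*_; _∸_; _≤_; _<_; z≤n; s≤s; _⊔_; _⊓_; _≤?_; _<?_; ⌊_/2⌋; ⌈_/2⌉)
open import Data.Nat.Properties
open import Data.Nat.DivMod using (_/_; /-monoˡ-≤; +-distrib-/-∣ʳ; n/n≡1; m<n⇒m/n≡0)
open import Data.Nat.Divisibility using (∣-refl)
open import Data.Nat.Tactic.RingSolver using (solve-∀)
open import Relation.Binary.Definitions using (tri<; tri≈; tri>)
open import Data.Nat.ListAction using (sum)
open import Data.Bool using (Bool; true; false; T; _∧_)
import Data.Bool.Properties as 𝔹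
open import Data.Integer using (ℤ; +_; -[1+_]) renaming (_+_ to _⊕_; -_ to ⊝_; _-_ to _⊟_)
import Data.Integer as ℤ
import Data.Integer.Properties as ℤₚ
open import Data.List using (List; []; _∷_; _++_; map; concatMap; upTo; length; foldr; applyUpTo; replicate; zipWith; filterᵇ)
open import Data.List.Properties using (≡-dec; length-++; length-map; map-++; map-injective; length-applyUpTo; length-replicate; ∷-injectiveˡ; ∷-injectiveʳ)
open import Data.List.Relation.Unary.All using (All; []; _∷_)
import Data.List.Relation.Unary.All as All
open import Data.List.Relation.Unary.All.Properties using (++⁺; ++⁻; applyUpTo⁺₂)
open import Data.List.Relation.Unary.Unique.Propositional.Properties using (upTo⁺)
open import Data.List.Relation.Unary.Any using (Any; here; there)
import Data.List.Relation.Unary.Any as Any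
open import Data.List.Relation.Unary.AllPairs using (AllPairs; []; _∷_)
open import Data.List.Membership.Propositional using (_∈_)
open import Data.List.Membership.Propositional.Properties using (∈-upTo⁺)
open import Data.Product using (∃; _×_; _,_; proj₁; proj₂)
open import Data.Sum using (_⊎_; inj₁; inj₂)
open import Data.Empty using (⊥; ⊥-elim)
open import Data.Unit using (⊤; tt)
open import Algebra.Properties.CommutativeSemigroup +-commutativeSemigroup using () renaming (interchange to +-interchange)
open import Algebra.Properties.CommutativeSemigroup ℤₚ.+-commutativeSemigroup using () renaming (interchange to ⊕-interchange)
open import Function using (_∘_; id; case_of_)
open import Function.Bundles using (Equivalence)
open import Relation.Nullary using (¬_; Dec; yes; no; does)
open import Relation.Nullary.Decidable using (_×-dec_; _→-dec_; ¬?)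
open import Relation.Binary.PropositionalEquality using (_≡_; _≢_; refl; sym; trans; cong; cong₂; subst; subst₂; module ≡-Reasoning)

-- The product of integers unfolds eagerly; an opaque copy keeps summands inferable.
infixl 7 _⊗_
opaque
  _⊗_ : ℤ → ℤ → ℤ
  _⊗_ = ℤ._*_

  ⊗-def : ∀ x y → x ⊗ y ≡ x ℤ.* y
  ⊗-def x y = refl

  ⊗-identityˡ : ∀ x → + 1 ⊗ x ≡ x
  ⊗-identityˡ = ℤₚ.*-identityˡ

  ⊗-zeroˡ : ∀ x → + 0 ⊗ x ≡ + 0
  ⊗-zeroˡ x = refl

  ⊗-zeroʳ : ∀ x → x ⊗ + 0 ≡ + 0
  ⊗-zeroʳ = ℤₚ.*-zeroʳ

  ⊗-assoc : ∀ x y z → x ⊗ y ⊗ z ≡ x ⊗ (y ⊗ z)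
  ⊗-assoc = ℤₚ.*-assoc

  ⊗-comm : ∀ x y → x ⊗ y ≡ y ⊗ x
  ⊗-comm = ℤₚ.*-comm

  ⊗-distribˡ-⊕ : ∀ x y z → x ⊗ (y ⊕ z) ≡ x ⊗ y ⊕ x ⊗ z
  ⊗-distribˡ-⊕ = ℤₚ.*-distribˡ-+

  ⊗-⊝ʳ : ∀ x y → x ⊗ ⊝ y ≡ ⊝ (x ⊗ y)
  ⊗-⊝ʳ x y = sym (ℤₚ.neg-distribʳ-* x y)

⊗-distribˡ-⊟ : ∀ z x y → z ⊗ (x ⊟ y) ≡ z ⊗ x ⊟ z ⊗ y
⊗-distribˡ-⊟ z x y = trans (⊗-distribˡ-⊕ z x (⊝ y)) (cong (z ⊗ x ⊕_) (⊗-⊝ʳ z y))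

⊗-distribʳ-⊟ : ∀ z x y → (x ⊟ y) ⊗ z ≡ x ⊗ z ⊟ y ⊗ z
⊗-distribʳ-⊟ z x y = begin
  (x ⊟ y) ⊗ z       ≡⟨ ⊗-comm (x ⊟ y) z ⟩
  z ⊗ (x ⊟ y)       ≡⟨ ⊗-distribˡ-⊕ z x (⊝ y) ⟩
  z ⊗ x ⊕ z ⊗ ⊝ y   ≡⟨ cong₂ _⊕_ (⊗-comm z x) (trans (⊗-⊝ʳ z y) (cong ⊝_ (⊗-comm z y))) ⟩
  x ⊗ z ⊟ y ⊗ z     ∎
  where open ≡-Reasoning

-- Finite sums and indicators

private variable
  𝒜 ℬ : Set
  𝒫 𝒬 ℛ : Set

∑ : List 𝒜 → (𝒜 → ℤ) → ℤ
∑ []       f = + 0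
∑ (x ∷ xs) f = f x ⊕ ∑ xs f

ind : Dec 𝒫 → ℤ
ind (yes _) = + 1
ind (no  _) = + 0

ind-cong : (dP : Dec 𝒫) (dQ : Dec 𝒬) → (𝒫 → 𝒬) → (𝒬 → 𝒫) → ind dP ≡ ind dQ
ind-cong (yes p) (yes q) f g = refl
ind-cong (yes p) (no ¬q) f g = ⊥-elim (¬q (f p))
ind-cong (no ¬p) (yes q) f g = ⊥-elim (¬p (g q))
ind-cong (no ¬p) (no ¬q) f g = refl

ind-yes : (dP : Dec 𝒫) → 𝒫 → ind dP ≡ + 1
ind-yes (yes _) p = refl
ind-yes (no ¬p) p = ⊥-elim (¬p p)

ind-no : (dP : Dec 𝒫) → ¬ 𝒫 → ind dP ≡ + 0
ind-no (yes p) ¬p = ⊥-elim (¬p p)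
ind-no (no _) ¬p = refl

ind-*-cong : (dP : Dec 𝒫) {x y : ℤ} → (𝒫 → x ≡ y) → ind dP ⊗ x ≡ ind dP ⊗ y
ind-*-cong (yes p) h = cong (ind (yes p) ⊗_) (h p)
ind-*-cong (no ¬p) h = trans (⊗-zeroˡ _) (sym (⊗-zeroˡ _))

ind-*-zero : (dP : Dec 𝒫) {x : ℤ} → (𝒫 → x ≡ + 0) → ind dP ⊗ x ≡ + 0
ind-*-zero (yes p) {x} h = trans (⊗-identityˡ x) (h p)
ind-*-zero (no ¬p) h = ⊗-zeroˡ _

ind-× : (dP : Dec 𝒫) (dQ : Dec 𝒬) (dR : Dec ℛ) → (𝒫 → 𝒬 → ℛ) → (ℛ → 𝒫 × 𝒬) → ind dP ⊗ ind dQ ≡ ind dR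
ind-× (yes p) (yes q) (yes r) f g = ⊗-identityˡ _
ind-× (yes p) (yes q) (no ¬r) f g = ⊥-elim (¬r (f p q))
ind-× (yes p) (no ¬q) (yes r) f g = ⊥-elim (¬q (proj₂ (g r)))
ind-× (yes p) (no ¬q) (no ¬r) f g = ⊗-identityˡ _
ind-× (no ¬p) dQ (yes r) f g = ⊥-elim (¬p (proj₁ (g r)))
ind-× (no ¬p) dQ (no ¬r) f g = ⊗-zeroˡ _

ind-¬ : (dP : Dec 𝒫) (dQ : Dec (¬ 𝒫)) → ind dQ ≡ + 1 ⊟ ind dP
ind-¬ (yes p) (yes q) = ⊥-elim (q p)
ind-¬ (yes p) (no q) = refl
ind-¬ (no p) (yes q) = refl
ind-¬ (no p) (no q) = ⊥-elim (q p)

∑-cong : (xs : List 𝒜) {f g : 𝒜 → ℤ} → (∀ x → f x ≡ g x) → ∑ xs f ≡ ∑ xs g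
∑-cong []       h = refl
∑-cong (x ∷ xs) h = cong₂ _⊕_ (h x) (∑-cong xs h)

∑-zero : (xs : List 𝒜) {f : 𝒜 → ℤ} → (∀ x → f x ≡ + 0) → ∑ xs f ≡ + 0
∑-zero []       h = refl
∑-zero (x ∷ xs) h = cong₂ _⊕_ (h x) (∑-zero xs h)

∑-+ : (xs : List 𝒜) (f g : 𝒜 → ℤ) → ∑ xs (λ x → f x ⊕ g x) ≡ ∑ xs f ⊕ ∑ xs g
∑-+ []       f g = refl
∑-+ (x ∷ xs) f g = trans (cong (f x ⊕ g x ⊕_) (∑-+ xs f g)) (⊕-interchange (f x) (g x) _ _)

∑-*ˡ : (xs : List 𝒜) (c : ℤ) (f : 𝒜 → ℤ) → ∑ xs (λ x → c ⊗ f x) ≡ c ⊗ ∑ xs f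
∑-*ˡ []       c f = sym (⊗-zeroʳ c)
∑-*ˡ (x ∷ xs) c f = trans (cong (c ⊗ f x ⊕_) (∑-*ˡ xs c f)) (sym (⊗-distribˡ-⊕ c (f x) _))

∑-neg : (xs : List 𝒜) (f : 𝒜 → ℤ) → ∑ xs (λ x → ⊝ f x) ≡ ⊝ ∑ xs f
∑-neg []       f = refl
∑-neg (x ∷ xs) f = trans (cong (⊝ f x ⊕_) (∑-neg xs f)) (sym (ℤₚ.neg-distrib-+ (f x) _))

∑-− : (xs : List 𝒜) (f g : 𝒜 → ℤ) → ∑ xs (λ x → f x ⊟ g x) ≡ ∑ xs f ⊟ ∑ xs g
∑-− xs f g = trans (∑-+ xs f (λ x → ⊝ g x)) (cong (∑ xs f ⊕_) (∑-neg xs g))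

∑-++ : (xs ys : List 𝒜) (f : 𝒜 → ℤ) → ∑ (xs ++ ys) f ≡ ∑ xs f ⊕ ∑ ys f
∑-++ []       ys f = sym (ℤₚ.+-identityˡ _)
∑-++ (x ∷ xs) ys f = trans (cong (f x ⊕_) (∑-++ xs ys f)) (sym (ℤₚ.+-assoc (f x) _ _))

∑-map : (h : 𝒜 → ℬ) (xs : List 𝒜) (f : ℬ → ℤ) → ∑ (map h xs) f ≡ ∑ xs (f ∘ h)
∑-map h []       f = refl
∑-map h (x ∷ xs) f = cong (f (h x) ⊕_) (∑-map h xs f)

∑-concatMap : (h : 𝒜 → List ℬ) (xs : List 𝒜) (f : ℬ → ℤ) → ∑ (concatMap h xs) f ≡ ∑ xs (λ x → ∑ (h x) f)
∑-concatMap h []       f = refl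
∑-concatMap h (x ∷ xs) f = trans (∑-++ (h x) (concatMap h xs) f) (cong (∑ (h x) f ⊕_) (∑-concatMap h xs f))

∑-swap : (xs : List 𝒜) (ys : List ℬ) (f : 𝒜 → ℬ → ℤ) → ∑ xs (λ x → ∑ ys (f x)) ≡ ∑ ys (λ y → ∑ xs (λ x → f x y))
∑-swap []       ys f = sym (∑-zero ys (λ _ → refl))
∑-swap (x ∷ xs) ys f = trans (cong (∑ ys (f x) ⊕_) (∑-swap xs ys f)) (sym (∑-+ ys (f x) _))

self-negative : ∀ x → x ≡ ⊝ x → x ≡ + 0
self-negative (+ zero) _ = refl
self-negative (+ suc n) ()
self-negative -[1+ n ] ()

-- A list enumerating each element satisfying Ok exactly once.
record Enumerates {𝒜 : Set} (_≟A_ : (x y : 𝒜) → Dec (x ≡ y)) (Ok : 𝒜 → Set) (xs : List 𝒜) : Set₁ where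
  field
    pick  : ∀ y (f : 𝒜 → ℤ) → Ok y → ∑ xs (λ x → ind (x ≟A y) ⊗ f x) ≡ f y
    sound : All Ok xs

∑-cong-All : {Ok : 𝒜 → Set} {xs : List 𝒜} → All Ok xs → {f g : 𝒜 → ℤ} → (∀ x → Ok x → f x ≡ g x) → ∑ xs f ≡ ∑ xs g
∑-cong-All []         h = refl
∑-cong-All (ok ∷ oks) h = cong₂ _⊕_ (h _ ok) (∑-cong-All oks h)

module _ {𝒜 : Set} {_≟A_ : (x y : 𝒜) → Dec (x ≡ y)} {Ok : 𝒜 → Set} {xs : List 𝒜}
         (E : Enumerates _≟A_ Ok xs) where
  open Enumerates E

  -- Each term `f (σ x)` is spread into a sum over all `y` with `y ≡ σ x`. For an involution this
  -- relation is symmetric, so summing over `x` first collapses the double sum to `f y`.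
  ∑-involution : (σ : 𝒜 → 𝒜) → (∀ x → Ok x → Ok (σ x)) → (∀ x → Ok x → σ (σ x) ≡ x) →
                 (f : 𝒜 → ℤ) → ∑ xs (f ∘ σ) ≡ ∑ xs f
  ∑-involution σ Okσ σσ f = begin
    ∑ xs (f ∘ σ)
      ≡⟨ ∑-cong-All sound (λ x ox → sym (pick (σ x) f (Okσ x ox))) ⟩
    ∑ xs (λ x → ∑ xs (λ y → ind (y ≟A σ x) ⊗ f y))
      ≡⟨ ∑-swap xs xs _ ⟩
    ∑ xs (λ y → ∑ xs (λ x → ind (y ≟A σ x) ⊗ f y))
      ≡⟨ ∑-cong-All sound (λ y oy → trans
           (∑-cong-All sound (λ x ox → cong (_⊗ f y)
              (ind-cong (y ≟A σ x) (x ≟A σ y)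
                (λ e → trans (sym (σσ x ox)) (cong σ (sym e)))
                (λ e → trans (sym (σσ y oy)) (cong σ (sym e))))))
           (pick (σ y) (λ _ → f y) (Okσ y oy))) ⟩
    ∑ xs f ∎
    where open ≡-Reasoning

-- Classes are struck out one after the other, for every `y` in the list with a nonzero term; each
-- removal changes the sum by a class sum, that is by zero, and in the end every remaining term is
-- zero. Class sums are requested only at nonzero terms, since the properties that make them vanish
-- later are derived from a term being nonzero.
∑-classes : {Ok : 𝒜 → Set} {xs : List 𝒜} → All Ok xs →
            {_~_ : 𝒜 → 𝒜 → Set} (_~?_ : ∀ x y → Dec (x ~ y)) →
            (∀ x → x ~ x) → (∀ {x y} → x ~ y → y ~ x) → (∀ {x y z} → x ~ y → y ~ z → x ~ z) →
            (f : 𝒜 → ℤ) → (∀ x → Ok x → f x ≢ + 0 → ∑ xs (λ y → ind (x ~? y) ⊗ f y) ≡ + 0) →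
            ∑ xs f ≡ + 0
∑-classes {𝒜} {Ok} {xs} oks {_~_} _~?_ rfl sm tr f h = trans (sym (removed xs oks)) (∑-zero-∈ xs (λ x∈ → x∈))
  where
  Fresh : List 𝒜 → 𝒜 → Set
  Fresh ys x = All (λ y → f y ≢ + 0 → ¬ (y ~ x)) ys
  fresh? : ∀ ys x → Dec (Fresh ys x)
  fresh? ys x = All.all? (λ y → ¬? (f y ℤₚ.≟ + 0) →-dec ¬? (y ~? x)) ys
  g : List 𝒜 → 𝒜 → ℤ
  g ys x = ind (fresh? ys x) ⊗ f x
  ∑-zero-∈ : ∀ zs → (∀ {x} → x ∈ zs → x ∈ xs) → ∑ zs (g xs) ≡ + 0
  ∑-zero-∈ []       _   = refl
  ∑-zero-∈ (z ∷ zs) sub = cong₂ _⊕_ zero-at (∑-zero-∈ zs (sub ∘ there))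
    where
    zero-at : g xs z ≡ + 0
    zero-at with f z ℤₚ.≟ + 0
    ... | yes e = trans (cong (ind (fresh? xs z) ⊗_) e) (⊗-zeroʳ (ind (fresh? xs z)))
    ... | no ne = ind-*-zero (fresh? xs z) (λ fr → ⊥-elim (All.lookup fr (sub (here refl)) ne (rfl z)))
  -- If `y` is not fresh, its whole class has been struck out before; the factor for freshness of
  -- `y` prevents a second subtraction.
  split′ : ∀ y ys x → f y ≢ + 0 → (d : Dec (Fresh (y ∷ ys) x)) (d₁ : Dec (Fresh ys x)) (d₂ : Dec (Fresh ys y)) (d₃ : Dec (y ~ x)) →
           ind d ≡ ind d₁ ⊟ ind d₂ ⊗ ind d₃
  split′ y ys x ne (yes (p ∷ _)) _ _ (yes q) = ⊥-elim (p ne q)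
  split′ y ys x ne (yes (_ ∷ ps)) (no ¬p) _ (no _) = ⊥-elim (¬p ps)
  split′ y ys x ne (yes _) (yes _) d₂ (no _) = sym (cong (λ t → + 1 ⊟ t) (⊗-zeroʳ (ind d₂)))
  split′ y ys x ne (no ¬p) (yes q) _ (no ¬r) = ⊥-elim (¬p ((λ _ → ¬r) ∷ q))
  split′ y ys x ne (no _) (yes _) (yes _) (yes _) = sym (cong (λ t → + 1 ⊟ t) (⊗-identityˡ (+ 1)))
  split′ y ys x ne (no _) (yes q) (no ¬r) (yes yx) = ⊥-elim (¬r (All.map (λ k nz e → k nz (tr e yx)) q))
  split′ y ys x ne (no _) (no ¬q) (yes r) (yes yx) = ⊥-elim (¬q (All.map (λ k nz e → k nz (tr e (sm yx))) r))
  split′ y ys x ne (no _) (no _) (no _) (yes _) = sym (cong (λ t → + 0 ⊟ t) (⊗-zeroˡ (+ 1)))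
  split′ y ys x ne (no _) (no _) d₂ (no _) = sym (cong (λ t → + 0 ⊟ t) (⊗-zeroʳ (ind d₂)))
  split : ∀ y ys x → f y ≢ + 0 → g (y ∷ ys) x ≡ g ys x ⊟ ind (fresh? ys y) ⊗ (ind (y ~? x) ⊗ f x)
  split y ys x ne = trans (cong (_⊗ f x) (split′ y ys x ne (fresh? (y ∷ ys) x) (fresh? ys x) (fresh? ys y) (y ~? x)))
    (trans (⊗-distribʳ-⊟ (f x) _ _) (cong (g ys x ⊟_) (⊗-assoc (ind (fresh? ys y)) (ind (y ~? x)) (f x))))
  skip : ∀ y ys x → f y ≡ + 0 → g (y ∷ ys) x ≡ g ys x
  skip y ys x e = cong (_⊗ f x) (ind-cong (fresh? (y ∷ ys) x) (fresh? ys x) (λ { (_ ∷ p) → p }) (λ p → (λ ne → ⊥-elim (ne e)) ∷ p))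
  removed : ∀ ys → All Ok ys → ∑ xs (g ys) ≡ ∑ xs f
  removed []       _ = ∑-cong xs (λ x → ⊗-identityˡ (f x))
  removed (y ∷ ys) (oy ∷ oys) = by (f y ℤₚ.≟ + 0)
    where
    open ≡-Reasoning
    by : Dec (f y ≡ + 0) → ∑ xs (g (y ∷ ys)) ≡ ∑ xs f
    by (yes e) = trans (∑-cong xs (λ x → skip y ys x e)) (removed ys oys)
    by (no ne) = begin
      ∑ xs (g (y ∷ ys))
        ≡⟨ ∑-cong xs (λ x → split y ys x ne) ⟩
      ∑ xs (λ x → g ys x ⊟ ind (fresh? ys y) ⊗ (ind (y ~? x) ⊗ f x))
        ≡⟨ ∑-− xs _ _ ⟩
      ∑ xs (g ys) ⊟ ∑ xs (λ x → ind (fresh? ys y) ⊗ (ind (y ~? x) ⊗ f x))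
        ≡⟨ cong₂ _⊟_ (removed ys oys) (trans (∑-*ˡ xs _ _) (trans (cong (ind (fresh? ys y) ⊗_) (h y oy ne)) (⊗-zeroʳ (ind (fresh? ys y))))) ⟩
      ∑ xs f ⊟ + 0
        ≡⟨ ℤₚ.+-identityʳ _ ⟩
      ∑ xs f ∎

-- Boxes of rows and of arrays

∑-upTo-suc : ∀ n (f : ℕ → ℤ) → ∑ (upTo (suc n)) f ≡ f 0 ⊕ ∑ (upTo n) (f ∘ suc)
∑-upTo-suc n f = cong (f 0 ⊕_) (shift n id)
  where
  shift : ∀ n (g : ℕ → ℕ) → ∑ (applyUpTo (suc ∘ g) n) f ≡ ∑ (applyUpTo g n) (f ∘ suc)
  shift zero    g = refl
  shift (suc n) g = cong (f (suc (g 0)) ⊕_) (shift n (g ∘ suc))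

upTo-enumerates : ∀ n → Enumerates _≟_ (_< n) (upTo n)
upTo-enumerates n = record { pick = pick n ; sound = sound n }
  where
  pick : ∀ n y (f : ℕ → ℤ) → y < n → ∑ (upTo n) (λ x → ind (x ≟ y) ⊗ f x) ≡ f y
  pick (suc n) zero f y<n = trans (∑-upTo-suc n (λ x → ind (x ≟ 0) ⊗ f x))
    (trans (cong₂ _⊕_ (⊗-identityˡ (f 0)) (∑-zero (upTo n) (λ x → ind-*-zero (suc x ≟ 0) {f (suc x)} (λ ()))))
           (ℤₚ.+-identityʳ (f 0)))
  pick (suc n) (suc y) f (s≤s y<n) = trans (∑-upTo-suc n (λ x → ind (x ≟ suc y) ⊗ f x))
    (trans (cong₂ _⊕_ (ind-*-zero (0 ≟ suc y) {f 0} (λ ()))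
             (trans (∑-cong (upTo n) (λ x → cong (_⊗ f (suc x)) (ind-cong (suc x ≟ suc y) (x ≟ y) suc-injective (cong suc))))
                    (pick n y (f ∘ suc) y<n)))
           (ℤₚ.+-identityˡ _))
  sound : ∀ n → All (_< n) (upTo n)
  sound n = bounded n id (λ i<n → i<n)
    where
    bounded : ∀ k (h : ℕ → ℕ) → (∀ {i} → i < k → h i < n) → All (_< n) (applyUpTo h k)
    bounded zero    h b = []
    bounded (suc k) h b = b (s≤s z≤n) ∷ bounded k (h ∘ suc) (b ∘ s≤s)

product-enumerates : {_≟A_ : (x y : 𝒜) → Dec (x ≡ y)} {_≟C_ : (x y : List 𝒜) → Dec (x ≡ y)} {OkA : 𝒜 → Set} {OkL : List 𝒜 → Set}
  {xs : List 𝒜} {zs : List (List 𝒜)} → Enumerates _≟A_ OkA xs → Enumerates _≟C_ OkL zs →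
  (Ok : List 𝒜 → Set) → (∀ {x z} → OkA x → OkL z → Ok (x ∷ z)) → (∀ {x z} → Ok (x ∷ z) → OkA x × OkL z) → ¬ Ok [] →
  Enumerates _≟C_ Ok (concatMap (λ x → map (x ∷_) zs) xs)
product-enumerates {𝒜 = 𝒜} {_≟A_ = _≟A_} {_≟C_} {OkA} {OkL} {xs} {zs} EA EL Ok con des nil = record { pick = pick ; sound = concatAll EA.sound }
  where
  module EA = Enumerates EA
  module EL = Enumerates EL
  mapAll : ∀ {x zs} → OkA x → All OkL zs → All Ok (map (x ∷_) zs)
  mapAll ox []         = []
  mapAll ox (oz ∷ ozs) = con ox oz ∷ mapAll ox ozs
  appAll : ∀ {us vs} → All Ok us → All Ok vs → All Ok (us ++ vs)
  appAll []       q = q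
  appAll (p ∷ ps) q = p ∷ appAll ps q
  concatAll : ∀ {xs} → All OkA xs → All Ok (concatMap (λ x → map (x ∷_) zs) xs)
  concatAll []         = []
  concatAll (ox ∷ oxs) = appAll (mapAll ox EL.sound) (concatAll oxs)
  pick : ∀ y (f : List 𝒜 → ℤ) → Ok y → ∑ (concatMap (λ x → map (x ∷_) zs) xs) (λ x → ind (x ≟C y) ⊗ f x) ≡ f y
  pick [] f ok = ⊥-elim (nil ok)
  pick (y ∷ w) f ok = begin
    ∑ (concatMap (λ x → map (x ∷_) zs) xs) (λ x → ind (x ≟C (y ∷ w)) ⊗ f x)
      ≡⟨ ∑-concatMap _ xs _ ⟩
    ∑ xs (λ x → ∑ (map (x ∷_) zs) (λ u → ind (u ≟C (y ∷ w)) ⊗ f u))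
      ≡⟨ ∑-cong xs (λ x → ∑-map (x ∷_) zs _) ⟩
    ∑ xs (λ x → ∑ zs (λ z → ind ((x ∷ z) ≟C (y ∷ w)) ⊗ f (x ∷ z)))
      ≡⟨ ∑-cong xs (λ x → trans (∑-cong zs (λ z → trans
            (cong (_⊗ f (x ∷ z)) (sym (ind-× (x ≟A y) (z ≟C w) ((x ∷ z) ≟C (y ∷ w)) (cong₂ _∷_) (λ { refl → refl , refl }))))
            (⊗-assoc (ind (x ≟A y)) (ind (z ≟C w)) _))) (∑-*ˡ zs (ind (x ≟A y)) _)) ⟩
    ∑ xs (λ x → ind (x ≟A y) ⊗ ∑ zs (λ z → ind (z ≟C w) ⊗ f (x ∷ z)))
      ≡⟨ EA.pick y _ (proj₁ (des ok)) ⟩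
    ∑ zs (λ z → ind (z ≟C w) ⊗ f (y ∷ z))
      ≡⟨ EL.pick w _ (proj₂ (des ok)) ⟩
    f (y ∷ w) ∎
    where open ≡-Reasoning

Row : Set
Row = List ℕ

_≟ᴿ_ : (x y : Row) → Dec (x ≡ y)
_≟ᴿ_ = ≡-dec _≟_

_≟ᴬ_ : (x y : List Row) → Dec (x ≡ y)
_≟ᴬ_ = ≡-dec _≟ᴿ_

InBox : Row → Row → Set
InBox b x = length x ≡ length b × (∀ j → at x j ≤ at b j)

box-enumerates : ∀ b → Enumerates _≟ᴿ_ (InBox b) (box b)
box-enumerates [] = record
  { pick  = λ { [] f _ → trans (ℤₚ.+-identityʳ _) (⊗-identityˡ (f [])) ; (_ ∷ _) f (() , _) }
  ; sound = (refl , λ _ → z≤n) ∷ [] }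
box-enumerates (u ∷ us) = product-enumerates (upTo-enumerates (suc u)) (box-enumerates us) (InBox (u ∷ us))
  (λ { (s≤s x≤u) (e , h) → cong suc e , λ { zero → x≤u ; (suc j) → h j } })
  (λ { (e , h) → s≤s (h 0) , suc-injective e , λ j → h (suc j) })
  (λ { (() , _) })

arrays : Row → ℕ → List (List Row)
arrays b zero    = [] ∷ []
arrays b (suc m) = concatMap (λ u → map (u ∷_) (arrays b m)) (box b)

InArrays : Row → ℕ → List Row → Set
InArrays b m z = length z ≡ m × All (InBox b) z

arrays-enumerates : ∀ b m → Enumerates _≟ᴬ_ (InArrays b m) (arrays b m)
arrays-enumerates b zero = record
  { pick  = λ { [] f _ → trans (ℤₚ.+-identityʳ _) (⊗-identityˡ (f [])) ; (_ ∷ _) f (() , _) }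
  ; sound = (refl , []) ∷ [] }
arrays-enumerates b (suc m) = product-enumerates (box-enumerates b) (arrays-enumerates b m) (InArrays b (suc m))
  (λ { ou (e , h) → cong suc e , ou ∷ h })
  (λ { (e , ou ∷ h) → ou , suc-injective e , h })
  (λ { (() , _) })

∑-arrays-suc : ∀ b m (f : List Row → ℤ) → ∑ (arrays b (suc m)) f ≡ ∑ (box b) (λ u → ∑ (arrays b m) (λ z → f (u ∷ z)))
∑-arrays-suc b m f = trans (∑-concatMap _ (box b) f) (∑-cong (box b) (λ u → ∑-map (u ∷_) (arrays b m) f))

∑-box-∷ : ∀ u us (f : Row → ℤ) → ∑ (box (u ∷ us)) f ≡ ∑ (upTo (suc u)) (λ x → ∑ (box us) (λ y → f (x ∷ y)))
∑-box-∷ u us f = trans (∑-concatMap (λ x → map (x ∷_) (box us)) (upTo (suc u)) f) (∑-cong (upTo (suc u)) (λ x → ∑-map (x ∷_) (box us) f))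

-- Isolates the row at one level as the innermost sum, so that it can be reversed while all other
-- rows stay fixed.
∑-arrays-split : ∀ b i r (f : List Row → ℤ) →
  ∑ (arrays b (i + suc r)) f ≡ ∑ (arrays b i) (λ p → ∑ (arrays b r) (λ q → ∑ (box b) (λ v → f (p ++ v ∷ q))))
∑-arrays-split b zero r f = trans (∑-arrays-suc b r f) (trans (∑-swap (box b) (arrays b r) _) (sym (ℤₚ.+-identityʳ _)))
∑-arrays-split b (suc i) r f = trans (∑-arrays-suc b (i + suc r) f)
  (trans (∑-cong (box b) (λ u → ∑-arrays-split b i r (λ z → f (u ∷ z)))) (sym (∑-arrays-suc b i (λ p → ∑ (arrays b r) (λ q → ∑ (box b) (λ v → f (p ++ v ∷ q)))))))

-- Rows as functions with finite support

sumTo : ℕ → (ℕ → ℕ) → ℕ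
sumTo zero    f = 0
sumTo (suc n) f = f 0 + sumTo n (f ∘ suc)

sumTo-cong : ∀ n {f g : ℕ → ℕ} → (∀ {j} → j < n → f j ≡ g j) → sumTo n f ≡ sumTo n g
sumTo-cong zero    h = refl
sumTo-cong (suc n) h = cong₂ _+_ (h (s≤s z≤n)) (sumTo-cong n (h ∘ s≤s))

sumTo-mono : ∀ n {f g : ℕ → ℕ} → (∀ {j} → j < n → f j ≤ g j) → sumTo n f ≤ sumTo n g
sumTo-mono zero    h = z≤n
sumTo-mono (suc n) h = +-mono-≤ (h (s≤s z≤n)) (sumTo-mono n (h ∘ s≤s))

sumTo-+ : ∀ n (f g : ℕ → ℕ) → sumTo n (λ j → f j + g j) ≡ sumTo n f + sumTo n g
sumTo-+ zero    f g = refl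
sumTo-+ (suc n) f g = trans (cong (λ t → f 0 + g 0 + t) (sumTo-+ n (f ∘ suc) (g ∘ suc))) (+-interchange (f 0) (g 0) _ _)

sumTo-snoc : ∀ n (f : ℕ → ℕ) → sumTo (suc n) f ≡ sumTo n f + f n
sumTo-snoc zero    f = +-identityʳ (f 0)
sumTo-snoc (suc n) f = trans (cong (λ t → f 0 + t) (sumTo-snoc n (f ∘ suc))) (sym (+-assoc (f 0) _ _))

sumTo-zero : ∀ n {f : ℕ → ℕ} → (∀ {j} → j < n → f j ≡ 0) → sumTo n f ≡ 0
sumTo-zero zero    h = refl
sumTo-zero (suc n) h = cong₂ _+_ (h (s≤s z≤n)) (sumTo-zero n (h ∘ s≤s))

sumTo-≥ : ∀ n {f : ℕ → ℕ} {j} → j < n → f j ≤ sumTo n f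
sumTo-≥ (suc n) {f} {zero}  _       = m≤m+n (f 0) _
sumTo-≥ (suc n) {f} {suc j} (s≤s l) = ≤-trans (sumTo-≥ n {f ∘ suc} l) (m≤n+m _ (f 0))

sumTo-< : ∀ n {f g : ℕ → ℕ} → (∀ {j} → j < n → f j ≤ g j) → ∀ {j} → j < n → f j < g j → sumTo n f < sumTo n g
sumTo-< (suc n) h {zero}  _       l = +-mono-<-≤ l (sumTo-mono n (h ∘ s≤s))
sumTo-< (suc n) h {suc j} (s≤s p) l = +-mono-≤-< (h (s≤s z≤n)) (sumTo-< n (h ∘ s≤s) p l)

sumTo-≤1 : ∀ n {f : ℕ → ℕ} → (∀ {j} → j < n → f j ≤ 1) → (∀ {i j} → i < j → j < n → ¬ (f i ≡ 1 × f j ≡ 1)) → sumTo n f ≤ 1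
sumTo-≤1 zero        b x = z≤n
sumTo-≤1 (suc n) {f} b x = by (f 0) refl
  where
  by : ∀ k → f 0 ≡ k → sumTo (suc n) f ≤ 1
  by zero e = subst (λ t → t + sumTo n (f ∘ suc) ≤ 1) (sym e) (sumTo-≤1 n (b ∘ s≤s) (λ i<j j<n → x (s≤s i<j) (s≤s j<n)))
  by (suc zero) e = subst₂ (λ t u → t + u ≤ 1) (sym e) (sym (sumTo-zero n (λ {j} j<n → small j<n (f (suc j)) refl))) ≤-refl
    where
    small : ∀ {j} → j < n → ∀ k → f (suc j) ≡ k → f (suc j) ≡ 0
    small j<n zero          e′ = e′
    small j<n (suc zero)    e′ = ⊥-elim (x (s≤s z≤n) (s≤s j<n) (e , e′))
    small j<n (suc (suc k)) e′ = ⊥-elim (<⇒≱ (s≤s (s≤s z≤n)) (subst (_≤ 1) e′ (b (s≤s j<n))))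
  by (suc (suc k)) e = ⊥-elim (<⇒≱ (s≤s (s≤s z≤n)) (subst (_≤ 1) e (b (s≤s z≤n))))

-- A branch on a decision as an ordinary function: it can be evaluated by `choose-yes` and
-- `choose-no` inside a larger term, without abstracting over the decision.
choose : {A P : Set} → Dec P → A → A → A
choose (yes _) x y = x
choose (no  _) x y = y

choose-yes : {A P : Set} (d : Dec P) {x y : A} → P → choose d x y ≡ x
choose-yes (yes _) p = refl
choose-yes (no ¬p) p = ⊥-elim (¬p p)

choose-no : {A P : Set} (d : Dec P) {x y : A} → ¬ P → choose d x y ≡ y
choose-no (yes p) ¬p = ⊥-elim (¬p p)
choose-no (no _)  ¬p = refl

upd : (ℕ → ℕ) → ℕ → ℕ → ℕ → ℕ
upd f i x j = choose (j ≟ i) x (f j)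

upd-same : ∀ f i x → upd f i x i ≡ x
upd-same f i x = choose-yes (i ≟ i) refl

upd-other : ∀ f i x {j} → j ≢ i → upd f i x j ≡ f j
upd-other f i x {j} = choose-no (j ≟ i)

upd-elim : ∀ f i x j (Q : ℕ → Set) → (j ≡ i → Q x) → (j ≢ i → Q (f j)) → Q (upd f i x j)
upd-elim f i x j Q same other with j ≟ i
... | yes e = same e
... | no ne = other ne

sumTo-upd : ∀ n f {i} x → i < n → sumTo n (upd f i x) + f i ≡ sumTo n f + x
sumTo-upd (suc n) f {zero} x _ = begin
  x + sumTo n (upd f 0 x ∘ suc) + f 0 ≡⟨ cong (λ t → x + t + f 0) (sumTo-cong n (λ _ → upd-other f 0 x (λ ()))) ⟩
  x + sumTo n (f ∘ suc) + f 0 ≡⟨ +-comm _ (f 0) ⟩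
  f 0 + (x + sumTo n (f ∘ suc)) ≡⟨ cong (λ t → f 0 + t) (+-comm x _) ⟩
  f 0 + (sumTo n (f ∘ suc) + x) ≡⟨ sym (+-assoc (f 0) _ x) ⟩
  f 0 + sumTo n (f ∘ suc) + x ∎
  where open ≡-Reasoning
sumTo-upd (suc n) f {suc i} x (s≤s l) = begin
  f 0 + sumTo n (upd f (suc i) x ∘ suc) + f (suc i) ≡⟨ +-assoc (f 0) _ _ ⟩
  f 0 + (sumTo n (upd f (suc i) x ∘ suc) + f (suc i)) ≡⟨ cong (λ t → f 0 + (t + f (suc i))) (sumTo-cong n shifted) ⟩
  f 0 + (sumTo n (upd (f ∘ suc) i x) + f (suc i)) ≡⟨ cong (λ t → f 0 + t) (sumTo-upd n (f ∘ suc) x l) ⟩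
  f 0 + (sumTo n (f ∘ suc) + x) ≡⟨ sym (+-assoc (f 0) _ x) ⟩
  f 0 + sumTo n (f ∘ suc) + x ∎
  where
  open ≡-Reasoning
  shifted : ∀ {j} → j < n → upd f (suc i) x (suc j) ≡ upd (f ∘ suc) i x j
  shifted {j} _ = upd-elim (f ∘ suc) i x j (λ t → upd f (suc i) x (suc j) ≡ t)
    (λ { refl → upd-same f (suc i) x }) (λ ne → upd-other f (suc i) x (ne ∘ suc-injective))

row : ℕ → (ℕ → ℕ) → Row
row w f = applyUpTo f w

length-row : ∀ w f → length (row w f) ≡ w
length-row zero    f = refl
length-row (suc w) f = cong suc (length-row w (f ∘ suc))

at-row : ∀ w f {j} → j < w → at (row w f) j ≡ f j
at-row (suc w) f {zero}  _       = refl
at-row (suc w) f {suc j} (s≤s l) = at-row w (f ∘ suc) l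

at-beyond : ∀ x {j} → length x ≤ j → at x j ≡ 0
at-beyond []       _       = refl
at-beyond (x ∷ xs) (s≤s l) = at-beyond xs l

row-ext : ∀ {x y} → length x ≡ length y → (∀ {j} → j < length x → at x j ≡ at y j) → x ≡ y
row-ext {[]}    {[]}    _ _ = refl
row-ext {x ∷ xs} {y ∷ ys} e h = cong₂ _∷_ (h (s≤s z≤n)) (row-ext (suc-injective e) (h ∘ s≤s))

sum-sumTo : ∀ x → sum x ≡ sumTo (length x) (at x)
sum-sumTo []       = refl
sum-sumTo (x ∷ xs) = cong (λ t → x + t) (sum-sumTo xs)

-- Reversing a product of intervals

record Link : Set where
  constructor link
  field src tgt low high : ℕ
open Link public

Locked : Link → Row → Set
Locked L v = low L ≤ at v (src L) × at v (tgt L) ≤ high L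

locked? : ∀ L v → Dec (Locked L v)
locked? L v = (low L ≤? at v (src L)) ×-dec (at v (tgt L) ≤? high L)

Within : ℕ → (lo hi : ℕ → ℕ) → Row → Set
Within w lo hi v = ∀ {j} → j < w → lo j ≤ at v j × at v j ≤ hi j

within? : ∀ w lo hi v → Dec (Within w lo hi v)
within? w lo hi v = allUpTo? (λ j → (lo j ≤? at v j) ×-dec (at v j ≤? hi j)) w

-- The shrunk intervals may be empty: a lock that no row satisfies contributes zero on both sides of
-- a reversal.
record LinkOk (w : ℕ) (lo hi : ℕ → ℕ) (L : Link) : Set where
  field
    src<w    : src L < w
    tgt<w    : tgt L < w
    lo≤low   : lo (src L) ≤ low L
    high≤hi  : high L ≤ hi (tgt L)
    balanced : low L + high L ≡ lo (src L) + hi (tgt L)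

-- A lock replaces the lower bound at its source and the upper bound at its target. Under this
-- condition two links replace different bounds, so shrinking for one keeps the other balanced; the
-- source of one may well be the target of the other.
Disjoint : Link → Link → Set
Disjoint L M = src L ≢ src M × tgt L ≢ tgt M

SameLocks : List Link → Row → Row → Set
SameLocks Ls v v′ = All (λ L → (Locked L v → Locked L v′) × (Locked L v′ → Locked L v)) Ls

sameLocks? : ∀ Ls v v′ → Dec (SameLocks Ls v v′)
sameLocks? Ls v v′ = All.all? (λ L → (locked? L v →-dec locked? L v′) ×-dec (locked? L v′ →-dec locked? L v)) Ls

module Reversal (b : Row) (w : ℕ) (eb : length b ≡ w) where

  module _ (lo hi : ℕ → ℕ) (hi≤b : ∀ {j} → j < w → hi j ≤ at b j) where

    reflect : ∀ v → Dec (Within w lo hi v) → Row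
    reflect v (yes _) = row w (λ j → lo j + hi j ∸ at v j)
    -- Rows outside the product of intervals are left fixed, which makes the reflection an
    -- involution of the whole box.
    reflect v (no  _) = v

    σ : Row → Row
    σ v = reflect v (within? w lo hi v)

    at-reflect : ∀ v (d : Dec (Within w lo hi v)) → Within w lo hi v → ∀ {j} → j < w → at (reflect v d) j ≡ lo j + hi j ∸ at v j
    at-reflect v (yes _) _  j<w = at-row w _ j<w
    at-reflect v (no ¬p) p  j<w = ⊥-elim (¬p p)

    length-reflect : ∀ v (d : Dec (Within w lo hi v)) → length v ≡ w → length (reflect v d) ≡ w
    length-reflect v (yes _) _ = length-row w _
    length-reflect v (no _)  e = e

    within-reflect : ∀ v (d : Dec (Within w lo hi v)) → Within w lo hi v → Within w lo hi (reflect v d)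
    within-reflect v d p {j} j<w rewrite at-reflect v d p j<w =
      ≤-trans (≤-reflexive (sym (m+n∸n≡m (lo j) (hi j)))) (∸-monoʳ-≤ (lo j + hi j) (proj₂ (p j<w))) ,
      ≤-trans (∸-monoʳ-≤ (lo j + hi j) (proj₁ (p j<w))) (≤-reflexive (m+n∸m≡n (lo j) (hi j)))

    σ-ok : ∀ v → InBox b v → InBox b (σ v)
    σ-ok v (e , h) with within? w lo hi v
    ... | no _  = e , h
    ... | yes p = trans (length-row w _) (sym eb) , bound
      where
      bound : ∀ j → at (row w (λ j → lo j + hi j ∸ at v j)) j ≤ at b j
      bound j with j <? w
      ... | yes j<w = ≤-trans (≤-reflexive (at-row w _ j<w))
                       (≤-trans (≤-trans (∸-monoʳ-≤ (lo j + hi j) (proj₁ (p j<w))) (≤-reflexive (m+n∸m≡n (lo j) (hi j)))) (hi≤b j<w))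
      ... | no ¬j<w = ≤-trans (≤-reflexive (at-beyond (row w (λ j → lo j + hi j ∸ at v j)) (≤-trans (≤-reflexive (length-row w _)) (≮⇒≥ ¬j<w)))) z≤n

    σ-within : ∀ v → Within w lo hi v → Within w lo hi (σ v)
    σ-within v p = within-reflect v (within? w lo hi v) p

    σ-outside : ∀ v → ¬ Within w lo hi v → σ v ≡ v
    σ-outside v ¬p with within? w lo hi v
    ... | yes p = ⊥-elim (¬p p)
    ... | no _  = refl

    σσ : ∀ v → InBox b v → σ (σ v) ≡ v
    σσ v (e , h) with within? w lo hi v
    ... | no ¬p = σ-outside v ¬p
    ... | yes p = row-ext (trans (length-reflect u (within? w lo hi u) (length-row w _)) (sym (trans e eb))) eq
      where
      u = row w (λ j → lo j + hi j ∸ at v j)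
      pu : Within w lo hi u
      pu = within-reflect v (yes p) p
      eq : ∀ {j} → j < length (σ u) → at (σ u) j ≡ at v j
      eq {j} l = trans (at-reflect u (within? w lo hi u) pu j<w)
        (trans (cong (λ t → lo j + hi j ∸ t) (at-row w _ j<w)) (m∸[m∸n]≡n (≤-trans (proj₂ (p j<w)) (m≤n+m (hi j) (lo j)))))
        where
        j<w : j < w
        j<w = subst (j <_) (length-reflect u (within? w lo hi u) (length-row w _)) l

    sum-σ : ∀ v → InBox b v → Within w lo hi v → sum (σ v) + sum v ≡ sumTo w lo + sumTo w hi
    sum-σ v ok@(e , _) p = begin
      sum (σ v) + sum v
        ≡⟨ cong₂ _+_ (trans (sum-sumTo (σ v)) (cong (λ n → sumTo n (at (σ v))) (trans (proj₁ (σ-ok v ok)) eb))) (trans (sum-sumTo v) (cong (λ n → sumTo n (at v)) (trans e eb))) ⟩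
      sumTo w (at (σ v)) + sumTo w (at v)
        ≡⟨ sym (sumTo-+ w (at (σ v)) (at v)) ⟩
      sumTo w (λ j → at (σ v) j + at v j)
        ≡⟨ sumTo-cong w (λ {j} j<w → trans (cong (_+ at v j) (at-reflect v (within? w lo hi v) p j<w))
              (m∸n+n≡m (≤-trans (proj₂ (p j<w)) (m≤n+m (hi j) (lo j))))) ⟩
      sumTo w (λ j → lo j + hi j)
        ≡⟨ sumTo-+ w lo hi ⟩
      sumTo w lo + sumTo w hi ∎
      where open ≡-Reasoning

    -- Reflection of every entry in its own interval is an involution, and it complements the row
    -- sum with respect to the sum of all bounds. The function `H` is arbitrary because a weight
    -- sees a row only through its sum.
    reverse-box : (H : ℕ → ℤ) → ∑ (box b) (λ v → ind (within? w lo hi v) ⊗ H (sum v)) ≡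
                                ∑ (box b) (λ v → ind (within? w lo hi v) ⊗ H (sumTo w lo + sumTo w hi ∸ sum v))
    reverse-box H = begin
      ∑ (box b) (λ v → ind (within? w lo hi v) ⊗ H (sum v))
        ≡⟨ sym (∑-involution (box-enumerates b) σ σ-ok σσ _) ⟩
      ∑ (box b) (λ v → ind (within? w lo hi (σ v)) ⊗ H (sum (σ v)))
        ≡⟨ ∑-cong-All (Enumerates.sound (box-enumerates b)) (λ v ok → trans
             (cong (_⊗ H (sum (σ v))) (ind-cong (within? w lo hi (σ v)) (within? w lo hi v) (back v ok) (σ-within v)))
             (ind-*-cong (within? w lo hi v) (λ p → cong H (sym (trans (cong (_∸ sum v) (sym (sum-σ v ok p))) (m+n∸n≡m (sum (σ v)) (sum v))))))) ⟩
      ∑ (box b) (λ v → ind (within? w lo hi v) ⊗ H (sumTo w lo + sumTo w hi ∸ sum v)) ∎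
      where
      open ≡-Reasoning
      back : ∀ v → InBox b v → Within w lo hi (σ v) → Within w lo hi v
      back v ok p = subst (Within w lo hi) (σσ v ok) (σ-within (σ v) p)

  lit : Link → Bool → Row → ℤ
  lit L true  v = ind (locked? L v)
  lit L false v = + 1 ⊟ ind (locked? L v)

  lits : List (Link × Bool) → Row → ℤ
  lits []             v = + 1
  lits ((L , c) ∷ Ls) v = lit L c v ⊗ lits Ls v

  -- A locked link shrinks two intervals by the same amount, so the centre does not move;
  -- unlocked links are handled by inclusion and exclusion.
  reverse-links : (Ls : List (Link × Bool)) (lo hi : ℕ → ℕ) → (∀ {j} → j < w → hi j ≤ at b j) →
    All (LinkOk w lo hi ∘ proj₁) Ls → AllPairs (λ x y → Disjoint (proj₁ x) (proj₁ y)) Ls →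
    (C : ℕ) → C ≡ sumTo w lo + sumTo w hi → (H : ℕ → ℤ) →
    ∑ (box b) (λ v → ind (within? w lo hi v) ⊗ (lits Ls v ⊗ H (sum v))) ≡
    ∑ (box b) (λ v → ind (within? w lo hi v) ⊗ (lits Ls v ⊗ H (C ∸ sum v)))
  reverse-links [] lo hi hi≤b _ _ C refl H =
    trans (∑-cong (box b) (λ v → cong (ind (within? w lo hi v) ⊗_) (⊗-identityˡ _)))
    (trans (reverse-box lo hi hi≤b H) (sym (∑-cong (box b) (λ v → cong (ind (within? w lo hi v) ⊗_) (⊗-identityˡ _)))))
  reverse-links ((L , c) ∷ Ls) lo hi hi≤b (ok ∷ oks) (dj ∷ djs) C eC H = by c
    where
    open LinkOk ok
    lo′ = upd lo (src L) (low L)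
    hi′ = upd hi (tgt L) (high L)

    hi′≤b : ∀ {j} → j < w → hi′ j ≤ at b j
    hi′≤b {j} j<w = upd-elim hi (tgt L) (high L) j (_≤ at b j) (λ { refl → ≤-trans high≤hi (hi≤b j<w) }) (λ _ → hi≤b j<w)

    oks′ : ∀ {Ms} → All (λ M → Disjoint L (proj₁ M)) Ms → All (LinkOk w lo hi ∘ proj₁) Ms → All (LinkOk w lo′ hi′ ∘ proj₁) Ms
    oks′ [] [] = []
    oks′ {M ∷ Ms} ((ns , nt) ∷ ds) (k ∷ ks) = record
      { src<w = K.src<w ; tgt<w = K.tgt<w
      ; lo≤low = ≤-trans (≤-reflexive el) K.lo≤low
      ; high≤hi = ≤-trans K.high≤hi (≤-reflexive (sym eh))
      ; balanced = trans K.balanced (sym (cong₂ _+_ el eh)) } ∷ oks′ ds ks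
      where
      module K = LinkOk k
      el : lo′ (src (proj₁ M)) ≡ lo (src (proj₁ M))
      el = upd-other lo (src L) (low L) (λ e → ns (sym e))
      eh : hi′ (tgt (proj₁ M)) ≡ hi (tgt (proj₁ M))
      eh = upd-other hi (tgt L) (high L) (λ e → nt (sym e))

    C′ : C ≡ sumTo w lo′ + sumTo w hi′
    C′ = trans eC (+-cancelʳ-≡ (lo (src L) + hi (tgt L)) _ _ (begin
      sumTo w lo + sumTo w hi + (lo (src L) + hi (tgt L)) ≡⟨ cong (λ t → sumTo w lo + sumTo w hi + t) (sym balanced) ⟩
      sumTo w lo + sumTo w hi + (low L + high L)          ≡⟨ +-interchange (sumTo w lo) _ _ _ ⟩
      sumTo w lo + low L + (sumTo w hi + high L)          ≡⟨ cong₂ _+_ (sym (sumTo-upd w lo (low L) src<w)) (sym (sumTo-upd w hi (high L) tgt<w)) ⟩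
      sumTo w lo′ + lo (src L) + (sumTo w hi′ + hi (tgt L)) ≡⟨ +-interchange (sumTo w lo′) _ _ _ ⟩
      sumTo w lo′ + sumTo w hi′ + (lo (src L) + hi (tgt L)) ∎))
      where open ≡-Reasoning

    restrict : ∀ v → ind (within? w lo hi v) ⊗ ind (locked? L v) ≡ ind (within? w lo′ hi′ v)
    restrict v = ind-× (within? w lo hi v) (locked? L v) (within? w lo′ hi′ v) to from
      where
      to : Within w lo hi v → Locked L v → Within w lo′ hi′ v
      to p (l , h) {j} j<w = lower , upper
        where
        lower : lo′ j ≤ at v j
        lower = upd-elim lo (src L) (low L) j (_≤ at v j) (λ { refl → l }) (λ _ → proj₁ (p j<w))
        upper : at v j ≤ hi′ j
        upper = upd-elim hi (tgt L) (high L) j (at v j ≤_) (λ { refl → h }) (λ _ → proj₂ (p j<w))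
      from : Within w lo′ hi′ v → Within w lo hi v × Locked L v
      from p = inside , subst (_≤ at v (src L)) (upd-same lo (src L) (low L)) (proj₁ (p src<w)) ,
                        subst (at v (tgt L) ≤_) (upd-same hi (tgt L) (high L)) (proj₂ (p tgt<w))
        where
        inside : Within w lo hi v
        inside {j} j<w = lower , upper
          where
          lower : lo j ≤ at v j
          lower = upd-elim lo (src L) (low L) j (λ t → t ≤ at v j → lo j ≤ at v j)
                    (λ { refl → ≤-trans lo≤low }) (λ _ → id) (proj₁ (p j<w))
          upper : at v j ≤ hi j
          upper = upd-elim hi (tgt L) (high L) j (λ t → at v j ≤ t → at v j ≤ hi j)
                    (λ { refl h → ≤-trans h high≤hi }) (λ _ → id) (proj₂ (p j<w))

    absorb : (h : Row → ℤ) → ∀ v → ind (within? w lo hi v) ⊗ (ind (locked? L v) ⊗ lits Ls v ⊗ h v) ≡ ind (within? w lo′ hi′ v) ⊗ (lits Ls v ⊗ h v)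
    absorb h v = trans (cong (ind (within? w lo hi v) ⊗_) (⊗-assoc (ind (locked? L v)) _ _))
                (trans (sym (⊗-assoc (ind (within? w lo hi v)) _ _)) (cong (_⊗ (lits Ls v ⊗ h v)) (restrict v)))

    on : (h : Row → ℤ) → ℤ
    on h = ∑ (box b) (λ v → ind (within? w lo′ hi′ v) ⊗ (lits Ls v ⊗ h v))

    all : (h : Row → ℤ) → ℤ
    all h = ∑ (box b) (λ v → ind (within? w lo hi v) ⊗ (lits Ls v ⊗ h v))

    locked-sum : (h : Row → ℤ) → ∑ (box b) (λ v → ind (within? w lo hi v) ⊗ (ind (locked? L v) ⊗ lits Ls v ⊗ h v)) ≡ on h
    locked-sum h = ∑-cong (box b) (absorb h)

    unlocked-sum : (h : Row → ℤ) → ∑ (box b) (λ v → ind (within? w lo hi v) ⊗ ((+ 1 ⊟ ind (locked? L v)) ⊗ lits Ls v ⊗ h v)) ≡ all h ⊟ on h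
    unlocked-sum h = trans (∑-cong (box b) expand) (∑-− (box b) _ _)
      where
      expand : ∀ v → ind (within? w lo hi v) ⊗ ((+ 1 ⊟ ind (locked? L v)) ⊗ lits Ls v ⊗ h v) ≡
                     ind (within? w lo hi v) ⊗ (lits Ls v ⊗ h v) ⊟ ind (within? w lo′ hi′ v) ⊗ (lits Ls v ⊗ h v)
      expand v = begin
        W ⊗ ((+ 1 ⊟ K) ⊗ l ⊗ h v)              ≡⟨ cong (λ t → W ⊗ (t ⊗ h v)) (⊗-distribʳ-⊟ l (+ 1) K) ⟩
        W ⊗ ((+ 1 ⊗ l ⊟ K ⊗ l) ⊗ h v)          ≡⟨ cong (W ⊗_) (⊗-distribʳ-⊟ (h v) _ _) ⟩
        W ⊗ (+ 1 ⊗ l ⊗ h v ⊟ K ⊗ l ⊗ h v)      ≡⟨ ⊗-distribˡ-⊟ W _ _ ⟩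
        W ⊗ (+ 1 ⊗ l ⊗ h v) ⊟ W ⊗ (K ⊗ l ⊗ h v) ≡⟨ cong₂ (λ s t → W ⊗ (s ⊗ h v) ⊟ t) (⊗-identityˡ l) (absorb h v) ⟩
        W ⊗ (l ⊗ h v) ⊟ ind (within? w lo′ hi′ v) ⊗ (l ⊗ h v) ∎
        where
        open ≡-Reasoning
        W = ind (within? w lo hi v)
        K = ind (locked? L v)
        l = lits Ls v

    ih-on : on (λ v → H (sum v)) ≡ on (λ v → H (C ∸ sum v))
    ih-on = reverse-links Ls lo′ hi′ hi′≤b (oks′ dj oks) djs C C′ H

    ih-all : all (λ v → H (sum v)) ≡ all (λ v → H (C ∸ sum v))
    ih-all = reverse-links Ls lo hi hi≤b oks djs C eC H

    by : ∀ c → ∑ (box b) (λ v → ind (within? w lo hi v) ⊗ (lit L c v ⊗ lits Ls v ⊗ H (sum v))) ≡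
               ∑ (box b) (λ v → ind (within? w lo hi v) ⊗ (lit L c v ⊗ lits Ls v ⊗ H (C ∸ sum v)))
    by true  = trans (locked-sum _) (trans ih-on (sym (locked-sum _)))
    by false = trans (unlocked-sum _) (trans (cong₂ _⊟_ ih-all ih-on) (sym (unlocked-sum _)))

-- Reversal of the part of a row to the left of a cut

-- Taking the maximum with the threshold forgets the cells to the left of the cut; only the part to
-- the right is compared.
SameAbove : ℕ → (ℕ → ℕ) → Row → Row → Set
SameAbove w c v v′ = ∀ {j} → j < w → at v j ⊔ c j ≡ at v′ j ⊔ c j

sameAbove? : ∀ w c v v′ → Dec (SameAbove w c v v′)
sameAbove? w c v v′ = allUpTo? (λ j → at v j ⊔ c j ≟ at v′ j ⊔ c j) w

module _ (lo hi c : ℕ → ℕ) where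

  -- An entry whose interval starts left of the cut may move up to the cut. Any other entry lies
  -- right of the cut and gets a one-point interval, so that a reversal of the whole row moves only
  -- its left part.
  cutLo cutHi : Row → ℕ → ℕ
  cutLo v j = choose (lo j ≤? c j) (lo j) (at v j)
  cutHi v j = choose (lo j ≤? c j) (hi j ⊓ c j) (at v j)

module LeftReversal (b : Row) (w : ℕ) (eb : length b ≡ w) (lo hi c : ℕ → ℕ) where

  open Reversal b w eb

  -- What the position of the cut has to guarantee: an entry that can be left of the cut is left of
  -- it, a link with `low` left of the cut keeps its bounds, the lock of any other link is visible
  -- right of the cut, and `C` is the centre of the truncated intervals.
  record Good (C : ℕ) (Ls : List Link) (v : Row) : Set where
    field
      below  : ∀ {j} → j < w → lo j ≤ c j → at v j ≤ c j
      inner  : All (λ L → low L ≤ c (src L) → hi (tgt L) ≤ c (tgt L)) Ls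
      frozen : All (λ L → c (src L) < low L → Locked L v → c (src L) < lo (src L) × c (tgt L) ≤ high L) Ls
      centre : C ≡ sumTo w (cutLo lo hi c v) + sumTo w (cutHi lo hi c v)

  module _ (hi≤b : ∀ {j} → j < w → hi j ≤ at b j)
           (Ls : List Link) (oks : All (LinkOk w lo hi) Ls) (dis : AllPairs Disjoint Ls)
           (C : ℕ) (Φ : Row → ℤ) (Ψ : Row → Set)
           (Φ⇒Ψ : ∀ v → InBox b v → Within w lo hi v → Φ v ≢ + 0 → Ψ v)
           (Ψ-resp : ∀ v v′ → InBox b v → InBox b v′ → Within w lo hi v → Within w lo hi v′ → SameAbove w c v v′ → Ψ v → Ψ v′)
           (Ψ⇒Good : ∀ v → InBox b v → Within w lo hi v → Ψ v → Good C Ls v)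
           (Φ-resp : ∀ v v′ → InBox b v → InBox b v′ → Within w lo hi v → Within w lo hi v′ →
                     SameAbove w c v v′ → SameLocks Ls v v′ → Φ v ≡ Φ v′)
           (H : ℕ → ℤ) where

    private
      D : Row → ℤ
      D v = H (sum v) ⊟ H (C ∸ sum v)

      f : Row → ℤ
      f v = ind (within? w lo hi v) ⊗ (Φ v ⊗ D v)

      _~_ : Row → Row → Set
      v ~ v′ = SameAbove w c v v′ × SameLocks Ls v v′

      _~?_ : ∀ v v′ → Dec (v ~ v′)
      v ~? v′ = sameAbove? w c v v′ ×-dec sameLocks? Ls v v′

      ~-refl : ∀ v → v ~ v
      ~-refl v = (λ _ → refl) , All.universal (λ _ → id , id) Ls

      ~-sym : ∀ {v v′} → v ~ v′ → v′ ~ v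
      ~-sym (p , q) = (λ l → sym (p l)) , All.map (λ { (s , t) → t , s }) q

      ~-trans : ∀ {u v x} → u ~ v → v ~ x → u ~ x
      ~-trans (p , q) (p′ , q′) = (λ l → trans (p l) (p′ l)) , All.map (λ { ((s , t) , (s′ , t′)) → s′ ∘ s , t ∘ t′ }) (All.zip (q , q′))

      movable? : (L : Link) → Dec (low L ≤ c (src L))
      movable? L = low L ≤? c (src L)

      module Class (v₀ : Row) (ok₀ : InBox b v₀) (in₀ : Within w lo hi v₀) (ψ₀ : Ψ v₀) where

        open Good (Ψ⇒Good v₀ ok₀ in₀ ψ₀)

        lo′ hi′ : ℕ → ℕ
        lo′ = cutLo lo hi c v₀
        hi′ = cutHi lo hi c v₀

        lo′-left : ∀ {j} → lo j ≤ c j → lo′ j ≡ lo j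
        lo′-left {j} = choose-yes (lo j ≤? c j)

        hi′-left : ∀ {j} → lo j ≤ c j → hi′ j ≡ hi j ⊓ c j
        hi′-left {j} = choose-yes (lo j ≤? c j)

        lo′-right : ∀ {j} → ¬ lo j ≤ c j → lo′ j ≡ at v₀ j
        lo′-right {j} = choose-no (lo j ≤? c j)

        hi′-right : ∀ {j} → ¬ lo j ≤ c j → hi′ j ≡ at v₀ j
        hi′-right {j} = choose-no (lo j ≤? c j)

        tag : Link → Link × Bool
        tag L = L , does (locked? L v₀)

        movable : List Link → List (Link × Bool)
        movable []       = []
        movable (L ∷ Ms) = choose (movable? L) (tag L ∷ movable Ms) (movable Ms)

        Same : Link → Row → Set
        Same L v = (Locked L v₀ → Locked L v) × (Locked L v → Locked L v₀)

        SameMovable : List Link → Row → Set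
        SameMovable Ms v = All (λ L → low L ≤ c (src L) → Same L v) Ms

        sameMovable? : ∀ Ms v → Dec (SameMovable Ms v)
        sameMovable? Ms v = All.all? (λ L → movable? L →-dec ((locked? L v₀ →-dec locked? L v) ×-dec (locked? L v →-dec locked? L v₀))) Ms

        lit-tag : ∀ L v (d : Dec (Locked L v₀)) (dS : Dec (Same L v)) → lit L (does d) v ≡ ind dS
        lit-tag L v (yes p) dS = ind-cong (locked? L v) dS (λ q → (λ _ → q) , (λ _ → p)) (λ s → proj₁ s p)
        lit-tag L v (no ¬p) dS = trans (sym (ind-¬ (locked? L v) (¬? (locked? L v))))
          (ind-cong (¬? (locked? L v)) dS (λ ¬q → (λ p → ⊥-elim (¬p p)) , (λ q → ⊥-elim (¬q q))) (λ s q → ¬p (proj₂ s q)))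

        lits-movable : ∀ Ms v → lits (movable Ms) v ≡ ind (sameMovable? Ms v)
        lits-movable []       v = refl
        lits-movable (L ∷ Ms) v = by (movable? L) refl
          where
          dS = (locked? L v₀ →-dec locked? L v) ×-dec (locked? L v →-dec locked? L v₀)
          by : (d : Dec (low L ≤ c (src L))) → movable? L ≡ d → lits (movable (L ∷ Ms)) v ≡ ind (sameMovable? (L ∷ Ms) v)
          by (yes m) e = trans (cong (λ l → lits l v) (choose-yes (movable? L) m))
            (trans (cong₂ _⊗_ (lit-tag L v (locked? L v₀) dS) (lits-movable Ms v))
                   (ind-× dS (sameMovable? Ms v) (sameMovable? (L ∷ Ms) v) (λ s r → (λ _ → s) ∷ r) (λ { (s ∷ r) → s m , r })))
          by (no ¬m) e = trans (cong (λ l → lits l v) (choose-no (movable? L) ¬m))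
            (trans (lits-movable Ms v) (ind-cong (sameMovable? Ms v) (sameMovable? (L ∷ Ms) v) (λ r → (λ m → ⊥-elim (¬m m)) ∷ r) (λ { (_ ∷ r) → r })))

        movable-All : {X : Link → Set} (Y : Link × Bool → Set) → (∀ L → low L ≤ c (src L) → X L → Y (tag L)) → ∀ {Ms} → All X Ms → All Y (movable Ms)
        movable-All Y h [] = []
        movable-All Y h {L ∷ Ms} (x ∷ xs) with movable? L
        ... | yes m = h L m x ∷ movable-All Y h xs
        ... | no _  = movable-All Y h xs

        movable-Disjoint : ∀ {Ms} → AllPairs Disjoint Ms → AllPairs (λ x y → Disjoint (proj₁ x) (proj₁ y)) (movable Ms)
        movable-Disjoint [] = []
        movable-Disjoint {L ∷ Ms} (d ∷ ds) with movable? L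
        ... | yes _ = movable-All (λ y → Disjoint L (proj₁ y)) (λ _ _ x → x) d ∷ movable-Disjoint ds
        ... | no _  = movable-Disjoint ds

        -- The source keeps its lower bound because `lo (src L)` is at most `low L`, hence left of
        -- the cut; the target keeps its upper bound by `inner`. So truncation does not disturb
        -- `balanced`.
        ok-movable : ∀ L → low L ≤ c (src L) → LinkOk w lo hi L × (low L ≤ c (src L) → hi (tgt L) ≤ c (tgt L)) → LinkOk w lo′ hi′ L
        ok-movable L m (k , inn) = record
          { src<w = K.src<w ; tgt<w = K.tgt<w
          ; lo≤low = ≤-trans (≤-reflexive el) K.lo≤low
          ; high≤hi = ≤-trans K.high≤hi (≤-reflexive (sym eh))
          ; balanced = trans K.balanced (sym (cong₂ _+_ el eh)) }
          where
          module K = LinkOk k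
          el : lo′ (src L) ≡ lo (src L)
          el = lo′-left (≤-trans K.lo≤low m)
          eh : hi′ (tgt L) ≡ hi (tgt L)
          eh = trans (hi′-left (≤-trans (≤-trans (proj₁ (in₀ K.tgt<w)) (proj₂ (in₀ K.tgt<w))) (inn m))) (m≤n⇒m⊓n≡m (inn m))

        hi′≤b : ∀ {j} → j < w → hi′ j ≤ at b j
        hi′≤b {j} j<w with lo j ≤? c j
        ... | yes l = ≤-trans (m⊓n≤m (hi j) (c j)) (hi≤b j<w)
        ... | no ¬l = proj₂ ok₀ j

        to-cut : ∀ v → Within w lo hi v → v₀ ~ v → Within w lo′ hi′ v
        to-cut v p (sa , _) {j} j<w with lo j ≤? c j
        ... | yes l = proj₁ (p j<w) , ⊓-glb (proj₂ (p j<w))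
              (≤-trans (m≤m⊔n (at v j) (c j)) (≤-reflexive (trans (sym (sa j<w)) (m≤n⇒m⊔n≡n (below j<w l)))))
        ... | no ¬l = ≤-reflexive e , ≤-reflexive (sym e)
          where
          e : at v₀ j ≡ at v j
          e = trans (sym (m≥n⇒m⊔n≡m (≤-trans (<⇒≤ (≰⇒> ¬l)) (proj₁ (in₀ j<w)))))
             (trans (sa j<w) (m≥n⇒m⊔n≡m (≤-trans (<⇒≤ (≰⇒> ¬l)) (proj₁ (p j<w)))))

        from-cut : ∀ v → Within w lo′ hi′ v → Within w lo hi v × SameAbove w c v₀ v
        from-cut v p = (λ {j} j<w → inside j j<w (lo j ≤? c j)) , (λ {j} j<w → same j j<w (lo j ≤? c j))
          where
          eqr : ∀ j → j < w → ¬ lo j ≤ c j → at v₀ j ≡ at v j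
          eqr j j<w ¬l = ≤-antisym (subst (_≤ at v j) (lo′-right ¬l) (proj₁ (p j<w))) (subst (at v j ≤_) (hi′-right ¬l) (proj₂ (p j<w)))
          left : ∀ j → j < w → lo j ≤ c j → at v j ≤ hi j ⊓ c j
          left j j<w l = subst (at v j ≤_) (hi′-left l) (proj₂ (p j<w))
          inside : ∀ j → j < w → Dec (lo j ≤ c j) → lo j ≤ at v j × at v j ≤ hi j
          inside j j<w (yes l) = subst (_≤ at v j) (lo′-left l) (proj₁ (p j<w)) , ≤-trans (left j j<w l) (m⊓n≤m (hi j) (c j))
          inside j j<w (no ¬l) = subst (λ t → lo j ≤ t × t ≤ hi j) (eqr j j<w ¬l) (in₀ j<w)
          same : ∀ j → j < w → Dec (lo j ≤ c j) → at v₀ j ⊔ c j ≡ at v j ⊔ c j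
          same j j<w (yes l) = trans (m≤n⇒m⊔n≡n (below j<w l)) (sym (m≤n⇒m⊔n≡n (≤-trans (left j j<w l) (m⊓n≤n (hi j) (c j)))))
          same j j<w (no ¬l) = cong (_⊔ c j) (eqr j j<w ¬l)

        -- A locked link that meets the cut is decided by the part above the cut.
        transfer : ∀ u v → InBox b u → InBox b v → Within w lo hi u → Within w lo hi v → Ψ u → SameAbove w c u v →
                   All (λ L → c (src L) < low L → Locked L u → Locked L v) Ls
        transfer u v oku okv inu inv ψu sa = All.map step (All.zip (oks , Good.frozen (Ψ⇒Good u oku inu ψu)))
          where
          step : ∀ {L} → LinkOk w lo hi L × (c (src L) < low L → Locked L u → c (src L) < lo (src L) × c (tgt L) ≤ high L) →
                 c (src L) < low L → Locked L u → Locked L v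
          step {L} (k , fr) m lk@(l , h) with fr m lk
          ... | (cs , ct) = ≤-trans l (≤-reflexive e) , ≤-trans (m≤m⊔n (at v (tgt L)) _) (≤-trans (≤-reflexive (sym (sa K.tgt<w))) (⊔-lub h ct))
            where
            module K = LinkOk k
            e : at u (src L) ≡ at v (src L)
            e = trans (sym (m≥n⇒m⊔n≡m (≤-trans (<⇒≤ cs) (proj₁ (inu K.src<w)))))
               (trans (sa K.src<w) (m≥n⇒m⊔n≡m (≤-trans (<⇒≤ cs) (proj₁ (inv K.src<w)))))

        class-iff : ∀ v → InBox b v → (Within w lo hi v × v₀ ~ v → Within w lo′ hi′ v × SameMovable Ls v) ×
                                       (Within w lo′ hi′ v × SameMovable Ls v → Within w lo hi v × v₀ ~ v)
        class-iff v okv = (λ { (p , r) → to-cut v p r , All.map (λ s _ → s) (proj₂ r) }) , back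
          where
          back : Within w lo′ hi′ v × SameMovable Ls v → Within w lo hi v × v₀ ~ v
          -- Frozen locks are carried over in both directions, so `v` must be good as well; `Ψ-resp`
          -- provides this from the goodness of `v₀`.
          back (p , sm) = inv , sa , All.map assemble (All.zip (sm , All.zip (transfer v₀ v ok₀ okv in₀ inv ψ₀ sa ,
                            transfer v v₀ okv ok₀ inv in₀ (Ψ-resp v₀ v ok₀ okv in₀ inv sa ψ₀) (λ l → sym (sa l)))))
            where
            inv : Within w lo hi v
            inv = proj₁ (from-cut v p)
            sa : SameAbove w c v₀ v
            sa = proj₂ (from-cut v p)
            assemble : ∀ {L} → (low L ≤ c (src L) → Same L v) × ((c (src L) < low L → Locked L v₀ → Locked L v) × (c (src L) < low L → Locked L v → Locked L v₀)) → Same L v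
            assemble {L} (m , (t , t′)) with movable? L
            ... | yes y = m y
            ... | no ¬y = t (≰⇒> ¬y) , t′ (≰⇒> ¬y)

        term : ∀ v → InBox b v → ind (v₀ ~? v) ⊗ f v ≡ Φ v₀ ⊗ (ind (within? w lo′ hi′ v) ⊗ (lits (movable Ls) v ⊗ D v))
        term v okv = begin
          ind (v₀ ~? v) ⊗ (ind (within? w lo hi v) ⊗ (Φ v ⊗ D v))
            ≡⟨ sym (⊗-assoc (ind (v₀ ~? v)) _ _) ⟩
          ind (v₀ ~? v) ⊗ ind (within? w lo hi v) ⊗ (Φ v ⊗ D v)
            ≡⟨ cong (_⊗ (Φ v ⊗ D v)) (ind-× (v₀ ~? v) (within? w lo hi v) dR (λ r p → proj₁ iff (p , r)) (λ r → proj₂ (proj₂ iff r) , proj₁ (proj₂ iff r))) ⟩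
          ind dR ⊗ (Φ v ⊗ D v)
            ≡⟨ ind-*-cong dR (λ r → cong (_⊗ D v) (sym (Φ-resp v₀ v ok₀ okv in₀ (proj₁ (proj₂ iff r)) (proj₁ (proj₂ (proj₂ iff r))) (proj₂ (proj₂ (proj₂ iff r)))))) ⟩
          ind dR ⊗ (Φ v₀ ⊗ D v)
            ≡⟨ cong (_⊗ (Φ v₀ ⊗ D v)) (sym (ind-× (within? w lo′ hi′ v) (sameMovable? Ls v) dR _,_ id)) ⟩
          W ⊗ S ⊗ (Φ v₀ ⊗ D v)
            ≡⟨ trans (sym (⊗-assoc (W ⊗ S) (Φ v₀) (D v))) (trans (cong (_⊗ D v) (⊗-comm (W ⊗ S) (Φ v₀))) (⊗-assoc (Φ v₀) (W ⊗ S) (D v))) ⟩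
          Φ v₀ ⊗ (W ⊗ S ⊗ D v)
            ≡⟨ cong (Φ v₀ ⊗_) (trans (⊗-assoc W S (D v)) (cong (λ t → W ⊗ (t ⊗ D v)) (sym (lits-movable Ls v)))) ⟩
          Φ v₀ ⊗ (W ⊗ (lits (movable Ls) v ⊗ D v)) ∎
          where
          open ≡-Reasoning
          iff = class-iff v okv
          dR = within? w lo′ hi′ v ×-dec sameMovable? Ls v
          W = ind (within? w lo′ hi′ v)
          S = ind (sameMovable? Ls v)

        class-zero : ∑ (box b) (λ v → ind (v₀ ~? v) ⊗ f v) ≡ + 0
        class-zero = begin
          ∑ (box b) (λ v → ind (v₀ ~? v) ⊗ f v)
            ≡⟨ ∑-cong-All (Enumerates.sound (box-enumerates b)) term ⟩
          ∑ (box b) (λ v → Φ v₀ ⊗ (ind (within? w lo′ hi′ v) ⊗ (lits (movable Ls) v ⊗ D v)))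
            ≡⟨ ∑-*ˡ (box b) (Φ v₀) _ ⟩
          Φ v₀ ⊗ ∑ (box b) (λ v → ind (within? w lo′ hi′ v) ⊗ (lits (movable Ls) v ⊗ D v))
            ≡⟨ cong (Φ v₀ ⊗_) (trans (∑-cong (box b) (λ v → trans (cong (ind (within? w lo′ hi′ v) ⊗_) (⊗-distribˡ-⊟ (lits (movable Ls) v) _ _)) (⊗-distribˡ-⊟ (ind (within? w lo′ hi′ v)) _ _)))
                               (∑-− (box b) _ _)) ⟩
          Φ v₀ ⊗ (∑ (box b) (λ v → ind (within? w lo′ hi′ v) ⊗ (lits (movable Ls) v ⊗ H (sum v))) ⊟
                  ∑ (box b) (λ v → ind (within? w lo′ hi′ v) ⊗ (lits (movable Ls) v ⊗ H (C ∸ sum v))))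
            ≡⟨ cong (λ t → Φ v₀ ⊗ (t ⊟ ∑ (box b) (λ v → ind (within? w lo′ hi′ v) ⊗ (lits (movable Ls) v ⊗ H (C ∸ sum v)))))
                 (reverse-links (movable Ls) lo′ hi′ hi′≤b (movable-All (LinkOk w lo′ hi′ ∘ proj₁) ok-movable (All.zip (oks , inner)))
                    (movable-Disjoint dis) C centre H) ⟩
          Φ v₀ ⊗ (∑ (box b) (λ v → ind (within? w lo′ hi′ v) ⊗ (lits (movable Ls) v ⊗ H (C ∸ sum v))) ⊟
                  ∑ (box b) (λ v → ind (within? w lo′ hi′ v) ⊗ (lits (movable Ls) v ⊗ H (C ∸ sum v))))
            ≡⟨ trans (cong (Φ v₀ ⊗_) (ℤₚ.+-inverseʳ (∑ (box b) (λ v → ind (within? w lo′ hi′ v) ⊗ (lits (movable Ls) v ⊗ H (C ∸ sum v)))))) (⊗-zeroʳ (Φ v₀)) ⟩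
          + 0 ∎
          where open ≡-Reasoning

    -- Rows are grouped by their part right of the cut and by their pattern of locks. On a group `Φ`
    -- is constant, and the group is the product of the truncated intervals with a prescribed
    -- pattern of the movable links, so `reverse-links` makes the difference of the two sides vanish
    -- there.
    reverse-left : ∑ (box b) (λ v → ind (within? w lo hi v) ⊗ (Φ v ⊗ H (sum v))) ≡
                   ∑ (box b) (λ v → ind (within? w lo hi v) ⊗ (Φ v ⊗ H (C ∸ sum v)))
    reverse-left = ℤₚ.i-j≡0⇒i≡j _ _ (begin
      ∑ (box b) (λ v → ind (within? w lo hi v) ⊗ (Φ v ⊗ H (sum v))) ⊟ ∑ (box b) (λ v → ind (within? w lo hi v) ⊗ (Φ v ⊗ H (C ∸ sum v)))
        ≡⟨ sym (∑-− (box b) _ _) ⟩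
      ∑ (box b) (λ v → ind (within? w lo hi v) ⊗ (Φ v ⊗ H (sum v)) ⊟ ind (within? w lo hi v) ⊗ (Φ v ⊗ H (C ∸ sum v)))
        ≡⟨ ∑-cong (box b) (λ v → sym (trans (cong (ind (within? w lo hi v) ⊗_) (⊗-distribˡ-⊟ (Φ v) _ _)) (⊗-distribˡ-⊟ (ind (within? w lo hi v)) _ _))) ⟩
      ∑ (box b) f
        ≡⟨ ∑-classes (Enumerates.sound (box-enumerates b)) _~?_ ~-refl (λ {x} {y} → ~-sym {x} {y}) (λ {x} {y} {z} → ~-trans {x} {y} {z}) f classes ⟩
      + 0 ∎)
      where
      open ≡-Reasoning
      classes : ∀ v → InBox b v → f v ≢ + 0 → ∑ (box b) (λ u → ind (v ~? u) ⊗ f u) ≡ + 0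
      classes v ok ne = by (within? w lo hi v) (Φ v ℤₚ.≟ + 0)
        where
        by : Dec (Within w lo hi v) → Dec (Φ v ≡ + 0) → ∑ (box b) (λ u → ind (v ~? u) ⊗ f u) ≡ + 0
        by (no ¬p) _       = ⊥-elim (ne (ind-*-zero (within? w lo hi v) (λ p → ⊥-elim (¬p p))))
        by (yes p) (yes e) = ⊥-elim (ne (ind-*-zero (within? w lo hi v) (λ _ → trans (cong (_⊗ D v) e) (⊗-zeroˡ _))))
        by (yes p) (no n)  = Class.class-zero v ok p (Φ⇒Ψ v ok p n)

-- A row between two rows, its free intervals and their links

⊔+⊓ : ∀ x y → (x ⊔ y) + (x ⊓ y) ≡ x + y
⊔+⊓ x y with ≤-total x y
... | inj₁ l = trans (cong₂ _+_ (m≤n⇒m⊔n≡n l) (m≤n⇒m⊓n≡m l)) (+-comm y x)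
... | inj₂ l = cong₂ _+_ (m≥n⇒m⊔n≡m l) (m≥n⇒m⊓n≡n l)

-- Even positions of a merged row belong to the first tableau, odd positions to the second.
dbl : ℕ → ℕ
dbl zero    = 0
dbl (suc n) = suc (suc (dbl n))

par : ℕ → ℕ
par zero          = 1
par (suc zero)    = 0
par (suc (suc j)) = suc (suc (par j))

par-par : ∀ j → par (par j) ≡ j
par-par zero          = refl
par-par (suc zero)    = refl
par-par (suc (suc j)) = cong (suc ∘ suc) (par-par j)

par<dbl : ∀ n {j} → j < dbl n → par j < dbl n
par<dbl (suc n) {zero}        _ = s≤s (s≤s z≤n)
par<dbl (suc n) {suc zero}    _ = s≤s z≤n
par<dbl (suc n) {suc (suc j)} (s≤s (s≤s l)) = s≤s (s≤s (par<dbl n l))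

par-≤ : ∀ j → par j ≤ suc j
par-≤ zero          = ≤-refl
par-≤ (suc zero)    = z≤n
par-≤ (suc (suc j)) = s≤s (s≤s (par-≤ j))

par-≥ : ∀ j → j ≤ suc (par j)
par-≥ j = subst (_≤ suc (par j)) (par-par j) (par-≤ (par j))

odd : ℕ → Bool
odd zero          = false
odd (suc zero)    = true
odd (suc (suc j)) = odd j

Decreasing : Row → Set
Decreasing x = ∀ j → at x (2 + j) ≤ at x j

decreasing-mono : ∀ x → Decreasing x → ∀ {i j} → odd i ≡ odd j → i ≤ j → at x j ≤ at x i
decreasing-mono x d {i} {j} = go i j (at x) d
  where
  far : ∀ i (f : ℕ → ℕ) → (∀ j → f (2 + j) ≤ f j) → odd i ≡ false → f i ≤ f 0
  far zero          f d _ = ≤-refl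
  far (suc (suc i)) f d e = ≤-trans (d i) (far i f d e)
  far′ : ∀ i (f : ℕ → ℕ) → (∀ j → f (2 + j) ≤ f j) → odd i ≡ true → f i ≤ f 1
  far′ (suc zero)    f d _ = ≤-refl
  far′ (suc (suc i)) f d e = ≤-trans (d i) (far′ i f d e)
  go : ∀ i j (f : ℕ → ℕ) → (∀ j → f (2 + j) ≤ f j) → odd i ≡ odd j → i ≤ j → f j ≤ f i
  go zero          j             f d e _ = far j f d (sym e)
  go (suc zero)    j             f d e _ = far′ j f d (sym e)
  go (suc (suc i)) (suc (suc j)) f d e (s≤s (s≤s l)) = go i j (λ k → f (2 + k)) (λ k → d (2 + k)) e l

odd-far : ∀ {i j} → odd i ≡ odd j → i < j → 2 + i ≤ j
odd-far {zero}        {suc (suc j)} e _ = s≤s (s≤s z≤n)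
odd-far {suc zero}    {suc (suc (suc j))} e _ = s≤s (s≤s (s≤s z≤n))
odd-far {suc zero}    {suc (suc zero)} () _
odd-far {suc zero}    {suc zero} e (s≤s ())
odd-far {suc (suc i)} {suc (suc j)} e (s≤s (s≤s l)) = s≤s (s≤s (odd-far {i} {j} e l))

Inter : ℕ → Row → Row → Set
Inter w x y = ∀ {j} → j < w → at x j ≤ at y j × at y (2 + j) ≤ at x j

inter? : ∀ w x y → Dec (Inter w x y)
inter? w x y = allUpTo? (λ j → (at x j ≤? at y j) ×-dec (at y (2 + j) ≤? at x j)) w

inter-all : ∀ {w} x y → length x ≡ w → length y ≡ w → Inter w x y → ∀ j → at x j ≤ at y j × at y (2 + j) ≤ at x j
inter-all {w} x y ex ey h j with j <? w
... | yes l = h l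
... | no ¬l = ≤-trans (≤-reflexive (at-beyond x (≤-trans (≤-reflexive ex) (≮⇒≥ ¬l)))) z≤n ,
              ≤-trans (≤-reflexive (at-beyond y (≤-trans (≤-reflexive ey) (≤-trans (≮⇒≥ ¬l) (m≤n+m j 2))))) z≤n

module Free (a u : Row) where

  -- The strip conditions with the rows `a` and `u` do not couple the entries of the row between
  -- them: they say exactly that each entry lies in its own interval.
  lo hi : ℕ → ℕ
  lo j = at a j ⊔ at u (2 + j)
  hi zero          = at u 0
  hi (suc zero)    = at u 1
  hi (suc (suc j)) = at u (2 + j) ⊓ at a j

  hi≤u : ∀ j → hi j ≤ at u j
  hi≤u zero          = ≤-refl
  hi≤u (suc zero)    = ≤-refl
  hi≤u (suc (suc j)) = m⊓n≤m _ _

  hi≤lo : ∀ j → hi (2 + j) ≤ lo j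
  hi≤lo j = ≤-trans (m⊓n≤n (at u (2 + j)) (at a j)) (m≤m⊔n (at a j) _)

  -- `LockAt j`: the pairs of `a` at `j` and of `u` at `2 + j` both increase strictly from `j` to
  -- `par j`, with overlapping gaps; the row between ties them to each other unless `lockL j` is
  -- locked. `CrossAt j`: the interval at `j` lies higher than the one at `par j` but meets it; the
  -- pair of the row at `j` is tied both downwards and upwards exactly when `crossL j` is locked.
  LockAt CrossAt : ℕ → Set
  LockAt j  = lo j < hi (2 + par j)
  CrossAt j = lo (par j) < lo j × hi (par j) < hi j × lo j ≤ hi (par j)

  lockAt? : ∀ j → Dec (LockAt j)
  lockAt? j = lo j <? hi (2 + par j)

  crossAt? : ∀ j → Dec (CrossAt j)
  crossAt? j = (lo (par j) <? lo j) ×-dec ((hi (par j) <? hi j) ×-dec (lo j ≤? hi (par j)))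

  lockL crossL : ℕ → Link
  lockL j  = link j (2 + par j) (hi (2 + par j)) (lo j)
  -- Both inequalities of this lock are strict; the two shifts by one cancel in `balanced`.
  crossL j = link j (par j) (suc (hi (par j))) (lo j ∸ 1)

  lock-cross : ∀ j → LockAt j → ¬ CrossAt j
  lock-cross j l (c , _) = <⇒≱ c (≤-trans (<⇒≤ l) (hi≤lo (par j)))

  linksOf : List ℕ → List Link
  linksOf []       = []
  linksOf (j ∷ js) = choose (lockAt? j) (lockL j ∷ linksOf js) (choose (crossAt? j) (crossL j ∷ linksOf js) (linksOf js))

  linksOf-All : (X : Link → Set) → ∀ {js} → All (λ j → (LockAt j → X (lockL j)) × (CrossAt j → X (crossL j))) js → All X (linksOf js)
  linksOf-All X [] = []
  linksOf-All X {j ∷ js} ((l , c) ∷ hs) with lockAt? j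
  ... | yes p = l p ∷ linksOf-All X hs
  ... | no _ with crossAt? j
  ...   | yes q = c q ∷ linksOf-All X hs
  ...   | no _  = linksOf-All X hs

  lock∈ : ∀ {js j} → j ∈ js → LockAt j → lockL j ∈ linksOf js
  lock∈ {i ∷ js} (here refl) p with lockAt? i
  ... | yes _ = here refl
  ... | no ¬p = ⊥-elim (¬p p)
  lock∈ {i ∷ js} (there m) p with lockAt? i
  ... | yes _ = there (lock∈ m p)
  ... | no _ with crossAt? i
  ...   | yes _ = there (lock∈ m p)
  ...   | no _  = lock∈ m p

  cross∈ : ∀ {js j} → j ∈ js → CrossAt j → crossL j ∈ linksOf js
  cross∈ {i ∷ js} (here refl) p with lockAt? i
  ... | yes l = ⊥-elim (lock-cross i l p)
  ... | no _ with crossAt? i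
  ...   | yes _ = here refl
  ...   | no ¬p = ⊥-elim (¬p p)
  cross∈ {i ∷ js} (there m) p with lockAt? i
  ... | yes _ = there (cross∈ m p)
  ... | no _ with crossAt? i
  ...   | yes _ = there (cross∈ m p)
  ...   | no _  = cross∈ m p

  private
    no-common : ∀ i j → LockAt i → CrossAt j → 2 + par i ≢ par j
    no-common i j l (_ , h , _) e = <⇒≱ (<-≤-trans l (≤-trans (≤-reflexive (cong hi e)) (<⇒≤ h)))
      (≤-trans (≤-reflexive (cong hi (trans (sym (par-par j)) (cong par (sym e))))) (subst (λ t → hi (2 + t) ≤ lo i) (sym (par-par i)) (hi≤lo i)))

    par-inj : ∀ {i j} → par i ≡ par j → i ≡ j
    par-inj {i} {j} e = trans (sym (par-par i)) (trans (cong par e) (par-par j))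

    dis-lock : ∀ i j → i ≢ j → LockAt i → (LockAt j → Disjoint (lockL i) (lockL j)) × (CrossAt j → Disjoint (lockL i) (crossL j))
    dis-lock i j ne l = (λ _ → ne , (λ e → ne (par-inj (suc-injective (suc-injective e))))) , (λ x → ne , no-common i j l x)

    dis-cross : ∀ i j → i ≢ j → CrossAt i → (LockAt j → Disjoint (crossL i) (lockL j)) × (CrossAt j → Disjoint (crossL i) (crossL j))
    dis-cross i j ne x = (λ l → ne , (λ e → no-common j i l x (sym e))) , (λ _ → ne , (λ e → ne (par-inj e)))

  linksOf-Disjoint : ∀ {js} → AllPairs _≢_ js → AllPairs Disjoint (linksOf js)
  linksOf-Disjoint [] = []
  linksOf-Disjoint {j ∷ js} (ne ∷ nes) with lockAt? j
  ... | yes p = linksOf-All (Disjoint (lockL j)) (All.map (λ n → dis-lock j _ n p) ne) ∷ linksOf-Disjoint nes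
  ... | no _ with crossAt? j
  ...   | yes q = linksOf-All (Disjoint (crossL j)) (All.map (λ n → dis-cross j _ n q) ne) ∷ linksOf-Disjoint nes
  ...   | no _  = linksOf-Disjoint nes

-- The lower bound at `j` and the upper bound at `2 + j` are the maximum and the minimum of the same
-- two numbers. The sums are therefore compared with a shift by two positions, and the two positions
-- left over at each end are treated separately.
sumTo-pairing : ∀ u (L X α β : ℕ → ℕ) → X 0 ≡ β 0 → X 1 ≡ β 1 → (∀ {j} → j < u → L j + X (2 + j) ≡ α j + β (2 + j)) →
  L u ≡ α u → L (suc u) ≡ α (suc u) → sumTo (2 + u) L + sumTo (2 + u) X ≡ sumTo (2 + u) α + sumTo (2 + u) β
sumTo-pairing u L X α β x₀ x₁ h l₀ l₁ = begin
  sumTo (2 + u) L + sumTo (2 + u) X ≡⟨ arrange L X ⟩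
  sumTo u (λ j → L j + X (2 + j)) + ((L u + L (suc u)) + (X 0 + X 1))
    ≡⟨ cong₂ _+_ (sumTo-cong u h) (cong₂ _+_ (cong₂ _+_ l₀ l₁) (cong₂ _+_ x₀ x₁)) ⟩
  sumTo u (λ j → α j + β (2 + j)) + ((α u + α (suc u)) + (β 0 + β 1)) ≡⟨ sym (arrange α β) ⟩
  sumTo (2 + u) α + sumTo (2 + u) β ∎
  where
  open ≡-Reasoning
  arrange : ∀ (F G : ℕ → ℕ) → sumTo (2 + u) F + sumTo (2 + u) G ≡ sumTo u (λ j → F j + G (2 + j)) + ((F u + F (suc u)) + (G 0 + G 1))
  arrange F G = begin
    sumTo (2 + u) F + (G 0 + (G 1 + sumTo u (λ j → G (2 + j))))
      ≡⟨ cong₂ _+_ (trans (sumTo-snoc (suc u) F) (trans (cong (_+ F (suc u)) (sumTo-snoc u F)) (+-assoc (sumTo u F) _ _)))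
                   (trans (sym (+-assoc (G 0) (G 1) _)) (+-comm (G 0 + G 1) _)) ⟩
    (sumTo u F + (F u + F (suc u))) + (sumTo u (λ j → G (2 + j)) + (G 0 + G 1))
      ≡⟨ +-interchange (sumTo u F) _ _ _ ⟩
    (sumTo u F + sumTo u (λ j → G (2 + j))) + ((F u + F (suc u)) + (G 0 + G 1))
      ≡⟨ cong (_+ ((F u + F (suc u)) + (G 0 + G 1))) (sym (sumTo-+ u F (λ j → G (2 + j)))) ⟩
    sumTo u (λ j → F j + G (2 + j)) + ((F u + F (suc u)) + (G 0 + G 1)) ∎

module Between (n : ℕ) (a u : Row) (ea : length a ≡ dbl (suc n)) (eu : length u ≡ dbl (suc n)) where

  open Free a u

  w : ℕ
  w = dbl (suc n)

  links : List Link
  links = linksOf (upTo w)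

  links-disjoint : AllPairs Disjoint links
  links-disjoint = linksOf-Disjoint (upTo⁺ w)

  links-All : (X : Link → Set) → (∀ {j} → j < w → LockAt j → X (lockL j)) → (∀ {j} → j < w → CrossAt j → X (crossL j)) → All X links
  links-All X l c = linksOf-All X (All.map (λ j<w → l j<w , c j<w) (Enumerates.sound (upTo-enumerates w)))

  lock-tgt : ∀ {j} → LockAt j → 2 + par j < w
  lock-tgt {j} l with 2 + par j <? w
  ... | yes p = p
  ... | no ¬p = ⊥-elim (<⇒≱ (≤-trans (s≤s z≤n) l) (≤-trans (hi≤u (2 + par j)) (≤-reflexive (at-beyond u (≤-trans (≤-reflexive eu) (≮⇒≥ ¬p))))))

  links-ok : All (LinkOk w lo hi) links
  links-ok = links-All (LinkOk w lo hi)
    (λ {j} j<w l → record { src<w = j<w ; tgt<w = lock-tgt l ; lo≤low = <⇒≤ l ; high≤hi = <⇒≤ l ; balanced = +-comm _ (lo j) })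
    (λ {j} j<w → cross j<w)
    where
    cross : ∀ {j} → j < w → CrossAt j → LinkOk w lo hi (crossL j)
    cross {j} j<w (p , q , r) = record
      { src<w = j<w ; tgt<w = par<dbl (suc n) j<w ; lo≤low = ≤-trans r (n≤1+n _) ; high≤hi = ≤-trans (m∸n≤m (lo j) 1) r
      ; balanced = trans (sym (+-suc (hi (par j)) (lo j ∸ 1))) (trans (cong (λ t → hi (par j) + t) (m+[n∸m]≡n (≤-trans (s≤s z≤n) p))) (+-comm _ (lo j))) }

  to-within : ∀ v → Inter w a v → Inter w v u → Within w lo hi v
  to-within v p q {j} j<w = ⊔-lub (proj₁ (p j<w)) (proj₂ (q j<w)) , upper j j<w
    where
    upper : ∀ j → j < w → at v j ≤ hi j
    upper zero          l = proj₁ (q l)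
    upper (suc zero)    l = proj₁ (q l)
    upper (suc (suc j)) l = ⊓-glb (proj₁ (q l)) (proj₂ (p (<-trans (n<1+n j) (<-trans (n<1+n (suc j)) l))))

  from-within : ∀ v → length v ≡ w → Within w lo hi v → Inter w a v × Inter w v u
  from-within v ev p = (λ {j} j<w → ≤-trans (m≤m⊔n _ _) (proj₁ (p j<w)) , next j) , (λ {j} j<w → ≤-trans (proj₂ (p j<w)) (hi≤u j) , ≤-trans (m≤n⊔m (at a j) _) (proj₁ (p j<w)))
    where
    next : ∀ j → at v (2 + j) ≤ at a j
    next j with 2 + j <? w
    ... | yes l = ≤-trans (proj₂ (p l)) (m⊓n≤n _ _)
    ... | no ¬l = ≤-trans (≤-reflexive (at-beyond v (≤-trans (≤-reflexive ev) (≮⇒≥ ¬l)))) z≤n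

  lo-tail : ∀ {j} → w ≤ 2 + j → lo j ≡ at a j
  lo-tail {j} l = trans (cong (at a j ⊔_) (at-beyond u (≤-trans (≤-reflexive eu) l))) (⊔-identityʳ _)

  sum-lo-hi : sumTo w lo + sumTo w hi ≡ sum a + sum u
  sum-lo-hi = trans (sumTo-pairing (dbl n) lo hi (at a) (at u) refl refl
      (λ {j} _ → trans (cong (λ t → (at a j ⊔ at u (2 + j)) + t) (⊓-comm (at u (2 + j)) (at a j))) (⊔+⊓ (at a j) (at u (2 + j))))
      (lo-tail ≤-refl) (lo-tail (n≤1+n _)))
    (cong₂ _+_ (sym (trans (sum-sumTo a) (cong (λ k → sumTo k (at a)) ea))) (sym (trans (sum-sumTo u) (cong (λ k → sumTo k (at u)) eu))))

-- Cuts of a row and the first violation of the lattice condition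

indᴺ : {P : Set} → Dec P → ℕ
indᴺ (yes _) = 1
indᴺ (no  _) = 0

indᴺ≤1 : {P : Set} (d : Dec P) → indᴺ d ≤ 1
indᴺ≤1 (yes _) = ≤-refl
indᴺ≤1 (no _)  = z≤n

indᴺ-yes : {P : Set} (d : Dec P) → P → indᴺ d ≡ 1
indᴺ-yes (yes _) p = refl
indᴺ-yes (no ¬p) p = ⊥-elim (¬p p)

indᴺ-no : {P : Set} (d : Dec P) → ¬ P → indᴺ d ≡ 0
indᴺ-no (yes p) ¬p = ⊥-elim (¬p p)
indᴺ-no (no _)  ¬p = refl

indᴺ-1 : {P : Set} (d : Dec P) → indᴺ d ≡ 1 → P
indᴺ-1 (yes p) _ = p
indᴺ-1 (no _) ()

three-bools : ∀ (x y z : Bool) → x ≢ y → z ≡ x ⊎ z ≡ y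
three-bools true  true  z ne = ⊥-elim (ne refl)
three-bools false false z ne = ⊥-elim (ne refl)
three-bools true  false true  _ = inj₁ refl
three-bools true  false false _ = inj₂ refl
three-bools false true  true  _ = inj₂ refl
three-bools false true  false _ = inj₁ refl

private
  gained : ∀ u c → u + c + (suc c + suc c) + 0 ≡ u + suc c + (c + c) + 1
  gained = solve-∀

  lost : ∀ u v c → u + c + (v + v) + 1 ≡ u + suc c + (v + v) + 0
  lost = solve-∀

  cut-above : ∀ l h c → (l + c) + (c + h) ≡ (l + h) + (c + c)
  cut-above = solve-∀

-- The effect of lowering a threshold by one: one new cell, with letter above v (gain) or below v (loss).
module _ {a v u c c′ : ℕ} (a≤v : a ≤ v) (v≤u : v ≤ u) where

  private
    at≤ : ∀ {x} → x ≤ c → x ⊔ c ≡ c × x ⊔ suc c ≡ suc c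
    at≤ l = m≤n⇒m⊔n≡n l , m≤n⇒m⊔n≡n (≤-trans l (n≤1+n c))
    at> : ∀ {x} → c < x → x ⊔ c ≡ x × x ⊔ suc c ≡ x
    at> l = m≥n⇒m⊔n≡m (<⇒≤ l) , m≥n⇒m⊔n≡m l

    by-values : ∀ {U A V U′ A′ V′ l k U₀ A₀ V₀ U₁ A₁ V₁ l₀ k₀ : ℕ} →
      U ≡ U₀ × U′ ≡ U₁ → A ≡ A₀ × A′ ≡ A₁ → V ≡ V₀ × V′ ≡ V₁ → l ≡ l₀ → k ≡ k₀ →
      U₀ + A₀ + (V₁ + V₁) + l₀ ≡ U₁ + A₁ + (V₀ + V₀) + k₀ → U + A + (V′ + V′) + l ≡ U′ + A′ + (V + V) + k
    by-values (refl , refl) (refl , refl) (refl , refl) refl refl e = e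

  cell-balance : c ≤ c′ → c′ ≤ suc c → (gain : Dec (c < c′ × v ≤ c × c < u)) (loss : Dec (c < c′ × a ≤ c × c < v)) →
    (u ⊔ c) + (a ⊔ c) + ((v ⊔ c′) + (v ⊔ c′)) + indᴺ loss ≡ (u ⊔ c′) + (a ⊔ c′) + ((v ⊔ c) + (v ⊔ c)) + indᴺ gain
  cell-balance c≤ ≤c gain loss with c <? c′
  ... | no ¬l with ≤-antisym c≤ (≮⇒≥ ¬l)
  ...   | refl = cong (λ t → (u ⊔ c) + (a ⊔ c) + ((v ⊔ c) + (v ⊔ c)) + t) (trans (indᴺ-no loss (λ p → ¬l (proj₁ p))) (sym (indᴺ-no gain (λ p → ¬l (proj₁ p)))))
  cell-balance c≤ ≤c gain loss | yes l with ≤-antisym ≤c l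
  ... | refl with u ≤? c | v ≤? c | a ≤? c
  ...   | yes u≤c | _ | _ = by-values (at≤ u≤c) (at≤ (≤-trans a≤v (≤-trans v≤u u≤c))) (at≤ (≤-trans v≤u u≤c))
            (indᴺ-no loss (λ p → <⇒≱ (proj₂ (proj₂ p)) (≤-trans v≤u u≤c))) (indᴺ-no gain (λ p → <⇒≱ (proj₂ (proj₂ p)) u≤c)) (cong (_+ 0) (+-comm (c + c) (suc c + suc c)))
  ...   | no u≰c | yes v≤c | _ = by-values (at> (≰⇒> u≰c)) (at≤ (≤-trans a≤v v≤c)) (at≤ v≤c)
            (indᴺ-no loss (λ p → <⇒≱ (proj₂ (proj₂ p)) v≤c)) (indᴺ-yes gain (l , v≤c , ≰⇒> u≰c)) (gained u c)
  ...   | no u≰c | no v≰c | yes a≤c = by-values (at> (≰⇒> u≰c)) (at≤ a≤c) (at> (≰⇒> v≰c))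
            (indᴺ-yes loss (l , a≤c , ≰⇒> v≰c)) (indᴺ-no gain (λ p → v≰c (proj₁ (proj₂ p)))) (lost u v c)
  ...   | no u≰c | no v≰c | no a≰c = by-values (at> (≰⇒> u≰c)) (at> (≰⇒> a≰c)) (at> (≰⇒> v≰c))
            (indᴺ-no loss (λ p → a≰c (proj₁ (proj₂ p)))) (indᴺ-no gain (λ p → v≰c (proj₁ (proj₂ p)))) refl

-- The cut at `Y` has the threshold `g (Y + j)` at position `j`. From `suc Y` to `Y` exactly one of
-- the `w` thresholds drops, by one, and `w` steps lower each of them once. For division by `w` this
-- reads the cells column by column from right to left, downwards in each column, alternating
-- between the two tableaux.
module Cut (n : ℕ) (g : ℕ → ℕ) (g-mono : ∀ {x y} → x ≤ y → g x ≤ g y) (g-w : ∀ x → g (x + dbl (suc n)) ≡ suc (g x)) where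

  private
    w : ℕ
    w = dbl (suc n)

  -- Row lengths, except that everything to the left of the cut Y is filled in.
  T≥ : Row → ℕ → ℕ
  T≥ x Y = sumTo w (λ j → at x j ⊔ g (Y + j))

  near : ∀ Y {i} j → i < w → g (Y + i) ≤ suc (g (Y + j))
  near Y {i} j i<w = ≤-trans (g-mono (≤-trans (+-monoʳ-≤ Y (≤-trans (<⇒≤ i<w) (m≤n+m w j))) (≤-reflexive (sym (+-assoc Y j w))))) (≤-reflexive (g-w (Y + j)))

  jump-unique : ∀ Y {i j} → i < j → j < w → g (Y + i) < g (suc Y + i) → g (Y + j) < g (suc Y + j) → ⊥
  jump-unique Y {i} {j} i<j j<w p q = <⇒≱ (<-≤-trans p (g-mono (≤-trans (≤-reflexive (sym (+-suc Y i))) (+-monoʳ-≤ Y i<j))))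
    (≤-pred (≤-trans q (≤-trans (g-mono (≤-trans (≤-trans (≤-reflexive (sym (+-suc Y j))) (+-monoʳ-≤ Y (≤-trans j<w (m≤n+m w i)))) (≤-reflexive (sym (+-assoc Y i w))))) (≤-reflexive (g-w (Y + i))))))

  module At (a u : Row) (ea : length a ≡ w) (eu : length u ≡ w) (v : Row) (ev : length v ≡ w)
            (iav : Inter w a v) (ivu : Inter w v u) where

    private
      av : ∀ j → at a j ≤ at v j × at v (2 + j) ≤ at a j
      av = inter-all a v ea ev iav
      vu : ∀ j → at v j ≤ at u j × at u (2 + j) ≤ at v j
      vu = inter-all v u ev eu ivu

      v-dec : Decreasing v
      v-dec j = ≤-trans (proj₂ (av j)) (proj₁ (av j))
      u-dec : Decreasing u
      u-dec j = ≤-trans (proj₂ (vu j)) (proj₁ (vu j))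

    -- Right of the cut, `T≥ u Y ∸ T≥ v Y` counts the cells with the upper letter and
    -- `T≥ v Y ∸ T≥ a Y` those with the lower one. So `Pos` is the lattice inequality for two
    -- consecutive letters, written without subtraction, and `Fail` is its violation by exactly one.
    Fail Pos : ℕ → Set
    Fail Y = T≥ u Y + T≥ a Y ≡ suc (T≥ v Y + T≥ v Y)
    Pos Y  = T≥ u Y + T≥ a Y ≤ T≥ v Y + T≥ v Y

    Gain Loss : ℕ → ℕ → ℕ → Set
    Gain Y Y′ j = g (Y + j) < g (Y′ + j) × at v j ≤ g (Y + j) × g (Y + j) < at u j
    Loss Y Y′ j = g (Y + j) < g (Y′ + j) × at a j ≤ g (Y + j) × g (Y + j) < at v j

    gain? : ∀ Y Y′ j → Dec (Gain Y Y′ j)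
    gain? Y Y′ j = (g (Y + j) <? g (Y′ + j)) ×-dec ((at v j ≤? g (Y + j)) ×-dec (g (Y + j) <? at u j))
    loss? : ∀ Y Y′ j → Dec (Loss Y Y′ j)
    loss? Y Y′ j = (g (Y + j) <? g (Y′ + j)) ×-dec ((at a j ≤? g (Y + j)) ×-dec (g (Y + j) <? at v j))

    gains losses : ℕ → ℕ → ℕ
    gains  Y Y′ = sumTo w (λ j → indᴺ (gain? Y Y′ j))
    losses Y Y′ = sumTo w (λ j → indᴺ (loss? Y Y′ j))

    -- Within at most `w` steps each threshold drops at most once, so each position contributes at
    -- most one cell and `cell-balance` can be summed over the positions.
    window-balance : ∀ Y d → d ≤ w →
      (T≥ u Y + T≥ a Y) + (T≥ v (d + Y) + T≥ v (d + Y)) + losses Y (d + Y) ≡ (T≥ u (d + Y) + T≥ a (d + Y)) + (T≥ v Y + T≥ v Y) + gains Y (d + Y)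
    window-balance Y d d≤w = trans (sym (total u a v Y (d + Y) (λ j → indᴺ (loss? Y (d + Y) j))))
      (trans (sumTo-cong w (λ {j} _ → cell-balance (proj₁ (av j)) (proj₁ (vu j)) (g-mono (+-monoˡ-≤ j (m≤n+m Y d))) (step j) (gain? Y (d + Y) j) (loss? Y (d + Y) j)))
             (total u a v (d + Y) Y (λ j → indᴺ (gain? Y (d + Y) j))))
      where
      step : ∀ j → g (d + Y + j) ≤ suc (g (Y + j))
      step j = ≤-trans (g-mono (≤-trans (≤-reflexive (trans (+-assoc d Y j) (+-comm d (Y + j)))) (+-monoʳ-≤ (Y + j) d≤w))) (≤-reflexive (g-w (Y + j)))
      total : ∀ x y z Y Y′ (f : ℕ → ℕ) →
        sumTo w (λ j → (at x j ⊔ g (Y + j)) + (at y j ⊔ g (Y + j)) + ((at z j ⊔ g (Y′ + j)) + (at z j ⊔ g (Y′ + j))) + f j) ≡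
        (T≥ x Y + T≥ y Y) + (T≥ z Y′ + T≥ z Y′) + sumTo w f
      total x y z Y Y′ f = trans (sumTo-+ w (λ j → X j + Y₁ j + (Z j + Z j)) f)
        (cong (_+ sumTo w f) (trans (sumTo-+ w (λ j → X j + Y₁ j) (λ j → Z j + Z j)) (cong₂ _+_ (sumTo-+ w X Y₁) (sumTo-+ w Z Z))))
        where
        X Y₁ Z : ℕ → ℕ
        X j = at x j ⊔ g (Y + j)
        Y₁ j = at y j ⊔ g (Y + j)
        Z j = at z j ⊔ g (Y′ + j)

    gains>losses : ∀ Y d → d ≤ w → Fail Y → Pos (d + Y) → losses Y (d + Y) < gains Y (d + Y)
    gains>losses Y d d≤w fl ps = +-cancelˡ-≤ (T≥ v Y + T≥ v Y + (T≥ v (d + Y) + T≥ v (d + Y))) _ _ (begin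
      V + V′ + suc N    ≡⟨ +-suc (V + V′) N ⟩
      suc V + V′ + N    ≡⟨ cong (λ t → t + V′ + N) (sym fl) ⟩
      (T≥ u Y + T≥ a Y) + V′ + N ≡⟨ window-balance Y d d≤w ⟩
      (T≥ u (d + Y) + T≥ a (d + Y)) + V + P ≤⟨ +-monoˡ-≤ P (+-monoˡ-≤ V ps) ⟩
      V′ + V + P        ≡⟨ cong (_+ P) (+-comm V′ V) ⟩
      V + V′ + P        ∎)
      where
      open ≤-Reasoning
      V = T≥ v Y + T≥ v Y
      V′ = T≥ v (d + Y) + T≥ v (d + Y)
      N = losses Y (d + Y)
      P = gains Y (d + Y)

    private
      -- Column strictness: within one tableau, an upper letter at position `i` leaves only cells
      -- outside `u` at the later positions of the window.
      same-parity : ∀ Y Y′ {i j} → odd i ≡ odd j → i < j → ¬ (Gain Y Y′ i × Gain Y Y′ j)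
      same-parity Y Y′ {i} {j} e i<j ((_ , p , _) , (_ , _ , q)) = <⇒≱ q
        (≤-trans (decreasing-mono u u-dec {2 + i} {j} e (odd-far {i} {j} e i<j)) (≤-trans (proj₂ (vu i)) (≤-trans p (g-mono (+-monoʳ-≤ Y (<⇒≤ i<j))))))

      -- By `same-parity` each tableau contributes at most one upper letter to the window. If a
      -- tableau has a lower letter there but no upper one, at most one gain faces at least one
      -- loss, too few to lead from a valid cut to a failing one.
      contradict : ∀ Y d → d ≤ w → Fail Y → Pos (d + Y) → ∀ {j} → j < w → Loss Y (d + Y) j →
        (∀ {i} → i < w → odd i ≡ odd j → ¬ Gain Y (d + Y) i) → ⊥
      contradict Y d d≤w fl ps {j} j<w ls no-gain = <⇒≱ (gains>losses Y d d≤w fl ps)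
        (≤-trans (sumTo-≤1 w {λ i → indᴺ (gain? Y (d + Y) i)} (λ {i} _ → indᴺ≤1 (gain? Y (d + Y) i)) excl)
                 (≤-trans (≤-reflexive (sym (indᴺ-yes (loss? Y (d + Y) j) ls))) (sumTo-≥ w {λ i → indᴺ (loss? Y (d + Y) i)} j<w)))
        where
        excl : ∀ {i k} → i < k → k < w → ¬ (indᴺ (gain? Y (d + Y) i) ≡ 1 × indᴺ (gain? Y (d + Y) k) ≡ 1)
        excl {i} {k} i<k k<w (p , q) = by (odd i 𝔹.≟ odd k)
          where
          gi = indᴺ-1 (gain? Y (d + Y) i) p
          gk = indᴺ-1 (gain? Y (d + Y) k) q
          by : Dec (odd i ≡ odd k) → ⊥
          by (yes e) = same-parity Y (d + Y) {i} {k} e i<k (gi , gk)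
          by (no ne) = case three-bools (odd i) (odd k) (odd j) ne of λ
            { (inj₁ e) → no-gain (<-trans i<k k<w) (sym e) gi
            ; (inj₂ e) → no-gain k<w (sym e) gk }

    -- One step reads at most one cell, so the excess of upper over lower letters grows by at most
    -- one. Hence the inequality cannot break without passing through an exact `Fail`.
    continuity : ∀ Y → Pos (suc Y) → ¬ Fail Y → Pos Y
    continuity Y ps nf = ≤-pred (≤∧≢⇒< bound nf)
      where
      open ≤-Reasoning
      V = T≥ v Y + T≥ v Y
      V′ = T≥ v (suc Y) + T≥ v (suc Y)
      one : gains Y (suc Y) ≤ 1
      one = sumTo-≤1 w {λ i → indᴺ (gain? Y (suc Y) i)} (λ {i} _ → indᴺ≤1 (gain? Y (suc Y) i))
        (λ {i} {k} i<k k<w (p , q) → jump-unique Y i<k k<w (proj₁ (indᴺ-1 (gain? Y (suc Y) i) p)) (proj₁ (indᴺ-1 (gain? Y (suc Y) k) q)))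
      bound : T≥ u Y + T≥ a Y ≤ suc V
      bound = +-cancelʳ-≤ V′ _ _ (begin
        T≥ u Y + T≥ a Y + V′ ≤⟨ m≤m+n _ (losses Y (suc Y)) ⟩
        T≥ u Y + T≥ a Y + V′ + losses Y (suc Y) ≡⟨ window-balance Y 1 (s≤s z≤n) ⟩
        (T≥ u (suc Y) + T≥ a (suc Y)) + V + gains Y (suc Y) ≤⟨ +-mono-≤ (+-monoˡ-≤ V ps) one ⟩
        V′ + V + 1 ≡⟨ trans (+-comm (V′ + V) 1) (cong suc (+-comm V′ V)) ⟩
        suc V + V′ ∎)

    module FirstFail (Y : ℕ) (fl : Fail Y) (ps : ∀ Y′ → Y < Y′ → Pos Y′) where

      open Between n a u ea eu hiding (w)
      open Free a u

      private
        c : ℕ → ℕ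
        c j = g (Y + j)

        no-gain-left : ∀ d {i j} → odd i ≡ odd j → i ≤ j → c j < at v j → ¬ Gain Y (d + Y) i
        no-gain-left d {i} {j} e i≤j c<v (_ , p , _) =
          <⇒≱ c<v (≤-trans (decreasing-mono v v-dec {i} {j} e i≤j) (≤-trans p (g-mono (+-monoʳ-≤ Y i≤j))))

      -- Otherwise the cell at `j` just right of the cut holds a lower letter without an upper
      -- letter beneath it. Then its tableau has no upper letter among the last `w` cells read,
      -- neither above `j` nor below, and `contradict` applies.
      left-of-cut : ∀ {j} → j < w → lo j ≤ c j → at v j ≤ c j
      left-of-cut {j} j<w l = ≮⇒≥ (λ c<v → contradict Y w ≤-refl fl (ps (w + Y) (s≤s (m≤n+m Y (suc (dbl n))))) j<w (jump , ≤-trans (m≤m⊔n _ _) l , c<v) (no-gain c<v))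
        where
        jump : c j < g (w + Y + j)
        jump = ≤-reflexive (trans (sym (g-w (Y + j))) (cong g (trans (+-comm (Y + j) w) (sym (+-assoc w Y j)))))
        no-gain : c j < at v j → ∀ {i} → i < w → odd i ≡ odd j → ¬ Gain Y (w + Y) i
        no-gain c<v {i} i<w e gn with i ≤? j
        ... | yes i≤j = no-gain-left w {i} {j} e i≤j c<v gn
        ... | no i≰j = <⇒≱ (proj₂ (proj₂ gn)) (≤-trans (decreasing-mono u u-dec {2 + j} {i} (sym e) (odd-far {j} {i} (sym e) (≰⇒> i≰j)))
                 (≤-trans (m≤n⊔m (at a j) _) (≤-trans l (g-mono (+-monoʳ-≤ Y (<⇒≤ (≰⇒> i≰j)))))))

      -- The threshold rises between `j` and `suc j` precisely when the last cell was read at `j`,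
      -- and the cell that completes a first failure holds the upper letter.
      last-read : ∀ {j} → j < w → c j < c (suc j) → at v j ≤ c j
      last-read {j} j<w jump = ≮⇒≥ (λ c<v → n≮0 (subst (losses Y (suc Y) <_) (no-gains c<v) (gains>losses Y 1 (s≤s z≤n) fl (ps (suc Y) ≤-refl))))
        where
        jump′ : c j < g (suc Y + j)
        jump′ = subst (λ t → c j < g t) (+-suc Y j) jump
        no-gains : c j < at v j → gains Y (suc Y) ≡ 0
        no-gains c<v = sumTo-zero w (λ {i} i<w → indᴺ-no (gain? Y (suc Y) i) (none i<w))
          where
          none : ∀ {i} → i < w → ¬ Gain Y (suc Y) i
          none {i} i<w (p , q , _) with <-cmp i j
          ... | tri< i<j _ _ = jump-unique Y i<j j<w p jump′
          ... | tri≈ _ refl _ = <⇒≱ c<v q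
          ... | tri> _ _ j<i = jump-unique Y j<i i<w jump′ p

      -- The one configuration in which the thresholds at `j` and `2 + j` would spoil the pairing of
      -- maximum and minimum in `centre`. If the last cell was read at `j`, `last-read` excludes it.
      -- Otherwise it was read at `suc j`, right after a lower letter at `j`, and two cells one of
      -- which is a lower letter do not lead from a valid cut to a failure.
      no-straddle : ∀ {j} → 2 + j < w → at a j ≤ c j → c j < c (2 + j) → c (2 + j) ≤ at u (2 + j) → ⊥
      no-straddle {j} j<w a≤c jump c≤u with c j <? c (suc j)
      ... | yes p = <⇒≱ c<v (last-read (<-trans (n<1+n j) (<-trans (n<1+n (suc j)) j<w)) p)
        where
        c<v : c j < at v j
        c<v = <-≤-trans jump (≤-trans c≤u (proj₂ (vu j)))
      ... | no ¬p = contradict Y 2 (s≤s (s≤s z≤n)) fl (ps (2 + Y) (n≤1+n (suc Y))) (<-trans (n<1+n j) (<-trans (n<1+n (suc j)) j<w)) (subst (c j <_) (cong g (shift j)) jump , a≤c , c<v) no-gain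
        where
        shift : ∀ j → Y + (2 + j) ≡ 2 + Y + j
        shift j = trans (+-suc Y (suc j)) (cong suc (+-suc Y j))
        c<v : c j < at v j
        c<v = <-≤-trans jump (≤-trans c≤u (proj₂ (vu j)))
        no-gain : ∀ {i} → i < w → odd i ≡ odd j → ¬ Gain Y (2 + Y) i
        no-gain {i} i<w e gn with i ≤? j
        ... | yes i≤j = no-gain-left 2 {i} {j} e i≤j c<v gn
        ... | no i≰j = <⇒≱ (proj₁ gn) (begin
          g (2 + Y + i)     ≤⟨ g-mono (≤-trans (≤-reflexive (sym (+-suc (suc Y) i))) (+-monoʳ-≤ (suc Y) i<w)) ⟩
          g (suc Y + w)     ≡⟨ g-w (suc Y) ⟩
          suc (g (suc Y))   ≤⟨ s≤s (g-mono (≤-trans (s≤s (m≤m+n Y j)) (≤-reflexive (sym (+-suc Y j))))) ⟩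
          suc (c (suc j))   ≤⟨ s≤s (≮⇒≥ ¬p) ⟩
          suc (c j)         ≤⟨ jump ⟩
          c (2 + j)         ≤⟨ g-mono (+-monoʳ-≤ Y (odd-far {j} {i} (sym e) (≰⇒> i≰j))) ⟩
          c i               ∎)
          where open ≤-Reasoning

      -- A failure needs at least one upper letter. The corresponding weight entry is then a
      -- successor, as the dot action in `DotAntisymmetric` demands.
      sum-v<sum-u : sumTo w (at v) < sumTo w (at u)
      sum-v<sum-u = ≰⇒> (λ le → n≮0 (subst (losses Y (suc Y) <_) (none le) (gains>losses Y 1 (s≤s z≤n) fl (ps (suc Y) ≤-refl))))
        where
        none : sumTo w (at u) ≤ sumTo w (at v) → gains Y (suc Y) ≡ 0
        none le = sumTo-zero w (λ {j} j<w → indᴺ-no (gain? Y (suc Y) j) (λ (_ , p , q) →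
          <⇒≱ (sumTo-< w {at v} {at u} (λ {i} _ → proj₁ (vu i)) j<w (≤-<-trans p q)) le))

      private
        pair-balance : ∀ {a u c c′} → c ≤ c′ → c′ ≤ suc c → ¬ (a ≤ c × c < c′ × c′ ≤ u) → ((a ⊔ u) ⊔ c) + ((u ⊓ a) ⊔ c′) ≡ (a ⊔ c) + (u ⊔ c′)
        pair-balance {a} {u} {c} {c′} c≤ ≤c ns with ≤-total u a
        ... | inj₁ u≤a rewrite m≥n⇒m⊔n≡m u≤a | m≤n⇒m⊓n≡m u≤a = refl
        ... | inj₂ a≤u rewrite m≤n⇒m⊔n≡n a≤u | m≥n⇒m⊓n≡n a≤u with c <? c′
        ...   | no ¬l rewrite ≤-antisym c≤ (≮⇒≥ ¬l) = +-comm (u ⊔ c′) (a ⊔ c′)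
        ...   | yes l with a ≤? c
        ...     | no a≰c rewrite m≥n⇒m⊔n≡m (≤-trans (<⇒≤ (≰⇒> a≰c)) a≤u) | m≥n⇒m⊔n≡m (≤-trans ≤c (≰⇒> a≰c))
                   | m≥n⇒m⊔n≡m (<⇒≤ (≰⇒> a≰c)) | m≥n⇒m⊔n≡m (≤-trans (≤-trans ≤c (≰⇒> a≰c)) a≤u) = +-comm u a
        ...     | yes a≤c rewrite m≤n⇒m⊔n≡n a≤c | m≤n⇒m⊔n≡n (≤-trans a≤c c≤) | m≤n⇒m⊔n≡n (≤-pred (≤-trans (≰⇒> (λ q → ns (a≤c , l , q))) ≤c))
                   | m≤n⇒m⊔n≡n (<⇒≤ (≰⇒> (λ q → ns (a≤c , l , q)))) = refl

        cut-balance : ∀ {lo hi v c} → (l? : Dec (lo ≤ c)) → lo ≤ v → v ≤ hi → (lo ≤ c → v ≤ c) →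
          (choose l? lo v + choose l? (hi ⊓ c) v) + ((lo ⊔ c) + (hi ⊔ c)) ≡ (lo + hi) + ((v ⊔ c) + (v ⊔ c))
        cut-balance {lo} {hi} {v} {c} (yes l) _ _ vc rewrite m≤n⇒m⊔n≡n l | m≤n⇒m⊔n≡n (vc l) with ≤-total hi c
        ... | inj₁ h rewrite m≤n⇒m⊓n≡m h | m≤n⇒m⊔n≡n h = refl
        ... | inj₂ h rewrite m≥n⇒m⊓n≡n h | m≥n⇒m⊔n≡m h = cut-above lo hi c
        cut-balance {lo} {hi} {v} {c} (no ¬l) lv vh _ rewrite m≥n⇒m⊔n≡m (<⇒≤ (≰⇒> ¬l)) | m≥n⇒m⊔n≡m (≤-trans (<⇒≤ (≰⇒> ¬l)) lv)
          | m≥n⇒m⊔n≡m (≤-trans (<⇒≤ (≰⇒> ¬l)) (≤-trans lv vh)) = +-comm (v + v) (lo + hi)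

      within : Within w lo hi v
      within = to-within v iav ivu

      -- Truncation would preserve the total of the bounds if as many upper as lower letters had
      -- been read; the excess of one recorded by `Fail` lowers it by one. Reversal thus sends the
      -- two weight entries `x` and `suc y` to `y` and `suc x`, the dot action of a transposition.
      centre : suc (sumTo w (cutLo lo hi c v) + sumTo w (cutHi lo hi c v)) ≡ sum a + sum u
      centre = +-cancelʳ-≡ (T≥ v Y + T≥ v Y) _ _ (begin
        suc (sumTo w (cutLo lo hi c v) + sumTo w (cutHi lo hi c v)) + V
          ≡⟨ sym (+-suc (sumTo w (cutLo lo hi c v) + sumTo w (cutHi lo hi c v)) V) ⟩
        sumTo w (cutLo lo hi c v) + sumTo w (cutHi lo hi c v) + suc V
          ≡⟨ cong (λ t → sumTo w (cutLo lo hi c v) + sumTo w (cutHi lo hi c v) + t) (trans (sym fl) (trans (+-comm (T≥ u Y) (T≥ a Y)) (sym pairs))) ⟩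
        sumTo w (cutLo lo hi c v) + sumTo w (cutHi lo hi c v) + (sumTo w (λ j → lo j ⊔ c j) + sumTo w (λ j → hi j ⊔ c j))
          ≡⟨ trans (cong₂ _+_ (sym (sumTo-+ w (cutLo lo hi c v) (cutHi lo hi c v))) (sym (sumTo-+ w (λ j → lo j ⊔ c j) (λ j → hi j ⊔ c j)))) (sym (sumTo-+ w (λ j → cutLo lo hi c v j + cutHi lo hi c v j) (λ j → (lo j ⊔ c j) + (hi j ⊔ c j)))) ⟩
        sumTo w (λ j → (cutLo lo hi c v j + cutHi lo hi c v j) + ((lo j ⊔ c j) + (hi j ⊔ c j)))
          ≡⟨ sumTo-cong w (λ {j} j<w → cut-balance (lo j ≤? c j) (proj₁ (within j<w)) (proj₂ (within j<w)) (left-of-cut j<w)) ⟩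
        sumTo w (λ j → (lo j + hi j) + ((at v j ⊔ c j) + (at v j ⊔ c j)))
          ≡⟨ trans (sumTo-+ w (λ j → lo j + hi j) (λ j → (at v j ⊔ c j) + (at v j ⊔ c j))) (cong₂ _+_ (sumTo-+ w lo hi) (sumTo-+ w (λ j → at v j ⊔ c j) (λ j → at v j ⊔ c j))) ⟩
        sumTo w lo + sumTo w hi + V
          ≡⟨ cong (_+ V) sum-lo-hi ⟩
        sum a + sum u + V ∎)
        where
        open ≡-Reasoning
        V = T≥ v Y + T≥ v Y
        pairs : sumTo w (λ j → lo j ⊔ c j) + sumTo w (λ j → hi j ⊔ c j) ≡ T≥ a Y + T≥ u Y
        pairs = sumTo-pairing (dbl n) (λ j → lo j ⊔ c j) (λ j → hi j ⊔ c j) (λ j → at a j ⊔ c j) (λ j → at u j ⊔ c j) refl refl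
          (λ {j} l → pair-balance (g-mono (+-monoʳ-≤ Y (m≤n+m j 2))) (near Y j (s≤s (s≤s l))) (λ (p , q , r) → no-straddle (s≤s (s≤s l)) p q r))
          (cong (_⊔ c (dbl n)) (lo-tail ≤-refl)) (cong (_⊔ c (suc (dbl n))) (lo-tail (n≤1+n _)))

      -- The target of a lock comes after its source, where the threshold is not smaller. The target
      -- of a cross may have a threshold smaller by one, which is absorbed by the successor in
      -- `crossL`.
      links-inner : All (λ L → low L ≤ c (src L) → hi (tgt L) ≤ c (tgt L)) links
      links-inner = links-All _
        (λ {j} _ _ l → ≤-trans l (g-mono (+-monoʳ-≤ Y (≤-trans (par-≥ j) (n≤1+n _)))))
        (λ {j} j<w _ l → ≤-pred (≤-trans l (near Y (par j) j<w)))

      -- If `low` lies right of the cut, a locked source lies there too, and by `left-of-cut` so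
      -- does its whole interval. The bound for the target then follows since two thresholds of one
      -- cut differ by at most one.
      links-frozen : All (λ L → c (src L) < low L → Locked L v → c (src L) < lo (src L) × c (tgt L) ≤ high L) links
      links-frozen = links-All _ lock cross
        where
        right : ∀ {j k} → j < w → c j < k → k ≤ at v j → c j < lo j
        right j<w l m = ≰⇒> (λ q → <⇒≱ (<-≤-trans l m) (left-of-cut j<w q))
        lock : ∀ {j} → j < w → LockAt j → c j < hi (2 + par j) → Locked (lockL j) v → c j < lo j × c (2 + par j) ≤ lo j
        lock {j} j<w la l (m , _) = right j<w l m , ≤-trans (near Y j (lock-tgt la)) (right j<w l m)
        cross : ∀ {j} → j < w → CrossAt j → c j < suc (hi (par j)) → Locked (crossL j) v → c j < lo j × c (par j) ≤ lo j ∸ 1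
        cross {j} j<w _ l (m , _) = r , ∸-monoˡ-≤ 1 (≤-trans (s≤s tgt≤) r)
          where
          r : c j < lo j
          r = right j<w l m
          -- The threshold can rise right after `j` only if the last cell was read at `j`, and then
          -- `last-read` would put the entry at `j` left of the cut.
          tgt≤ : c (par j) ≤ c j
          tgt≤ with c j <? c (suc j)
          ... | yes p = ⊥-elim (<⇒≱ r (≤-trans (proj₁ (within j<w)) (last-read j<w p)))
          ... | no ¬p = ≤-trans (g-mono (+-monoʳ-≤ Y (par-≤ j))) (≮⇒≥ ¬p)

-- Chains of rows

lev : List Row → ℕ → Row
lev []       _       = []
lev (x ∷ xs) zero    = x
lev (x ∷ xs) (suc i) = lev xs i

lev-++ˡ : ∀ ρ τ {i} → i < length ρ → lev (ρ ++ τ) i ≡ lev ρ i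
lev-++ˡ (x ∷ ρ) τ {zero}  _       = refl
lev-++ˡ (x ∷ ρ) τ {suc i} (s≤s l) = lev-++ˡ ρ τ l

lev-++ʳ : ∀ ρ τ i → lev (ρ ++ τ) (length ρ + i) ≡ lev τ i
lev-++ʳ []      τ i = refl
lev-++ʳ (x ∷ ρ) τ i = lev-++ʳ ρ τ i

lev-other : ∀ ρ τ v v′ {i} → i ≢ length ρ → lev (ρ ++ v ∷ τ) i ≡ lev (ρ ++ v′ ∷ τ) i
lev-other []      τ v v′ {zero}  ne = ⊥-elim (ne refl)
lev-other []      τ v v′ {suc i} ne = refl
lev-other (x ∷ ρ) τ v v′ {zero}  ne = refl
lev-other (x ∷ ρ) τ v v′ {suc i} ne = lev-other ρ τ v v′ (ne ∘ cong suc)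

All-lev : {X : Row → Set} → ∀ {ρ} → All X ρ → ∀ {i} → i < length ρ → X (lev ρ i)
All-lev (x ∷ xs) {zero}  _       = x
All-lev (x ∷ xs) {suc i} (s≤s l) = All-lev xs l

diffs : List ℕ → List ℕ
diffs []          = []
diffs (x ∷ [])    = []
diffs (x ∷ y ∷ r) = (y ∸ x) ∷ diffs (y ∷ r)

length-diffs : ∀ x A → length (diffs (x ∷ A)) ≡ length A
length-diffs x []      = refl
length-diffs x (y ∷ A) = cong suc (length-diffs y A)

lastOf : ℕ → List ℕ → ℕ
lastOf x []      = x
lastOf x (y ∷ A) = lastOf y A

diffs-split : ∀ x A t y B → diffs ((x ∷ A) ++ t ∷ y ∷ B) ≡ diffs (x ∷ A) ++ (t ∸ lastOf x A) ∷ (y ∸ t) ∷ diffs (y ∷ B)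
diffs-split x []      t y B = refl
diffs-split x (z ∷ A) t y B = cong ((z ∸ x) ∷_) (diffs-split z A t y B)

lastOf-sum : ∀ s p → lastOf (sum s) (map sum p) ≡ sum (lev (s ∷ p) (length p))
lastOf-sum s []      = refl
lastOf-sum s (x ∷ p) = lastOf-sum x p

swapAt : ℕ → List ℕ → List ℕ
swapAt zero    (x ∷ y ∷ r) = y ∷ x ∷ r
swapAt (suc k) (x ∷ r)     = x ∷ swapAt k r
swapAt _       r           = r

swapAt-++ : ∀ P x y R → swapAt (length P) (P ++ x ∷ y ∷ R) ≡ P ++ y ∷ x ∷ R
swapAt-++ []      x y R = refl
swapAt-++ (z ∷ P) x y R = cong (z ∷_) (swapAt-++ P x y R)

-- Antisymmetry under the dot action of the symmetric group, in a shape that avoids subtraction.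
DotAntisymmetric : (List ℕ → ℤ) → Set
DotAntisymmetric f = ∀ P x y R → f (P ++ x ∷ suc y ∷ R) ≡ ⊝ f (P ++ y ∷ suc x ∷ R)

at≤sum : ∀ x j → at x j ≤ sum x
at≤sum []       j       = z≤n
at≤sum (x ∷ xs) zero    = m≤m+n x _
at≤sum (x ∷ xs) (suc j) = ≤-trans (at≤sum xs j) (m≤n+m _ x)

module Widths (n : ℕ) where

  w : ℕ
  w = dbl (suc n)

  g : ℕ → ℕ
  g x = x / dbl (suc n)

  g-mono : ∀ {x y} → x ≤ y → g x ≤ g y
  g-mono l = /-monoˡ-≤ (dbl (suc n)) l

  g-w : ∀ x → g (x + dbl (suc n)) ≡ suc (g x)
  g-w x = trans (+-distrib-/-∣ʳ x (∣-refl {dbl (suc n)})) (trans (cong (λ t → g x + t) (n/n≡1 (dbl (suc n)))) (+-comm (g x) 1))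

  g-zero : ∀ {j} → j < w → g j ≡ 0
  g-zero l = m<n⇒m/n≡0 l

  g-big : ∀ N j → N ≤ g (N * w + j)
  g-big zero    j = z≤n
  g-big (suc N) j = ≤-trans (s≤s (g-big N j)) (≤-reflexive (trans (sym (g-w (N * w + j))) (cong g (trans (+-comm (N * w + j) w) (sym (+-assoc w (N * w) j))))))

  open Cut n g g-mono g-w public

  sum-T≥ : ∀ x → length x ≡ w → T≥ x 0 ≡ sum x
  sum-T≥ x ex = trans (sumTo-cong w (λ {j} l → trans (cong (at x j ⊔_) (g-zero l)) (⊔-identityʳ _))) (sym (trans (sum-sumTo x) (cong (λ k → sumTo k (at x)) ex)))

  FailAt : List Row → ℕ → ℕ → Set
  FailAt ρ i Y = T≥ (lev ρ (2 + i)) Y + T≥ (lev ρ i) Y ≡ suc (T≥ (lev ρ (1 + i)) Y + T≥ (lev ρ (1 + i)) Y)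

  PosAt : List Row → ℕ → ℕ → Set
  PosAt ρ i Y = T≥ (lev ρ (2 + i)) Y + T≥ (lev ρ i) Y ≤ T≥ (lev ρ (1 + i)) Y + T≥ (lev ρ (1 + i)) Y

  failAt? : ∀ ρ i Y → Dec (FailAt ρ i Y)
  failAt? ρ i Y = _ ≟ _

-- Chains with fixed ends: symmetry in the weight and the lattice rule

module Chains (n : ℕ) (s e : Row) (es : length s ≡ dbl (suc n)) (ee : length e ≡ dbl (suc n)) (m : ℕ) where

  open Widths n

  -- `N` bounds every entry of every row of a chain, so at the cut `Ymax` nothing has been read.
  N Ymax : ℕ
  N = sum s + sum e
  Ymax = N * w

  Valid : List Row → Set
  Valid z = (∀ {i} → i < m → Inter w (lev (s ∷ z) i) (lev (s ∷ z) (suc i))) × lev (s ∷ z) m ≡ e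

  valid? : ∀ z → Dec (Valid z)
  valid? z = allUpTo? (λ i → inter? w (lev (s ∷ z) i) (lev (s ∷ z) (suc i))) m ×-dec (lev (s ∷ z) m ≟ᴿ e)

  wt : List Row → List ℕ
  wt z = diffs (map sum (s ∷ z))

  NoFail : ℕ → List Row → Set
  NoFail Y z = ∀ {Y′} → Y′ < Ymax → Y ≤ Y′ → ∀ {i} → i < m ∸ 1 → ¬ FailAt (s ∷ z) i Y′

  noFail? : ∀ Y z → Dec (NoFail Y z)
  noFail? Y z = allUpTo? (λ Y′ → (Y ≤? Y′) →-dec allUpTo? (λ i → ¬? (failAt? (s ∷ z) i Y′)) (m ∸ 1)) Ymax

  Lattice : List Row → Set
  Lattice = NoFail 0

  lattice? : ∀ z → Dec (Lattice z)
  lattice? = noFail? 0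

  -- No violation before (Y , i): cuts are scanned from right to left, and levels upwards at each cut.
  Before : ℕ → ℕ → List Row → Set
  Before Y i z = NoFail (suc Y) z × (∀ {i′} → i′ < i → ¬ FailAt (s ∷ z) i′ Y)

  before? : ∀ Y i z → Dec (Before Y i z)
  before? Y i z = noFail? (suc Y) z ×-dec allUpTo? (λ i′ → ¬? (failAt? (s ∷ z) i′ Y)) i

  rows-length : ∀ {z} → InArrays e m z → ∀ {i} → i ≤ m → length (lev (s ∷ z) i) ≡ w
  rows-length (ez , oks) {i} i≤m = All-lev {λ x → length x ≡ w} (es ∷ All.map (λ ok → trans (proj₁ ok) ee) oks) (s≤s (≤-trans i≤m (≤-reflexive (sym ez))))

  rows-bound : ∀ {z} → InArrays e m z → ∀ {i} → i ≤ m → ∀ j → at (lev (s ∷ z) i) j ≤ N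
  rows-bound {z} (ez , oks) {i} i≤m = All-lev {λ x → ∀ j → at x j ≤ N} (first ∷ All.map (λ {x} → rest x) oks) (s≤s (≤-trans i≤m (≤-reflexive (sym ez))))
    where
    first : ∀ j → at s j ≤ N
    first j = ≤-trans (at≤sum s j) (m≤m+n (sum s) (sum e))
    rest : ∀ x → InBox e x → ∀ j → at x j ≤ N
    rest x ok j = ≤-trans (proj₂ ok j) (≤-trans (at≤sum e j) (m≤n+m (sum e) (sum s)))

  -- Descends from `Ymax`, where both sides are equal; `continuity` turns the absence of exact
  -- failures into the inequality at every later cut.
  pos-above : ∀ {z} → InArrays e m z → Valid z → ∀ Y → NoFail Y z → ∀ {i} → i < m ∸ 1 → ∀ Y′ → Y ≤ Y′ → PosAt (s ∷ z) i Y′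
  pos-above {z} ok (val , _) Y nf {i} i<m Y′ Y≤Y′ = go (Ymax ∸ Y′) Y′ Y≤Y′ refl
    where
    2+i≤m : 2 + i ≤ m
    2+i≤m = ≤-trans (s≤s i<m) (suc-pred-≤ m i<m)
      where
      suc-pred-≤ : ∀ m {i} → i < m ∸ 1 → suc (m ∸ 1) ≤ m
      suc-pred-≤ (suc m) _ = ≤-refl
    open At (lev (s ∷ z) i) (lev (s ∷ z) (2 + i)) (rows-length ok (≤-trans (m≤n+m i 2) 2+i≤m)) (rows-length ok 2+i≤m)
            (lev (s ∷ z) (1 + i)) (rows-length ok (≤-trans (n≤1+n _) 2+i≤m)) (val (≤-trans (n≤1+n _) 2+i≤m)) (val 2+i≤m)
    far : ∀ Y′ → Ymax ≤ Y′ → ∀ {i} → i ≤ m → T≥ (lev (s ∷ z) i) Y′ ≡ sumTo w (λ j → g (Y′ + j))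
    far Y′ l i≤m = sumTo-cong w (λ {j} _ → m≤n⇒m⊔n≡n (≤-trans (rows-bound ok i≤m j) (≤-trans (g-big N j) (g-mono (+-monoˡ-≤ j l)))))
    go : ∀ d Y′ → Y ≤ Y′ → Ymax ∸ Y′ ≡ d → PosAt (s ∷ z) i Y′
    go zero Y′ l eq = ≤-reflexive (cong₂ _+_ (trans (far Y′ big 2+i≤m) (sym (far Y′ big (≤-trans (n≤1+n _) 2+i≤m))))
                                            (trans (far Y′ big (≤-trans (m≤n+m i 2) 2+i≤m)) (sym (far Y′ big (≤-trans (n≤1+n _) 2+i≤m)))))
      where
      big : Ymax ≤ Y′
      big = m∸n≡0⇒m≤n eq
    go (suc d) Y′ l eq = continuity Y′ (go d (suc Y′) (≤-trans l (n≤1+n _)) (trans (sym (pred[m∸n]≡m∸[1+n] Ymax Y′)) (cong (_∸ 1) eq)))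
      (nf (m∸n≢0⇒n<m (λ z → case trans (sym eq) z of λ ())) l i<m)

  -- The weighting may depend on an inner row only through the pattern of its locks with the two
  -- neighbouring rows. The constant 1, used for straight shapes, and the indicator of
  -- nonseparability are of this kind.
  InvariantUnderLocks : (List Row → ℤ) → Set
  InvariantUnderLocks G = ∀ p v v′ u q → InArrays e m (p ++ v ∷ u ∷ q) → InArrays e m (p ++ v′ ∷ u ∷ q) →
    Valid (p ++ v ∷ u ∷ q) → Valid (p ++ v′ ∷ u ∷ q) →
    SameLocks (Free.linksOf (lev (s ∷ p) (length p)) u (upTo w)) v v′ → G (p ++ v ∷ u ∷ q) ≡ G (p ++ v′ ∷ u ∷ q)

  module _ (G : List Row → ℤ) (G-inv : InvariantUnderLocks G) where

    weigh : (List ℕ → ℤ) → List Row → ℤ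
    weigh f z = ind (valid? z) ⊗ (G z ⊗ f (wt z))

    total : (List ℕ → ℤ) → ℤ
    total f = ∑ (arrays e m) (weigh f)

    module Split (p : List Row) (u : Row) (q : List Row)
                 (okp : All (InBox e) p) (oku : InBox e u) (okq : All (InBox e) q)
                 (em : m ≡ length p + (2 + length q)) where

      k : ℕ
      k = length p

      a : Row
      a = lev (s ∷ p) k

      z : Row → List Row
      z v = p ++ v ∷ u ∷ q

      ρ : Row → List Row
      ρ v = s ∷ z v

      k<m : k < m
      k<m = ≤-trans (≤-trans (≤-reflexive (+-comm 1 k)) (+-monoʳ-≤ k (s≤s z≤n))) (≤-reflexive (sym em))

      1+k<m : suc k < m
      1+k<m = ≤-trans (≤-trans (≤-reflexive (+-comm 2 k)) (+-monoʳ-≤ k (s≤s (s≤s z≤n)))) (≤-reflexive (sym em))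

      k<m∸1 : k < m ∸ 1
      k<m∸1 = ∸-monoˡ-≤ 1 1+k<m

      all-z : ∀ {p : List Row} → All (InBox e) p → ∀ {v} → InBox e v → All (InBox e) (p ++ v ∷ u ∷ q)
      all-z []       okv = okv ∷ oku ∷ okq
      all-z (x ∷ xs) okv = x ∷ all-z xs okv

      ok-z : ∀ v → InBox e v → InArrays e m (z v)
      ok-z v okv = trans (length-++ p) (sym em) , all-z okp okv

      ea : length a ≡ w
      ea = All-lev {λ x → length x ≡ w} (es ∷ All.map (λ ok → trans (proj₁ ok) ee) okp) ≤-refl

      eu : length u ≡ w
      eu = trans (proj₁ oku) ee

      lev-a : ∀ v → lev (ρ v) k ≡ a
      lev-a v = lev-++ˡ (s ∷ p) (v ∷ u ∷ q) ≤-refl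

      lev-v : ∀ v → lev (ρ v) (suc k) ≡ v
      lev-v v = trans (cong (lev (ρ v)) (cong suc (sym (+-identityʳ k)))) (lev-++ʳ (s ∷ p) (v ∷ u ∷ q) 0)

      lev-u : ∀ v → lev (ρ v) (2 + k) ≡ u
      lev-u v = trans (cong (lev (ρ v)) (cong suc (+-comm 1 k))) (lev-++ʳ (s ∷ p) (v ∷ u ∷ q) 1)

      lev-o : ∀ v v′ {i} → i ≢ suc k → lev (ρ v) i ≡ lev (ρ v′) i
      lev-o v v′ = lev-other (s ∷ p) (u ∷ q) v v′

      open Between n a u ea eu hiding (w)
      open Free a u

      Rest : Row → Set
      Rest v = (∀ {i} → i < m → i ≢ k → i ≢ suc k → Inter w (lev (ρ v) i) (lev (ρ v) (suc i))) × lev (ρ v) m ≡ e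

      rest? : ∀ v → Dec (Rest v)
      rest? v = allUpTo? (λ i → ¬? (i ≟ k) →-dec (¬? (i ≟ suc k) →-dec inter? w (lev (ρ v) i) (lev (ρ v) (suc i)))) m ×-dec (lev (ρ v) m ≟ᴿ e)

      rest-indep : ∀ v v′ → Rest v → Rest v′
      rest-indep v v′ (h , l) = (λ i<m n₁ n₂ → subst₂ (Inter w) (lev-o v v′ n₂) (lev-o v v′ (n₁ ∘ suc-injective)) (h i<m n₁ n₂)) ,
                                trans (sym (lev-o v v′ (λ e → <⇒≢ 1+k<m (sym e)))) l

      -- `Rest` does not depend on the row at the chosen level, so it is tested with the empty row
      -- and becomes a constant factor of the inner sum.
      rest : Dec (Rest [])
      rest = rest? []

      valid-split : ∀ v → Valid (z v) → Rest [] × (Inter w a v × Inter w v u)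
      valid-split v (h , l) = rest-indep v [] ((λ i<m _ _ → h i<m) , l) ,
        subst₂ (Inter w) (lev-a v) (lev-v v) (h k<m) , subst₂ (Inter w) (lev-v v) (lev-u v) (h 1+k<m)

      valid-join : ∀ v → Rest [] → Inter w a v → Inter w v u → Valid (z v)
      valid-join v r iav ivu = all , proj₂ r′
        where
        r′ = rest-indep [] v r
        all : ∀ {i} → i < m → Inter w (lev (ρ v) i) (lev (ρ v) (suc i))
        all {i} i<m with i ≟ k | i ≟ suc k
        ... | yes refl | _        = subst₂ (Inter w) (sym (lev-a v)) (sym (lev-v v)) iav
        ... | no _     | yes refl = subst₂ (Inter w) (sym (lev-v v)) (sym (lev-u v)) ivu
        ... | no n₁    | no n₂    = proj₁ r′ i<m n₁ n₂

      length-v : ∀ v → InBox e v → length v ≡ w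
      length-v v okv = trans (proj₁ okv) ee

      from-in : ∀ v → InBox e v → Within w lo hi v → Inter w a v × Inter w v u
      from-in v okv p = from-within v (length-v v okv) p

      valid-in : ∀ v → InBox e v → Rest [] → Within w lo hi v → Valid (z v)
      valid-in v okv r p = valid-join v r (proj₁ (from-in v okv p)) (proj₂ (from-in v okv p))

      ind-valid : ∀ v → InBox e v → ind (within? w lo hi v) ⊗ ind rest ≡ ind (valid? (z v))
      ind-valid v okv = ind-× (within? w lo hi v) rest (valid? (z v)) (λ p r → valid-in v okv r p)
        (λ val → to-within v (proj₁ (proj₂ (valid-split v val))) (proj₂ (proj₂ (valid-split v val))) , proj₁ (valid-split v val))

      α β : ℕ
      α = sum a
      β = sum u

      P R : List ℕ
      P = diffs (map sum (s ∷ p))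
      R = diffs (map sum (u ∷ q))

      weight : ℕ → List ℕ
      weight t = P ++ (t ∸ α) ∷ (β ∸ t) ∷ R

      wt-z : ∀ v → wt (z v) ≡ weight (sum v)
      wt-z v = trans (cong diffs (map-++ sum (s ∷ p) (v ∷ u ∷ q)))
        (trans (diffs-split (sum s) (map sum p) (sum v) (sum u) (map sum q)) (cong (λ t → P ++ (sum v ∸ t) ∷ (β ∸ sum v) ∷ R) (lastOf-sum s p)))

      length-P : length P ≡ k
      length-P = trans (length-diffs (sum s) (map sum p)) (length-map sum p)

      sums : ∀ v → InBox e v → Within w lo hi v → α ≤ sum v × sum v ≤ β
      sums v okv p = le a v ea (length-v v okv) (λ l → proj₁ (proj₁ (from-in v okv p) l)) , le v u (length-v v okv) eu (λ l → proj₁ (proj₂ (from-in v okv p) l))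
        where
        le : ∀ x y → length x ≡ w → length y ≡ w → (∀ {j} → j < w → at x j ≤ at y j) → sum x ≤ sum y
        le x y ex ey h = subst₂ _≤_ (sym (trans (sum-sumTo x) (cong (λ t → sumTo t (at x)) ex))) (sym (trans (sum-sumTo y) (cong (λ t → sumTo t (at y)) ey))) (sumTo-mono w h)

      hi≤e : ∀ {j} → j < w → hi j ≤ at e j
      hi≤e {j} _ = ≤-trans (hi≤u j) (proj₂ oku j)

      private
        top : ℕ → ℕ
        top j = g (Ymax + j)

        u≤top : ∀ i j → at u i ≤ top j
        u≤top i j = ≤-trans (proj₂ oku i) (≤-trans (at≤sum e i) (≤-trans (m≤n+m (sum e) (sum s)) (g-big N j)))

      -- With the cut right of all cells nothing is frozen and no interval is truncated, so the
      -- reversal of the left part is the reversal of the whole row and the centre is `α + β`.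
      good-top : ∀ v → InBox e v → Within w lo hi v → ⊤ → LeftReversal.Good e w ee lo hi top (α + β) links v
      good-top v okv p _ = record
        { below = λ {j} l _ → ≤-trans (proj₂ (p l)) (≤-trans (hi≤u j) (u≤top j j))
        ; inner = All.universal (λ L _ → ≤-trans (hi≤u (tgt L)) (u≤top (tgt L) (tgt L))) links
        ; frozen = links-All _ (λ {j} _ _ l → ⊥-elim (<⇒≱ l (≤-trans (hi≤u (2 + par j)) (u≤top (2 + par j) j)))) (λ {j} _ c l → ⊥-elim (<⇒≱ l (≤-trans (proj₁ (proj₂ c)) (≤-trans (hi≤u j) (u≤top j j)))))
        ; centre = trans (sym sum-lo-hi) (sym (cong₂ _+_
            (sumTo-cong w {cutLo lo hi top v} {lo} (λ {j} l → choose-yes (lo j ≤? top j) (left l)))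
            (sumTo-cong w {cutHi lo hi top v} {hi} (λ {j} l → trans (choose-yes (lo j ≤? top j) (left l)) (m≤n⇒m⊓n≡m (≤-trans (hi≤u j) (u≤top j j))))))) }
        where
        left : ∀ {j} → j < w → lo j ≤ top j
        left {j} l = ≤-trans (proj₁ (p l)) (≤-trans (proj₂ (p l)) (≤-trans (hi≤u j) (u≤top j j)))

      weight-flip : ∀ t → α ≤ t → t ≤ β → swapAt k (weight t) ≡ weight (α + β ∸ t)
      weight-flip t l h = trans (cong (λ i → swapAt i (weight t)) (sym length-P)) (trans (swapAt-++ P (t ∸ α) (β ∸ t) R)
        (cong₂ (λ x y → P ++ x ∷ y ∷ R) e₁ e₂))
        where
        e₁ : β ∸ t ≡ α + β ∸ t ∸ α
        e₁ = sym (trans (∸-+-assoc (α + β) t α) (trans (cong (α + β ∸_) (+-comm t α)) ([m+n]∸[m+o]≡n∸o α β t)))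
        e₂ : t ∸ α ≡ β ∸ (α + β ∸ t)
        e₂ = sym (trans (cong (_∸ (α + β ∸ t)) (sym (m+n∸m≡n α β))) (trans (∸-+-assoc (α + β) α (α + β ∸ t))
          (trans (cong (α + β ∸_) (+-comm α (α + β ∸ t))) (trans (sym (∸-+-assoc (α + β) (α + β ∸ t) α))
            (cong (_∸ α) (m∸[m∸n]≡n (≤-trans h (m≤n+m β α))))))))

      row-symmetric : ∀ f → ∑ (box e) (λ v → weigh f (z v)) ≡ ∑ (box e) (λ v → weigh (f ∘ swapAt k) (z v))
      row-symmetric f = begin
        ∑ (box e) (λ v → weigh f (z v))
          ≡⟨ ∑-cong-All (Enumerates.sound (box-enumerates e)) (λ v okv → trans (shape v okv (f (wt (z v)))) (cong (λ t → ind (within? w lo hi v) ⊗ (Φ v ⊗ f t)) (wt-z v))) ⟩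
        ∑ (box e) (λ v → ind (within? w lo hi v) ⊗ (Φ v ⊗ f (weight (sum v))))
          ≡⟨ LeftReversal.reverse-left e w ee lo hi top hi≤e links links-ok links-disjoint (α + β) Φ (λ _ → ⊤) (λ _ _ _ _ → tt) (λ _ _ _ _ _ _ _ _ → tt) good-top Φ-resp (f ∘ weight) ⟩
        ∑ (box e) (λ v → ind (within? w lo hi v) ⊗ (Φ v ⊗ f (weight (α + β ∸ sum v))))
          ≡⟨ ∑-cong-All (Enumerates.sound (box-enumerates e)) (λ v okv → sym (trans (shape v okv (f (swapAt k (wt (z v)))))
               (ind-*-cong (within? w lo hi v) (λ p → cong (λ t → Φ v ⊗ f t) (trans (cong (swapAt k) (wt-z v)) (weight-flip (sum v) (proj₁ (sums v okv p)) (proj₂ (sums v okv p)))))))) ⟩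
        ∑ (box e) (λ v → weigh (f ∘ swapAt k) (z v)) ∎
        where
        open ≡-Reasoning
        Φ : Row → ℤ
        Φ v = ind rest ⊗ G (z v)
        shape : ∀ v → InBox e v → (x : ℤ) → ind (valid? (z v)) ⊗ (G (z v) ⊗ x) ≡ ind (within? w lo hi v) ⊗ (Φ v ⊗ x)
        shape v okv x = trans (cong (_⊗ (G (z v) ⊗ x)) (sym (ind-valid v okv)))
          (trans (⊗-assoc (ind (within? w lo hi v)) (ind rest) _) (cong (ind (within? w lo hi v) ⊗_) (sym (⊗-assoc (ind rest) (G (z v)) x))))
        Φ-resp : ∀ v v′ → InBox e v → InBox e v′ → Within w lo hi v → Within w lo hi v′ → SameAbove w top v v′ → SameLocks links v v′ → Φ v ≡ Φ v′
        Φ-resp v v′ okv okv′ i i′ _ sl = ind-*-cong rest (λ r → G-inv p v v′ u q (ok-z v okv) (ok-z v′ okv′) (valid-in v okv r i) (valid-in v′ okv′ r i′) sl)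

      module AtCut (Y : ℕ) (f : List ℕ → ℤ) (anti : DotAntisymmetric f) where

        private
          c : ℕ → ℕ
          c j = g (Y + j)

          C : ℕ
          -- One less than for the whole row, by `centre`.
          C = α + β ∸ 1

          -- A threshold of a later cut absorbs that of the cut `Y`. So the statistics at `Y` and at
          -- all later cuts see only the part of the row that `SameAbove` fixes, and being the first
          -- failure is a property of a class.
          T-lev : ∀ v v′ → SameAbove w c v v′ → ∀ {Y′} → Y ≤ Y′ → ∀ i → T≥ (lev (ρ v) i) Y′ ≡ T≥ (lev (ρ v′) i) Y′
          T-lev v v′ sa {Y′} l i = by (i ≟ suc k)
            where
            deeper : ∀ x j → at x j ⊔ g (Y′ + j) ≡ (at x j ⊔ c j) ⊔ g (Y′ + j)
            deeper x j = trans (cong (at x j ⊔_) (sym (m≤n⇒m⊔n≡n (g-mono (+-monoˡ-≤ j l))))) (sym (⊔-assoc (at x j) (c j) _))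
            by : Dec (i ≡ suc k) → T≥ (lev (ρ v) i) Y′ ≡ T≥ (lev (ρ v′) i) Y′
            by (no ne)    = cong (λ x → T≥ x Y′) (lev-o v v′ ne)
            by (yes refl) = trans (cong (λ x → T≥ x Y′) (lev-v v)) (trans
              (sumTo-cong w {λ j → at v j ⊔ g (Y′ + j)} {λ j → at v′ j ⊔ g (Y′ + j)}
                 (λ {j} j<w → trans (deeper v j) (trans (cong (_⊔ g (Y′ + j)) (sa j<w)) (sym (deeper v′ j)))))
              (cong (λ x → T≥ x Y′) (sym (lev-v v′))))

          fail-resp : ∀ v v′ → SameAbove w c v v′ → ∀ {Y′} → Y ≤ Y′ → ∀ i → FailAt (ρ v) i Y′ → FailAt (ρ v′) i Y′
          fail-resp v v′ sa l i h = trans (sym (cong₂ _+_ (T-lev v v′ sa l (2 + i)) (T-lev v v′ sa l i)))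
            (trans h (cong suc (cong₂ _+_ (T-lev v v′ sa l (1 + i)) (T-lev v v′ sa l (1 + i)))))

          pos-resp : ∀ v v′ → SameAbove w c v v′ → ∀ {Y′} → Y ≤ Y′ → ∀ i → PosAt (ρ v) i Y′ → PosAt (ρ v′) i Y′
          pos-resp v v′ sa l i = subst₂ _≤_ (cong₂ _+_ (T-lev v v′ sa l (2 + i)) (T-lev v v′ sa l i)) (cong₂ _+_ (T-lev v v′ sa l (1 + i)) (T-lev v v′ sa l (1 + i)))

          sa-sym : ∀ v v′ → SameAbove w c v v′ → SameAbove w c v′ v
          sa-sym v v′ sa l = sym (sa l)

          before-resp : ∀ v v′ → SameAbove w c v v′ → Before Y k (z v) → Before Y k (z v′)
          before-resp v v′ sa (h₁ , h₂) =
            (λ l Y<Y′ {i} i<m h → h₁ l Y<Y′ i<m (fail-resp v′ v (sa-sym v v′ sa) (<⇒≤ Y<Y′) i h)) ,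
            (λ {i} i<k h → h₂ i<k (fail-resp v′ v (sa-sym v v′ sa) ≤-refl i h))

          Ψ : Row → Set
          Ψ v = FailAt (ρ v) k Y × (∀ Y′ → Y < Y′ → PosAt (ρ v) k Y′)

          first : Row → ℤ
          first v = ind (before? Y k (z v)) ⊗ ind (failAt? (ρ v) k Y)

          Φ : Row → ℤ
          Φ v = ind rest ⊗ (G (z v) ⊗ first v)

          Φ⇒Ψ : ∀ v → InBox e v → Within w lo hi v → Φ v ≢ + 0 → Ψ v
          Φ⇒Ψ v okv i ne = by rest refl (before? Y k (z v)) refl (failAt? (ρ v) k Y) refl
            where
            by : (d : Dec (Rest [])) → rest ≡ d → (d₁ : Dec (Before Y k (z v))) → before? Y k (z v) ≡ d₁ → (d₂ : Dec (FailAt (ρ v) k Y)) → failAt? (ρ v) k Y ≡ d₂ → Ψ v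
            by (no ¬r) _ _ _ _ _ = ⊥-elim (ne (ind-*-zero rest (λ r → ⊥-elim (¬r r))))
            by _ _ (no ¬b) _ _ _ = ⊥-elim (ne (ind-*-zero rest (λ _ → trans (cong (G (z v) ⊗_) (ind-*-zero (before? Y k (z v)) (λ b → ⊥-elim (¬b b)))) (⊗-zeroʳ _))))
            by _ _ _ _ (no ¬f) _ = ⊥-elim (ne (ind-*-zero rest (λ _ → trans (cong (G (z v) ⊗_) (ind-*-zero (before? Y k (z v)) (λ _ → ind-no (failAt? (ρ v) k Y) ¬f))) (⊗-zeroʳ _))))
            by (yes r) _ (yes b) _ (yes fl) _ = fl , pos-above (ok-z v okv) (valid-in v okv r i) (suc Y) (proj₁ b) k<m∸1

          Ψ-resp : ∀ v v′ → InBox e v → InBox e v′ → Within w lo hi v → Within w lo hi v′ → SameAbove w c v v′ → Ψ v → Ψ v′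
          Ψ-resp v v′ _ _ _ _ sa (h , ps) = fail-resp v v′ sa ≤-refl k h , (λ Y′ l → pos-resp v v′ sa (<⇒≤ l) k (ps Y′ l))

          module Fixed (v : Row) (okv : InBox e v) (i : Within w lo hi v) (ψ : Ψ v) where
            open At a u ea eu v (length-v v okv) (proj₁ (from-in v okv i)) (proj₂ (from-in v okv i))
            T-eq : ∀ Y′ → (T≥ (lev (ρ v) (2 + k)) Y′ + T≥ (lev (ρ v) k) Y′ ≡ T≥ u Y′ + T≥ a Y′) × (T≥ (lev (ρ v) (1 + k)) Y′ + T≥ (lev (ρ v) (1 + k)) Y′ ≡ T≥ v Y′ + T≥ v Y′)
            T-eq Y′ = cong₂ (λ x y → T≥ x Y′ + T≥ y Y′) (lev-u v) (lev-a v) , cong (λ x → T≥ x Y′ + T≥ x Y′) (lev-v v)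
            fl : Fail Y
            fl = trans (sym (proj₁ (T-eq Y))) (trans (proj₁ ψ) (cong suc (proj₂ (T-eq Y))))
            ps : ∀ Y′ → Y < Y′ → Pos Y′
            ps Y′ l = subst₂ _≤_ (proj₁ (T-eq Y′)) (proj₂ (T-eq Y′)) (proj₂ ψ Y′ l)
            open FirstFail Y fl ps public

          Ψ⇒Good : ∀ v → InBox e v → Within w lo hi v → Ψ v → LeftReversal.Good e w ee lo hi c C links v
          Ψ⇒Good v okv i ψ = record { below = F.left-of-cut ; inner = F.links-inner ; frozen = F.links-frozen ; centre = sym (cong (_∸ 1) F.centre) }
            where module F = Fixed v okv i ψ

          Φ-resp : ∀ v v′ → InBox e v → InBox e v′ → Within w lo hi v → Within w lo hi v′ → SameAbove w c v v′ → SameLocks links v v′ → Φ v ≡ Φ v′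
          Φ-resp v v′ okv okv′ i i′ sa sl = ind-*-cong rest (λ r → cong₂ _⊗_
            (G-inv p v v′ u q (ok-z v okv) (ok-z v′ okv′) (valid-in v okv r i) (valid-in v′ okv′ r i′) sl)
            (cong₂ _⊗_ (ind-cong (before? Y k (z v)) (before? Y k (z v′)) (before-resp v v′ sa) (before-resp v′ v (sa-sym v v′ sa)))
                       (ind-cong (failAt? (ρ v) k Y) (failAt? (ρ v′) k Y) (fail-resp v v′ sa ≤-refl k) (fail-resp v′ v (sa-sym v v′ sa) ≤-refl k))))

          -- In the coordinates `t = α + x` and `β = t + suc y` every truncated subtraction is
          -- exact.
          dot-arith : ∀ α x y → let t = α + x ; β = t + suc y ; t′ = α + β ∸ 1 ∸ t in
            (t ∸ α ≡ x × β ∸ t ≡ suc y) × (t′ ∸ α ≡ y × β ∸ t′ ≡ suc x)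
          dot-arith α x y = (m+n∸m≡n α x , m+n∸m≡n (α + x) (suc y)) , (trans (cong (_∸ α) t′≡) (m+n∸m≡n α y)) , trans (cong ((α + x + suc y) ∸_) t′≡) last
            where
            t′≡ : α + (α + x + suc y) ∸ 1 ∸ (α + x) ≡ α + y
            t′≡ = trans (cong (λ s → s ∸ 1 ∸ (α + x)) (rearr α x y)) (m+n∸n≡m (α + y) (α + x))
              where
              rearr : ∀ α x y → α + (α + x + suc y) ≡ suc (α + y + (α + x))
              rearr = solve-∀
            last : α + x + suc y ∸ (α + y) ≡ suc x
            last = trans (cong (_∸ (α + y)) (rearr α x y)) (m+n∸n≡m (suc x) (α + y))
              where
              rearr : ∀ α x y → α + x + suc y ≡ suc x + (α + y)
              rearr = solve-∀

          weight-dot : ∀ t → α ≤ t → t < β → f (weight (C ∸ t)) ≡ ⊝ f (weight t)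
          weight-dot t l h = general α β (t ∸ α) (β ∸ suc t) t (sym (m+[n∸m]≡n l)) (sym (trans (+-suc t _) (m+[n∸m]≡n h)))
            where
            general : ∀ α β x y t → t ≡ α + x → β ≡ t + suc y →
              f (P ++ (α + β ∸ 1 ∸ t ∸ α) ∷ (β ∸ (α + β ∸ 1 ∸ t)) ∷ R) ≡ ⊝ f (P ++ (t ∸ α) ∷ (β ∸ t) ∷ R)
            general α _ x y _ refl refl with dot-arith α x y
            ... | (e₁ , e₂) , (e₃ , e₄) = trans (cong₂ (λ s t → f (P ++ s ∷ t ∷ R)) e₃ e₄) (trans (anti P y x R) (cong ⊝_ (sym (cong₂ (λ s t → f (P ++ s ∷ t ∷ R)) e₁ e₂))))

          flips : ∀ v → InBox e v → Within w lo hi v → Φ v ⊗ f (weight (C ∸ sum v)) ≡ ⊝ (Φ v ⊗ f (weight (sum v)))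
          flips v okv i = by (Φ v ℤₚ.≟ + 0)
            where
            by : Dec (Φ v ≡ + 0) → Φ v ⊗ f (weight (C ∸ sum v)) ≡ ⊝ (Φ v ⊗ f (weight (sum v)))
            by (yes e₀) = trans (trans (cong (_⊗ f (weight (C ∸ sum v))) e₀) (⊗-zeroˡ _)) (sym (cong ⊝_ (trans (cong (_⊗ f (weight (sum v))) e₀) (⊗-zeroˡ _))))
            by (no ne)  = trans (cong (Φ v ⊗_) (weight-dot (sum v) (proj₁ (sums v okv i))
                (subst₂ _<_ (sym (trans (sum-sumTo v) (cong (λ l → sumTo l (at v)) (length-v v okv)))) (sym (trans (sum-sumTo u) (cong (λ l → sumTo l (at u)) eu)))
                  (Fixed.sum-v<sum-u v okv i (Φ⇒Ψ v okv i ne))))) (⊗-⊝ʳ (Φ v) _)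

          shape : ∀ v → InBox e v → weigh f (z v) ⊗ first v ≡ ind (within? w lo hi v) ⊗ (Φ v ⊗ f (weight (sum v)))
          shape v okv = begin
            ind (valid? (z v)) ⊗ (G (z v) ⊗ f (wt (z v))) ⊗ first v
              ≡⟨ cong (λ t → ind (valid? (z v)) ⊗ (G (z v) ⊗ f t) ⊗ first v) (wt-z v) ⟩
            ind (valid? (z v)) ⊗ (G (z v) ⊗ F) ⊗ first v
              ≡⟨ cong (λ t → t ⊗ (G (z v) ⊗ F) ⊗ first v) (sym (ind-valid v okv)) ⟩
            W ⊗ ind rest ⊗ (G (z v) ⊗ F) ⊗ first v
              ≡⟨ trans (cong (_⊗ first v) (⊗-assoc W (ind rest) _)) (⊗-assoc W _ (first v)) ⟩
            W ⊗ (ind rest ⊗ (G (z v) ⊗ F) ⊗ first v)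
              ≡⟨ cong (W ⊗_) (trans (⊗-assoc (ind rest) _ (first v)) (trans (cong (ind rest ⊗_) (trans (⊗-assoc (G (z v)) F (first v))
                   (trans (cong (G (z v) ⊗_) (⊗-comm F (first v))) (sym (⊗-assoc (G (z v)) (first v) F))))) (sym (⊗-assoc (ind rest) _ F)))) ⟩
            W ⊗ (Φ v ⊗ F) ∎
            where
            open ≡-Reasoning
            W = ind (within? w lo hi v)
            F = f (weight (sum v))

        -- Reversal about the centre for `C` changes the sign of `f` in every surviving term, so the
        -- sum is its own negative.
        row-zero : ∑ (box e) (λ v → weigh f (z v) ⊗ first v) ≡ + 0
        row-zero = trans (∑-cong-All (Enumerates.sound (box-enumerates e)) shape) (self-negative _ (begin
          ∑ (box e) (λ v → ind (within? w lo hi v) ⊗ (Φ v ⊗ f (weight (sum v))))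
            ≡⟨ LeftReversal.reverse-left e w ee lo hi c hi≤e links links-ok links-disjoint C Φ Ψ Φ⇒Ψ Ψ-resp Ψ⇒Good Φ-resp (f ∘ weight) ⟩
          ∑ (box e) (λ v → ind (within? w lo hi v) ⊗ (Φ v ⊗ f (weight (C ∸ sum v))))
            ≡⟨ ∑-cong-All (Enumerates.sound (box-enumerates e)) (λ v okv → trans (ind-*-cong (within? w lo hi v) (flips v okv)) (⊗-⊝ʳ (ind (within? w lo hi v)) _)) ⟩
          ∑ (box e) (λ v → ⊝ (ind (within? w lo hi v) ⊗ (Φ v ⊗ f (weight (sum v)))))
            ≡⟨ ∑-neg (box e) _ ⟩
          ⊝ ∑ (box e) (λ v → ind (within? w lo hi v) ⊗ (Φ v ⊗ f (weight (sum v)))) ∎))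
          where open ≡-Reasoning

    ∑-level : ∀ {k} → suc k < m → (F F′ : List Row → ℤ) →
      (∀ p u q → All (InBox e) p → InBox e u → All (InBox e) q → m ≡ length p + (2 + length q) → length p ≡ k →
         ∑ (box e) (λ v → F (p ++ v ∷ u ∷ q)) ≡ ∑ (box e) (λ v → F′ (p ++ v ∷ u ∷ q))) →
      ∑ (arrays e m) F ≡ ∑ (arrays e m) F′
    ∑-level {k} k<m F F′ h = begin
      ∑ (arrays e m) F ≡⟨ cong (λ t → ∑ (arrays e t) F) em ⟩
      ∑ (arrays e (k + suc r)) F ≡⟨ ∑-arrays-split e k r F ⟩
      ∑ (arrays e k) (λ p → ∑ (arrays e r) (λ q → ∑ (box e) (λ v → F (p ++ v ∷ q))))
        ≡⟨ ∑-cong-All (Enumerates.sound (arrays-enumerates e k)) (λ p okp → ∑-cong-All (Enumerates.sound (arrays-enumerates e r)) (λ q okq → inner p okp q okq)) ⟩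
      ∑ (arrays e k) (λ p → ∑ (arrays e r) (λ q → ∑ (box e) (λ v → F′ (p ++ v ∷ q))))
        ≡⟨ sym (∑-arrays-split e k r F′) ⟩
      ∑ (arrays e (k + suc r)) F′ ≡⟨ cong (λ t → ∑ (arrays e t) F′) (sym em) ⟩
      ∑ (arrays e m) F′ ∎
      where
      open ≡-Reasoning
      r : ℕ
      r = suc (m ∸ (2 + k))
      em : m ≡ k + suc r
      em = trans (sym (m+[n∸m]≡n k<m)) (trans (cong (λ t → suc (suc t)) refl) (sym (trans (+-suc k r) (cong suc (+-suc k (m ∸ (2 + k)))))))
      inner : ∀ p → InArrays e k p → ∀ q → InArrays e r q → ∑ (box e) (λ v → F (p ++ v ∷ q)) ≡ ∑ (box e) (λ v → F′ (p ++ v ∷ q))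
      inner p (ep , okp) (u ∷ q) (eq , oku ∷ okq) = h p u q okp oku okq (trans em (cong₂ _+_ (sym ep) (cong suc (sym eq)))) ep

    total-symmetric : ∀ {k} → suc k < m → ∀ f → total f ≡ total (f ∘ swapAt k)
    total-symmetric k<m f = ∑-level k<m (weigh f) (weigh (f ∘ swapAt _)) (λ { p u q okp oku okq em refl → Split.row-symmetric p u q okp oku okq em f })

    -- A chain violating the condition has a unique first violation. The violating chains are
    -- therefore removed in batches indexed by cut and level, and each batch sums to zero by
    -- `row-zero`.
    total-lattice : ∀ f → DotAntisymmetric f → total f ≡ ∑ (arrays e m) (λ z → weigh f z ⊗ ind (lattice? z))
    total-lattice f anti = trans start (descend Ymax ≤-refl)
      where
      open ≡-Reasoning
      Q : ℕ → ℤ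
      Q Y = ∑ (arrays e m) (λ z → weigh f z ⊗ ind (noFail? Y z))
      Q′ : ℕ → ℕ → ℤ
      Q′ Y i = ∑ (arrays e m) (λ z → weigh f z ⊗ ind (before? Y i z))
      start : total f ≡ Q Ymax
      start = ∑-cong (arrays e m) (λ z → sym (trans (cong (weigh f z ⊗_) (ind-yes (noFail? Ymax z) (λ l h → ⊥-elim (<⇒≱ l h)))) (trans (⊗-comm (weigh f z) (+ 1)) (⊗-identityˡ _))))
      advance : ∀ Y i → i < m ∸ 1 → Q′ Y i ≡ Q′ Y (suc i)
      advance Y i i<m = sym (begin
        Q′ Y (suc i)
          ≡⟨ ∑-cong (arrays e m) (λ z → trans (cong (weigh f z ⊗_) (less z)) (⊗-distribˡ-⊟ (weigh f z) _ _)) ⟩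
        ∑ (arrays e m) (λ z → weigh f z ⊗ ind (before? Y i z) ⊟ weigh f z ⊗ (ind (before? Y i z) ⊗ ind (failAt? (s ∷ z) i Y)))
          ≡⟨ ∑-− (arrays e m) _ _ ⟩
        Q′ Y i ⊟ ∑ (arrays e m) (λ z → weigh f z ⊗ (ind (before? Y i z) ⊗ ind (failAt? (s ∷ z) i Y)))
          ≡⟨ cong (λ t → Q′ Y i ⊟ t) (trans (∑-level 1+i<m _ (λ _ → + 0) (λ { p u q okp oku okq em refl → trans (Split.AtCut.row-zero p u q okp oku okq em Y f anti) (sym (∑-zero (box e) (λ _ → refl))) })) (∑-zero (arrays e m) (λ _ → refl))) ⟩
        Q′ Y i ⊟ + 0
          ≡⟨ ℤₚ.+-identityʳ _ ⟩
        Q′ Y i ∎)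
        where
        1+i<m : suc i < m
        1+i<m = up m i<m
          where
          up : ∀ m → i < m ∸ 1 → suc i < m
          up (suc m) l = s≤s l
        less : ∀ z → ind (before? Y (suc i) z) ≡ ind (before? Y i z) ⊟ ind (before? Y i z) ⊗ ind (failAt? (s ∷ z) i Y)
        less z = by (before? Y (suc i) z) (before? Y i z) (failAt? (s ∷ z) i Y)
          where
          by : (d : Dec (Before Y (suc i) z)) (d₁ : Dec (Before Y i z)) (d₂ : Dec (FailAt (s ∷ z) i Y)) → ind d ≡ ind d₁ ⊟ ind d₁ ⊗ ind d₂
          by (yes (b , h)) (no ¬b) _ = ⊥-elim (¬b (b , λ l → h (≤-trans l (n≤1+n i))))
          by (yes (b , h)) _ (yes x) = ⊥-elim (h ≤-refl x)
          by (yes _) (yes _) (no _) = sym (cong (λ t → + 1 ⊟ t) (⊗-zeroʳ (+ 1)))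
          by (no ¬b) (yes (b , h)) (no ¬f) = ⊥-elim (¬b (b , λ {i′} l fl → extend i′ l fl))
            where
            extend : ∀ i′ → i′ < suc i → ¬ FailAt (s ∷ z) i′ Y
            extend i′ l fl with i′ ≟ i
            ... | yes refl = ¬f fl
            ... | no ne = h (≤∧≢⇒< (≤-pred l) ne) fl
          by (no _) (yes _) (yes _) = sym (cong (λ t → + 1 ⊟ t) (⊗-identityˡ (+ 1)))
          by (no _) (no _) d₂ = sym (cong (λ t → + 0 ⊟ t) (⊗-zeroˡ (ind d₂)))
      scan : ∀ Y i → i ≤ m ∸ 1 → Q′ Y 0 ≡ Q′ Y i
      scan Y zero    _ = refl
      scan Y (suc i) l = trans (scan Y i (≤-trans (n≤1+n i) l)) (advance Y i l)
      step : ∀ Y → Y < Ymax → Q (suc Y) ≡ Q Y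
      step Y l = trans (∑-cong (arrays e m) (λ z → cong (weigh f z ⊗_) (ind-cong (noFail? (suc Y) z) (before? Y 0 z) (λ h → h , λ ()) proj₁)))
        (trans (scan Y (m ∸ 1) ≤-refl)
               (∑-cong (arrays e m) (λ z → cong (weigh f z ⊗_) (ind-cong (before? Y (m ∸ 1) z) (noFail? Y z) (join z) (λ h → (λ a b → h a (<⇒≤ b)) , h l ≤-refl)))))
        where
        join : ∀ z → Before Y (m ∸ 1) z → NoFail Y z
        join z (h , h₀) {Y′} l′ Y≤Y′ with Y ≟ Y′
        ... | yes refl = h₀
        ... | no ne = h l′ (≤∧≢⇒< Y≤Y′ ne)
      descend : ∀ Y → Y ≤ Ymax → Q Y ≡ Q 0
      descend zero    _ = refl
      descend (suc Y) l = trans (step Y l) (descend Y (≤-trans (n≤1+n Y) l))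

-- Symmetric functions are determined by their antisymmetrization

sg : ℕ → ℕ → ℤ
sg x y with <-cmp x y
... | tri< _ _ _ = ⊝ + 1
... | tri≈ _ _ _ = + 0
... | tri> _ _ _ = + 1

sg-anti : ∀ x y → sg x y ≡ ⊝ sg y x
sg-anti x y with <-cmp x y | <-cmp y x
... | tri< _ _ _   | tri> _ _ _   = refl
... | tri≈ _ _ _   | tri≈ _ _ _   = refl
... | tri> _ _ _   | tri< _ _ _   = refl
... | tri< l _ _   | tri< l′ _ _  = ⊥-elim (<-asym l l′)
... | tri< _ ne _  | tri≈ _ e _   = ⊥-elim (ne (sym e))
... | tri≈ _ e _   | tri< _ ne _  = ⊥-elim (ne (sym e))
... | tri≈ _ e _   | tri> _ ne _  = ⊥-elim (ne (sym e))
... | tri> _ ne _  | tri≈ _ e _   = ⊥-elim (ne (sym e))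
... | tri> _ _ l   | tri> _ _ l′  = ⊥-elim (<-asym l l′)

sg-> : ∀ {x y} → y < x → sg x y ≡ + 1
sg-> {x} {y} l with <-cmp x y
... | tri< _ _ ¬l = ⊥-elim (¬l l)
... | tri≈ _ _ ¬l = ⊥-elim (¬l l)
... | tri> _ _ _  = refl

sgs : ℕ → List ℕ → ℤ
sgs x []       = + 1
sgs x (y ∷ ys) = sg x y ⊗ sgs x ys

-- The sign of the permutation sorting a list, and 0 if entries repeat.
sign : List ℕ → ℤ
sign []       = + 1
sign (x ∷ xs) = sgs x xs ⊗ sign xs

private
  ⊗-swap : ∀ x y z → x ⊗ (y ⊗ z) ≡ y ⊗ (x ⊗ z)
  ⊗-swap x y z = trans (sym (⊗-assoc x y z)) (trans (cong (_⊗ z) (⊗-comm x y)) (⊗-assoc y x z))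

  ⊗-⊝ˡ : ∀ x y → (⊝ x) ⊗ y ≡ ⊝ (x ⊗ y)
  ⊗-⊝ˡ x y = trans (⊗-comm (⊝ x) y) (trans (⊗-⊝ʳ y x) (cong ⊝_ (⊗-comm y x)))

sgs-swap : ∀ z P x y R → sgs z (P ++ x ∷ y ∷ R) ≡ sgs z (P ++ y ∷ x ∷ R)
sgs-swap z []      x y R = ⊗-swap (sg z x) (sg z y) (sgs z R)
sgs-swap z (p ∷ P) x y R = cong (sg z p ⊗_) (sgs-swap z P x y R)

sign-swap : ∀ P x y R → sign (P ++ x ∷ y ∷ R) ≡ ⊝ sign (P ++ y ∷ x ∷ R)
sign-swap (p ∷ P) x y R = trans (cong₂ _⊗_ (sgs-swap p P x y R) (sign-swap P x y R)) (⊗-⊝ʳ (sgs p (P ++ y ∷ x ∷ R)) _)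
sign-swap [] x y R = begin
  sg x y ⊗ sgs x R ⊗ (sgs y R ⊗ sign R) ≡⟨ cong (λ t → t ⊗ sgs x R ⊗ (sgs y R ⊗ sign R)) (sg-anti x y) ⟩
  (⊝ sg y x) ⊗ sgs x R ⊗ (sgs y R ⊗ sign R) ≡⟨ cong (_⊗ (sgs y R ⊗ sign R)) (⊗-⊝ˡ (sg y x) (sgs x R)) ⟩
  (⊝ (sg y x ⊗ sgs x R)) ⊗ (sgs y R ⊗ sign R) ≡⟨ ⊗-⊝ˡ _ _ ⟩
  ⊝ (sg y x ⊗ sgs x R ⊗ (sgs y R ⊗ sign R)) ≡⟨ cong ⊝_ (trans (⊗-assoc (sg y x) (sgs x R) _) (trans (cong (sg y x ⊗_) (⊗-swap (sgs x R) (sgs y R) (sign R))) (sym (⊗-assoc (sg y x) (sgs y R) _)))) ⟩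
  ⊝ (sg y x ⊗ sgs y R ⊗ (sgs x R ⊗ sign R)) ∎
  where open ≡-Reasoning

-- The staircase, sorting and alternants

addδ : List ℕ → List ℕ
addδ []       = []
addδ (x ∷ xs) = (x + length xs) ∷ addδ xs

-- After addition of the staircase the dot action becomes an ordinary transposition of adjacent
-- entries.
addδ-dot : ∀ P x y R → ∃ λ P′ → ∃ λ a → ∃ λ b → addδ (P ++ x ∷ suc y ∷ R) ≡ P′ ++ a ∷ b ∷ addδ R × addδ (P ++ y ∷ suc x ∷ R) ≡ P′ ++ b ∷ a ∷ addδ R
addδ-dot [] x y R = [] , x + suc (length R) , suc y + length R , refl ,
  cong₂ (λ s t → s ∷ t ∷ addδ R) (+-suc y (length R)) (sym (+-suc x (length R)))
addδ-dot (p ∷ P) x y R with addδ-dot P x y R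
... | P′ , a , b , e₁ , e₂ = (p + length (P ++ x ∷ suc y ∷ R)) ∷ P′ , a , b , cong (_ ∷_) e₁ ,
  cong₂ _∷_ (cong (λ t → p + t) (trans (length-++ P) (sym (length-++ P)))) e₂

addδ-injective : ∀ {x y} → length x ≡ length y → addδ x ≡ addδ y → x ≡ y
addδ-injective {[]} {[]} _ _ = refl
addδ-injective {x ∷ xs} {y ∷ ys} l e = cong₂ _∷_
  (+-cancelʳ-≡ (length xs) x y (trans (∷-injectiveˡ e) (cong (λ t → y + t) (sym (suc-injective l))))) (addδ-injective (suc-injective l) (∷-injectiveʳ e))

insert : ℕ → List ℕ → List ℕ
insert x []       = x ∷ []
insert x (y ∷ ys) = choose (y ≤? x) (x ∷ y ∷ ys) (y ∷ insert x ys)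

isort : List ℕ → List ℕ
isort []       = []
isort (x ∷ xs) = insert x (isort xs)

insert-≤ : ∀ {x y} ys → y ≤ x → insert x (y ∷ ys) ≡ x ∷ y ∷ ys
insert-≤ {x} {y} ys = choose-yes (y ≤? x)

insert-> : ∀ {x y} ys → x < y → insert x (y ∷ ys) ≡ y ∷ insert x ys
insert-> {x} {y} ys l = choose-no (y ≤? x) (<⇒≱ l)

private
  insert-comm-< : ∀ x y l → x < y → insert x (insert y l) ≡ insert y (insert x l)
  insert-comm-< x y [] l = trans (insert-> [] l) (sym (insert-≤ [] (<⇒≤ l)))
  insert-comm-< x y (z ∷ zs) l with z ≤? x | z ≤? y
  ... | yes p | yes q = trans (insert-> (z ∷ zs) l) (trans (cong (y ∷_) (insert-≤ zs p)) (sym (insert-≤ (z ∷ zs) (<⇒≤ l))))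
  ... | yes p | no ¬q = ⊥-elim (¬q (≤-trans p (<⇒≤ l)))
  ... | no ¬p | yes q = trans (insert-> (z ∷ zs) l) (trans (cong (y ∷_) (insert-> zs (≰⇒> ¬p))) (sym (insert-≤ (insert x zs) q)))
  ... | no ¬p | no ¬q = trans (insert-> (insert y zs) (≰⇒> ¬p)) (trans (cong (z ∷_) (insert-comm-< x y zs l)) (sym (insert-> (insert x zs) (≰⇒> ¬q))))

insert-comm : ∀ x y l → insert x (insert y l) ≡ insert y (insert x l)
insert-comm x y l with <-cmp x y
... | tri< x<y _ _  = insert-comm-< x y l x<y
... | tri≈ _ refl _ = refl
... | tri> _ _ y<x  = sym (insert-comm-< y x l y<x)

isort-swap : ∀ P x y R → isort (P ++ x ∷ y ∷ R) ≡ isort (P ++ y ∷ x ∷ R)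
isort-swap []      x y R = insert-comm x y (isort R)
isort-swap (p ∷ P) x y R = cong (insert p) (isort-swap P x y R)

-- For strictly decreasing `τ`, the coefficient of the monomial with exponent `addδ β` in the
-- antisymmetrization of the monomial with exponent `τ`.
alternant : List ℕ → List ℕ → ℤ
alternant τ β = sign (addδ β) ⊗ ind (isort (addδ β) ≟ᴿ τ)

alternant-dot : ∀ τ → DotAntisymmetric (alternant τ)
alternant-dot τ P x y R with addδ-dot P x y R
... | P′ , a , b , e₁ , e₂ = begin
  sign (addδ (P ++ x ∷ suc y ∷ R)) ⊗ ind (isort (addδ (P ++ x ∷ suc y ∷ R)) ≟ᴿ τ) ≡⟨ cong (λ l → sign l ⊗ ind (isort l ≟ᴿ τ)) e₁ ⟩
  sign (P′ ++ a ∷ b ∷ addδ R) ⊗ ind (isort (P′ ++ a ∷ b ∷ addδ R) ≟ᴿ τ)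
    ≡⟨ cong₂ (λ s l → s ⊗ ind (l ≟ᴿ τ)) (sign-swap P′ a b (addδ R)) (isort-swap P′ a b (addδ R)) ⟩
  (⊝ sign (P′ ++ b ∷ a ∷ addδ R)) ⊗ ind (isort (P′ ++ b ∷ a ∷ addδ R) ≟ᴿ τ) ≡⟨ ⊗-⊝ˡ _ _ ⟩
  ⊝ (sign (P′ ++ b ∷ a ∷ addδ R) ⊗ ind (isort (P′ ++ b ∷ a ∷ addδ R) ≟ᴿ τ)) ≡⟨ cong (λ l → ⊝ (sign l ⊗ ind (isort l ≟ᴿ τ))) (sym e₂) ⟩
  ⊝ (sign (addδ (P ++ y ∷ suc x ∷ R)) ⊗ ind (isort (addδ (P ++ y ∷ suc x ∷ R)) ≟ᴿ τ)) ∎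
  where open ≡-Reasoning

sq dotδ sqδ : List ℕ → ℕ
sq []         = 0
sq (x ∷ xs)   = x * x + sq xs
dotδ []       = 0
dotδ (x ∷ xs) = x * length xs + dotδ xs
sqδ []        = 0
sqδ (x ∷ xs)  = length xs * length xs + sqδ xs

length-addδ : ∀ β → length (addδ β) ≡ length β
length-addδ []      = refl
length-addδ (x ∷ β) = cong suc (length-addδ β)

-- The expansion of the squared norm of `addδ β` minus the staircase, arranged without subtraction.
-- Among all `β` of one length for which `addδ β` is a rearrangement of a fixed list, only the inner
-- product with the staircase varies.
sq-addδ : ∀ β → sq β + (dotδ (addδ β) + dotδ (addδ β)) ≡ sq (addδ β) + sqδ β
sq-addδ []      = refl
sq-addδ (x ∷ β) = begin
  x * x + sq β + ((x + ℓ) * length (addδ β) + d + ((x + ℓ) * length (addδ β) + d))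
    ≡⟨ cong (λ t → x * x + sq β + ((x + ℓ) * t + d + ((x + ℓ) * t + d))) (length-addδ β) ⟩
  x * x + sq β + ((x + ℓ) * ℓ + d + ((x + ℓ) * ℓ + d)) ≡⟨ expand x ℓ (sq β) d ⟩
  (x + ℓ) * (x + ℓ) + ℓ * ℓ + (sq β + (d + d)) ≡⟨ cong (λ t → (x + ℓ) * (x + ℓ) + ℓ * ℓ + t) (sq-addδ β) ⟩
  (x + ℓ) * (x + ℓ) + ℓ * ℓ + (sq (addδ β) + sqδ β) ≡⟨ +-interchange ((x + ℓ) * (x + ℓ)) (ℓ * ℓ) (sq (addδ β)) (sqδ β) ⟩
  (x + ℓ) * (x + ℓ) + sq (addδ β) + (ℓ * ℓ + sqδ β) ∎
  where
  open ≡-Reasoning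
  ℓ = length β
  d = dotδ (addδ β)
  expand : ∀ x ℓ s d → x * x + s + ((x + ℓ) * ℓ + d + ((x + ℓ) * ℓ + d)) ≡ (x + ℓ) * (x + ℓ) + ℓ * ℓ + (s + (d + d))
  expand = solve-∀

sqδ-cong : ∀ β γ → length β ≡ length γ → sqδ β ≡ sqδ γ
sqδ-cong []      []      _ = refl
sqδ-cong (x ∷ β) (y ∷ γ) e = cong₂ _+_ (cong (λ t → t * t) (suc-injective e)) (sqδ-cong β γ (suc-injective e))

length-insert : ∀ x ys → length (insert x ys) ≡ suc (length ys)
length-insert x []       = refl
length-insert x (y ∷ ys) with y ≤? x
... | yes _ = refl
... | no _  = cong suc (length-insert x ys)

length-isort : ∀ xs → length (isort xs) ≡ length xs
length-isort []       = refl
length-isort (x ∷ xs) = trans (length-insert x (isort xs)) (cong suc (length-isort xs))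

sq-insert : ∀ x ys → sq (insert x ys) ≡ x * x + sq ys
sq-insert x []       = refl
sq-insert x (y ∷ ys) with y ≤? x
... | yes _ = refl
... | no _  = trans (cong (λ t → y * y + t) (sq-insert x ys)) (trans (sym (+-assoc (y * y) (x * x) (sq ys)))
                (trans (cong (_+ sq ys) (+-comm (y * y) (x * x))) (+-assoc (x * x) (y * y) (sq ys))))

sq-isort : ∀ xs → sq (isort xs) ≡ sq xs
sq-isort []       = refl
sq-isort (x ∷ xs) = trans (sq-insert x (isort xs)) (cong (λ t → x * x + t) (sq-isort xs))

-- The rearrangement inequality.
insert-dotδ : ∀ x ys → insert x ys ≡ x ∷ ys ⊎ x * length ys + dotδ ys < dotδ (insert x ys)
insert-dotδ x []       = inj₁ refl
insert-dotδ x (y ∷ ys) with y ≤? x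
... | yes _ = inj₁ refl
... | no ¬l = inj₂ (begin-strict
  x * suc ℓ + (y * ℓ + dotδ ys)        ≡⟨ expand x y ℓ (dotδ ys) ⟩
  x + (y * ℓ + (x * ℓ + dotδ ys))      <⟨ +-monoˡ-< _ (≰⇒> ¬l) ⟩
  y + (y * ℓ + (x * ℓ + dotδ ys))      ≤⟨ +-monoʳ-≤ y (+-monoʳ-≤ (y * ℓ) (weak (insert-dotδ x ys))) ⟩
  y + (y * ℓ + dotδ (insert x ys))     ≡⟨ trans (sym (+-assoc y (y * ℓ) _)) (cong (_+ dotδ (insert x ys)) (trans (sym (*-suc y ℓ)) (cong (y *_) (sym (length-insert x ys))))) ⟩
  y * length (insert x ys) + dotδ (insert x ys) ∎)
  where
  open ≤-Reasoning
  ℓ = length ys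
  expand : ∀ x y ℓ d → x * suc ℓ + (y * ℓ + d) ≡ x + (y * ℓ + (x * ℓ + d))
  expand = solve-∀
  weak : insert x ys ≡ x ∷ ys ⊎ x * ℓ + dotδ ys < dotδ (insert x ys) → x * ℓ + dotδ ys ≤ dotδ (insert x ys)
  weak (inj₁ e) = ≤-reflexive (sym (cong dotδ e))
  weak (inj₂ l) = <⇒≤ l

isort-dotδ : ∀ xs → isort xs ≡ xs ⊎ dotδ xs < dotδ (isort xs)
isort-dotδ []       = inj₁ refl
isort-dotδ (x ∷ xs) with isort-dotδ xs | insert-dotδ x (isort xs)
... | inj₁ e | inj₁ e′ = inj₁ (trans e′ (cong (x ∷_) e))
... | inj₁ e | inj₂ l  = inj₂ (subst (λ t → x * length t + dotδ t < dotδ (insert x (isort xs))) e l)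
... | inj₂ l | inj₁ e′ = inj₂ (<-≤-trans (+-mono-≤-< (≤-reflexive (cong (x *_) (sym (length-isort xs)))) l) (≤-reflexive (sym (cong dotδ e′))))
... | inj₂ l | inj₂ l′ = inj₂ (<-trans (+-mono-≤-< (≤-reflexive (cong (x *_) (sym (length-isort xs)))) l) l′)

Descending : List ℕ → Set
Descending = AllPairs (λ x y → y ≤ x)

insert-All : ∀ {X : ℕ → Set} x {ys} → X x → All X ys → All X (insert x ys)
insert-All x px [] = px ∷ []
insert-All x {y ∷ ys} px (py ∷ pys) with y ≤? x
... | yes _ = px ∷ py ∷ pys
... | no _  = py ∷ insert-All x px pys

insert-descending : ∀ x {ys} → Descending ys → Descending (insert x ys)
insert-descending x [] = [] ∷ []
insert-descending x {y ∷ ys} (d ∷ ds) with y ≤? x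
... | yes l = (l ∷ All.map (λ h → ≤-trans h l) d) ∷ d ∷ ds
... | no ¬l = insert-All x (<⇒≤ (≰⇒> ¬l)) d ∷ insert-descending x ds

isort-descending : ∀ xs → Descending (isort xs)
isort-descending []       = []
isort-descending (x ∷ xs) = insert-descending x (isort-descending xs)

descending-isort : ∀ {xs} → Descending xs → isort xs ≡ xs
descending-isort [] = refl
descending-isort {x ∷ xs} (d ∷ ds) = trans (cong (insert x) (descending-isort ds)) (front d)
  where
  front : ∀ {ys} → All (_≤ x) ys → insert x ys ≡ x ∷ ys
  front []              = refl
  front {y ∷ ys} (l ∷ _) = insert-≤ ys l

addδ-below : ∀ {x ys} → All (_≤ x) ys → All (_< x + length ys) (addδ ys)
addδ-below [] = []
addδ-below {x} {y ∷ ys} (l ∷ ls) = below ∷ All.map (λ h → <-trans h (+-monoʳ-< x (n<1+n (length ys)))) (addδ-below ls)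
  where
  below : y + length ys < x + suc (length ys)
  below = ≤-trans (s≤s (+-monoˡ-≤ (length ys) l)) (≤-reflexive (sym (+-suc x (length ys))))

addδ-descending : ∀ {xs} → Descending xs → AllPairs (λ x y → y < x) (addδ xs)
addδ-descending []       = []
addδ-descending (d ∷ ds) = addδ-below d ∷ addδ-descending ds

sign-descending : ∀ {xs} → AllPairs (λ x y → y < x) xs → sign xs ≡ + 1
sign-descending [] = refl
sign-descending {x ∷ xs} (d ∷ ds) = trans (cong₂ _⊗_ (all-one d) (sign-descending ds)) (⊗-identityˡ (+ 1))
  where
  all-one : ∀ {ys} → All (_< x) ys → sgs x ys ≡ + 1
  all-one []       = refl
  all-one (l ∷ ls) = trans (cong₂ _⊗_ (sg-> l) (all-one ls)) (⊗-identityˡ (+ 1))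

alternant-self : ∀ {α} → Descending α → alternant (addδ α) α ≡ + 1
alternant-self {α} d = trans (cong₂ _⊗_ (sign-descending ds) (ind-yes (isort (addδ α) ≟ᴿ addδ α) (descending-isort (weaken ds)))) (⊗-identityˡ (+ 1))
  where
  ds = addδ-descending d
  weaken : ∀ {xs} → AllPairs (λ x y → y < x) xs → Descending xs
  weaken []       = []
  weaken (p ∷ ps) = All.map <⇒≤ p ∷ weaken ps

-- Vanishing of a symmetric function orthogonal to all antisymmetric functions

module Uniqueness (m B : ℕ) (D : List ℕ → ℤ)
  (D-sym : ∀ P x y R → length (P ++ x ∷ y ∷ R) ≡ m → D (P ++ x ∷ y ∷ R) ≡ D (P ++ y ∷ x ∷ R))
  (D-out : ∀ β → length β ≡ m → ¬ InBox (replicate m B) β → D β ≡ + 0)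
  (D-anti : ∀ f → DotAntisymmetric f → ∑ (box (replicate m B)) (λ β → D β ⊗ f β) ≡ + 0) where

  private
    bx : List ℕ
    bx = replicate m B

    ++-snoc : ∀ (P : List ℕ) y R → (P ++ y ∷ []) ++ R ≡ P ++ y ∷ R
    ++-snoc []      y R = refl
    ++-snoc (p ∷ P) y R = cong (p ∷_) (++-snoc P y R)

    D-insert : ∀ P x ys → length (P ++ x ∷ ys) ≡ m → D (P ++ insert x ys) ≡ D (P ++ x ∷ ys)
    D-insert P x []       e = refl
    D-insert P x (y ∷ ys) e with y ≤? x
    ... | yes _ = refl
    ... | no _  = trans (cong D (sym (++-snoc P y (insert x ys)))) (trans (D-insert (P ++ y ∷ []) x ys (trans (cong length (++-snoc P y (x ∷ ys))) e′))
                    (trans (cong D (++-snoc P y (x ∷ ys))) (D-sym P y x ys e′)))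
      where
      e′ : length (P ++ y ∷ x ∷ ys) ≡ m
      e′ = trans (trans (length-++ P) (sym (length-++ P))) e

    D-isort : ∀ P xs → length (P ++ xs) ≡ m → D (P ++ isort xs) ≡ D (P ++ xs)
    D-isort P []       e = refl
    D-isort P (x ∷ xs) e = trans (D-insert P x (isort xs) e′) (trans (cong D (sym (++-snoc P x (isort xs))))
      (trans (D-isort (P ++ x ∷ []) xs (trans (cong length (++-snoc P x xs)) e)) (cong D (++-snoc P x xs))))
      where
      e′ : length (P ++ x ∷ isort xs) ≡ m
      e′ = trans (trans (length-++ P) (trans (cong (λ t → length P + suc t) (length-isort xs)) (sym (length-++ P)))) e

    sq-bound : ∀ m β → InBox (replicate m B) β → sq β ≤ m * (B * B)
    sq-bound zero    []      _ = z≤n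
    sq-bound zero    (_ ∷ _) (() , _)
    sq-bound (suc m) []      (() , _)
    sq-bound (suc m) (x ∷ β) (e , h) = +-mono-≤ (*-mono-≤ (h 0) (h 0)) (sq-bound m β (suc-injective e , λ j → h (suc j)))

    inBox? : ∀ β → length β ≡ m → Dec (InBox bx β)
    inBox? β e = by (allUpTo? (λ j → at β j ≤? at bx j) m)
      where
      length-rep : ∀ m → length (replicate m B) ≡ m
      length-rep zero    = refl
      length-rep (suc m) = cong suc (length-rep m)
      cases : (∀ {j} → j < m → at β j ≤ at bx j) → ∀ j → at β j ≤ at bx j
      cases h j with j <? m
      ... | yes l = h l
      ... | no ¬l = ≤-trans (≤-reflexive (at-beyond β (≤-trans (≤-reflexive e) (≮⇒≥ ¬l)))) z≤n
      by : Dec (∀ {j} → j < m → at β j ≤ at bx j) → Dec (InBox bx β)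
      by (yes h) = yes (trans e (sym (length-rep m)) , cases h)
      by (no ¬h) = no (λ (_ , h) → ¬h (λ {j} _ → h j))

    -- Testing against the alternant of `addδ α` leaves `D α` and terms at those `β` for which
    -- `addδ β` is another rearrangement of `addδ α`. By the rearrangement inequality they have a
    -- larger sum of squares, where `D` is already known to vanish: the inverse Kostka matrix is
    -- unitriangular.
    vanish-sorted : ∀ α → length α ≡ m → Descending α → (∀ γ → length γ ≡ m → sq α < sq γ → D γ ≡ + 0) → D α ≡ + 0
    vanish-sorted α eα dα ih with inBox? α eα
    ... | no ¬in = D-out α eα ¬in
    ... | yes inα = begin
      D α ≡⟨ sym (trans (⊗-comm (D α) _) (trans (cong (_⊗ D α) (alternant-self dα)) (⊗-identityˡ _))) ⟩
      D α ⊗ alternant τ α ≡⟨ sym (Enumerates.pick (box-enumerates bx) α (λ β → D β ⊗ alternant τ β) inα) ⟩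
      ∑ (box bx) (λ β → ind (β ≟ᴿ α) ⊗ (D β ⊗ alternant τ β)) ≡⟨ ∑-cong-All (Enumerates.sound (box-enumerates bx)) only ⟩
      ∑ (box bx) (λ β → D β ⊗ alternant τ β) ≡⟨ D-anti (alternant τ) (alternant-dot τ) ⟩
      + 0 ∎
      where
      open ≡-Reasoning
      τ = addδ α
      only : ∀ β → InBox bx β → ind (β ≟ᴿ α) ⊗ (D β ⊗ alternant τ β) ≡ D β ⊗ alternant τ β
      only β okβ = by (β ≟ᴿ α) (isort (addδ β) ≟ᴿ τ)
        where
        eβ : length β ≡ m
        eβ = trans (proj₁ okβ) (trans (sym (proj₁ inα)) eα)
        by : Dec (β ≡ α) → Dec (isort (addδ β) ≡ τ) → ind (β ≟ᴿ α) ⊗ (D β ⊗ alternant τ β) ≡ D β ⊗ alternant τ β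
        by (yes e) _ = trans (cong (_⊗ (D β ⊗ alternant τ β)) (ind-yes (β ≟ᴿ α) e)) (⊗-identityˡ _)
        by (no ne) dτ = trans (ind-*-zero (β ≟ᴿ α) (λ e → ⊥-elim (ne e))) (sym (vanish dτ))
          where
          vanish : Dec (isort (addδ β) ≡ τ) → D β ⊗ alternant τ β ≡ + 0
          vanish (no ¬e) = trans (cong (D β ⊗_) (trans (cong (sign (addδ β) ⊗_) (ind-no (isort (addδ β) ≟ᴿ τ) ¬e)) (⊗-zeroʳ _))) (⊗-zeroʳ _)
          vanish (yes e) with isort-dotδ (addδ β)
          ... | inj₁ e′ = ⊥-elim (ne (addδ-injective (trans eβ (sym eα)) (trans (sym e′) e)))
          ... | inj₂ l  = trans (cong (_⊗ alternant τ β) (ih β eβ bigger)) (⊗-zeroˡ _)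
            where
            bigger : sq α < sq β
            bigger = +-cancelʳ-< (dotδ τ + dotδ τ) (sq α) (sq β) (≤-<-trans (≤-reflexive (begin
              sq α + (dotδ τ + dotδ τ)                       ≡⟨ sq-addδ α ⟩
              sq τ + sqδ α                                   ≡⟨ cong₂ _+_ (trans (sym (cong sq e)) (sq-isort (addδ β))) (sqδ-cong α β (trans eα (sym eβ))) ⟩
              sq (addδ β) + sqδ β                            ≡⟨ sym (sq-addδ β) ⟩
              sq β + (dotδ (addδ β) + dotδ (addδ β))         ∎))
              (+-monoʳ-< (sq β) (+-mono-< l′ l′)))
              where
              l′ : dotδ (addδ β) < dotδ τ
              l′ = subst (λ t → dotδ (addδ β) < dotδ t) e l

    -- Downward induction on the sum of squares, which is at most `m * (B * B)` in the box; beyond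
    -- that bound `D` vanishes by `D-out`. Symmetry reduces each step to a sorted exponent.
    descend : ∀ d β → length β ≡ m → m * (B * B) < sq β + d → D β ≡ + 0
    descend zero β e l = D-out β e (λ ok → <⇒≱ (subst (m * (B * B) <_) (+-identityʳ (sq β)) l) (sq-bound m β ok))
    descend (suc d) β e l = trans (sym (D-isort [] β e)) (vanish-sorted (isort β) (trans (length-isort β) e) (isort-descending β)
      (λ γ eγ h → descend d γ eγ (≤-trans l (≤-trans (≤-reflexive (+-suc (sq β) d)) (+-monoˡ-≤ d (subst (_< sq γ) (sq-isort β) h))))))

  vanishes : ∀ β → length β ≡ m → D β ≡ + 0
  vanishes β e = descend (suc (m * (B * B))) β e (m≤n+m _ (sq β))

-- Counting chains by weight

count : ℕ → Row → Row → List ℕ → ℤ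
count w e s []      = ind (s ≟ᴿ e)
count w e s (a ∷ α) = ∑ (box e) (λ u → ind (inter? w s u) ⊗ (ind (sum u ≟ sum s + a) ⊗ count w e u α))

δ : List ℕ → List ℕ → ℤ
δ β γ = ind (γ ≟ᴿ β)

inter-sum : ∀ {w} x y → length x ≡ w → length y ≡ w → Inter w x y → sum x ≤ sum y
inter-sum {w} x y ex ey h = subst₂ _≤_ (sym (trans (sum-sumTo x) (cong (λ t → sumTo t (at x)) ex))) (sym (trans (sum-sumTo y) (cong (λ t → sumTo t (at y)) ey)))
  (sumTo-mono w (λ l → proj₁ (h l)))

module _ (n : ℕ) (e : Row) (ee : length e ≡ dbl (suc n)) where

  private
    w = dbl (suc n)
    V? : (s : Row) (es : length s ≡ w) (m : ℕ) → ∀ z → Dec (Chains.Valid n s e es ee m z)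
    V? s es m = Chains.valid? n s e es ee m

  -- The recursive count suits comparisons that proceed letter by letter, such as products and
  -- shifts; the sum over arrays allows a row in the middle of a chain to be changed.
  count-chains : ∀ α s (es : length s ≡ w) →
    count w e s α ≡ ∑ (arrays e (length α)) (λ z → ind (V? s es (length α) z) ⊗ δ α (Chains.wt n s e es ee (length α) z))
  count-chains [] s es = sym (trans (ℤₚ.+-identityʳ _) (trans (trans (⊗-comm (ind (V? s es 0 [])) (+ 1)) (⊗-identityˡ _)) (ind-cong (V? s es 0 []) (s ≟ᴿ e) proj₂ (λ p → (λ ()) , p))))
  count-chains (a ∷ α) s es = begin
    ∑ (box e) (λ u → ind (inter? w s u) ⊗ (ind (sum u ≟ sum s + a) ⊗ count w e u α))
      ≡⟨ ∑-cong-All (Enumerates.sound (box-enumerates e)) row-step ⟩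
    ∑ (box e) (λ u → ∑ (arrays e m) (λ z → ind (V? s es (suc m) (u ∷ z)) ⊗ δ (a ∷ α) (wt′ (u ∷ z))))
      ≡⟨ sym (∑-arrays-suc e m (λ z → ind (V? s es (suc m) z) ⊗ δ (a ∷ α) (wt′ z))) ⟩
    ∑ (arrays e (suc m)) (λ z → ind (V? s es (suc m) z) ⊗ δ (a ∷ α) (wt′ z)) ∎
    where
    open ≡-Reasoning
    m = length α
    wt′ = Chains.wt n s e es ee (suc m)
    row-step : ∀ u → InBox e u → ind (inter? w s u) ⊗ (ind (sum u ≟ sum s + a) ⊗ count w e u α) ≡
                                 ∑ (arrays e m) (λ z → ind (V? s es (suc m) (u ∷ z)) ⊗ δ (a ∷ α) (wt′ (u ∷ z)))
    row-step u oku = begin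
      I ⊗ (S ⊗ count w e u α)
        ≡⟨ cong (λ t → I ⊗ (S ⊗ t)) (count-chains α u eu) ⟩
      I ⊗ (S ⊗ ∑ (arrays e m) (λ z → ind (V? u eu m z) ⊗ δ α (wtu z)))
        ≡⟨ trans (cong (I ⊗_) (sym (∑-*ˡ (arrays e m) S _))) (sym (∑-*ˡ (arrays e m) I _)) ⟩
      ∑ (arrays e m) (λ z → I ⊗ (S ⊗ (ind (V? u eu m z) ⊗ δ α (wtu z))))
        ≡⟨ ∑-cong (arrays e m) (λ z → merge z (inter? w s u) (sum u ≟ sum s + a) (V? u eu m z) (wtu z ≟ᴿ α) (V? s es (suc m) (u ∷ z)) (wt′ (u ∷ z) ≟ᴿ (a ∷ α))) ⟩
      ∑ (arrays e m) (λ z → ind (V? s es (suc m) (u ∷ z)) ⊗ δ (a ∷ α) (wt′ (u ∷ z))) ∎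
      where
      eu : length u ≡ w
      eu = trans (proj₁ oku) ee
      I = ind (inter? w s u)
      S = ind (sum u ≟ sum s + a)
      wtu = Chains.wt n u e eu ee m
      cons : ∀ {z} → Inter w s u → Chains.Valid n u e eu ee m z → Chains.Valid n s e es ee (suc m) (u ∷ z)
      cons i (h , l) = (λ { {zero} _ → i ; {suc k} (s≤s k<m) → h k<m }) , l
      uncons : ∀ {z} → Chains.Valid n s e es ee (suc m) (u ∷ z) → Inter w s u × Chains.Valid n u e eu ee m z
      uncons (h , l) = h {0} (s≤s z≤n) , (λ k<m → h (s≤s k<m)) , l
      merge : ∀ z (d₁ : Dec (Inter w s u)) (d₂ : Dec (sum u ≡ sum s + a)) (d₃ : Dec (Chains.Valid n u e eu ee m z)) (d₄ : Dec (wtu z ≡ α))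
        (d₅ : Dec (Chains.Valid n s e es ee (suc m) (u ∷ z))) (d₆ : Dec (wt′ (u ∷ z) ≡ a ∷ α)) → ind d₁ ⊗ (ind d₂ ⊗ (ind d₃ ⊗ ind d₄)) ≡ ind d₅ ⊗ ind d₆
      merge z d₁ d₂ d₃ d₄ d₅ d₆ = begin
        ind d₁ ⊗ (ind d₂ ⊗ (ind d₃ ⊗ ind d₄))
          ≡⟨ cong (λ t → ind d₁ ⊗ (ind d₂ ⊗ t)) (ind-× d₃ d₄ (d₃ ×-dec d₄) _,_ id) ⟩
        ind d₁ ⊗ (ind d₂ ⊗ ind (d₃ ×-dec d₄))
          ≡⟨ cong (ind d₁ ⊗_) (ind-× d₂ (d₃ ×-dec d₄) (d₂ ×-dec (d₃ ×-dec d₄)) _,_ id) ⟩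
        ind d₁ ⊗ ind (d₂ ×-dec (d₃ ×-dec d₄))
          ≡⟨ ind-× d₁ (d₂ ×-dec (d₃ ×-dec d₄)) (d₅ ×-dec d₆)
               (λ i (sm , v , wz) → cons i v , cong₂ _∷_ (trans (cong (_∸ sum s) sm) (m+n∸m≡n (sum s) a)) wz)
               (λ (v , wz) → proj₁ (uncons v) , trans (sym (m+[n∸m]≡n (inter-sum s u es eu (proj₁ (uncons v))))) (cong (λ t → sum s + t) (∷-injectiveˡ wz)) ,
                             proj₂ (uncons v) , ∷-injectiveʳ wz) ⟩
        ind (d₅ ×-dec d₆)
          ≡⟨ sym (ind-× d₅ d₆ (d₅ ×-dec d₆) _,_ id) ⟩
        ind d₅ ⊗ ind d₆ ∎

-- Straight shapes

-- A straight shape is treated as a pair whose second tableau is empty, so the rule for pairs covers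
-- Schur functions too.
str : List ℕ → Row
str []       = []
str (x ∷ xs) = x ∷ 0 ∷ str xs

top : ℕ → List ℕ → List ℕ
top _       []       = []
top zero    (x ∷ xs) = 0 ∷ top zero xs
top (suc k) (x ∷ xs) = x ∷ top k xs

length-str : ∀ κ → length (str κ) ≡ dbl (length κ)
length-str []      = refl
length-str (x ∷ κ) = cong (suc ∘ suc) (length-str κ)

length-top : ∀ k κ → length (top k κ) ≡ length κ
length-top k       []      = refl
length-top zero    (x ∷ κ) = cong suc (length-top zero κ)
length-top (suc k) (x ∷ κ) = cong suc (length-top k κ)

at-str-even : ∀ κ i → at (str κ) (dbl i) ≡ at κ i
at-str-even []      i       = refl
at-str-even (x ∷ κ) zero    = refl
at-str-even (x ∷ κ) (suc i) = at-str-even κ i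

at-str-odd : ∀ κ i → at (str κ) (suc (dbl i)) ≡ 0
at-str-odd []      i       = refl
at-str-odd (x ∷ κ) zero    = refl
at-str-odd (x ∷ κ) (suc i) = at-str-odd κ i

sum-str : ∀ κ → sum (str κ) ≡ sum κ
sum-str []      = refl
sum-str (x ∷ κ) = cong (λ t → x + t) (sum-str κ)

at-top-< : ∀ {k} κ {i} → i < k → at (top k κ) i ≡ at κ i
at-top-< []      _ = refl
at-top-< {suc k} (x ∷ κ) {zero}  _       = refl
at-top-< {suc k} (x ∷ κ) {suc i} (s≤s l) = at-top-< κ l

at-top-≥ : ∀ {k} κ {i} → k ≤ i → at (top k κ) i ≡ 0
at-top-≥ [] _ = refl
at-top-≥ {zero}  (x ∷ κ) {zero}  _       = refl
at-top-≥ {zero}  (x ∷ κ) {suc i} _       = at-top-≥ {zero} κ z≤n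
at-top-≥ {suc k} (x ∷ κ) {suc i} (s≤s l) = at-top-≥ κ l

top-≤ : ∀ k κ i → at (top k κ) i ≤ at κ i
top-≤ k κ i with i <? k
... | yes l = ≤-reflexive (at-top-< κ l)
... | no ¬l = ≤-trans (≤-reflexive (at-top-≥ κ (≮⇒≥ ¬l))) z≤n

top-mono : ∀ k κ i → at (top k κ) i ≤ at (top (suc k) κ) i
top-mono k κ i with i <? k
... | yes l = ≤-reflexive (trans (at-top-< κ l) (sym (at-top-< κ (≤-trans l (n≤1+n k)))))
... | no ¬l = ≤-trans (≤-reflexive (at-top-≥ κ (≮⇒≥ ¬l))) z≤n

top-all : ∀ κ → top (length κ) κ ≡ κ
top-all []      = refl
top-all (x ∷ κ) = cong (x ∷_) (top-all κ)

sum-top : ∀ k κ → sum (top (suc k) κ) ≡ sum (top k κ) + at κ k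
sum-top k       []      = refl
sum-top zero    (x ∷ κ) = +-comm x _
sum-top (suc k) (x ∷ κ) = trans (cong (λ t → x + t) (sum-top k κ)) (sym (+-assoc x _ _))

halves : ∀ j → ∃ λ i → j ≡ dbl i ⊎ j ≡ suc (dbl i)
halves zero          = 0 , inj₁ refl
halves (suc zero)    = 0 , inj₂ refl
halves (suc (suc j)) with halves j
... | i , inj₁ e = suc i , inj₁ (cong (suc ∘ suc) e)
... | i , inj₂ e = suc i , inj₂ (cong (suc ∘ suc) e)

dbl-mono : ∀ {i j} → i ≤ j → dbl i ≤ dbl j
dbl-mono z≤n     = z≤n
dbl-mono (s≤s l) = s≤s (s≤s (dbl-mono l))

dbl-cancel : ∀ {i j} → dbl i < dbl j → i < j
dbl-cancel {zero}  {suc j} _             = s≤s z≤n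
dbl-cancel {suc i} {suc j} (s≤s (s≤s l)) = s≤s (dbl-cancel l)

sumTo-squeeze : ∀ n {f g : ℕ → ℕ} → (∀ {j} → j < n → f j ≤ g j) → sumTo n g ≤ sumTo n f → ∀ {j} → j < n → f j ≡ g j
sumTo-squeeze n {f} {g} h l {j} j<n with f j ≟ g j
... | yes e = e
... | no ne = ⊥-elim (<⇒≱ (sumTo-< n h j<n (≤∧≢⇒< (h j<n) ne)) l)

lev-applyUpTo : (F : ℕ → Row) → ∀ M {i} → i < M → lev (applyUpTo F M) i ≡ F i
lev-applyUpTo F (suc M) {zero}  _       = refl
lev-applyUpTo F (suc M) {suc i} (s≤s l) = lev-applyUpTo (F ∘ suc) M l

diffs-applyUpTo : ∀ (F : ℕ → Row) M → diffs (map sum (applyUpTo F (suc M))) ≡ applyUpTo (λ k → sum (F (suc k)) ∸ sum (F k)) M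
diffs-applyUpTo F zero    = refl
diffs-applyUpTo F (suc M) = cong ((sum (F 1) ∸ sum (F 0)) ∷_) (diffs-applyUpTo (F ∘ suc) M)

rows-ext : ∀ {x y : List Row} → length x ≡ length y → (∀ {i} → i < length x → lev x i ≡ lev y i) → x ≡ y
rows-ext {[]}    {[]}    _ _ = refl
rows-ext {x ∷ xs} {y ∷ ys} e h = cong₂ _∷_ (h (s≤s z≤n)) (rows-ext (suc-injective e) (h ∘ s≤s))

length-cong-str : ∀ {κ m} → length κ ≡ m → length (str κ) ≡ dbl m
length-cong-str {κ} e = trans (length-str κ) (cong dbl e)

module Straight (m₀ : ℕ) (κ : List ℕ) (eκ : length κ ≡ suc m₀) (dec : IsPartition κ) where

  m : ℕ
  m = suc m₀

  F : ℕ → Row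
  F k = str (top k κ)

  es : length (F 0) ≡ dbl m
  es = length-cong-str {top 0 κ} (trans (length-top 0 κ) eκ)

  ee : length (str κ) ≡ dbl m
  ee = length-cong-str {κ} eκ

  open Chains m₀ (F 0) (str κ) es ee m
  open Widths m₀

  F-len : ∀ k → length (F k) ≡ dbl m
  F-len k = length-cong-str {top k κ} (trans (length-top k κ) eκ)

  F-even : ∀ k i → at (F k) (dbl i) ≡ at (top k κ) i
  F-even k = at-str-even (top k κ)

  F-odd : ∀ k i → at (F k) (suc (dbl i)) ≡ 0
  F-odd k = at-str-odd (top k κ)

  -- The superstandard tableau: each row is filled with its own letter.
  canonical : List Row
  canonical = applyUpTo (F ∘ suc) m

  levels : ∀ {i} → i ≤ m → lev (F 0 ∷ canonical) i ≡ F i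
  levels {i} l = lev-applyUpTo F (suc m) (s≤s l)

  F-box : ∀ k → InBox (str κ) (F k)
  F-box k = trans (F-len k) (sym ee) , bound
    where
    bound : ∀ j → at (F k) j ≤ at (str κ) j
    bound j with halves j
    ... | i , inj₁ refl = subst₂ _≤_ (sym (F-even k i)) (sym (at-str-even κ i)) (top-≤ k κ i)
    ... | i , inj₂ refl = ≤-trans (≤-reflexive (F-odd k i)) z≤n

  canonical-in : InArrays (str κ) m canonical
  canonical-in = length-applyUpTo (F ∘ suc) m , applyUpTo⁺₂ (F ∘ suc) m (F-box ∘ suc)

  F-inter : ∀ k → Inter (dbl m) (F k) (F (suc k))
  F-inter k {j} _ with halves j
  ... | i , inj₁ refl = subst₂ _≤_ (sym (F-even k i)) (sym (F-even (suc k) i)) (top-mono k κ i) ,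
                        subst₂ _≤_ (sym (F-even (suc k) (suc i))) (sym (F-even k i)) (next i)
    where
    next : ∀ i → at (top (suc k) κ) (suc i) ≤ at (top k κ) i
    next i with i <? k
    ... | yes l = ≤-trans (≤-reflexive (at-top-< κ (s≤s l))) (≤-trans (dec i) (≤-reflexive (sym (at-top-< κ l))))
    ... | no ¬l = ≤-trans (≤-reflexive (at-top-≥ κ (s≤s (≮⇒≥ ¬l)))) z≤n
  ... | i , inj₂ refl = ≤-trans (≤-reflexive (F-odd k i)) z≤n , ≤-trans (≤-reflexive (F-odd (suc k) (suc i))) z≤n

  F-last : F m ≡ str κ
  F-last = cong str (trans (cong (λ t → top t κ) (sym eκ)) (top-all κ))

  canonical-valid : Valid canonical
  canonical-valid = (λ {i} l → subst₂ (Inter (dbl m)) (sym (levels (<⇒≤ l))) (sym (levels l)) (F-inter i)) , trans (levels ≤-refl) F-last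

  canonical-wt : wt canonical ≡ κ
  canonical-wt = trans (diffs-applyUpTo F m) (row-ext (trans (length-row m Δ) (sym eκ)) (λ {j} l → trans (at-row m Δ (subst (j <_) (length-row m Δ) l)) (inc j)))
    where
    Δ : ℕ → ℕ
    Δ k = sum (F (suc k)) ∸ sum (F k)
    inc : ∀ k → sum (F (suc k)) ∸ sum (F k) ≡ at κ k
    inc k = trans (cong₂ _∸_ (trans (sum-str (top (suc k) κ)) (sum-top k κ)) (sum-str (top k κ))) (m+n∸m≡n (sum (top k κ)) (at κ k))

  T-step : ∀ k Y → k < m → T≥ (F (suc k)) Y + g (Y + dbl k) ≡ T≥ (F k) Y + (at κ k ⊔ g (Y + dbl k))
  T-step k Y k<m = trans (cong₂ _+_ (sumTo-cong (dbl m) {λ j → at (F (suc k)) j ⊔ g (Y + j)} (λ {j} _ → changed j)) (cong (_⊔ g (Y + dbl k)) (sym (trans (F-even k k) (at-top-≥ {k} κ ≤-refl)))))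
    (sumTo-upd (dbl m) (λ j → at (F k) j ⊔ g (Y + j)) {dbl k} (at κ k ⊔ g (Y + dbl k)) (≤-trans (n≤1+n _) (dbl-mono k<m)))
    where
    changed : ∀ j → at (F (suc k)) j ⊔ g (Y + j) ≡ upd (λ j → at (F k) j ⊔ g (Y + j)) (dbl k) (at κ k ⊔ g (Y + dbl k)) j
    changed j = upd-elim (λ j → at (F k) j ⊔ g (Y + j)) (dbl k) (at κ k ⊔ g (Y + dbl k)) j (λ t → at (F (suc k)) j ⊔ g (Y + j) ≡ t)
      (λ { refl → cong (_⊔ g (Y + dbl k)) (trans (F-even (suc k) k) (at-top-< κ ≤-refl)) })
      (λ ne → cong (_⊔ g (Y + j)) (same ne (halves j)))
      where
      same : j ≢ dbl k → (∃ λ i → j ≡ dbl i ⊎ j ≡ suc (dbl i)) → at (F (suc k)) j ≡ at (F k) j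
      same ne (i , inj₂ refl) = trans (F-odd (suc k) i) (sym (F-odd k i))
      same ne (i , inj₁ refl) = trans (F-even (suc k) i) (trans (eq (<-cmp i k)) (sym (F-even k i)))
        where
        eq : _ → at (top (suc k) κ) i ≡ at (top k κ) i
        eq (tri< l _ _) = trans (at-top-< κ (≤-trans l (n≤1+n k))) (sym (at-top-< κ l))
        eq (tri≈ _ refl _) = ⊥-elim (ne refl)
        eq (tri> _ _ l) = trans (at-top-≥ κ l) (sym (at-top-≥ κ (<⇒≤ l)))

  -- By `T-step` each level fills one row. The row of the next letter is not longer and its
  -- threshold is not smaller, so at no cut has more of it been read.
  canonical-lattice : Lattice canonical
  canonical-lattice {Y} _ _ {i} i<m fl = <⇒≱ (≤-reflexive (sym fl′)) pos
    where
    2+i≤m : 2 + i ≤ m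
    2+i≤m = s≤s i<m
    A = T≥ (F i) Y
    B = T≥ (F (suc i)) Y
    C = T≥ (F (2 + i)) Y
    c = g (Y + dbl i)
    c′ = g (Y + dbl (suc i))
    fl′ : C + A ≡ suc (B + B)
    fl′ = subst₂ (λ x y → T≥ x Y + A ≡ suc (T≥ y Y + T≥ y Y)) (levels 2+i≤m) (levels (≤-trans (n≤1+n _) 2+i≤m))
            (subst (λ x → T≥ (lev (F 0 ∷ canonical) (2 + i)) Y + T≥ x Y ≡ suc (T≥ (lev (F 0 ∷ canonical) (1 + i)) Y + T≥ (lev (F 0 ∷ canonical) (1 + i)) Y)) (levels (≤-trans (m≤n+m i 2) 2+i≤m)) fl)
    pos : C + A ≤ B + B
    pos = +-cancelʳ-≤ (c + c′) (C + A) (B + B) (begin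
      C + A + (c + c′)                ≡⟨ arr₁ C A c c′ ⟩
      (C + c′) + (A + c)              ≡⟨ cong (_+ (A + c)) (T-step (suc i) Y 2+i≤m) ⟩
      (B + (at κ (suc i) ⊔ c′)) + (A + c) ≡⟨ arr₂ B (at κ (suc i) ⊔ c′) A c ⟩
      B + (A + ((at κ (suc i) ⊔ c′) + c)) ≤⟨ +-monoʳ-≤ B (+-monoʳ-≤ A (cells (dec i) (g-mono (+-monoʳ-≤ Y (m≤n+m (dbl i) 2))))) ⟩
      B + (A + ((at κ i ⊔ c) + c′))   ≡⟨ cong (λ t → B + t) (sym (+-assoc A (at κ i ⊔ c) c′)) ⟩
      B + (A + (at κ i ⊔ c) + c′)     ≡⟨ cong (λ t → B + (t + c′)) (sym (T-step i Y (≤-trans (n≤1+n _) 2+i≤m))) ⟩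
      B + (B + c + c′)                ≡⟨ trans (cong (λ t → B + t) (+-assoc B c c′)) (sym (+-assoc B B (c + c′))) ⟩
      B + B + (c + c′)                ∎)
      where
      open ≤-Reasoning
      arr₁ : ∀ C A c c′ → C + A + (c + c′) ≡ (C + c′) + (A + c)
      arr₁ = solve-∀
      arr₂ : ∀ B x A c → (B + x) + (A + c) ≡ B + (A + (x + c))
      arr₂ = solve-∀
      cells : ∀ {x y c c′} → x ≤ y → c ≤ c′ → (x ⊔ c′) + c ≤ (y ⊔ c) + c′
      cells {x} {y} {c} {c′} xy cc with ≤-total x c′
      ... | inj₁ l rewrite m≤n⇒m⊔n≡n l = ≤-trans (≤-reflexive (+-comm c′ c)) (+-monoˡ-≤ c′ (m≤n⊔m y c))
      ... | inj₂ l rewrite m≥n⇒m⊔n≡m l = +-mono-≤ (≤-trans xy (m≤m⊔n y c)) cc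

  module _ {z : List Row} (inz : InArrays (str κ) m z) (val : Valid z) (lat : Lattice z) where

    private
      A : ℕ → ℕ → ℕ
      A k i = at (lev (F 0 ∷ z) k) (dbl i)

      L : ℕ → Row
      L k = lev (F 0 ∷ z) k

      len : ∀ {k} → k ≤ m → length (L k) ≡ dbl m
      len = rows-length inz

      full : ∀ {k} → k < m → ∀ j → at (L k) j ≤ at (L (suc k)) j × at (L (suc k)) (2 + j) ≤ at (L k) j
      full {k} l = inter-all (L k) (L (suc k)) (len (<⇒≤ l)) (len l) (proj₁ val l)

      odd-zero : ∀ {k} → k ≤ m → ∀ i → at (L k) (suc (dbl i)) ≡ 0
      odd-zero {zero}  _ i = F-odd 0 i
      odd-zero {suc k} l i = n≤0⇒n≡0 (≤-trans (proj₂ (All-lev (proj₂ inz) (≤-trans l (≤-reflexive (sym (proj₁ inz))))) (suc (dbl i))) (≤-reflexive (at-str-odd κ i)))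

      low-zero : ∀ {k} → k ≤ m → ∀ {i} → k ≤ i → A k i ≡ 0
      low-zero {zero}  _ {i} _ = trans (F-even 0 i) (at-top-≥ {0} κ z≤n)
      low-zero {suc k} l {suc i} (s≤s h) = n≤0⇒n≡0 (≤-trans (proj₂ (full l (dbl i))) (≤-reflexive (low-zero (<⇒≤ l) h)))

      row-desc : ∀ {k} → k < m → ∀ i → A (suc k) (suc i) ≤ A (suc k) i
      row-desc l i = ≤-trans (proj₂ (full l (dbl i))) (proj₁ (full l (dbl i)))

      row-desc* : ∀ {k} → k < m → ∀ {i j} → i ≤ j → A (suc k) j ≤ A (suc k) i
      row-desc* {k} l {i} {j} h = subst (λ t → A (suc k) t ≤ A (suc k) i) (m∸n+n≡m h) (go (j ∸ i))
        where
        go : ∀ d → A (suc k) (d + i) ≤ A (suc k) i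
        go zero    = ≤-refl
        go (suc d) = ≤-trans (row-desc l (d + i)) (go d)

      -- By induction the levels `k` and `suc k` differ only in row `k`, of length `t` at the
      -- latter. The cut at column `t` hides this difference: no lower letter is read there, so the
      -- lattice inequality admits no upper letter either. The rows up to `k` are at least `t` long
      -- and hence cannot grow at the next level.
      stable : ∀ k → suc k ≤ m → ∀ {i} → i < k → A (suc k) i ≡ A k i
      stable (suc k) l {i} i<k = begin
        A (2 + k) i     ≡⟨ sym (m≥n⇒m⊔n≡m (≤-trans t≤ (proj₁ (full l (dbl i))))) ⟩
        A (2 + k) i ⊔ t ≡⟨ sym (squeezed (≤-trans (≤-trans (n≤1+n _) (dbl-mono i<k)) (dbl-mono (<⇒≤ l)))) ⟩
        A (1 + k) i ⊔ t ≡⟨ m≥n⇒m⊔n≡m t≤ ⟩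
        A (1 + k) i     ∎
        where
        open ≡-Reasoning
        t : ℕ
        t = A (suc k) k
        Y : ℕ
        Y = t * dbl m
        t≤ : t ≤ A (suc k) i
        t≤ = row-desc* (<⇒≤ l) (≤-pred i<k)
        at-t : ∀ {j} → j < dbl m → g (Y + j) ≡ t
        at-t {j} j<w = go t
          where
          go : ∀ t → g (t * dbl m + j) ≡ t
          go zero    = g-zero j<w
          go (suc t) = trans (cong g (trans (+-assoc (dbl m) (t * dbl m) j) (+-comm (dbl m) _))) (trans (g-w (t * dbl m + j)) (cong suc (go t)))
        same : T≥ (L k) Y ≡ T≥ (L (suc k)) Y
        same = sumTo-cong (dbl m) {λ j → at (L k) j ⊔ g (Y + j)} {λ j → at (L (suc k)) j ⊔ g (Y + j)} (λ {j} j<w → entry j j<w (halves j))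
          where
          entry : ∀ j → j < dbl m → (∃ λ i → j ≡ dbl i ⊎ j ≡ suc (dbl i)) → at (L k) j ⊔ g (Y + j) ≡ at (L (suc k)) j ⊔ g (Y + j)
          entry j j<w (i , inj₂ refl) = cong (_⊔ g (Y + j)) (trans (odd-zero (<⇒≤ (<⇒≤ l)) i) (sym (odd-zero (<⇒≤ l) i)))
          entry j j<w (i , inj₁ refl) with <-cmp i k
          ... | tri< i<k _ _ = cong (_⊔ g (Y + j)) (sym (stable k (<⇒≤ l) i<k))
          ... | tri≈ _ refl _ = trans (cong₂ _⊔_ (low-zero (<⇒≤ (<⇒≤ l)) ≤-refl) (at-t j<w)) (sym (trans (cong (t ⊔_) (at-t j<w)) (⊔-idem t)))
          ... | tri> _ _ k<i = cong (_⊔ g (Y + j)) (trans (low-zero (<⇒≤ (<⇒≤ l)) (<⇒≤ k<i)) (sym (low-zero (<⇒≤ l) k<i)))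
        pos : T≥ (L (2 + k)) Y + T≥ (L k) Y ≤ T≥ (L (suc k)) Y + T≥ (L (suc k)) Y
        pos = pos-above inz val 0 lat (≤-pred l) Y z≤n
        upper : T≥ (L (2 + k)) Y ≤ T≥ (L (suc k)) Y
        upper = +-cancelʳ-≤ (T≥ (L (suc k)) Y) _ _ (subst (λ t → T≥ (L (2 + k)) Y + t ≤ T≥ (L (suc k)) Y + T≥ (L (suc k)) Y) same pos)
        squeezed : dbl i < dbl m → A (1 + k) i ⊔ t ≡ A (2 + k) i ⊔ t
        squeezed j<w = subst (λ c → A (1 + k) i ⊔ c ≡ A (2 + k) i ⊔ c) (at-t j<w)
          (sumTo-squeeze (dbl m) {λ j → at (L (suc k)) j ⊔ g (Y + j)} {λ j → at (L (2 + k)) j ⊔ g (Y + j)}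
            (λ {j} _ → ⊔-monoˡ-≤ (g (Y + j)) (proj₁ (full l j))) upper j<w)

      final : ∀ d k → d + k ≡ m → ∀ {i} → i < k → A k i ≡ at κ i
      final zero    k refl {i} _ = trans (cong (λ x → at x (dbl i)) (proj₂ val)) (at-str-even κ i)
      final (suc d) k e    {i} l = trans (sym (stable k (≤-trans (s≤s (m≤n+m k d)) (≤-reflexive e)) l)) (final d (suc k) (trans (+-suc d k) e) (≤-trans l (n≤1+n k)))

      row-eq : ∀ {k} → k ≤ m → L k ≡ F k
      row-eq {k} l = row-ext (trans (len l) (sym (F-len k))) (λ {j} _ → entry j (halves j))
        where
        entry : ∀ j → (∃ λ i → j ≡ dbl i ⊎ j ≡ suc (dbl i)) → at (L k) j ≡ at (F k) j
        entry j (i , inj₂ refl) = trans (odd-zero l i) (sym (F-odd k i))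
        entry j (i , inj₁ refl) with i <? k
        ... | yes i<k = trans (final (m ∸ k) k (m∸n+n≡m l) i<k) (sym (trans (F-even k i) (at-top-< κ i<k)))
        ... | no i≮k  = trans (low-zero l (≮⇒≥ i≮k)) (sym (trans (F-even k i) (at-top-≥ κ (≮⇒≥ i≮k))))

    lattice-unique : z ≡ canonical
    lattice-unique = rows-ext (trans (proj₁ inz) (sym (proj₁ canonical-in)))
      (λ {i} l → trans (row-eq (subst (i <_) (proj₁ inz) l)) (sym (levels (subst (i <_) (proj₁ inz) l))))

  one : List Row → ℤ
  one _ = + 1

  one-inv : InvariantUnderLocks one
  one-inv _ _ _ _ _ _ _ _ _ _ = refl

  -- The bialternant formula for Schur functions in dual form: only the superstandard tableau
  -- survives the test.
  straight-total : ∀ f → DotAntisymmetric f → total one one-inv f ≡ f κ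
  straight-total f anti = trans (total-lattice one one-inv f anti) (trans
    (∑-cong-All (Enumerates.sound (arrays-enumerates (str κ) m)) (λ z inz → by z inz (valid? z) (lattice? z) (z ≟ᴬ canonical)))
    (Enumerates.pick (arrays-enumerates (str κ) m) canonical (λ _ → f κ) canonical-in))
    where
    by : ∀ z → InArrays (str κ) m z → (d₁ : Dec (Valid z)) (d₂ : Dec (Lattice z)) (d₃ : Dec (z ≡ canonical)) → ind d₁ ⊗ (+ 1 ⊗ f (wt z)) ⊗ ind d₂ ≡ ind d₃ ⊗ f κ
    by z inz (yes v) (yes l) (no ne)   = ⊥-elim (ne (lattice-unique inz v l))
    by z inz (yes v) (yes l) (yes refl) = trans (⊗-comm _ (+ 1)) (trans (⊗-identityˡ _) (cong (+ 1 ⊗_) (trans (⊗-identityˡ _) (cong f canonical-wt))))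
    by z inz (no ¬v) _ (yes refl)      = ⊥-elim (¬v canonical-valid)
    by z inz _ (no ¬l) (yes refl)      = ⊥-elim (¬l canonical-lattice)
    by z inz (no _) d₂ (no _)          = trans (cong (_⊗ ind d₂) (⊗-zeroˡ _)) (trans (⊗-zeroˡ _) (sym (⊗-zeroˡ _)))
    by z inz d₁ (no _) (no _)          = trans (⊗-zeroʳ _) (sym (⊗-zeroˡ _))

-- Schur expansion of a lock-invariant family of chains

swapAt-involutive : ∀ k γ → swapAt k (swapAt k γ) ≡ γ
swapAt-involutive zero    []          = refl
swapAt-involutive zero    (x ∷ [])    = refl
swapAt-involutive zero    (x ∷ y ∷ r) = refl
swapAt-involutive (suc k) []          = refl
swapAt-involutive (suc k) (x ∷ r)     = cong (x ∷_) (swapAt-involutive k r)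

δ-swap : ∀ k β γ → δ β (swapAt k γ) ≡ δ (swapAt k β) γ
δ-swap k β γ = ind-cong (swapAt k γ ≟ᴿ β) (γ ≟ᴿ swapAt k β)
  (λ e → trans (sym (swapAt-involutive k γ)) (cong (swapAt k) e)) (λ e → trans (cong (swapAt k) e) (swapAt-involutive k β))

-- Passes from coefficients to tests: summing the coefficient function against `f` evaluates `f` at
-- the weight of each object, provided the box contains the weights of all objects that count.
∑-collapse : {A : Set} {Ok : A → Set} {xs : List A} → All Ok xs → (b : Row) (h : A → ℤ) (γ : A → List ℕ) →
  (∀ x → Ok x → h x ≡ + 0 ⊎ InBox b (γ x)) → (f : List ℕ → ℤ) →
  ∑ (box b) (λ β → ∑ xs (λ x → h x ⊗ δ β (γ x)) ⊗ f β) ≡ ∑ xs (λ x → h x ⊗ f (γ x))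
∑-collapse {xs = xs} oks b h γ ok f = begin
  ∑ (box b) (λ β → ∑ xs (λ x → h x ⊗ δ β (γ x)) ⊗ f β)
    ≡⟨ ∑-cong (box b) (λ β → trans (⊗-comm _ (f β)) (sym (∑-*ˡ xs (f β) _))) ⟩
  ∑ (box b) (λ β → ∑ xs (λ x → f β ⊗ (h x ⊗ δ β (γ x))))
    ≡⟨ ∑-swap (box b) xs _ ⟩
  ∑ xs (λ x → ∑ (box b) (λ β → f β ⊗ (h x ⊗ δ β (γ x))))
    ≡⟨ ∑-cong-All oks (λ x okx → trans (∑-cong (box b) (λ β → rearrange β x)) (trans (∑-*ˡ (box b) (h x) _) (single x (ok x okx)))) ⟩
  ∑ xs (λ x → h x ⊗ f (γ x)) ∎
  where
  open ≡-Reasoning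
  rearrange : ∀ β x → f β ⊗ (h x ⊗ δ β (γ x)) ≡ h x ⊗ (ind (β ≟ᴿ γ x) ⊗ f β)
  rearrange β x = trans (⊗-comm (f β) _) (trans (⊗-assoc (h x) _ (f β)) (cong (λ t → h x ⊗ (t ⊗ f β)) (ind-cong (γ x ≟ᴿ β) (β ≟ᴿ γ x) sym sym)))
  single : ∀ x → h x ≡ + 0 ⊎ InBox b (γ x) → h x ⊗ ∑ (box b) (λ β → ind (β ≟ᴿ γ x) ⊗ f β) ≡ h x ⊗ f (γ x)
  single x (inj₁ z) = trans (trans (cong (_⊗ ∑ (box b) (λ β → ind (β ≟ᴿ γ x) ⊗ f β)) z) (⊗-zeroˡ _)) (sym (trans (cong (_⊗ f (γ x)) z) (⊗-zeroˡ _)))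
  single x (inj₂ i) = cong (h x ⊗_) (Enumerates.pick (box-enumerates b) (γ x) f i)

at-map-sum : ∀ ρ i → at (map sum ρ) i ≡ sum (lev ρ i)
at-map-sum []      i       = refl
at-map-sum (x ∷ ρ) zero    = refl
at-map-sum (x ∷ ρ) (suc i) = at-map-sum ρ i

at-diffs : ∀ x A {i} → i < length A → at (diffs (x ∷ A)) i ≡ at (x ∷ A) (suc i) ∸ at (x ∷ A) i
at-diffs x (y ∷ A) {zero}  _       = refl
at-diffs x (y ∷ A) {suc i} (s≤s l) = at-diffs y A l

sum-diffs : ∀ x A → (∀ {i} → i < length A → at (x ∷ A) i ≤ at (x ∷ A) (suc i)) → sum (diffs (x ∷ A)) + x ≡ lastOf x A
sum-diffs x []      h = refl
sum-diffs x (y ∷ A) h = trans (trans (cong (_+ x) (+-comm (y ∸ x) _)) (+-assoc _ (y ∸ x) x))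
  (trans (cong (λ t → sum (diffs (y ∷ A)) + t) (m∸n+n≡m (h (s≤s z≤n)))) (sum-diffs y A (h ∘ s≤s)))

at-replicate : ∀ m B {j} → j < m → at (replicate m B) j ≡ B
at-replicate (suc m) B {zero}  _       = refl
at-replicate (suc m) B {suc j} (s≤s l) = at-replicate m B l

in-replicate : ∀ m B β → length β ≡ m → sum β ≤ B → InBox (replicate m B) β
in-replicate m B β e l = trans e (sym (length-replicate m)) , bound
  where
  bound : ∀ j → at β j ≤ at (replicate m B) j
  bound j with j <? m
  ... | yes h = ≤-trans (≤-trans (at≤sum β j) l) (≤-reflexive (sym (at-replicate m B h)))
  ... | no ¬h = ≤-trans (≤-reflexive (at-beyond β (≤-trans (≤-reflexive e) (≮⇒≥ ¬h)))) z≤n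

isPartition? : ∀ κ → Dec (IsPartition κ)
isPartition? κ with allUpTo? (λ i → at κ (suc i) ≤? at κ i) (length κ)
... | yes h = yes (λ i → case i <? length κ of λ
        { (yes l) → h l
        ; (no ¬l) → ≤-trans (≤-reflexive (at-beyond κ (≤-trans (≮⇒≥ ¬l) (n≤1+n i)))) z≤n })
... | no ¬h = no (λ h → ¬h (λ {i} _ → h i))

-- Weights of chains and coefficients of Schur functions

module WeightBounds (n : ℕ) (s e : Row) (es : length s ≡ dbl (suc n)) (ee : length e ≡ dbl (suc n)) (m : ℕ) where

  open Chains n s e es ee m
  open Widths n

  wt-length : ∀ {z} → InArrays e m z → length (wt z) ≡ m
  wt-length {z} (l , _) = trans (length-diffs (sum s) (map sum z)) (trans (length-map sum z) l)

  wt-sum : ∀ {z} → InArrays e m z → Valid z → sum (wt z) + sum s ≡ sum e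
  wt-sum {z} inz (val , l) = trans (sum-diffs (sum s) (map sum z) mono)
    (trans (lastOf-sum s z) (cong sum (trans (cong (lev (s ∷ z)) (proj₁ inz)) l)))
    where
    mono : ∀ {i} → i < length (map sum z) → at (map sum (s ∷ z)) i ≤ at (map sum (s ∷ z)) (suc i)
    mono {i} h = subst₂ _≤_ (sym (at-map-sum (s ∷ z) i)) (sym (at-map-sum (s ∷ z) (suc i)))
      (inter-sum (lev (s ∷ z) i) (lev (s ∷ z) (suc i)) (rows-length inz (<⇒≤ i<m)) (rows-length inz i<m) (val i<m))
      where
      i<m : i < m
      i<m = subst (i <_) (trans (length-map sum z) (proj₁ inz)) h

  wt-in : ∀ {z} → InArrays e m z → Valid z → ∀ {B} → sum e ≤ B → InBox (replicate m B) (wt z)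
  wt-in {z} inz v {B} l = in-replicate m B (wt z) (wt-length inz) (≤-trans (≤-trans (m≤m+n _ (sum s)) (≤-reflexive (wt-sum inz v))) l)

  -- At the cut 0 everything has been read, so there the lattice inequality compares adjacent
  -- entries of the weight.
  wt-partition : ∀ {z} → InArrays e m z → Valid z → Lattice z → IsPartition (wt z)
  wt-partition {z} inz v lat i with suc i <? m
  ... | no ¬l = ≤-trans (≤-reflexive (at-beyond (wt z) (≤-trans (≤-reflexive (wt-length inz)) (≮⇒≥ ¬l)))) z≤n
  ... | yes l = subst₂ _≤_ (sym (entry l)) (sym (entry (<⇒≤ l))) (concave (S (2 + i)) (S (suc i)) (S i) pos)
    where
    S : ℕ → ℕ
    S k = sum (lev (s ∷ z) k)
    entry : ∀ {k} → k < m → at (wt z) k ≡ S (suc k) ∸ S k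
    entry {k} h = trans (at-diffs (sum s) (map sum z) (subst (k <_) (sym (trans (length-map sum z) (proj₁ inz))) h)) (cong₂ _∸_ (at-map-sum (s ∷ z) (suc k)) (at-map-sum (s ∷ z) k))
    T0 : ∀ {k} → k ≤ m → T≥ (lev (s ∷ z) k) 0 ≡ S k
    T0 {k} h = sum-T≥ (lev (s ∷ z) k) (rows-length inz h)
    pos : S (2 + i) + S i ≤ S (suc i) + S (suc i)
    pos = subst₂ _≤_ (cong₂ _+_ (T0 l) (T0 (≤-trans (n≤1+n i) (<⇒≤ l)))) (cong₂ _+_ (T0 (<⇒≤ l)) (T0 (<⇒≤ l)))
      (pos-above inz v 0 lat (∸-monoˡ-≤ 1 l) 0 z≤n)
    concave : ∀ x y w → x + w ≤ y + y → x ∸ y ≤ y ∸ w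
    concave x y w h = ≤-trans (∸-monoˡ-≤ y (≤-trans (≤-reflexive (sym (m+n∸n≡m x w))) (∸-monoˡ-≤ w h))) (≤-reflexive (trans (∸-+-assoc (y + y) w y) (trans (cong (y + y ∸_) (+-comm w y)) ([m+n]∸[m+o]≡n∸o y y w))))

schurCount : ℕ → List ℕ → List ℕ → ℤ
schurCount m κ β = count (dbl m) (str κ) (str (top 0 κ)) β

module _ (m₀ : ℕ) (κ : List ℕ) (eκ : length κ ≡ suc m₀) (dec : IsPartition κ) where

  open Straight m₀ κ eκ dec
  open Chains m₀ (F 0) (str κ) es ee m
  open WeightBounds m₀ (F 0) (str κ) es ee m

  private
    as-total : ∀ β → length β ≡ m → schurCount m κ β ≡ total one one-inv (δ β)
    as-total β eβ = trans (count-chains m₀ (str κ) ee β (F 0) es) (trans (lengths (length β) eβ) (∑-cong (arrays (str κ) m) (λ z → cong (ind (valid? z) ⊗_) (sym (⊗-identityˡ (δ β (wt z)))))))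
      where
      lengths : ∀ l → l ≡ m → ∑ (arrays (str κ) l) (λ z → ind (Chains.valid? m₀ (F 0) (str κ) es ee l z) ⊗ δ β (Chains.wt m₀ (F 0) (str κ) es ee l z)) ≡
                              ∑ (arrays (str κ) m) (λ z → ind (valid? z) ⊗ δ β (wt z))
      lengths l refl = refl

  schurCount-swap : ∀ P x y R → length (P ++ x ∷ y ∷ R) ≡ m → schurCount m κ (P ++ x ∷ y ∷ R) ≡ schurCount m κ (P ++ y ∷ x ∷ R)
  schurCount-swap P x y R e = begin
    schurCount m κ β ≡⟨ as-total β e ⟩
    total one one-inv (δ β) ≡⟨ total-symmetric one one-inv k<m (δ β) ⟩
    total one one-inv (δ β ∘ swapAt (length P)) ≡⟨ ∑-cong (arrays (str κ) m) (λ z → cong (λ t → ind (valid? z) ⊗ (one z ⊗ t)) (trans (δ-swap (length P) β (wt z)) (cong (λ b → δ b (wt z)) (swapAt-++ P x y R)))) ⟩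
    total one one-inv (δ β′) ≡⟨ sym (as-total β′ (trans (trans (length-++ P) (sym (length-++ P))) e)) ⟩
    schurCount m κ β′ ∎
    where
    open ≡-Reasoning
    β = P ++ x ∷ y ∷ R
    β′ = P ++ y ∷ x ∷ R
    k<m : suc (length P) < m
    k<m = ≤-trans (≤-trans (≤-reflexive (+-comm 2 (length P))) (+-monoʳ-≤ (length P) (s≤s (s≤s z≤n)))) (≤-reflexive (trans (sym (length-++ P)) e))

  schurCount-out : ∀ B → sum κ ≤ B → ∀ β → length β ≡ m → ¬ InBox (replicate m B) β → schurCount m κ β ≡ + 0
  schurCount-out B l β e out = trans (as-total β e) (trans (∑-cong-All (Enumerates.sound (arrays-enumerates (str κ) m)) zero-at) (∑-zero (arrays (str κ) m) (λ _ → refl)))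
    where
    zero-at : ∀ z → InArrays (str κ) m z → ind (valid? z) ⊗ (one z ⊗ δ β (wt z)) ≡ + 0
    zero-at z inz = ind-*-zero (valid? z) (λ v → trans (⊗-identityˡ _) (ind-no (wt z ≟ᴿ β) (λ eq → out (subst (InBox (replicate m B)) eq (wt-in inz v (≤-trans (≤-reflexive (sum-str κ)) l))))))

  schurCount-anti : ∀ B → sum κ ≤ B → ∀ f → DotAntisymmetric f → ∑ (box (replicate m B)) (λ β → schurCount m κ β ⊗ f β) ≡ f κ
  schurCount-anti B l f anti = begin
    ∑ (box bx) (λ β → schurCount m κ β ⊗ f β)
      ≡⟨ ∑-cong-All (Enumerates.sound (box-enumerates bx)) (λ β okβ → cong (_⊗ f β) (trans (as-total β (trans (proj₁ okβ) (length-replicate m)))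
           (∑-cong (arrays (str κ) m) (λ z → sym (⊗-assoc (ind (valid? z)) (one z) _))))) ⟩
    ∑ (box bx) (λ β → ∑ (arrays (str κ) m) (λ z → ind (valid? z) ⊗ one z ⊗ δ β (wt z)) ⊗ f β)
      ≡⟨ ∑-collapse (Enumerates.sound (arrays-enumerates (str κ) m)) bx (λ z → ind (valid? z) ⊗ one z) wt (λ z inz → cases z inz (valid? z)) f ⟩
    ∑ (arrays (str κ) m) (λ z → ind (valid? z) ⊗ one z ⊗ f (wt z))
      ≡⟨ ∑-cong (arrays (str κ) m) (λ z → ⊗-assoc (ind (valid? z)) (one z) _) ⟩
    total one one-inv f
      ≡⟨ straight-total f anti ⟩
    f κ ∎
    where
    open ≡-Reasoning
    bx = replicate m B
    cases : ∀ z → InArrays (str κ) m z → (d : Dec (Valid z)) → ind d ⊗ one z ≡ + 0 ⊎ InBox bx (wt z)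
    cases z inz (yes v) = inj₂ (wt-in inz v (≤-trans (≤-reflexive (sum-str κ)) l))
    cases z inz (no ¬v) = inj₁ (⊗-zeroˡ _)

module Expansion (n : ℕ) (s e : Row) (es : length s ≡ dbl (suc n)) (ee : length e ≡ dbl (suc n)) (m₀ : ℕ)
                 (G : List Row → ℤ) (G-inv : Chains.InvariantUnderLocks n s e es ee (suc m₀) G) where

  m : ℕ
  m = suc m₀

  open Chains n s e es ee m
  open WeightBounds n s e es ee m

  B : ℕ
  B = sum e

  bx : List ℕ
  bx = replicate m B

  -- The coefficient of the Schur function of κ: the Littlewood–Richardson rule weighted by G.
  mult : List ℕ → ℤ
  mult κ = ∑ (arrays e m) (λ z → ind (valid? z) ⊗ G z ⊗ ind (lattice? z) ⊗ δ κ (wt z))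

  -- The symmetry, support and pairing of `schurCount` are established only for partitions of
  -- bounded size; all other terms of the expansion must drop out through their coefficient.
  mult-support : ∀ κ → mult κ ≡ + 0 ⊎ (IsPartition κ × sum κ ≤ B)
  mult-support κ with isPartition? κ | sum κ ≤? B
  ... | yes p | yes l = inj₂ (p , l)
  ... | yes _ | no ¬l = inj₁ (trans (∑-cong-All (Enumerates.sound (arrays-enumerates e m)) (λ z inz → by z inz (valid? z) (wt z ≟ᴿ κ))) (∑-zero (arrays e m) (λ _ → refl)))
    where
    by : ∀ z → InArrays e m z → (d : Dec (Valid z)) (d′ : Dec (wt z ≡ κ)) → ind d ⊗ G z ⊗ ind (lattice? z) ⊗ ind d′ ≡ + 0
    by z inz (yes v) (yes eq) = ⊥-elim (¬l (subst (λ t → sum t ≤ B) eq (≤-trans (m≤m+n _ (sum s)) (≤-reflexive (wt-sum inz v)))))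
    by z inz _ (no _)         = ⊗-zeroʳ _
    by z inz (no _) d′        = trans (cong (λ t → t ⊗ ind (lattice? z) ⊗ ind d′) (⊗-zeroˡ (G z))) (trans (cong (_⊗ ind d′) (⊗-zeroˡ _)) (⊗-zeroˡ _))
  ... | no ¬p | _ = inj₁ (trans (∑-cong-All (Enumerates.sound (arrays-enumerates e m)) (λ z inz → by z inz (valid? z) (lattice? z) (wt z ≟ᴿ κ))) (∑-zero (arrays e m) (λ _ → refl)))
    where
    by : ∀ z → InArrays e m z → (d : Dec (Valid z)) (d₁ : Dec (Lattice z)) (d′ : Dec (wt z ≡ κ)) → ind d ⊗ G z ⊗ ind d₁ ⊗ ind d′ ≡ + 0
    by z inz (yes v) (yes l) (yes eq) = ⊥-elim (¬p (subst IsPartition eq (wt-partition inz v l)))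
    by z inz _ _ (no _)               = ⊗-zeroʳ _
    by z inz d (no _) d′              = trans (cong (_⊗ ind d′) (⊗-zeroʳ _)) (⊗-zeroˡ _)
    by z inz (no _) d₁ d′             = trans (cong (λ t → t ⊗ ind d₁ ⊗ ind d′) (⊗-zeroˡ (G z))) (trans (cong (_⊗ ind d′) (⊗-zeroˡ _)) (⊗-zeroˡ _))

  private
    main : (List ℕ → ℤ) → ℤ
    main = total G G-inv

    term : List ℕ → List ℕ → ℤ
    term κ β = mult κ ⊗ schurCount m κ β

    D : List ℕ → ℤ
    D β = main (δ β) ⊟ ∑ (box bx) (λ κ → term κ β)

    box-length : ∀ κ → InBox bx κ → length κ ≡ m
    box-length κ ok = trans (proj₁ ok) (length-replicate m)

    term-eq : ∀ κ → InBox bx κ → ∀ β β′ → (IsPartition κ → sum κ ≤ B → schurCount m κ β ≡ schurCount m κ β′) → term κ β ≡ term κ β′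
    term-eq κ ok β β′ h with mult-support κ
    ... | inj₁ z       = trans (trans (cong (_⊗ schurCount m κ β) z) (⊗-zeroˡ _)) (sym (trans (cong (_⊗ schurCount m κ β′) z) (⊗-zeroˡ _)))
    ... | inj₂ (p , l) = cong (mult κ ⊗_) (h p l)

    D-sym : ∀ P x y R → length (P ++ x ∷ y ∷ R) ≡ m → D (P ++ x ∷ y ∷ R) ≡ D (P ++ y ∷ x ∷ R)
    D-sym P x y R eq = cong₂ _⊟_
      (trans (total-symmetric G G-inv k<m (δ (P ++ x ∷ y ∷ R))) (∑-cong (arrays e m) (λ z → cong (λ t → ind (valid? z) ⊗ (G z ⊗ t))
        (trans (δ-swap (length P) (P ++ x ∷ y ∷ R) (wt z)) (cong (λ b → δ b (wt z)) (swapAt-++ P x y R))))))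
      (∑-cong-All (Enumerates.sound (box-enumerates bx)) (λ κ ok → term-eq κ ok (P ++ x ∷ y ∷ R) (P ++ y ∷ x ∷ R) (λ p _ → schurCount-swap m₀ κ (box-length κ ok) p P x y R eq)))
      where
      k<m : suc (length P) < m
      k<m = ≤-trans (≤-trans (≤-reflexive (+-comm 2 (length P))) (+-monoʳ-≤ (length P) (s≤s (s≤s z≤n)))) (≤-reflexive (trans (sym (length-++ P)) eq))

    D-out : ∀ β → length β ≡ m → ¬ InBox bx β → D β ≡ + 0
    D-out β eq out = trans (cong₂ _⊟_
      (trans (∑-cong-All (Enumerates.sound (arrays-enumerates e m)) (λ z inz → ind-*-zero (valid? z) (λ v → trans (cong (G z ⊗_) (ind-no (wt z ≟ᴿ β) (λ q → out (subst (InBox bx) q (wt-in inz v ≤-refl))))) (⊗-zeroʳ (G z))))) (∑-zero (arrays e m) (λ _ → refl)))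
      (trans (∑-cong-All (Enumerates.sound (box-enumerates bx)) term-zero) (∑-zero (box bx) (λ _ → refl)))) refl
      where
      term-zero : ∀ κ → InBox bx κ → term κ β ≡ + 0
      term-zero κ ok with mult-support κ
      ... | inj₁ z       = trans (cong (_⊗ schurCount m κ β) z) (⊗-zeroˡ _)
      ... | inj₂ (p , l) = trans (cong (mult κ ⊗_) (schurCount-out m₀ κ (box-length κ ok) p B l β eq out)) (⊗-zeroʳ _)

    D-anti : ∀ f → DotAntisymmetric f → ∑ (box bx) (λ β → D β ⊗ f β) ≡ + 0
    D-anti f anti = begin
      ∑ (box bx) (λ β → D β ⊗ f β)
        ≡⟨ trans (∑-cong (box bx) (λ β → ⊗-distribʳ-⊟ (f β) _ _)) (∑-− (box bx) _ _) ⟩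
      ∑ (box bx) (λ β → main (δ β) ⊗ f β) ⊟ ∑ (box bx) (λ β → ∑ (box bx) (λ κ → term κ β) ⊗ f β)
        ≡⟨ cong₂ _⊟_ left right ⟩
      ∑ (box bx) (λ κ → mult κ ⊗ f κ) ⊟ ∑ (box bx) (λ κ → mult κ ⊗ f κ)
        ≡⟨ ℤₚ.+-inverseʳ (∑ (box bx) (λ κ → mult κ ⊗ f κ)) ⟩
      + 0 ∎
      where
      open ≡-Reasoning
      in-box : ∀ z → InArrays e m z → ∀ (d : Dec (Valid z)) x → ind d ⊗ x ≡ + 0 ⊎ InBox bx (wt z)
      in-box z inz (yes v) x = inj₂ (wt-in inz v ≤-refl)
      in-box z inz (no _)  x = inj₁ (⊗-zeroˡ x)
      in-box′ : ∀ z → InArrays e m z → ind (valid? z) ⊗ G z ⊗ ind (lattice? z) ≡ + 0 ⊎ InBox bx (wt z)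
      in-box′ z inz with in-box z inz (valid? z) (G z)
      ... | inj₁ q = inj₁ (trans (cong (_⊗ ind (lattice? z)) q) (⊗-zeroˡ _))
      ... | inj₂ q = inj₂ q
      left : ∑ (box bx) (λ β → main (δ β) ⊗ f β) ≡ ∑ (box bx) (λ κ → mult κ ⊗ f κ)
      left = begin
        ∑ (box bx) (λ β → main (δ β) ⊗ f β)
          ≡⟨ ∑-cong (box bx) (λ β → cong (_⊗ f β) (∑-cong (arrays e m) (λ z → sym (⊗-assoc (ind (valid? z)) (G z) _)))) ⟩
        ∑ (box bx) (λ β → ∑ (arrays e m) (λ z → ind (valid? z) ⊗ G z ⊗ δ β (wt z)) ⊗ f β)
          ≡⟨ ∑-collapse (Enumerates.sound (arrays-enumerates e m)) bx (λ z → ind (valid? z) ⊗ G z) wt (λ z inz → in-box z inz (valid? z) (G z)) f ⟩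
        ∑ (arrays e m) (λ z → ind (valid? z) ⊗ G z ⊗ f (wt z))
          ≡⟨ ∑-cong (arrays e m) (λ z → ⊗-assoc (ind (valid? z)) (G z) _) ⟩
        main f
          ≡⟨ total-lattice G G-inv f anti ⟩
        ∑ (arrays e m) (λ z → ind (valid? z) ⊗ (G z ⊗ f (wt z)) ⊗ ind (lattice? z))
          ≡⟨ ∑-cong (arrays e m) (λ z → trans (cong (_⊗ ind (lattice? z)) (sym (⊗-assoc (ind (valid? z)) (G z) _)))
               (trans (⊗-assoc _ (f (wt z)) (ind (lattice? z))) (trans (cong (ind (valid? z) ⊗ G z ⊗_) (⊗-comm (f (wt z)) _)) (sym (⊗-assoc _ (ind (lattice? z)) (f (wt z))))))) ⟩
        ∑ (arrays e m) (λ z → ind (valid? z) ⊗ G z ⊗ ind (lattice? z) ⊗ f (wt z))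
          ≡⟨ sym (∑-collapse (Enumerates.sound (arrays-enumerates e m)) bx (λ z → ind (valid? z) ⊗ G z ⊗ ind (lattice? z)) wt in-box′ f) ⟩
        ∑ (box bx) (λ κ → mult κ ⊗ f κ) ∎
      right : ∑ (box bx) (λ β → ∑ (box bx) (λ κ → term κ β) ⊗ f β) ≡ ∑ (box bx) (λ κ → mult κ ⊗ f κ)
      right = begin
        ∑ (box bx) (λ β → ∑ (box bx) (λ κ → term κ β) ⊗ f β)
          ≡⟨ ∑-cong (box bx) (λ β → trans (⊗-comm _ (f β)) (sym (∑-*ˡ (box bx) (f β) _))) ⟩
        ∑ (box bx) (λ β → ∑ (box bx) (λ κ → f β ⊗ term κ β))
          ≡⟨ ∑-swap (box bx) (box bx) _ ⟩
        ∑ (box bx) (λ κ → ∑ (box bx) (λ β → f β ⊗ term κ β))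
          ≡⟨ ∑-cong-All (Enumerates.sound (box-enumerates bx)) (λ κ ok → trans (∑-cong (box bx) (λ β → trans (⊗-comm (f β) _) (⊗-assoc (mult κ) _ (f β)))) (trans (∑-*ˡ (box bx) (mult κ) _) (inner κ ok))) ⟩
        ∑ (box bx) (λ κ → mult κ ⊗ f κ) ∎
        where
        inner : ∀ κ → InBox bx κ → mult κ ⊗ ∑ (box bx) (λ β → schurCount m κ β ⊗ f β) ≡ mult κ ⊗ f κ
        inner κ ok with mult-support κ
        ... | inj₁ z       = trans (trans (cong (_⊗ ∑ (box bx) (λ β → schurCount m κ β ⊗ f β)) z) (⊗-zeroˡ _)) (sym (trans (cong (_⊗ f κ) z) (⊗-zeroˡ _)))
        ... | inj₂ (p , l) = cong (mult κ ⊗_) (schurCount-anti m₀ κ (box-length κ ok) p B l f anti)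

  -- Both sides are symmetric and supported in the box. Against a dot-antisymmetric `f` both give
  -- the sum of `mult κ ⊗ f κ`: the left side by `total-lattice`, the right side by
  -- `straight-total`. `Uniqueness` then identifies them.
  expansion : ∀ β → length β ≡ m → main (δ β) ≡ ∑ (box bx) (λ κ → mult κ ⊗ schurCount m κ β)
  expansion β eq = ℤₚ.i-j≡0⇒i≡j _ _ (Uniqueness.vanishes m B D D-sym D-out D-anti β eq)

-- Labellings of pairs of entries

-- Minimum and maximum of a pair do not change when the pair is exchanged; a graph defined through
-- them is therefore preserved by every exchange.
mn mx : Row → ℕ → ℕ
mn x j = at x j ⊓ at x (par j)
mx x j = at x j ⊔ at x (par j)

mn-par : ∀ x j → mn x (par j) ≡ mn x j
mn-par x j = trans (cong (at x (par j) ⊓_) (cong (at x) (par-par j))) (⊓-comm (at x (par j)) (at x j))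

mx-par : ∀ x j → mx x (par j) ≡ mx x j
mx-par x j = trans (cong (at x (par j) ⊔_) (cong (at x) (par-par j))) (⊔-comm (at x (par j)) (at x j))

mx-pick : ∀ x j {p} → at x j ≤ p → p < mx x j → p < at x (par j)
mx-pick x j {p} l h with at x (par j) ≤? p
... | yes q = ⊥-elim (<⇒≱ h (⊔-lub l q))
... | no ¬q = ≰⇒> ¬q

mn-pick : ∀ x j {p} → p ≤ at x (par j) → mn x j < p → at x j < p
mn-pick x j {p} l h with p ≤? at x j
... | yes q = ⊥-elim (<⇒≱ h (⊓-glb q l))
... | no ¬q = ≰⇒> ¬q

mx-range : ∀ n x → length x ≡ dbl (suc n) → ∀ {p j} → p < mx x j → j < dbl (suc n)
mx-range n x ex {p} {j} h with j <? dbl (suc n)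
... | yes l = l
... | no ¬l = ⊥-elim (n≮0 (subst (p <_) (cong₂ _⊔_ (out ¬l) (out (λ q → ¬l (subst (_< dbl (suc n)) (par-par j) (par<dbl (suc n) q))))) h))
  where
  out : ∀ {i} → ¬ i < dbl (suc n) → at x i ≡ 0
  out ¬q = at-beyond x (≤-trans (≤-reflexive ex) (≮⇒≥ ¬q))

-- The neighbours, in the rows a below and u above, of the pair at position j of v.
module Neighbours (a u : Row) (sa su : ℕ → ℕ) where

  data Down (v : Row) (j : ℕ) : ℕ → Set where
    d₁ : mn v j < mx a j → Down v j (sa j)
    d₂ : mn v j < mx u (2 + j) → Down v j (su (2 + j))

  data Up (v : Row) : ℕ → ℕ → Set where
    u₁ : ∀ {j} → mn u j < mx v j → Up v j (su j)
    u₂ : ∀ {j} → mn a j < mx v (2 + j) → Up v (2 + j) (sa j)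

module Relabel (n : ℕ) (a u : Row) (ea : length a ≡ dbl (suc n)) (eu : length u ≡ dbl (suc n)) (sa su : ℕ → ℕ)
  (sa-par : ∀ {j} → j < dbl (suc n) → sa (par j) ≡ sa j) (su-par : ∀ {j} → j < dbl (suc n) → su (par j) ≡ su j) where

  open Neighbours a u sa su
  open Between n a u ea eu
  open Free a u

  private
    in-range : ∀ x → length x ≡ w → ∀ {p j} → p < mx x j → j < w
    in-range = mx-range n

  down-par : ∀ {v j ℓ} → Down v j ℓ → Down v (par j) ℓ
  down-par {v} {j} (d₁ h) = subst (Down v (par j)) (sa-par (in-range a ea h)) (d₁ (subst₂ _<_ (sym (mn-par v j)) (sym (mx-par a j)) h))
  down-par {v} {j} (d₂ h) = subst (Down v (par j)) (su-par (in-range u eu h)) (d₂ (subst₂ _<_ (sym (mn-par v j)) (sym (mx-par u (2 + j))) h))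

  up-par : ∀ {v j ℓ} → length v ≡ w → Up v j ℓ → Up v (par j) ℓ
  up-par {v} {j} ev (u₁ h) = subst (Up v (par j)) (su-par (in-range v ev h)) (u₁ (subst₂ _<_ (sym (mn-par u j)) (sym (mx-par v j)) h))
  up-par {v} ev (u₂ {j} h) = subst (Up v (2 + par j)) (sa-par (<-trans (n<1+n j) (<-trans (n<1+n (suc j)) (in-range v ev h))))
    (u₂ (subst₂ _<_ (sym (mn-par a j)) (sym (mx-par v (2 + j))) h))

  -- A labelling of the rows `a` and `u` that extends to `v` also extends to `v′`. Each pair of `v′`
  -- copies the label of some neighbour to which it is tied; if it is tied to two, the equal locks
  -- show that `v` also forces these two labels to agree.
  module Move {v v′ : Row} (ev′ : length v′ ≡ w) (iv : Within w lo hi v) (iv′ : Within w lo hi v′) (sl : SameLocks links v v′)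
           (sv : ℕ → ℕ) (sv-down : ∀ {j ℓ} → Down v j ℓ → sv j ≡ ℓ) (sv-up : ∀ {j ℓ} → Up v j ℓ → sv j ≡ ℓ) where

    private
      -- If the lock fails in `v`, either the entry at `j` is so small that the pair at `j` is tied
      -- to both neighbours, or the entry at `2 + par j` is so large that the pair at `2 + j` is.
      unlocked : ∀ {j} → j < w → LockAt j → ¬ Locked (lockL j) v′ → sa j ≡ su (2 + j)
      unlocked {j} j<w la ¬lk with low (lockL j) ≤? at v j
      ... | no ¬q = trans (sym (sv-down (d₁ (below (≤-trans (m⊓n≤n (at u (2 + par j)) _) (m≤n⊔m (at a j) _))))))
                          (sv-down (d₂ (below (≤-trans (m⊓n≤m (at u (2 + par j)) _) (m≤n⊔m (at u (2 + j)) _)))))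
        where
        below : ∀ {x} → hi (2 + par j) ≤ x → mn v j < x
        below h = ≤-<-trans (m⊓n≤m (at v j) _) (<-≤-trans (≰⇒> ¬q) h)
      ... | yes q with at v (2 + par j) ≤? lo j
      ...   | yes r = ⊥-elim (¬lk (proj₁ (All.lookup sl (lock∈ (∈-upTo⁺ j<w) la)) (q , r)))
      ...   | no ¬r = trans (sym (sv-up (u₂ (above (≤-trans (m⊓n≤m (at a j) _) (m≤m⊔n (at a j) _)))))) (sv-up (u₁ (above (≤-trans (m⊓n≤m (at u (2 + j)) _) (m≤n⊔m (at a j) _)))))
        where
        above : ∀ {x} → x ≤ lo j → x < mx v (2 + j)
        above h = ≤-<-trans h (<-≤-trans (≰⇒> ¬r) (m≤n⊔m (at v (2 + j)) _))

      module Smaller {j : ℕ} (j<w : j < w) (P≤Q : at v′ j ≤ at v′ (par j)) where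

        jj : ℕ
        jj = par j

        jj<w : jj < w
        jj<w = par<dbl (suc n) j<w

        lo≤P : lo j ≤ at v′ j
        lo≤P = proj₁ (iv′ j<w)

        Q≤hi : at v′ jj ≤ hi jj
        Q≤hi = proj₂ (iv′ jj<w)

        mn-P : mn v′ j ≡ at v′ j
        mn-P = m≤n⇒m⊓n≡m P≤Q

        mx-Q : mx v′ j ≡ at v′ jj
        mx-Q = m≤n⇒m⊔n≡n P≤Q

        D1 : mn v′ j < mx a j → at v′ j < at a jj
        D1 h = mx-pick a j (≤-trans (m≤m⊔n (at a j) _) lo≤P) (subst (_< mx a j) mn-P h)

        D2 : mn v′ j < mx u (2 + j) → at v′ j < at u (2 + jj)
        D2 h = mx-pick u (2 + j) (≤-trans (m≤n⊔m (at a j) _) lo≤P) (subst (_< mx u (2 + j)) mn-P h)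

        U1 : mn u j < mx v′ j → at u j < at v′ jj
        U1 h = mn-pick u j (≤-trans Q≤hi (hi≤u jj)) (subst (mn u j <_) mx-Q h)

        DD₁₂ : mn v′ j < mx a j → mn v′ j < mx u (2 + j) → sa j ≡ su (2 + j)
        DD₁₂ h h′ = unlocked j<w (≤-<-trans lo≤P P<) (λ (q , _) → <⇒≱ P< q)
          where
          P< : at v′ j < hi (2 + jj)
          P< = ⊓-glb (D2 h′) (D1 h)

        DD : ∀ {ℓ ℓ′} → Down v′ j ℓ → Down v′ j ℓ′ → ℓ ≡ ℓ′
        DD (d₁ _) (d₁ _) = refl
        DD (d₁ h) (d₂ h′) = DD₁₂ h h′
        DD (d₂ h) (d₁ h′) = sym (DD₁₂ h′ h)
        DD (d₂ _) (d₂ _) = refl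

        down-lo : ∀ {ℓ} → Down v′ j ℓ → at v′ j < lo jj
        down-lo (d₁ h) = <-≤-trans (D1 h) (m≤m⊔n (at a jj) _)
        down-lo (d₂ h) = <-≤-trans (D2 h) (m≤n⊔m (at a jj) _)

        up-hi : ∀ {ℓ} → Up v′ j ℓ → hi j < at v′ jj
        up-hi (u₁ h) = ≤-<-trans (hi≤u j) (U1 h)
        up-hi (u₂ {i} h) = ≤-<-trans (m⊓n≤n (at u (2 + i)) (at a i)) (mn-pick a i (≤-trans Q≤hi (m⊓n≤n _ _)) (subst (mn a i <_) mx-Q h))

        -- The neighbour is the one whose entry attains the bound `lo jj`. This choice does not
        -- involve the row, so the same neighbour serves `v` and `v′`; `attain-up` is the
        -- counterpart for `hi j`.
        attain-down : ∀ x → at x j < lo jj → ∃ λ ℓ → ∀ x → at x j < lo jj → Down x j ℓ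
        attain-down _ _ with ≤-total (at u (2 + jj)) (at a jj)
        ... | inj₁ l = sa j , λ x h → d₁ (≤-<-trans (m⊓n≤m (at x j) _) (<-≤-trans h (≤-trans (≤-reflexive (m≥n⇒m⊔n≡m l)) (m≤n⊔m (at a j) _))))
        ... | inj₂ l = su (2 + j) , λ x h → d₂ (≤-<-trans (m⊓n≤m (at x j) _) (<-≤-trans h (≤-trans (≤-reflexive (m≤n⇒m⊔n≡n l)) (m≤n⊔m (at u (2 + j)) _))))

      attain-up : ∀ j → ∃ λ ℓ → ∀ x → hi j < at x (par j) → Up x j ℓ
      attain-up zero       = su 0 , λ x h → u₁ (≤-<-trans (m⊓n≤m (at u 0) _) (<-≤-trans h (m≤n⊔m (at x 0) _)))
      attain-up (suc zero) = su 1 , λ x h → u₁ (≤-<-trans (m⊓n≤m (at u 1) _) (<-≤-trans h (m≤n⊔m (at x 1) _)))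
      attain-up (suc (suc i)) with ≤-total (at u (2 + i)) (at a i)
      ... | inj₁ l = su (2 + i) , λ x h → u₁ (≤-<-trans (≤-trans (m⊓n≤m (at u (2 + i)) _) (≤-reflexive (sym (m≤n⇒m⊓n≡m l)))) (<-≤-trans h (m≤n⊔m (at x (2 + i)) _)))
      ... | inj₂ l = sa i , λ x h → u₂ (≤-<-trans (≤-trans (m⊓n≤m (at a i) _) (≤-reflexive (sym (m≥n⇒m⊓n≡n l)))) (<-≤-trans h (m≤n⊔m (at x (2 + i)) _)))

      UU₁₂ : ∀ {i} → 2 + i < w → at v′ (2 + i) ≤ at v′ (2 + par i) → mn u (2 + i) < mx v′ (2 + i) → mn a i < mx v′ (2 + i) → su (2 + i) ≡ sa i
      UU₁₂ {i} l P≤Q h h′ = sym (unlocked (<-trans (n<1+n i) (<-trans (n<1+n (suc i)) l)) (<-≤-trans lo<Q Q≤hi) (λ (_ , q) → <⇒≱ lo<Q q))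
        where
        open Smaller {2 + i} l P≤Q
        lo<Q : lo i < at v′ (2 + par i)
        lo<Q = ⊔-lub (mn-pick a i (≤-trans Q≤hi (m⊓n≤n _ _)) (subst (mn a i <_) mx-Q h′)) (U1 h)

      UU : ∀ {j} → j < w → at v′ j ≤ at v′ (par j) → ∀ {ℓ ℓ′} → Up v′ j ℓ → Up v′ j ℓ′ → ℓ ≡ ℓ′
      UU l q (u₁ _)     (u₁ _)      = refl
      UU l q (u₁ h)     (u₂ h′)     = UU₁₂ l q h h′
      UU l q (u₂ h)     (u₁ h′)     = sym (UU₁₂ l q h′ h)
      UU l q (u₂ _)     (u₂ _)      = refl

      -- Being tied on both sides puts the smaller entry below `lo jj` and the larger one above
      -- `hi j`. Either the intervals are disjoint, and this holds for `v` as well, or it says that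
      -- `crossL jj` is locked in `v′` and therefore in `v`.
      UD : ∀ {j} → j < w → at v′ j ≤ at v′ (par j) → ∀ {ℓ ℓ′} → Up v′ j ℓ → Down v′ j ℓ′ → ℓ ≡ ℓ′
      UD {j} l q up down = trans (UU l q up (proj₂ au v′ (up-hi up))) (trans (sym (sv-up (proj₂ au v (proj₁ apart)))) (trans (sv-down (proj₂ ad v (proj₂ apart))) (DD (proj₂ ad v′ (down-lo down)) down)))
        where
        open Smaller l q
        au = attain-up j
        ad = attain-down v′ (down-lo down)
        apart : hi j < at v jj × at v j < lo jj
        apart with lo jj ≤? hi j
        ... | no ¬h = <-≤-trans (≰⇒> ¬h) (proj₁ (iv jj<w)) , ≤-<-trans (proj₂ (iv l)) (≰⇒> ¬h)
        ... | yes h = proj₁ lk , <-≤-trans (s≤s (proj₂ lk′)) (≤-reflexive (m+[n∸m]≡n (≤-trans (s≤s z≤n) lo<)))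
          where
          lo< : lo j < lo jj
          lo< = ≤-<-trans lo≤P (down-lo down)
          back : par jj ≡ j
          back = par-par j
          cross : CrossAt jj
          cross = subst (λ t → lo t < lo jj) (sym back) lo< , subst (λ t → hi t < hi jj) (sym back) (<-≤-trans (up-hi up) Q≤hi) , subst (λ t → lo jj ≤ hi t) (sym back) h
          lk″ : Locked (crossL jj) v
          lk″ = proj₂ (All.lookup sl (cross∈ (∈-upTo⁺ jj<w) cross))
            (subst (λ t → suc (hi t) ≤ at v′ jj) (sym back) (up-hi up) , subst (λ t → at v′ t ≤ lo jj ∸ 1) (sym back) (∸-monoˡ-≤ 1 (down-lo down)))
          lk : Locked (link jj j (suc (hi j)) (lo jj ∸ 1)) v
          lk = subst (λ t → Locked (link jj t (suc (hi t)) (lo jj ∸ 1)) v) back lk″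
          lk′ = lk

      Adj : Row → ℕ → ℕ → Set
      Adj x j ℓ = Up x j ℓ ⊎ Down x j ℓ

      consistent≤ : ∀ {j} → j < w → at v′ j ≤ at v′ (par j) → ∀ {ℓ ℓ′} → Adj v′ j ℓ → Adj v′ j ℓ′ → ℓ ≡ ℓ′
      consistent≤ l q (inj₁ x) (inj₁ y) = UU l q x y
      consistent≤ l q (inj₁ x) (inj₂ y) = UD l q x y
      consistent≤ l q (inj₂ x) (inj₁ y) = sym (UD l q y x)
      consistent≤ l q (inj₂ x) (inj₂ y) = Smaller.DD l q x y

      adj-par : ∀ {j ℓ} → Adj v′ j ℓ → Adj v′ (par j) ℓ
      adj-par (inj₁ x) = inj₁ (up-par ev′ x)
      adj-par (inj₂ x) = inj₂ (down-par x)

      consistent : ∀ {j} → j < w → ∀ {ℓ ℓ′} → Adj v′ j ℓ → Adj v′ j ℓ′ → ℓ ≡ ℓ′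
      consistent {j} l x y with ≤-total (at v′ j) (at v′ (par j))
      ... | inj₁ q = consistent≤ l q x y
      ... | inj₂ q = consistent≤ (par<dbl (suc n) l) (≤-trans q (≤-reflexive (cong (at v′) (sym (par-par j))))) (adj-par x) (adj-par y)

      search : ∀ j → (∃ (Adj v′ j)) ⊎ (∀ {ℓ} → ¬ Adj v′ j ℓ)
      search j with mn v′ j <? mx a j | mn v′ j <? mx u (2 + j) | mn u j <? mx v′ j
      ... | yes h | _     | _     = inj₁ (sa j , inj₂ (d₁ h))
      ... | no _  | yes h | _     = inj₁ (su (2 + j) , inj₂ (d₂ h))
      ... | no _  | no _  | yes h = inj₁ (su j , inj₁ (u₁ h))
      search zero | no ¬1 | no ¬2 | no ¬3 = inj₂ λ { (inj₁ (u₁ h)) → ¬3 h ; (inj₂ (d₁ h)) → ¬1 h ; (inj₂ (d₂ h)) → ¬2 h }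
      search (suc zero) | no ¬1 | no ¬2 | no ¬3 = inj₂ λ { (inj₁ (u₁ h)) → ¬3 h ; (inj₂ (d₁ h)) → ¬1 h ; (inj₂ (d₂ h)) → ¬2 h }
      search (suc (suc i)) | no ¬1 | no ¬2 | no ¬3 with mn a i <? mx v′ (2 + i)
      ... | yes h = inj₁ (sa i , inj₁ (u₂ h))
      ... | no ¬4 = inj₂ λ { (inj₁ (u₁ h)) → ¬3 h ; (inj₁ (u₂ h)) → ¬4 h ; (inj₂ (d₁ h)) → ¬1 h ; (inj₂ (d₂ h)) → ¬2 h }

      labelOf : ∀ {j} → (∃ (Adj v′ j)) ⊎ (∀ {ℓ} → ¬ Adj v′ j ℓ) → ℕ
      labelOf (inj₁ (ℓ , _)) = ℓ
      -- A pair tied to nothing is free, and 0 is its default label.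
      labelOf (inj₂ _)       = 0

    relabel : ℕ → ℕ
    relabel j = labelOf (search j)

    relabel-adj : ∀ {j} → j < w → ∀ {ℓ} → Up v′ j ℓ ⊎ Down v′ j ℓ → relabel j ≡ ℓ
    relabel-adj {j} l x with search j
    ... | inj₁ (_ , y) = consistent l y x
    ... | inj₂ none    = ⊥-elim (none x)

    relabel-par : ∀ {j} → j < w → relabel (par j) ≡ relabel j
    relabel-par {j} l with search j
    ... | inj₁ (_ , y) = relabel-adj (par<dbl (suc n) l) (adj-par y)
    ... | inj₂ none with search (par j)
    ...   | inj₁ (_ , y) = ⊥-elim (none (subst (λ t → Adj v′ t _) (par-par j) (adj-par y)))
    ...   | inj₂ _       = refl

    relabel-≤1 : (∀ i → sa i ≤ 1) → (∀ i → su i ≤ 1) → ∀ j → relabel j ≤ 1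
    relabel-≤1 ha hu j with search j
    ... | inj₂ _ = z≤n
    ... | inj₁ (_ , inj₁ (u₁ _)) = hu _
    ... | inj₁ (_ , inj₁ (u₂ _)) = ha _
    ... | inj₁ (_ , inj₂ (d₁ _)) = ha _
    ... | inj₁ (_ , inj₂ (d₂ _)) = hu _

-- Exchanging the two tableaux along a labelling

-- Records at both positions of a pair whether putting the larger entry first exchanges them.
negAt : (ℕ → ℕ) → ℕ → ℕ
negAt f zero          = indᴺ (f 0 <? f 1)
negAt f (suc zero)    = indᴺ (f 0 <? f 1)
negAt f (suc (suc j)) = negAt (λ i → f (2 + i)) j

negAt-par : ∀ f j → negAt f (par j) ≡ negAt f j
negAt-par f zero          = refl
negAt-par f (suc zero)    = refl
negAt-par f (suc (suc j)) = negAt-par (λ i → f (2 + i)) j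

negAt≤1 : ∀ f j → negAt f j ≤ 1
negAt≤1 f zero          = indᴺ≤1 (f 0 <? f 1)
negAt≤1 f (suc zero)    = indᴺ≤1 (f 0 <? f 1)
negAt≤1 f (suc (suc j)) = negAt≤1 (λ i → f (2 + i)) j

negAt-same : ∀ f h j → f j < f (par j) → h j < h (par j) → negAt f j ≡ negAt h j
negAt-same f h zero          p q = trans (indᴺ-yes (f 0 <? f 1) p) (sym (indᴺ-yes (h 0 <? h 1) q))
negAt-same f h (suc zero)    p q = trans (indᴺ-no (f 0 <? f 1) (<⇒≯ p)) (sym (indᴺ-no (h 0 <? h 1) (<⇒≯ q)))
negAt-same f h (suc (suc j)) p q = negAt-same (λ i → f (2 + i)) (λ i → h (2 + i)) j p q

private
  negAt-edge≤ : ∀ f h j → f j ≤ h j → f (par j) ≤ h (par j) → h j ≤ h (par j) → h j ⊓ h (par j) < f j ⊔ f (par j) → negAt h j ≡ negAt f j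
  negAt-edge≤ f h j p q l e = negAt-same h f j (<-≤-trans hj< q) (≤-<-trans p hj<)
    where
    hj< : h j < f (par j)
    hj< = ≰⇒> (λ r → <⇒≱ e (≤-trans (⊔-lub p r) (≤-reflexive (sym (m≤n⇒m⊓n≡m l)))))

-- If `h j` is the smaller entry of its pair, the edge must come from `f (par j)`, because `f j` is
-- at most `h j`. So `h j` lies strictly below `f (par j)`, and both pairs increase strictly in the
-- same direction.
negAt-edge : ∀ f h j → f j ≤ h j → f (par j) ≤ h (par j) → h j ⊓ h (par j) < f j ⊔ f (par j) → negAt h j ≡ negAt f j
negAt-edge f h j p q e with ≤-total (h j) (h (par j))
... | inj₁ l = negAt-edge≤ f h j p q l e
... | inj₂ l = trans (sym (negAt-par h j)) (trans (negAt-edge≤ f h (par j) q (back p) (back′ l) (subst₂ _<_ (trans (⊓-comm (h j) _) (cong (h (par j) ⊓_) (cong h (sym (par-par j))))) (trans (⊔-comm (f j) _) (cong (f (par j) ⊔_) (cong f (sym (par-par j))))) e)) (negAt-par f j))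
  where
  back : f j ≤ h j → f (par (par j)) ≤ h (par (par j))
  back = subst (λ t → f t ≤ h t) (sym (par-par j))
  back′ : h (par j) ≤ h j → h (par j) ≤ h (par (par j))
  back′ = subst (λ t → h (par j) ≤ h t) (sym (par-par j))

sumTo-swap : ∀ N (l f : ℕ → ℕ) → (∀ {j} → j < dbl N → l (par j) ≡ l j) → sumTo (dbl N) (λ j → choose (l j ≟ 1) (f (par j)) (f j)) ≡ sumTo (dbl N) f
sumTo-swap zero    l f h = refl
sumTo-swap (suc N) l f h = trans (sym (+-assoc (choose (l 0 ≟ 1) (f 1) (f 0)) _ _)) (trans (cong₂ _+_ (two (l 0) (l 1) (sym (h {0} (s≤s z≤n)))) (sumTo-swap N (λ j → l (2 + j)) (λ j → f (2 + j)) (λ q → h (s≤s (s≤s q))))) (+-assoc (f 0) (f 1) _))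
  where
  two : ∀ x y → x ≡ y → choose (x ≟ 1) (f 1) (f 0) + choose (y ≟ 1) (f 0) (f 1) ≡ f 0 + f 1
  two x _ refl with x ≟ 1
  ... | yes _ = +-comm (f 1) (f 0)
  ... | no _  = refl

enumerates-∈ : {A : Set} {_≟A_ : (x y : A) → Dec (x ≡ y)} {Ok : A → Set} {xs : List A} → Enumerates _≟A_ Ok xs → ∀ {y} → Ok y → y ∈ xs
enumerates-∈ {_≟A_ = _≟A_} {xs = xs} E {y} ok with Any.any? (λ x → y ≟A x) xs
... | yes p = p
... | no ¬p = ⊥-elim (zero≢one (trans (sym (none xs ¬p)) (Enumerates.pick E y (λ _ → + 1) ok)))
  where
  zero≢one : + 0 ≢ + 1
  zero≢one ()
  none : ∀ xs → ¬ Any (y ≡_) xs → ∑ xs (λ x → ind (x ≟A y) ⊗ + 1) ≡ + 0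
  none []       _ = refl
  none (x ∷ xs) h = cong₂ _⊕_ (ind-*-zero (x ≟A y) (λ e → ⊥-elim (h (here (sym e))))) (none xs (h ∘ there))

-- Exchanging alters the final row and with it the box of admissible rows; this places both families
-- of chains in one common box.
∑-enlarge : {A : Set} {_≟A_ : (x y : A) → Dec (x ≡ y)} {Ok Ok′ : A → Set} {xs ys : List A} →
  Enumerates _≟A_ Ok xs → Enumerates _≟A_ Ok′ ys → (∀ x → Ok x → Ok′ x) → (f : A → ℤ) → (∀ y → Ok′ y → f y ≡ + 0 ⊎ Ok y) → ∑ xs f ≡ ∑ ys f
∑-enlarge {_≟A_ = _≟A_} {xs = xs} {ys} E E′ sub f h = begin
  ∑ xs f
    ≡⟨ ∑-cong-All (Enumerates.sound E) (λ x ok → sym (Enumerates.pick E′ x f (sub x ok))) ⟩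
  ∑ xs (λ x → ∑ ys (λ y → ind (y ≟A x) ⊗ f y))
    ≡⟨ ∑-swap xs ys _ ⟩
  ∑ ys (λ y → ∑ xs (λ x → ind (y ≟A x) ⊗ f y))
    ≡⟨ ∑-cong-All (Enumerates.sound E′) (λ y ok → trans (∑-cong xs (λ x → cong (_⊗ f y) (ind-cong (y ≟A x) (x ≟A y) sym sym))) (single y (h y ok))) ⟩
  ∑ ys f ∎
  where
  open ≡-Reasoning
  single : ∀ y → f y ≡ + 0 ⊎ _ → ∑ xs (λ x → ind (x ≟A y) ⊗ f y) ≡ f y
  single y (inj₁ z) = trans (∑-zero xs (λ x → trans (cong (ind (x ≟A y) ⊗_) z) (⊗-zeroʳ _))) (sym z)
  single y (inj₂ ok) = Enumerates.pick E y (λ _ → f y) ok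

setLev : List Row → ℕ → Row → List Row
setLev []       _       r = []
setLev (x ∷ xs) zero    r = r ∷ xs
setLev (x ∷ xs) (suc k) r = x ∷ setLev xs k r

lev-set-same : ∀ xs {k} r → k < length xs → lev (setLev xs k r) k ≡ r
lev-set-same (x ∷ xs) {zero}  r _       = refl
lev-set-same (x ∷ xs) {suc k} r (s≤s l) = lev-set-same xs r l

lev-set-other : ∀ xs {k} r {i} → i ≢ k → lev (setLev xs k r) i ≡ lev xs i
lev-set-other []       r ne = refl
lev-set-other (x ∷ xs) {zero}  r {zero}  ne = ⊥-elim (ne refl)
lev-set-other (x ∷ xs) {zero}  r {suc i} ne = refl
lev-set-other (x ∷ xs) {suc k} r {zero}  ne = refl
lev-set-other (x ∷ xs) {suc k} r {suc i} ne = lev-set-other xs r (ne ∘ cong suc)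

length-set : ∀ xs k r → length (setLev xs k r) ≡ length xs
length-set []       k       r = refl
length-set (x ∷ xs) zero    r = refl
length-set (x ∷ xs) (suc k) r = cong suc (length-set xs k r)

All-set : {X : Row → Set} → ∀ {xs} → All X xs → ∀ k {r} → X r → All X (setLev xs k r)
All-set []       k       h = []
All-set (_ ∷ ps) zero    h = h ∷ ps
All-set (p ∷ ps) (suc k) h = p ∷ All-set ps k h

All-from-lev : {X : Row → Set} → ∀ xs → (∀ {i} → i < length xs → X (lev xs i)) → All X xs
All-from-lev []       h = []
All-from-lev (x ∷ xs) h = h (s≤s z≤n) ∷ All-from-lev xs (h ∘ s≤s)

module Swap (n : ℕ) where

  w : ℕ
  w = dbl (suc n)

  ParInvariant : Row → Set
  ParInvariant l = ∀ {j} → j < w → at l (par j) ≡ at l j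

  negRow : Row → Row
  negRow x = row w (negAt (at x))

  at-negRow : ∀ x {j} → j < w → at (negRow x) j ≡ negAt (at x) j
  at-negRow x = at-row w (negAt (at x))

  swapRow : Row → Row → Row
  swapRow l x = row w (λ j → choose (at l j ≟ 1) (at x (par j)) (at x j))

  length-swapRow : ∀ l x → length (swapRow l x) ≡ w
  length-swapRow l x = length-row w (λ j → choose (at l j ≟ 1) (at x (par j)) (at x j))

  at-swapRow : ∀ l x {j} → j < w → at (swapRow l x) j ≡ choose (at l j ≟ 1) (at x (par j)) (at x j)
  at-swapRow l x = at-row w (λ j → choose (at l j ≟ 1) (at x (par j)) (at x j))

  par<w : ∀ {j} → j < w → par j < w
  par<w = par<dbl (suc n)

  beyond : ∀ x → length x ≡ w → ∀ {j} → ¬ j < w → at x j ≡ 0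
  beyond x ex ¬l = at-beyond x (≤-trans (≤-reflexive ex) (≮⇒≥ ¬l))

  pair-swapRow : ∀ l x → ParInvariant l → ∀ {j} → j < w →
    (at (swapRow l x) j ≡ at x j × at (swapRow l x) (par j) ≡ at x (par j)) ⊎ (at (swapRow l x) j ≡ at x (par j) × at (swapRow l x) (par j) ≡ at x j)
  pair-swapRow l x inv {j} j<w with at l j ≟ 1
  ... | yes e = inj₂ (trans (at-swapRow l x j<w) (choose-yes (at l j ≟ 1) e) ,
                      trans (at-swapRow l x (par<w j<w)) (trans (choose-yes (at l (par j) ≟ 1) (trans (inv j<w) e)) (cong (at x) (par-par j))))
  ... | no ne = inj₁ (trans (at-swapRow l x j<w) (choose-no (at l j ≟ 1) ne) ,
                      trans (at-swapRow l x (par<w j<w)) (choose-no (at l (par j) ≟ 1) (λ e → ne (trans (sym (inv j<w)) e))))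

  mn-mx-swapRow : ∀ l x → ParInvariant l → length x ≡ w → ∀ j → mn (swapRow l x) j ≡ mn x j × mx (swapRow l x) j ≡ mx x j
  mn-mx-swapRow l x inv ex j with j <? w
  ... | no ¬l = cong₂ _⊓_ (o ¬l) (o ¬l′) , cong₂ _⊔_ (o ¬l) (o ¬l′)
    where
    ¬l′ : ¬ par j < w
    ¬l′ q = ¬l (subst (_< w) (par-par j) (par<w q))
    o : ∀ {i} → ¬ i < w → at (swapRow l x) i ≡ at x i
    o q = trans (beyond (swapRow l x) (length-swapRow l x) q) (sym (beyond x ex q))
  ... | yes j<w with pair-swapRow l x inv j<w
  ...   | inj₁ (p , q) = cong₂ _⊓_ p q , cong₂ _⊔_ p q
  ...   | inj₂ (p , q) = trans (cong₂ _⊓_ p q) (⊓-comm (at x (par j)) (at x j)) , trans (cong₂ _⊔_ p q) (⊔-comm (at x (par j)) (at x j))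

  swapRow-swapRow : ∀ l l′ x → ParInvariant l → (∀ {j} → j < w → at l j ≡ at l′ j) → length x ≡ w → swapRow l (swapRow l′ x) ≡ x
  swapRow-swapRow l l′ x inv eq ex = row-ext (trans (length-swapRow l (swapRow l′ x)) (sym ex)) (λ {j} h → entry (subst (j <_) (length-swapRow l (swapRow l′ x)) h))
    where
    entry : ∀ {j} → j < w → at (swapRow l (swapRow l′ x)) j ≡ at x j
    entry {j} j<w = trans (at-swapRow l (swapRow l′ x) j<w) (by (at l j ≟ 1))
      where
      by : Dec (at l j ≡ 1) → choose (at l j ≟ 1) (at (swapRow l′ x) (par j)) (at (swapRow l′ x) j) ≡ at x j
      by (yes e) = trans (choose-yes (at l j ≟ 1) e) (trans (at-swapRow l′ x (par<w j<w))
        (trans (choose-yes (at l′ (par j) ≟ 1) (trans (sym (eq (par<w j<w))) (trans (inv j<w) e))) (cong (at x) (par-par j))))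
      by (no ne) = trans (choose-no (at l j ≟ 1) ne) (trans (at-swapRow l′ x j<w) (choose-no (at l′ j ≟ 1) (λ e → ne (trans (eq j<w) e))))

  sum-swapRow : ∀ l x → ParInvariant l → length x ≡ w → sum (swapRow l x) ≡ sum x
  sum-swapRow l x inv ex = begin
    sum (swapRow l x) ≡⟨ trans (sum-sumTo (swapRow l x)) (cong (λ t → sumTo t (at (swapRow l x))) (length-swapRow l x)) ⟩
    sumTo w (at (swapRow l x)) ≡⟨ sumTo-cong w {at (swapRow l x)} {λ j → choose (at l j ≟ 1) (at x (par j)) (at x j)} (at-swapRow l x) ⟩
    sumTo w (λ j → choose (at l j ≟ 1) (at x (par j)) (at x j)) ≡⟨ sumTo-swap (suc n) (at l) (at x) inv ⟩
    sumTo w (at x) ≡⟨ sym (trans (sum-sumTo x) (cong (λ t → sumTo t (at x)) ex)) ⟩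
    sum x ∎
    where open ≡-Reasoning

  -- Exchanging a pair in only one of two rows is harmless when both its entries are comparable with both neighbours.
  inter-swap : ∀ l l′ x y → length x ≡ w → length y ≡ w → ParInvariant l → ParInvariant l′ →
    (∀ {j} → j < w → mn y j < mx x j → at l′ j ≡ at l j) → (∀ {j} → j < w → mn x j < mx y (2 + j) → at l j ≡ at l′ (2 + j)) →
    Inter w x y → Inter w (swapRow l x) (swapRow l′ y)
  inter-swap l l′ x y ex ey inv inv′ e₁ e₂ xy {j} j<w =
    subst₂ _≤_ (sym (at-swapRow l x j<w)) (sym (at-swapRow l′ y j<w)) (same (at l j ≟ 1) (at l′ j ≟ 1)) , next
    where
    full = inter-all x y ex ey xy
    same : (d : Dec (at l j ≡ 1)) (d′ : Dec (at l′ j ≡ 1)) → choose d (at x (par j)) (at x j) ≤ choose d′ (at y (par j)) (at y j)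
    same (yes _) (yes _) = proj₁ (full (par j))
    same (no _)  (no _)  = proj₁ (full j)
    same (yes p) (no q)  = ≤-trans (m≤n⊔m (at x j) _) (≤-trans (≮⇒≥ (λ h → q (trans (e₁ j<w h) p))) (m⊓n≤m (at y j) _))
    same (no p)  (yes q) = ≤-trans (m≤m⊔n (at x j) _) (≤-trans (≮⇒≥ (λ h → p (trans (sym (e₁ j<w h)) q))) (m⊓n≤n (at y j) _))
    next : at (swapRow l′ y) (2 + j) ≤ at (swapRow l x) j
    next with 2 + j <? w
    ... | no ¬l = ≤-trans (≤-reflexive (beyond (swapRow l′ y) (length-swapRow l′ y) ¬l)) z≤n
    ... | yes h = subst₂ _≤_ (sym (at-swapRow l′ y h)) (sym (at-swapRow l x j<w)) (below (at l′ (2 + j) ≟ 1) (at l j ≟ 1))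
      where
      below : (d : Dec (at l′ (2 + j) ≡ 1)) (d′ : Dec (at l j ≡ 1)) → choose d (at y (2 + par j)) (at y (2 + j)) ≤ choose d′ (at x (par j)) (at x j)
      below (yes _) (yes _) = proj₂ (full (par j))
      below (no _)  (no _)  = proj₂ (full j)
      below (yes p) (no q)  = ≤-trans (m≤n⊔m (at y (2 + j)) _) (≤-trans (≮⇒≥ (λ h → q (trans (e₂ j<w h) p))) (m⊓n≤m (at x j) _))
      below (no p)  (yes q) = ≤-trans (m≤m⊔n (at y (2 + j)) _) (≤-trans (≮⇒≥ (λ h → p (trans (sym (e₂ j<w h)) q))) (m⊓n≤n (at x j) _))

-- Sorting the two shapes

module MeetJoin (n : ℕ) (s e : Row) (es : length s ≡ dbl (suc n)) (ee : length e ≡ dbl (suc n)) (m₀ : ℕ) where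

  open Swap n

  m : ℕ
  m = suc m₀

  s⁺ e⁺ : Row
  s⁺ = swapRow (negRow s) s
  e⁺ = swapRow (negRow e) e

  es⁺ : length s⁺ ≡ w
  es⁺ = length-swapRow (negRow s) s

  ee⁺ : length e⁺ ≡ w
  ee⁺ = length-swapRow (negRow e) e

  module X = Chains n s⁺ e⁺ es⁺ ee⁺ m
  module Y = Chains n s e es ee m

  private
    negRow-par : ∀ x → ParInvariant (negRow x)
    negRow-par x {j} l = trans (at-negRow x (par<w l)) (trans (negAt-par (at x) j) (sym (at-negRow x l)))

  -- A labelling is constant along the edges joining pairs whose exchange must be simultaneous,
  -- and selects at both ends exactly the pairs that have to be exchanged.
  record Compatible (ρ lab : List Row) : Set where
    constructor compatible
    field
      edges  : ∀ {k} → k < m → ∀ {j} → j < w →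
               (mn (lev ρ (suc k)) j < mx (lev ρ k) j → at (lev lab (suc k)) j ≡ at (lev lab k) j) ×
               (mn (lev ρ k) j < mx (lev ρ (suc k)) (2 + j) → at (lev lab k) j ≡ at (lev lab (suc k)) (2 + j))
      paired : ∀ {k} → k < suc m → ParInvariant (lev lab k)
      ends   : ∀ {j} → j < w → at (lev lab 0) j ≡ negAt (at s) j × at (lev lab m) j ≡ negAt (at e) j

  compatible? : ∀ ρ lab → Dec (Compatible ρ lab)
  compatible? ρ lab with
      allUpTo? (λ k → allUpTo? (λ j →
        ((mn (lev ρ (suc k)) j <? mx (lev ρ k) j) →-dec (at (lev lab (suc k)) j ≟ at (lev lab k) j)) ×-dec
        ((mn (lev ρ k) j <? mx (lev ρ (suc k)) (2 + j)) →-dec (at (lev lab k) j ≟ at (lev lab (suc k)) (2 + j)))) w) m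
    | allUpTo? (λ k → allUpTo? (λ j → at (lev lab k) (par j) ≟ at (lev lab k) j) w) (suc m)
    | allUpTo? (λ j → (at (lev lab 0) j ≟ negAt (at s) j) ×-dec (at (lev lab m) j ≟ negAt (at e) j)) w
  ... | yes x | yes y | yes z = yes (compatible x y z)
  ... | no ¬x | _     | _     = no (λ (compatible x _ _) → ¬x x)
  ... | _     | no ¬y | _     = no (λ (compatible _ y _) → ¬y y)
  ... | _     | _     | no ¬z = no (λ (compatible _ _ z) → ¬z z)

  ones : Row
  ones = replicate w 1

  labels : List (List Row)
  labels = arrays ones (suc m)

  -- The labels are 0 and 1 in arrays of fixed size, so a compatible labelling is found by finite
  -- search and separability is decidable.
  Separable : List Row → Set
  Separable ρ = Any (Compatible ρ) labels

  separable? : ∀ ρ → Dec (Separable ρ)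
  separable? ρ = Any.any? (compatible? ρ) labels

  SameGraph : List Row → List Row → Set
  SameGraph ρ ρ′ = ∀ {k} → k ≤ m → ∀ j → mn (lev ρ k) j ≡ mn (lev ρ′ k) j × mx (lev ρ k) j ≡ mx (lev ρ′ k) j

  compatible-resp : ∀ {ρ ρ′} → SameGraph ρ ρ′ → ∀ {lab} → Compatible ρ lab → Compatible ρ′ lab
  compatible-resp sg (compatible h p q) = compatible
    (λ {k} k<m {j} j<w → (λ l → proj₁ (h k<m j<w) (subst₂ _<_ (sym (proj₁ (sg k<m j))) (sym (proj₂ (sg (<⇒≤ k<m) j))) l)) ,
                         (λ l → proj₂ (h k<m j<w) (subst₂ _<_ (sym (proj₁ (sg (<⇒≤ k<m) j))) (sym (proj₂ (sg k<m (2 + j)))) l))) p q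

  sameGraph-sym : ∀ {ρ ρ′} → SameGraph ρ ρ′ → SameGraph ρ′ ρ
  sameGraph-sym sg l j = sym (proj₁ (sg l j)) , sym (proj₂ (sg l j))

  separable-resp : ∀ {ρ ρ′} → SameGraph ρ ρ′ → Separable ρ → Separable ρ′
  separable-resp sg = Any.map (compatible-resp sg)

  private
    lab-in : ∀ {lab} → lab ∈ labels → InArrays ones (suc m) lab
    lab-in = All.lookup (Enumerates.sound (arrays-enumerates ones (suc m)))

    lab≤1 : ∀ {lab} → InArrays ones (suc m) lab → ∀ k → ∀ j → at (lev lab k) j ≤ 1
    lab≤1 {lab} (l , oks) k j with k <? length lab
    ... | yes h = ≤-trans (proj₂ (All-lev oks h) j) (one≤ j)
      where
      one≤ : ∀ j → at ones j ≤ 1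
      one≤ j with j <? w
      ... | yes q = ≤-reflexive (at-replicate w 1 q)
      ... | no ¬q = ≤-trans (≤-reflexive (at-beyond ones (≤-trans (≤-reflexive (length-replicate w)) (≮⇒≥ ¬q)))) z≤n
    ... | no ¬h = subst (λ x → at x j ≤ 1) (sym (out lab k (≮⇒≥ ¬h))) z≤n
      where
      out : ∀ xs k → length xs ≤ k → lev xs k ≡ []
      out []       k       _       = refl
      out (x ∷ xs) (suc k) (s≤s l) = out xs k l

    row-in-ones : ∀ f → (∀ j → f j ≤ 1) → InBox ones (row w f)
    row-in-ones f h = trans (length-row w f) (sym (length-replicate w)) , bound
      where
      bound : ∀ j → at (row w f) j ≤ at ones j
      bound j with j <? w
      ... | yes q = ≤-trans (≤-reflexive (at-row w f q)) (≤-trans (h j) (≤-reflexive (sym (at-replicate w 1 q))))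
      ... | no ¬q = ≤-trans (≤-reflexive (at-beyond (row w f) (≤-trans (≤-reflexive (length-row w f)) (≮⇒≥ ¬q)))) z≤n

    any-intro : ∀ {ρ lab} → InArrays ones (suc m) lab → Compatible ρ lab → Separable ρ
    any-intro ok c = go (enumerates-∈ (arrays-enumerates ones (suc m)) ok) c
      where
      go : ∀ {ρ lab xs} → lab ∈ xs → Compatible ρ lab → Any (Compatible ρ) xs
      go (here refl) c = here c
      go (there m)   c = there (go m c)

    any-elim : ∀ {ρ xs} → Any (Compatible ρ) xs → ∃ λ lab → lab ∈ xs × Compatible ρ lab
    any-elim (here c)  = _ , here refl , c
    any-elim (there a) with any-elim a
    ... | lab , i , c = lab , there i , c

  module Relabelled (p : List Row) (v v′ u : Row) (q : List Row) (inz : InArrays e⁺ m (p ++ v ∷ u ∷ q)) (inz′ : InArrays e⁺ m (p ++ v′ ∷ u ∷ q))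
    (val : X.Valid (p ++ v ∷ u ∷ q)) (val′ : X.Valid (p ++ v′ ∷ u ∷ q))
    (sl : SameLocks (Free.linksOf (lev (s⁺ ∷ p) (length p)) u (upTo w)) v v′)
    (lab : List Row) (lab-ok : InArrays ones (suc m) lab) (comp : Compatible (s⁺ ∷ p ++ v ∷ u ∷ q) lab) where

    private
      okv : InBox e⁺ v
      okv = All.head (proj₂ (++⁻ p (proj₂ inz)))
      okv′ : InBox e⁺ v′
      okv′ = All.head (proj₂ (++⁻ p (proj₂ inz′)))
      okuq : All (InBox e⁺) (u ∷ q)
      okuq = All.tail (proj₂ (++⁻ p (proj₂ inz)))

    open Compatible comp
    open X.Split (λ _ → + 1) (λ _ _ _ _ _ _ _ _ _ _ → refl) p u q (proj₁ (++⁻ p (proj₂ inz))) (All.head okuq) (All.tail okuq) (trans (sym (proj₁ inz)) (length-++ p))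
      using (k; a; ρ; k<m; 1+k<m; ea; eu; lev-a; lev-v; lev-u; lev-o; valid-split)
    open Between n a u ea eu using (to-within)

    private
      S : ℕ → ℕ → ℕ
      S i j = at (lev lab i) j

      ev : length v ≡ w
      ev = trans (proj₁ okv) ee⁺
      ev′ : length v′ ≡ w
      ev′ = trans (proj₁ okv′) ee⁺

    open Neighbours a u (S k) (S (2 + k))

    private
      2+<w : ∀ {j} → 2 + j < w → j < w
      2+<w {j} l = <-trans (n<1+n j) (<-trans (n<1+n (suc j)) l)

      sv-down : ∀ {j ℓ} → Down v j ℓ → S (suc k) j ≡ ℓ
      sv-down {j} (d₁ h) = proj₁ (edges k<m (mx-range n a ea h)) (subst₂ (λ x y → mn x j < mx y j) (sym (lev-v v)) (sym (lev-a v)) h)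
      sv-down {j} (d₂ h) = proj₂ (edges 1+k<m (2+<w (mx-range n u eu h))) (subst₂ (λ x y → mn x j < mx y (2 + j)) (sym (lev-v v)) (sym (lev-u v)) h)

      sv-up : ∀ {j ℓ} → Up v j ℓ → S (suc k) j ≡ ℓ
      sv-up (u₁ {j} h) = sym (proj₁ (edges 1+k<m (mx-range n v ev h)) (subst₂ (λ x y → mn x j < mx y j) (sym (lev-u v)) (sym (lev-v v)) h))
      sv-up (u₂ {j} h) = sym (proj₂ (edges k<m (2+<w (mx-range n v ev h))) (subst₂ (λ x y → mn x j < mx y (2 + j)) (sym (lev-a v)) (sym (lev-v v)) h))

    open Relabel.Move n a u ea eu (S k) (S (2 + k)) (paired (≤-trans k<m (n≤1+n m))) (paired (s≤s 1+k<m)) {v} {v′} ev′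
      (to-within v (proj₁ (proj₂ (valid-split v val))) (proj₂ (proj₂ (valid-split v val))))
      (to-within v′ (proj₁ (proj₂ (valid-split v′ val′))) (proj₂ (proj₂ (valid-split v′ val′)))) sl (S (suc k)) sv-down sv-up

    private
      lab′ : List Row
      lab′ = setLev lab (suc k) (row w relabel)

      ok′ : InArrays ones (suc m) lab′
      ok′ = trans (length-set lab (suc k) (row w relabel)) (proj₁ lab-ok) ,
            All-set (proj₂ lab-ok) (suc k) (row-in-ones relabel (relabel-≤1 (lab≤1 lab-ok k) (lab≤1 lab-ok (2 + k))))

      new : ∀ {j} → j < w → at (lev lab′ (suc k)) j ≡ relabel j
      new {j} l = trans (cong (λ x → at x j) (lev-set-same lab (row w relabel) (subst (suc k <_) (sym (proj₁ lab-ok)) (≤-trans 1+k<m (n≤1+n m))))) (at-row w relabel l)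

      old : ∀ {i} → i ≢ suc k → ∀ j → at (lev lab′ i) j ≡ S i j
      old ne j = cong (λ x → at x j) (lev-set-other lab (row w relabel) ne)

      k≢1+k : k ≢ suc k
      k≢1+k q = <⇒≢ (n<1+n k) q

      2+k≢1+k : 2 + k ≢ suc k
      2+k≢1+k q = k≢1+k (sym (suc-injective q))

      Edge : ℕ → ℕ → Set
      Edge i j = (mn (lev (ρ v′) (suc i)) j < mx (lev (ρ v′) i) j → at (lev lab′ (suc i)) j ≡ at (lev lab′ i) j) ×
                 (mn (lev (ρ v′) i) j < mx (lev (ρ v′) (suc i)) (2 + j) → at (lev lab′ i) j ≡ at (lev lab′ (suc i)) (2 + j))

      edge-below : ∀ {j} → j < w → Edge k j
      edge-below {j} j<w =
        (λ h → trans (new j<w) (trans (relabel-adj j<w (inj₂ (d₁ (subst₂ (λ x y → mn x j < mx y j) (lev-v v′) (lev-a v′) h)))) (sym (old k≢1+k j)))) ,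
        (λ h → up (subst₂ (λ x y → mn x j < mx y (2 + j)) (lev-a v′) (lev-v v′) h))
        where
        up : mn a j < mx v′ (2 + j) → at (lev lab′ k) j ≡ at (lev lab′ (suc k)) (2 + j)
        up h = trans (old k≢1+k j) (sym (trans (new (mx-range n v′ ev′ h)) (relabel-adj (mx-range n v′ ev′ h) (inj₁ (u₂ h)))))

      edge-above : ∀ {j} → j < w → Edge (suc k) j
      edge-above {j} j<w =
        (λ h → trans (old 2+k≢1+k j) (sym (trans (new j<w) (relabel-adj j<w (inj₁ (u₁ (subst₂ (λ x y → mn x j < mx y j) (lev-u v′) (lev-v v′) h))))))) ,
        (λ h → trans (new j<w) (trans (relabel-adj j<w (inj₂ (d₂ (subst₂ (λ x y → mn x j < mx y (2 + j)) (lev-v v′) (lev-u v′) h)))) (sym (old 2+k≢1+k (2 + j)))))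

      edge-other : ∀ {i} → i < m → i ≢ k → i ≢ suc k → ∀ {j} → j < w → Edge i j
      edge-other i<m n₁ n₂ {j} j<w =
        (λ h → trans (old (n₁ ∘ suc-injective) j) (trans (proj₁ (edges i<m j<w) (subst₂ (λ x y → mn x j < mx y j) (lev-o v′ v (n₁ ∘ suc-injective)) (lev-o v′ v n₂) h)) (sym (old n₂ j)))) ,
        (λ h → trans (old n₂ j) (trans (proj₂ (edges i<m j<w) (subst₂ (λ x y → mn x j < mx y (2 + j)) (lev-o v′ v n₂) (lev-o v′ v (n₁ ∘ suc-injective)) h)) (sym (old (n₁ ∘ suc-injective) (2 + j)))))

      edges′ : ∀ {i} → i < m → ∀ {j} → j < w → Edge i j
      edges′ {i} i<m {j} j<w = by (i ≟ k) (i ≟ suc k)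
        where
        by : Dec (i ≡ k) → Dec (i ≡ suc k) → Edge i j
        by (yes q) _       = subst (λ t → Edge t j) (sym q) (edge-below j<w)
        by (no _)  (yes q) = subst (λ t → Edge t j) (sym q) (edge-above j<w)
        by (no n₁) (no n₂) = edge-other i<m n₁ n₂ j<w

      paired′ : ∀ {i} → i < suc m → ParInvariant (lev lab′ i)
      paired′ {i} l {j} j<w = by (i ≟ suc k)
        where
        by : Dec (i ≡ suc k) → at (lev lab′ i) (par j) ≡ at (lev lab′ i) j
        by (yes q) = subst (λ t → at (lev lab′ t) (par j) ≡ at (lev lab′ t) j) (sym q) (trans (new (par<w j<w)) (trans (relabel-par j<w) (sym (new j<w))))
        by (no ne) = trans (old ne (par j)) (trans (paired l j<w) (sym (old ne j)))

      ends′ : ∀ {j} → j < w → at (lev lab′ 0) j ≡ negAt (at s) j × at (lev lab′ m) j ≡ negAt (at e) j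
      ends′ {j} j<w = trans (old (λ ()) j) (proj₁ (ends j<w)) , trans (old (λ q → <⇒≢ 1+k<m (sym q)) j) (proj₂ (ends j<w))

    separable′ : Separable (s⁺ ∷ p ++ v′ ∷ u ∷ q)
    separable′ = any-intro ok′ (compatible edges′ paired′ ends′)

  -- Only the labels of the changed row are replaced, by `relabel`. That row lies strictly between
  -- others, so the labels prescribed at the two ends stay as they are.
  separable-locks : ∀ p v v′ u q → InArrays e⁺ m (p ++ v ∷ u ∷ q) → InArrays e⁺ m (p ++ v′ ∷ u ∷ q) →
    X.Valid (p ++ v ∷ u ∷ q) → X.Valid (p ++ v′ ∷ u ∷ q) →
    SameLocks (Free.linksOf (lev (s⁺ ∷ p) (length p)) u (upTo w)) v v′ → Separable (s⁺ ∷ p ++ v ∷ u ∷ q) → Separable (s⁺ ∷ p ++ v′ ∷ u ∷ q)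
  separable-locks p v v′ u q inz inz′ val val′ sl sep = go (any-elim sep)
    where
    go : (∃ λ lab → lab ∈ labels × Compatible (s⁺ ∷ p ++ v ∷ u ∷ q) lab) → Separable (s⁺ ∷ p ++ v′ ∷ u ∷ q)
    go (lab , lab∈ , c) = Relabelled.separable′ p v v′ u q inz inz′ val val′ sl lab (lab-in lab∈) c

  G : List Row → ℤ
  G z = ind (¬? (separable? (s⁺ ∷ z)))

  G-inv : X.InvariantUnderLocks G
  G-inv p v v′ u q inz inz′ val val′ sl = ind-cong (¬? (separable? _)) (¬? (separable? _))
    (λ h sep → h (separable-locks p v′ v u q inz′ inz val′ val (All.map (λ { (x , y) → y , x }) sl) sep))
    (λ h sep → h (separable-locks p v v′ u q inz inz′ val val′ sl sep))

  private
    -- Contains both `e` and `e⁺`, and is itself stable under exchanges because it takes equal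
    -- values on the two positions of a pair.
    bound : Row
    bound = row w (mx e)

    length-bound : length bound ≡ w
    length-bound = length-row w (mx e)

    Ok : List Row → Set
    Ok = InArrays bound m

    e≤bound : ∀ j → at e j ≤ at bound j
    e≤bound j with j <? w
    ... | yes l = ≤-trans (m≤m⊔n (at e j) _) (≤-reflexive (sym (at-row w (mx e) l)))
    ... | no ¬l = ≤-trans (≤-reflexive (beyond e ee ¬l)) z≤n

    e⁺≤bound : ∀ j → at e⁺ j ≤ at bound j
    e⁺≤bound j with j <? w
    ... | yes l = ≤-trans (m≤m⊔n (at e⁺ j) _) (≤-reflexive (trans (proj₂ (mn-mx-swapRow (negRow e) e (negRow-par e) ee j)) (sym (at-row w (mx e) l))))
    ... | no ¬l = ≤-trans (≤-reflexive (beyond e⁺ ee⁺ ¬l)) z≤n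

    box-grow : ∀ t → length t ≡ w → (∀ j → at t j ≤ at bound j) → ∀ z → InArrays t m z → Ok z
    box-grow t et h z (l , oks) = l , All.map (λ (x , y) → trans x (trans et (sym length-bound)) , λ j → ≤-trans (y j) (h j)) oks

    z-length : ∀ z → Ok z → ∀ {i} → i < m → length (lev z i) ≡ w
    z-length z (l , oks) {i} i<m = trans (proj₁ (All-lev oks (subst (i <_) (sym l) i<m))) length-bound

    level-length : ∀ z → Ok z → ∀ t → length t ≡ w → ∀ {k} → k ≤ m → length (lev (t ∷ z) k) ≡ w
    level-length z ok t et {zero}  _ = et
    level-length z ok t et {suc k} l = z-length z ok l

    valid-bound : ∀ t f → length t ≡ w → length f ≡ w → ∀ z → Ok z →
      (∀ {i} → i < m → Inter w (lev (t ∷ z) i) (lev (t ∷ z) (suc i))) → lev (t ∷ z) m ≡ f → InArrays f m z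
    valid-bound t f et ef z ok val last = proj₁ ok , All-from-lev z (λ {i} l → let i<m = subst (i <_) (proj₁ ok) l in
        trans (z-length z ok i<m) (sym ef) , λ j → subst (λ x → at (lev z i) j ≤ at x j) last (climb (m ∸ suc i) (suc i) (m∸n+n≡m i<m) j))
      where
      climb : ∀ d k → d + k ≡ m → ∀ j → at (lev (t ∷ z) k) j ≤ at (lev (t ∷ z) m) j
      climb zero    k refl j = ≤-refl
      climb (suc d) k q    j = ≤-trans (proj₁ (inter-all (lev (t ∷ z) k) (lev (t ∷ z) (suc k)) (level-length z ok t et (<⇒≤ k<m)) (level-length z ok t et k<m) (val k<m) j)) (climb d (suc k) (trans (+-suc d k) q) j)
        where
        k<m : k < m
        k<m = ≤-trans (s≤s (m≤n+m k d)) (≤-reflexive q)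

    sel : List (List Row) → List Row → List Row
    sel []         ρ = []
    sel (lab ∷ ls) ρ = choose (compatible? ρ lab) lab (sel ls ρ)

    sel-compatible : ∀ {xs} ρ → Any (Compatible ρ) xs → Compatible ρ (sel xs ρ)
    sel-compatible {lab ∷ ls} ρ a with compatible? ρ lab
    ... | yes c = c
    ... | no ¬c with a
    ...   | here c  = ⊥-elim (¬c c)
    ...   | there b = sel-compatible ρ b

    sel-cong : ∀ xs {ρ ρ′} → SameGraph ρ ρ′ → sel xs ρ ≡ sel xs ρ′
    sel-cong []         sg = refl
    sel-cong (lab ∷ ls) {ρ} {ρ′} sg = by (compatible? ρ lab)
      where
      by : Dec (Compatible ρ lab) → choose (compatible? ρ lab) lab (sel ls ρ) ≡ choose (compatible? ρ′ lab) lab (sel ls ρ′)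
      by (yes c) = trans (choose-yes (compatible? ρ lab) c) (sym (choose-yes (compatible? ρ′ lab) (compatible-resp sg c)))
      by (no ¬c) = trans (choose-no (compatible? ρ lab) ¬c) (trans (sel-cong ls sg) (sym (choose-no (compatible? ρ′ lab) (λ c → ¬c (compatible-resp (λ {k} → sameGraph-sym {ρ} {ρ′} sg {k}) c)))))

    swapRows : List Row → List Row → List Row
    swapRows lab z = applyUpTo (λ i → swapRow (lev lab (suc i)) (lev z i)) m

    lev-swapRows : ∀ lab z {i} → i < m → lev (swapRows lab z) i ≡ swapRow (lev lab (suc i)) (lev z i)
    lev-swapRows lab z = lev-applyUpTo (λ i → swapRow (lev lab (suc i)) (lev z i)) m

    length-swapRows : ∀ lab z → length (swapRows lab z) ≡ m
    length-swapRows lab z = length-applyUpTo (λ i → swapRow (lev lab (suc i)) (lev z i)) m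

    module Along {lab : List Row} {ρ₀ : List Row} (c : Compatible ρ₀ lab) where
      open Compatible c

      inv : ∀ {k} → k ≤ m → ParInvariant (lev lab k)
      inv l = paired (s≤s l)

      at-start : swapRow (lev lab 0) s⁺ ≡ s
      at-start = swapRow-swapRow (lev lab 0) (negRow s) s (inv z≤n) (λ l → trans (proj₁ (ends l)) (sym (at-negRow s l))) es

      at-end : swapRow (lev lab m) e⁺ ≡ e
      at-end = swapRow-swapRow (lev lab m) (negRow e) e (inv ≤-refl) (λ l → trans (proj₂ (ends l)) (sym (at-negRow e l))) ee

      back-start : swapRow (lev lab 0) s ≡ s⁺
      back-start = trans (cong (swapRow (lev lab 0)) (sym at-start)) (swapRow-swapRow (lev lab 0) (lev lab 0) s⁺ (inv z≤n) (λ _ → refl) es⁺)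

      back-end : swapRow (lev lab m) e ≡ e⁺
      back-end = trans (cong (swapRow (lev lab m)) (sym at-end)) (swapRow-swapRow (lev lab m) (lev lab m) e⁺ (inv ≤-refl) (λ _ → refl) ee⁺)

      level : ∀ t t′ → swapRow (lev lab 0) t ≡ t′ → ∀ z {k} → k ≤ m → lev (t′ ∷ swapRows lab z) k ≡ swapRow (lev lab k) (lev (t ∷ z) k)
      level t t′ q z {zero}  _ = sym q
      level t t′ q z {suc k} l = lev-swapRows lab z l

      valid-swap : ∀ t t′ {f f′} → length t ≡ w → swapRow (lev lab 0) t ≡ t′ → swapRow (lev lab m) f ≡ f′ → ∀ z → Ok z → Compatible (t ∷ z) lab →
        (∀ {i} → i < m → Inter w (lev (t ∷ z) i) (lev (t ∷ z) (suc i))) × lev (t ∷ z) m ≡ f →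
        (∀ {i} → i < m → Inter w (lev (t′ ∷ swapRows lab z) i) (lev (t′ ∷ swapRows lab z) (suc i))) × lev (t′ ∷ swapRows lab z) m ≡ f′
      valid-swap t t′ et qt qf z ok c′ (val , last) =
        (λ {i} i<m → subst₂ (Inter w) (sym (level t t′ qt z (<⇒≤ i<m))) (sym (level t t′ qt z i<m))
           (inter-swap (lev lab i) (lev lab (suc i)) (lev (t ∷ z) i) (lev (t ∷ z) (suc i)) (level-length z ok t et (<⇒≤ i<m)) (level-length z ok t et i<m) (inv (<⇒≤ i<m)) (inv i<m)
              (λ l → proj₁ (Compatible.edges c′ i<m l)) (λ l → proj₂ (Compatible.edges c′ i<m l)) (val i<m))) ,
        trans (level t t′ qt z ≤-refl) (trans (cong (swapRow (lev lab m)) last) qf)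

      same-graph : ∀ t t′ → length t ≡ w → swapRow (lev lab 0) t ≡ t′ → ∀ z → Ok z → SameGraph (t′ ∷ swapRows lab z) (t ∷ z)
      same-graph t t′ et q z ok {k} l j = subst (λ x → mn x j ≡ mn (lev (t ∷ z) k) j × mx x j ≡ mx (lev (t ∷ z) k) j) (sym (level t t′ q z l)) (mn-mx-swapRow (lev lab k) (lev (t ∷ z) k) (inv l) (level-length z ok t et l) j)

      swapRows-ok : ∀ z → Ok z → Ok (swapRows lab z)
      swapRows-ok z ok = length-swapRows lab z , All-from-lev (swapRows lab z) (λ {i} l → let i<m = subst (i <_) (length-swapRows lab z) l in
          subst (InBox bound) (sym (lev-swapRows lab z i<m)) (trans (length-swapRow (lev lab (suc i)) (lev z i)) (sym length-bound) , entry i i<m))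
        where
        entry : ∀ i → i < m → ∀ j → at (swapRow (lev lab (suc i)) (lev z i)) j ≤ at bound j
        entry i i<m j with j <? w
        ... | no ¬l = ≤-trans (≤-reflexive (beyond (swapRow (lev lab (suc i)) (lev z i)) (length-swapRow (lev lab (suc i)) (lev z i)) ¬l)) z≤n
        ... | yes l with pair-swapRow (lev lab (suc i)) (lev z i) (inv i<m) l
        ...   | inj₁ (p , _) = ≤-trans (≤-reflexive p) (proj₂ (All-lev (proj₂ ok) (subst (i <_) (sym (proj₁ ok)) i<m)) j)
        ...   | inj₂ (p , _) = ≤-trans (≤-reflexive p) (≤-trans (proj₂ (All-lev (proj₂ ok) (subst (i <_) (sym (proj₁ ok)) i<m)) (par j))
                (≤-reflexive (trans (at-row w (mx e) (par<w l)) (trans (mx-par e j) (sym (at-row w (mx e) l))))))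

      swapRows-involutive : ∀ z → Ok z → swapRows lab (swapRows lab z) ≡ z
      swapRows-involutive z ok = rows-ext (trans (length-swapRows lab (swapRows lab z)) (sym (proj₁ ok)))
        (λ {i} l → let i<m = subst (i <_) (length-swapRows lab (swapRows lab z)) l in
          trans (lev-swapRows lab (swapRows lab z) i<m) (trans (cong (swapRow (lev lab (suc i))) (lev-swapRows lab z i<m))
            (swapRow-swapRow (lev lab (suc i)) (lev lab (suc i)) (lev z i) (inv i<m) (λ _ → refl) (z-length z ok i<m))))

      sums : ∀ t t′ → length t ≡ w → swapRow (lev lab 0) t ≡ t′ → ∀ z → Ok z → map sum (t′ ∷ swapRows lab z) ≡ map sum (t ∷ z)
      sums t t′ et q z ok = row-ext lengths (λ {k} l → trans (at-map-sum (t′ ∷ swapRows lab z) k) (trans (same (subst (k <_) len l)) (sym (at-map-sum (t ∷ z) k))))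
        where
        len : length (map sum (t′ ∷ swapRows lab z)) ≡ suc m
        len = cong suc (trans (length-map sum (swapRows lab z)) (length-swapRows lab z))
        lengths : length (map sum (t′ ∷ swapRows lab z)) ≡ length (map sum (t ∷ z))
        lengths = trans len (cong suc (sym (trans (length-map sum z) (proj₁ ok))))
        same : ∀ {k} → k < suc m → sum (lev (t′ ∷ swapRows lab z) k) ≡ sum (lev (t ∷ z) k)
        same {k} (s≤s l) = trans (cong sum (level t t′ q z l)) (sum-swapRow (lev lab k) (lev (t ∷ z) k) (inv l) (level-length z ok t et l))

    start-graph : ∀ z → SameGraph (s⁺ ∷ z) (s ∷ z)
    start-graph z {zero}  _ j = mn-mx-swapRow (negRow s) s (negRow-par s) es j
    start-graph z {suc k} _ j = refl , refl

    -- In a chain with the original ends, the labels given by `negAt` are compatible: across every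
    -- edge the two pairs are ordered alike, by `negAt-edge`, and at the ends these are the
    -- prescribed labels.
    valid-separable : ∀ z → Ok z → Y.Valid z → Separable (s ∷ z)
    valid-separable z ok (val , last) = any-intro {s ∷ z} {neg} (length-applyUpTo (λ k → negRow (lev (s ∷ z) k)) (suc m) , applyUpTo⁺₂ (λ k → negRow (lev (s ∷ z) k)) (suc m) (λ k → row-in-ones (negAt (at (lev (s ∷ z) k))) (negAt≤1 (at (lev (s ∷ z) k)))))
      (compatible edges (λ {k} l {j} → subst (λ x → j < w → at x (par j) ≡ at x j) (sym (lev-neg l)) (negRow-par (lev (s ∷ z) k))) ends)
      where
      neg : List Row
      neg = applyUpTo (λ k → negRow (lev (s ∷ z) k)) (suc m)
      lev-neg : ∀ {k} → k < suc m → lev neg k ≡ negRow (lev (s ∷ z) k)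
      lev-neg = lev-applyUpTo (λ k → negRow (lev (s ∷ z) k)) (suc m)
      at-neg : ∀ {k} → k < suc m → ∀ {j} → j < w → at (lev neg k) j ≡ negAt (at (lev (s ∷ z) k)) j
      at-neg {k} l {j} j<w = trans (cong (λ x → at x j) (lev-neg l)) (at-negRow (lev (s ∷ z) k) j<w)
      edges : ∀ {k} → k < m → ∀ {j} → j < w →
        (mn (lev (s ∷ z) (suc k)) j < mx (lev (s ∷ z) k) j → at (lev neg (suc k)) j ≡ at (lev neg k) j) ×
        (mn (lev (s ∷ z) k) j < mx (lev (s ∷ z) (suc k)) (2 + j) → at (lev neg k) j ≡ at (lev neg (suc k)) (2 + j))
      edges {k} k<m {j} j<w =
        (λ h → trans (at-neg (s≤s k<m) j<w) (trans (negAt-edge (at x) (at y) j (proj₁ (full j)) (proj₁ (full (par j))) h) (sym (at-neg (≤-trans k<m (n≤1+n m)) j<w)))) ,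
        (λ h → trans (at-neg (≤-trans k<m (n≤1+n m)) j<w) (trans (negAt-edge (λ i → at y (2 + i)) (at x) j (proj₂ (full j)) (proj₂ (full (par j))) h) (sym (at-neg (s≤s k<m) (mx-range n y ey h)))))
        where
        x = lev (s ∷ z) k
        y = lev (s ∷ z) (suc k)
        ey = level-length z ok s es k<m
        full = inter-all x y (level-length z ok s es (<⇒≤ k<m)) ey (val k<m)
      ends : ∀ {j} → j < w → at (lev neg 0) j ≡ negAt (at s) j × at (lev neg m) j ≡ negAt (at e) j
      ends {j} j<w = at-neg (s≤s z≤n) j<w , trans (at-neg ≤-refl j<w) (cong (λ x → negAt (at x) j) last)

    -- The exchange is determined by the graph, which it preserves; hence it is an involution.
    σ : List Row → List Row
    σ z = choose (separable? (s ∷ z)) (swapRows (sel labels (s ∷ z)) z) z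

    σ-yes : ∀ z → Separable (s ∷ z) → σ z ≡ swapRows (sel labels (s ∷ z)) z
    σ-yes z = choose-yes (separable? (s ∷ z))

    σ-no : ∀ z → ¬ Separable (s ∷ z) → σ z ≡ z
    σ-no z = choose-no (separable? (s ∷ z))

    σ-ok : ∀ z → Ok z → Ok (σ z)
    σ-ok z ok with separable? (s ∷ z)
    ... | yes sep = Along.swapRows-ok (sel-compatible (s ∷ z) sep) z ok
    ... | no _    = ok

    module _ (z : List Row) (ok : Ok z) (sep : Separable (s ∷ z)) where

      private
        lab = sel labels (s ∷ z)
        c = sel-compatible (s ∷ z) sep
        open Along c

      graph-σ : SameGraph (s ∷ swapRows lab z) (s ∷ z)
      graph-σ {zero}  _ j = refl , refl
      graph-σ {suc k} l j = same-graph s⁺ s es⁺ at-start z ok {suc k} l j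

      σσ-yes : σ (swapRows lab z) ≡ z
      σσ-yes = trans (σ-yes (swapRows lab z) (separable-resp (λ {k} → sameGraph-sym {s ∷ swapRows lab z} {s ∷ z} graph-σ {k}) sep))
        (trans (cong (λ l → swapRows l (swapRows lab z)) (sel-cong labels {s ∷ swapRows lab z} {s ∷ z} (λ {k} → graph-σ {k}))) (swapRows-involutive z ok))

      c⁺ : Compatible (s⁺ ∷ z) lab
      c⁺ = compatible-resp (λ {k} → sameGraph-sym {s⁺ ∷ z} {s ∷ z} (start-graph z) {k}) c

      X⇒Y : X.Valid z → Y.Valid (swapRows lab z)
      X⇒Y = valid-swap s⁺ s es⁺ at-start at-end z ok c⁺

      Y⇒X : Y.Valid (swapRows lab z) → X.Valid z
      Y⇒X v = subst X.Valid (swapRows-involutive z ok) (valid-swap s s⁺ es back-start back-end (swapRows lab z) (swapRows-ok z ok)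
        (compatible-resp (λ {k} → sameGraph-sym {s ∷ swapRows lab z} {s ∷ z} graph-σ {k}) c) v)

      wt-σ : Y.wt (swapRows lab z) ≡ X.wt z
      wt-σ = cong diffs (sums s⁺ s es⁺ at-start z ok)

    σσ : ∀ z → Ok z → σ (σ z) ≡ z
    σσ z ok = by (separable? (s ∷ z))
      where
      by : Dec (Separable (s ∷ z)) → σ (σ z) ≡ z
      by (yes sep) = trans (cong σ (σ-yes z sep)) (σσ-yes z ok sep)
      by (no ¬sep) = trans (cong σ (σ-no z ¬sep)) (σ-no z ¬sep)

    term : ∀ β z → Ok z → ind (Y.valid? (σ z)) ⊗ δ β (Y.wt (σ z)) ≡ ind (X.valid? z) ⊗ (ind (separable? (s⁺ ∷ z)) ⊗ δ β (X.wt z))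
    term β z ok = by (separable? (s ∷ z))
      where
      by : Dec (Separable (s ∷ z)) → ind (Y.valid? (σ z)) ⊗ δ β (Y.wt (σ z)) ≡ ind (X.valid? z) ⊗ (ind (separable? (s⁺ ∷ z)) ⊗ δ β (X.wt z))
      by (yes sep) = trans (cong (λ y → ind (Y.valid? y) ⊗ δ β (Y.wt y)) (σ-yes z sep))
        (cong₂ _⊗_ (ind-cong (Y.valid? _) (X.valid? z) (Y⇒X z ok sep) (X⇒Y z ok sep))
          (trans (cong (δ β) (wt-σ z ok sep)) (sym (trans (cong (_⊗ δ β (X.wt z)) (ind-yes (separable? (s⁺ ∷ z)) (separable-resp (λ {k} → sameGraph-sym {s⁺ ∷ z} {s ∷ z} (start-graph z) {k}) sep))) (⊗-identityˡ _)))))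
      by (no ¬sep) = trans (cong (λ y → ind (Y.valid? y) ⊗ δ β (Y.wt y)) (σ-no z ¬sep))
        (trans (ind-*-zero (Y.valid? z) (λ v → ⊥-elim (¬sep (valid-separable z ok v))))
          (sym (trans (cong (ind (X.valid? z) ⊗_) (ind-*-zero (separable? (s⁺ ∷ z)) (λ sep → ⊥-elim (¬sep (separable-resp (λ {k} → start-graph z {k}) sep))))) (⊗-zeroʳ _))))

    cases : ∀ {P : Set} {Q : Set} (d : Dec P) x → (P → Q) → ind d ⊗ x ≡ + 0 ⊎ Q
    cases (yes p) x h = inj₂ (h p)
    cases (no _)  x h = inj₁ (⊗-zeroˡ x)

  count-exchange : ∀ β → ∑ (arrays e m) (λ z → ind (Y.valid? z) ⊗ δ β (Y.wt z)) ≡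
                         ∑ (arrays e⁺ m) (λ z → ind (X.valid? z) ⊗ (ind (separable? (s⁺ ∷ z)) ⊗ δ β (X.wt z)))
  count-exchange β = begin
    ∑ (arrays e m) (λ z → ind (Y.valid? z) ⊗ δ β (Y.wt z))
      ≡⟨ ∑-enlarge (arrays-enumerates e m) (arrays-enumerates bound m) (box-grow e ee e≤bound) (λ z → ind (Y.valid? z) ⊗ δ β (Y.wt z))
           (λ z ok → cases (Y.valid? z) (δ β (Y.wt z)) (λ (val , last) → valid-bound s e es ee z ok val last)) ⟩
    ∑ (arrays bound m) (λ z → ind (Y.valid? z) ⊗ δ β (Y.wt z))
      ≡⟨ sym (∑-involution (arrays-enumerates bound m) σ σ-ok σσ (λ z → ind (Y.valid? z) ⊗ δ β (Y.wt z))) ⟩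
    ∑ (arrays bound m) (λ z → ind (Y.valid? (σ z)) ⊗ δ β (Y.wt (σ z)))
      ≡⟨ ∑-cong-All (Enumerates.sound (arrays-enumerates bound m)) (term β) ⟩
    ∑ (arrays bound m) (λ z → ind (X.valid? z) ⊗ (ind (separable? (s⁺ ∷ z)) ⊗ δ β (X.wt z)))
      ≡⟨ sym (∑-enlarge (arrays-enumerates e⁺ m) (arrays-enumerates bound m) (box-grow e⁺ ee⁺ e⁺≤bound) (λ z → ind (X.valid? z) ⊗ (ind (separable? (s⁺ ∷ z)) ⊗ δ β (X.wt z)))
           (λ z ok → cases (X.valid? z) (ind (separable? (s⁺ ∷ z)) ⊗ δ β (X.wt z)) (λ (val , last) → valid-bound s⁺ e⁺ es⁺ ee⁺ z ok val last))) ⟩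
    ∑ (arrays e⁺ m) (λ z → ind (X.valid? z) ⊗ (ind (separable? (s⁺ ∷ z)) ⊗ δ β (X.wt z))) ∎
    where open ≡-Reasoning

  module E = Expansion n s⁺ e⁺ es⁺ ee⁺ m₀ G G-inv

  private
    count-at : ∀ β → length β ≡ m → ∀ (t f : Row) (et : length t ≡ w) (ef : length f ≡ w) →
      count w f t β ≡ ∑ (arrays f m) (λ z → ind (Chains.valid? n t f et ef m z) ⊗ δ β (Chains.wt n t f et ef m z))
    count-at β eβ t f et ef = trans (count-chains n f ef β t et) (lengths (length β) eβ)
      where
      lengths : ∀ l → l ≡ m → ∑ (arrays f l) (λ z → ind (Chains.valid? n t f et ef l z) ⊗ δ β (Chains.wt n t f et ef l z)) ≡
                              ∑ (arrays f m) (λ z → ind (Chains.valid? n t f et ef m z) ⊗ δ β (Chains.wt n t f et ef m z))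
      lengths l refl = refl

  difference : ∀ β → length β ≡ m → count w e⁺ s⁺ β ⊟ count w e s β ≡ ∑ (box E.bx) (λ κ → E.mult κ ⊗ schurCount m κ β)
  difference β eβ = begin
    count w e⁺ s⁺ β ⊟ count w e s β
      ≡⟨ cong₂ _⊟_ (count-at β eβ s⁺ e⁺ es⁺ ee⁺) (trans (count-at β eβ s e es ee) (count-exchange β)) ⟩
    ∑ (arrays e⁺ m) (λ z → ind (X.valid? z) ⊗ δ β (X.wt z)) ⊟ ∑ (arrays e⁺ m) (λ z → ind (X.valid? z) ⊗ (ind (separable? (s⁺ ∷ z)) ⊗ δ β (X.wt z)))
      ≡⟨ sym (∑-− (arrays e⁺ m) _ _) ⟩
    ∑ (arrays e⁺ m) (λ z → ind (X.valid? z) ⊗ δ β (X.wt z) ⊟ ind (X.valid? z) ⊗ (ind (separable? (s⁺ ∷ z)) ⊗ δ β (X.wt z)))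
      ≡⟨ ∑-cong (arrays e⁺ m) (λ z → trans (sym (⊗-distribˡ-⊟ (ind (X.valid? z)) _ _)) (cong (ind (X.valid? z) ⊗_)
           (trans (cong (λ t → t ⊟ ind (separable? (s⁺ ∷ z)) ⊗ δ β (X.wt z)) (sym (⊗-identityˡ _))) (trans (sym (⊗-distribʳ-⊟ (δ β (X.wt z)) (+ 1) _)) (cong (_⊗ δ β (X.wt z)) (sym (ind-¬ (separable? (s⁺ ∷ z)) (¬? (separable? (s⁺ ∷ z)))))))))) ⟩
    X.total G G-inv (δ β)
      ≡⟨ E.expansion β eβ ⟩
    ∑ (box E.bx) (λ κ → E.mult κ ⊗ schurCount m κ β) ∎
    where open ≡-Reasoning

-- Single tableaux and products

Strip : ℕ → Row → Row → Set
Strip N x y = ∀ {j} → j < N → at x j ≤ at y j × at y (suc j) ≤ at x j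

strip? : ∀ N x y → Dec (Strip N x y)
strip? N x y = allUpTo? (λ j → (at x j ≤? at y j) ×-dec (at y (suc j) ≤? at x j)) N

tab : ℕ → Row → Row → List ℕ → ℤ
tab N e s []      = ind (s ≟ᴿ e)
tab N e s (a ∷ α) = ∑ (box e) (λ u → ind (strip? N s u) ⊗ (ind (sum u ≟ sum s + a) ⊗ tab N e u α))

pad : ℕ → List ℕ → Row
pad N l = row N (at l)

Within-length : ℕ → List ℕ → Set
Within-length N l = ∀ j → N ≤ j → at l j ≡ 0

at-pad : ∀ N l → Within-length N l → ∀ j → at (pad N l) j ≡ at l j
at-pad N l h j with j <? N
... | yes q = at-row N (at l) q
... | no ¬q = trans (at-beyond (pad N l) (≤-trans (≤-reflexive (length-row N (at l))) (≮⇒≥ ¬q))) (sym (h j (≮⇒≥ ¬q)))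

sum-pad : ∀ N l → Within-length N l → sum (pad N l) ≡ sum l
sum-pad zero    []      h = refl
sum-pad zero    (x ∷ l) h = sym (cong₂ _+_ (h 0 z≤n) (trans (sym (sum-pad zero l (λ j _ → h (suc j) z≤n))) refl))
sum-pad (suc N) []      h = trans (sum-sumTo (pad (suc N) [])) (trans (cong (λ k → sumTo k (at (pad (suc N) []))) (length-row (suc N) (at []))) (sumTo-zero (suc N) (λ {j} q → at-row (suc N) (at []) q)))
sum-pad (suc N) (x ∷ l) h = cong (λ t → x + t) (sum-pad N l (λ j q → h (suc j) (s≤s q)))

within-longer : ∀ {N} l → length l ≤ N → Within-length N l
within-longer l q j r = at-beyond l (≤-trans q r)

∑-box-zero : ∀ N (F : Row → ℤ) → ∑ (box (pad N [])) F ≡ F (pad N [])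
∑-box-zero zero    F = ℤₚ.+-identityʳ _
∑-box-zero (suc N) F = trans (∑-box-∷ 0 (pad N []) F) (trans (ℤₚ.+-identityʳ _) (∑-box-zero N (λ y → F (0 ∷ y))))

∑-box-pad : ∀ N l → length l ≤ N → (F : Row → ℤ) → ∑ (box (pad N l)) F ≡ ∑ (box l) (λ u → F (pad N u))
∑-box-pad N       []      _       F = trans (∑-box-zero N F) (sym (ℤₚ.+-identityʳ _))
∑-box-pad (suc N) (x ∷ l) (s≤s q) F = trans (∑-box-∷ x (pad N l) F)
  (trans (∑-cong (upTo (suc x)) (λ y → ∑-box-pad N l q (λ u → F (y ∷ u)))) (sym (∑-box-∷ x l (λ u → F (pad (suc N) u)))))

all-elim : ∀ (p : ℕ → Bool) xs → T (foldr _∧_ true (map p xs)) → ∀ {x} → x ∈ xs → T (p x)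
all-elim p (x ∷ xs) h (here refl) = proj₁ (Equivalence.to (𝔹.T-∧ {p x}) h)
all-elim p (x ∷ xs) h (there i)   = all-elim p xs (proj₂ (Equivalence.to (𝔹.T-∧ {p x}) h)) i

all-intro : ∀ (p : ℕ → Bool) xs → (∀ x → T (p x)) → T (foldr _∧_ true (map p xs))
all-intro p []       h = tt
all-intro p (x ∷ xs) h = Equivalence.from (𝔹.T-∧ {p x}) (h x , all-intro p xs h)

hstrip-elim : ∀ nu mu → T (isHStrip nu mu) → ∀ j → at mu j ≤ at nu j × at nu (suc j) ≤ at mu j
hstrip-elim nu mu h j with j <? suc (length nu ⊔ length mu)
... | yes q with Equivalence.to (𝔹.T-∧ {at mu j ≤ᵇ at nu j}) (all-elim (λ j → (at mu j ≤ᵇ at nu j) ∧ (at nu (suc j) ≤ᵇ at mu j)) (upTo (suc (length nu ⊔ length mu))) h (∈-upTo⁺ q))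
...   | (l , r) = ≤ᵇ⇒≤ _ _ l , ≤ᵇ⇒≤ _ _ r
hstrip-elim nu mu h j | no ¬q = ≤-trans (≤-reflexive (at-beyond mu (≤-trans (m≤n⊔m (length nu) _) far))) z≤n ,
                                ≤-trans (≤-reflexive (at-beyond nu (≤-trans (m≤m⊔n (length nu) _) (≤-trans far (n≤1+n j))))) z≤n
  where
  far : length nu ⊔ length mu ≤ j
  far = ≤-trans (n≤1+n _) (≮⇒≥ ¬q)

hstrip-intro : ∀ nu mu → (∀ j → at mu j ≤ at nu j × at nu (suc j) ≤ at mu j) → T (isHStrip nu mu)
hstrip-intro nu mu h = all-intro _ (upTo (suc (length nu ⊔ length mu))) (λ j → Equivalence.from (𝔹.T-∧ {at mu j ≤ᵇ at nu j}) (≤⇒≤ᵇ (proj₁ (h j)) , ≤⇒≤ᵇ (proj₂ (h j))))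

padEq-elim : ∀ x y → T (padEq x y) → ∀ j → at x j ≡ at y j
padEq-elim x y h j with j <? length x ⊔ length y
... | yes q = ≡ᵇ⇒≡ _ _ (all-elim (λ j → at x j ≡ᵇ at y j) (upTo (length x ⊔ length y)) h (∈-upTo⁺ q))
... | no ¬q = trans (at-beyond x (≤-trans (m≤m⊔n (length x) _) (≮⇒≥ ¬q))) (sym (at-beyond y (≤-trans (m≤n⊔m (length x) _) (≮⇒≥ ¬q))))

padEq-intro : ∀ x y → (∀ j → at x j ≡ at y j) → T (padEq x y)
padEq-intro x y h = all-intro _ (upTo (length x ⊔ length y)) (λ j → ≡⇒≡ᵇ (at x j) (at y j) (h j))

pad-cong : ∀ N {x y} → (∀ j → at x j ≡ at y j) → pad N x ≡ pad N y
pad-cong N {x} {y} h = row-ext (trans (length-row N (at x)) (sym (length-row N (at y))))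
  (λ {j} q → let j<N = subst (j <_) (length-row N (at x)) q in trans (at-row N (at x) j<N) (trans (h j) (sym (at-row N (at y) j<N))))

sum-filter : {A : Set} (p : A → Bool) {P : A → Set} (P? : ∀ x → Dec (P x)) (f : A → ℕ) → ∀ {Ok : A → Set} {xs} → All Ok xs →
  (∀ x → Ok x → T (p x) → P x) → (∀ x → Ok x → P x → T (p x)) → + sum (map f (filterᵇ p xs)) ≡ ∑ xs (λ x → ind (P? x) ⊗ + f x)
sum-filter p P? f [] to from = refl
sum-filter p P? f {xs = x ∷ xs} (ok ∷ oks) to from with p x in eq
... | true  = trans (ℤₚ.pos-+ (f x) _) (cong₂ _⊕_ (sym (trans (cong (_⊗ + f x) (ind-yes (P? x) (to x ok (subst T (sym eq) tt)))) (⊗-identityˡ _))) (sum-filter p P? f oks to from))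
... | false = trans (sum-filter p P? f oks to from) (sym (trans (cong (_⊕ _) (ind-*-zero (P? x) (λ q → ⊥-elim (subst T eq (from x ok q))))) (ℤₚ.+-identityˡ _)))

sstCount-tab : ∀ N la → length la ≤ N → ∀ α mu → Within-length N mu → + sstCount la mu α ≡ tab N (pad N la) (pad N mu) α
sstCount-tab N la q [] mu hm with padEq la mu in eq
... | true  = sym (ind-yes (pad N mu ≟ᴿ pad N la) (sym (pad-cong N {la} {mu} (padEq-elim la mu (subst T (sym eq) tt)))))
... | false = sym (ind-no (pad N mu ≟ᴿ pad N la) (λ e → subst T eq (padEq-intro la mu (λ j →
                trans (sym (at-pad N la (within-longer la q) j)) (trans (cong (λ x → at x j) (sym e)) (at-pad N mu hm j))))))
sstCount-tab N la q (a ∷ α) mu hm = begin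
  + sum (map (λ nu → sstCount la nu α) (strips la mu a))
    ≡⟨ sum-filter (λ nu → isHStrip nu mu ∧ (sum nu ≡ᵇ (sum mu + a))) (λ nu → strip? N (pad N mu) (pad N nu) ×-dec (sum (pad N nu) ≟ sum (pad N mu) + a)) (λ nu → sstCount la nu α) (Enumerates.sound (box-enumerates la)) to from ⟩
  ∑ (box la) (λ nu → ind (strip? N (pad N mu) (pad N nu) ×-dec (sum (pad N nu) ≟ sum (pad N mu) + a)) ⊗ + sstCount la nu α)
    ≡⟨ ∑-cong-All (Enumerates.sound (box-enumerates la)) (λ nu ok → trans (cong₂ _⊗_ (sym (ind-× (strip? N (pad N mu) (pad N nu)) (sum (pad N nu) ≟ sum (pad N mu) + a) (strip? N (pad N mu) (pad N nu) ×-dec (sum (pad N nu) ≟ sum (pad N mu) + a)) _,_ id)) (sstCount-tab N la q α nu (hn nu ok))) (⊗-assoc (ind (strip? N (pad N mu) (pad N nu))) _ _)) ⟩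
  ∑ (box la) (λ nu → ind (strip? N (pad N mu) (pad N nu)) ⊗ (ind (sum (pad N nu) ≟ sum (pad N mu) + a) ⊗ tab N (pad N la) (pad N nu) α))
    ≡⟨ sym (∑-box-pad N la q (λ u → ind (strip? N (pad N mu) u) ⊗ (ind (sum u ≟ sum (pad N mu) + a) ⊗ tab N (pad N la) u α))) ⟩
  ∑ (box (pad N la)) (λ u → ind (strip? N (pad N mu) u) ⊗ (ind (sum u ≟ sum (pad N mu) + a) ⊗ tab N (pad N la) u α)) ∎
  where
  open ≡-Reasoning
  hn : ∀ nu → InBox la nu → Within-length N nu
  hn nu ok = within-longer nu (≤-trans (≤-reflexive (proj₁ ok)) q)
  to : ∀ nu → InBox la nu → T (isHStrip nu mu ∧ (sum nu ≡ᵇ (sum mu + a))) → Strip N (pad N mu) (pad N nu) × sum (pad N nu) ≡ sum (pad N mu) + a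
  to nu ok h = (λ {j} _ → subst₂ _≤_ (sym (at-pad N mu hm j)) (sym (at-pad N nu (hn nu ok) j)) (proj₁ (hs j)) ,
                          subst₂ _≤_ (sym (at-pad N nu (hn nu ok) (suc j))) (sym (at-pad N mu hm j)) (proj₂ (hs j))) ,
               trans (sum-pad N nu (hn nu ok)) (trans (≡ᵇ⇒≡ (sum nu) (sum mu + a) (proj₂ (Equivalence.to (𝔹.T-∧ {isHStrip nu mu}) h))) (cong (_+ a) (sym (sum-pad N mu hm))))
    where hs = hstrip-elim nu mu (proj₁ (Equivalence.to (𝔹.T-∧ {isHStrip nu mu}) h))
  from : ∀ nu → InBox la nu → Strip N (pad N mu) (pad N nu) × sum (pad N nu) ≡ sum (pad N mu) + a → T (isHStrip nu mu ∧ (sum nu ≡ᵇ (sum mu + a)))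
  from nu ok (st , sm) = Equivalence.from (𝔹.T-∧ {isHStrip nu mu}) (hstrip-intro nu mu full , ≡⇒≡ᵇ (sum nu) (sum mu + a) (trans (sym (sum-pad N nu (hn nu ok))) (trans sm (cong (_+ a) (sum-pad N mu hm)))))
    where
    full : ∀ j → at mu j ≤ at nu j × at nu (suc j) ≤ at mu j
    full j with j <? N
    ... | yes l = subst₂ _≤_ (at-pad N mu hm j) (at-pad N nu (hn nu ok) j) (proj₁ (st l)) , subst₂ _≤_ (at-pad N nu (hn nu ok) (suc j)) (at-pad N mu hm j) (proj₂ (st l))
    ... | no ¬l = ≤-trans (≤-reflexive (hm j (≮⇒≥ ¬l))) z≤n , ≤-trans (≤-reflexive (hn nu ok (suc j) (≤-trans (≮⇒≥ ¬l) (n≤1+n j)))) z≤n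

mrg : List ℕ → List ℕ → Row
mrg (x ∷ xs) (y ∷ ys) = x ∷ y ∷ mrg xs ys
mrg _        _        = []

length-mrg : ∀ N x y → length x ≡ N → length y ≡ N → length (mrg x y) ≡ dbl N
length-mrg zero    []      []      _ _ = refl
length-mrg (suc N) (x ∷ xs) (y ∷ ys) p q = cong (suc ∘ suc) (length-mrg N xs ys (suc-injective p) (suc-injective q))

at-mrg : ∀ x y → length x ≡ length y → ∀ i → at (mrg x y) (dbl i) ≡ at x i × at (mrg x y) (suc (dbl i)) ≡ at y i
at-mrg []       []       _ i       = refl , refl
at-mrg (x ∷ xs) (y ∷ ys) _ zero    = refl , refl
at-mrg (x ∷ xs) (y ∷ ys) e (suc i) = at-mrg xs ys (suc-injective e) i

sum-mrg : ∀ x y → length x ≡ length y → sum (mrg x y) ≡ sum x + sum y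
sum-mrg []       []       _ = refl
sum-mrg (x ∷ xs) (y ∷ ys) e = trans (cong (λ t → x + (y + t)) (sum-mrg xs ys (suc-injective e))) (arr x y (sum xs) (sum ys))
  where
  arr : ∀ x y a b → x + (y + (a + b)) ≡ (x + a) + (y + b)
  arr = solve-∀

mrg-injective : ∀ x y x′ y′ → length x ≡ length y → length x ≡ length x′ → length x′ ≡ length y′ → mrg x y ≡ mrg x′ y′ → x ≡ x′ × y ≡ y′
mrg-injective []       []       []         []         _ _ _ _ = refl , refl
mrg-injective (x ∷ xs) (y ∷ ys) (x′ ∷ xs′) (y′ ∷ ys′) p q r e with mrg-injective xs ys xs′ ys′ (suc-injective p) (suc-injective q) (suc-injective r) (∷-injectiveʳ (∷-injectiveʳ e))
... | (e₁ , e₂) = cong₂ _∷_ (∷-injectiveˡ e) e₁ , cong₂ _∷_ (∷-injectiveˡ (∷-injectiveʳ e)) e₂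

∑-box-mrg : ∀ x y → length x ≡ length y → (F : Row → ℤ) → ∑ (box (mrg x y)) F ≡ ∑ (box x) (λ u → ∑ (box y) (λ v → F (mrg u v)))
∑-box-mrg []       []       _ F = sym (ℤₚ.+-identityʳ _)
∑-box-mrg (x ∷ xs) (y ∷ ys) e F = begin
  ∑ (box (x ∷ y ∷ mrg xs ys)) F
    ≡⟨ trans (∑-box-∷ x (y ∷ mrg xs ys) F) (∑-cong (upTo (suc x)) (λ a → ∑-box-∷ y (mrg xs ys) (λ r → F (a ∷ r)))) ⟩
  ∑ (upTo (suc x)) (λ a → ∑ (upTo (suc y)) (λ b → ∑ (box (mrg xs ys)) (λ r → F (a ∷ b ∷ r))))
    ≡⟨ ∑-cong (upTo (suc x)) (λ a → ∑-cong (upTo (suc y)) (λ b → ∑-box-mrg xs ys (suc-injective e) (λ r → F (a ∷ b ∷ r)))) ⟩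
  ∑ (upTo (suc x)) (λ a → ∑ (upTo (suc y)) (λ b → ∑ (box xs) (λ u → ∑ (box ys) (λ v → F (a ∷ b ∷ mrg u v)))))
    ≡⟨ ∑-cong (upTo (suc x)) (λ a → ∑-swap (upTo (suc y)) (box xs) _) ⟩
  ∑ (upTo (suc x)) (λ a → ∑ (box xs) (λ u → ∑ (upTo (suc y)) (λ b → ∑ (box ys) (λ v → F (mrg (a ∷ u) (b ∷ v))))))
    ≡⟨ ∑-cong (upTo (suc x)) (λ a → ∑-cong (box xs) (λ u → sym (∑-box-∷ y ys (λ v → F (mrg (a ∷ u) v))))) ⟩
  ∑ (upTo (suc x)) (λ a → ∑ (box xs) (λ u → ∑ (box (y ∷ ys)) (λ v → F (mrg (a ∷ u) v))))
    ≡⟨ sym (∑-box-∷ x xs (λ u → ∑ (box (y ∷ ys)) (λ v → F (mrg u v)))) ⟩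
  ∑ (box (x ∷ xs)) (λ u → ∑ (box (y ∷ ys)) (λ v → F (mrg u v))) ∎
  where open ≡-Reasoning

inter-mrg : ∀ N x y u v → length x ≡ N → length y ≡ N → length u ≡ N → length v ≡ N →
  (Strip N x u × Strip N y v → Inter (dbl N) (mrg x y) (mrg u v)) × (Inter (dbl N) (mrg x y) (mrg u v) → Strip N x u × Strip N y v)
inter-mrg N x y u v ex ey eu ev = to , from
  where
  xy = at-mrg x y (trans ex (sym ey))
  uv = at-mrg u v (trans eu (sym ev))
  to : Strip N x u × Strip N y v → Inter (dbl N) (mrg x y) (mrg u v)
  to (p , q) {j} l with halves j
  ... | i , inj₁ refl = let i<N = dbl-cancel l in subst₂ _≤_ (sym (proj₁ (xy i))) (sym (proj₁ (uv i))) (proj₁ (p i<N)) , subst₂ _≤_ (sym (proj₁ (uv (suc i)))) (sym (proj₁ (xy i))) (proj₂ (p i<N))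
  ... | i , inj₂ refl = let i<N = dbl-cancel (<-trans (n<1+n _) l) in subst₂ _≤_ (sym (proj₂ (xy i))) (sym (proj₂ (uv i))) (proj₁ (q i<N)) , subst₂ _≤_ (sym (proj₂ (uv (suc i)))) (sym (proj₂ (xy i))) (proj₂ (q i<N))
  from : Inter (dbl N) (mrg x y) (mrg u v) → Strip N x u × Strip N y v
  from h = (λ {i} l → let r = h (≤-trans (n≤1+n _) (dbl-mono l)) in subst₂ _≤_ (proj₁ (xy i)) (proj₁ (uv i)) (proj₁ r) , subst₂ _≤_ (proj₁ (uv (suc i))) (proj₁ (xy i)) (proj₂ r)) ,
           (λ {i} l → let r = h (dbl-mono l) in subst₂ _≤_ (proj₂ (xy i)) (proj₂ (uv i)) (proj₁ r) , subst₂ _≤_ (proj₂ (uv (suc i))) (proj₂ (xy i)) (proj₂ r))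

strip-sum : ∀ N x y → length x ≡ N → length y ≡ N → Strip N x y → sum x ≤ sum y
strip-sum N x y ex ey h = subst₂ _≤_ (sym (trans (sum-sumTo x) (cong (λ t → sumTo t (at x)) ex))) (sym (trans (sum-sumTo y) (cong (λ t → sumTo t (at y)) ey))) (sumTo-mono N (λ l → proj₁ (h l)))

-- The rows determine how a letter is shared between the two tableaux: `b` is forced to be `p′ ∸ p`.
-- Hence the convolution over contents collapses to a condition on the merged row sum.
∑-split-content : ∀ a p p′ q q′ → p ≤ p′ → q ≤ q′ →
  ∑ (upTo (suc a)) (λ b → ind (p′ ≟ p + b) ⊗ ind (q′ ≟ q + (a ∸ b))) ≡ ind (p′ + q′ ≟ (p + q) + a)
∑-split-content a p p′ q q′ p≤ q≤ = by (p′ + q′ ≟ (p + q) + a)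
  where
  d = p′ ∸ p
  pd : p + d ≡ p′
  pd = m+[n∸m]≡n p≤
  by : (r : Dec (p′ + q′ ≡ (p + q) + a)) → ∑ (upTo (suc a)) (λ b → ind (p′ ≟ p + b) ⊗ ind (q′ ≟ q + (a ∸ b))) ≡ ind r
  by (yes e) = trans (∑-cong-All (Enumerates.sound (upTo-enumerates (suc a))) same) (Enumerates.pick (upTo-enumerates (suc a)) d (λ _ → + 1) (s≤s d≤a))
    where
    e′ : d + q′ ≡ q + a
    e′ = +-cancelˡ-≡ p (d + q′) (q + a) (trans (sym (+-assoc p d q′)) (trans (cong (_+ q′) pd) (trans e (+-assoc p q a))))
    d≤a : d ≤ a
    d≤a = +-cancelˡ-≤ q d a (≤-trans (≤-trans (+-monoˡ-≤ d q≤) (≤-reflexive (+-comm q′ d))) (≤-reflexive e′))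
    same : ∀ b → b < suc a → ind (p′ ≟ p + b) ⊗ ind (q′ ≟ q + (a ∸ b)) ≡ ind (b ≟ d) ⊗ + 1
    same b l = trans (ind-× (p′ ≟ p + b) (q′ ≟ q + (a ∸ b)) (b ≟ d)
        (λ e₁ _ → +-cancelˡ-≡ p b d (trans (sym e₁) (sym pd)))
        (λ { refl → sym pd , +-cancelˡ-≡ d q′ (q + (a ∸ d)) (trans e′ (trans (cong (λ t → q + t) (sym (m+[n∸m]≡n d≤a))) (trans (sym (+-assoc q d (a ∸ d))) (trans (cong (_+ (a ∸ d)) (+-comm q d)) (+-assoc d q (a ∸ d)))))) }))
      (sym (trans (⊗-comm _ (+ 1)) (⊗-identityˡ _)))
  by (no ne) = trans (∑-cong-All (Enumerates.sound (upTo-enumerates (suc a))) (λ b l → trans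
      (ind-× (p′ ≟ p + b) (q′ ≟ q + (a ∸ b)) ((p′ ≟ p + b) ×-dec (q′ ≟ q + (a ∸ b))) _,_ id)
      (ind-no ((p′ ≟ p + b) ×-dec (q′ ≟ q + (a ∸ b))) (λ (e₁ , e₂) → ne (trans (cong₂ _+_ e₁ e₂) (trans (+-interchange p b q (a ∸ b)) (cong (λ t → (p + q) + t) (m+[n∸m]≡n (≤-pred l)))))))))
    (∑-zero (upTo (suc a)) (λ _ → refl))

module _ (N : ℕ) (e₁ e₂ : Row) (l₁ : length e₁ ≡ N) (l₂ : length e₂ ≡ N) where

  private
    e = mrg e₁ e₂
    e₁₂ : length e₁ ≡ length e₂
    e₁₂ = trans l₁ (sym l₂)

  product-count : ∀ α s₁ s₂ → length s₁ ≡ N → length s₂ ≡ N →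
    ∑ (box α) (λ β → tab N e₁ s₁ β ⊗ tab N e₂ s₂ (zipWith _∸_ α β)) ≡ count (dbl N) e (mrg s₁ s₂) α
  product-count [] s₁ s₂ k₁ k₂ = trans (ℤₚ.+-identityʳ _) (ind-× (s₁ ≟ᴿ e₁) (s₂ ≟ᴿ e₂) (mrg s₁ s₂ ≟ᴿ e) (cong₂ mrg)
    (mrg-injective s₁ s₂ e₁ e₂ (trans k₁ (sym k₂)) (trans k₁ (sym l₁)) e₁₂))
  product-count (a ∷ α) s₁ s₂ k₁ k₂ = begin
    ∑ (box (a ∷ α)) (λ β → tab N e₁ s₁ β ⊗ tab N e₂ s₂ (zipWith _∸_ (a ∷ α) β))
      ≡⟨ ∑-box-∷ a α _ ⟩
    ∑ (upTo (suc a)) (λ b → ∑ (box α) (λ β → tab N e₁ s₁ (b ∷ β) ⊗ tab N e₂ s₂ ((a ∸ b) ∷ zipWith _∸_ α β)))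
      ≡⟨ ∑-cong (upTo (suc a)) (λ b → ∑-cong (box α) (λ β → spread b β)) ⟩
    ∑ (upTo (suc a)) (λ b → ∑ (box α) (λ β → ∑ (box e₁) (λ u → ∑ (box e₂) (λ v → S u v ⊗ (I b u v ⊗ t u v β)))))
      ≡⟨ ∑-cong (upTo (suc a)) (λ b → trans (∑-swap (box α) (box e₁) _) (∑-cong (box e₁) (λ u → ∑-swap (box α) (box e₂) _))) ⟩
    ∑ (upTo (suc a)) (λ b → ∑ (box e₁) (λ u → ∑ (box e₂) (λ v → ∑ (box α) (λ β → S u v ⊗ (I b u v ⊗ t u v β)))))
      ≡⟨ trans (∑-swap (upTo (suc a)) (box e₁) _) (∑-cong (box e₁) (λ u → ∑-swap (upTo (suc a)) (box e₂) _)) ⟩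
    ∑ (box e₁) (λ u → ∑ (box e₂) (λ v → ∑ (upTo (suc a)) (λ b → ∑ (box α) (λ β → S u v ⊗ (I b u v ⊗ t u v β)))))
      ≡⟨ ∑-cong-All (Enumerates.sound (box-enumerates e₁)) (λ u oku → ∑-cong-All (Enumerates.sound (box-enumerates e₂)) (λ v okv → collect u oku v okv)) ⟩
    ∑ (box e₁) (λ u → ∑ (box e₂) (λ v → ind (inter? (dbl N) (mrg s₁ s₂) (mrg u v)) ⊗ (ind (sum (mrg u v) ≟ sum (mrg s₁ s₂) + a) ⊗ count (dbl N) e (mrg u v) α)))
      ≡⟨ sym (∑-box-mrg e₁ e₂ e₁₂ (λ u → ind (inter? (dbl N) (mrg s₁ s₂) u) ⊗ (ind (sum u ≟ sum (mrg s₁ s₂) + a) ⊗ count (dbl N) e u α))) ⟩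
    count (dbl N) e (mrg s₁ s₂) (a ∷ α) ∎
    where
    open ≡-Reasoning
    S : Row → Row → ℤ
    S u v = ind (strip? N s₁ u) ⊗ ind (strip? N s₂ v)
    I : ℕ → Row → Row → ℤ
    I b u v = ind (sum u ≟ sum s₁ + b) ⊗ ind (sum v ≟ sum s₂ + (a ∸ b))
    t : Row → Row → List ℕ → ℤ
    t u v β = tab N e₁ u β ⊗ tab N e₂ v (zipWith _∸_ α β)
    interchange₃ : ∀ x y z x′ y′ z′ → x ⊗ (y ⊗ z) ⊗ (x′ ⊗ (y′ ⊗ z′)) ≡ x ⊗ x′ ⊗ (y ⊗ y′ ⊗ (z ⊗ z′))
    interchange₃ x y z x′ y′ z′ = trans (ex x (y ⊗ z) x′ (y′ ⊗ z′)) (cong (x ⊗ x′ ⊗_) (ex y z y′ z′))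
      where
      ex : ∀ a b c d → a ⊗ b ⊗ (c ⊗ d) ≡ a ⊗ c ⊗ (b ⊗ d)
      ex a b c d = trans (⊗-assoc a b _) (trans (cong (a ⊗_) (trans (sym (⊗-assoc b c d)) (trans (cong (_⊗ d) (⊗-comm b c)) (⊗-assoc c b d)))) (sym (⊗-assoc a c _)))
    spread : ∀ b β → tab N e₁ s₁ (b ∷ β) ⊗ tab N e₂ s₂ ((a ∸ b) ∷ zipWith _∸_ α β) ≡ ∑ (box e₁) (λ u → ∑ (box e₂) (λ v → S u v ⊗ (I b u v ⊗ t u v β)))
    spread b β = trans (⊗-comm (tab N e₁ s₁ (b ∷ β)) _) (trans (sym (∑-*ˡ (box e₁) _ _)) (∑-cong (box e₁) (λ u → trans (⊗-comm _ _) (trans (sym (∑-*ˡ (box e₂) _ _))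
      (∑-cong (box e₂) (λ v → interchange₃ (ind (strip? N s₁ u)) (ind (sum u ≟ sum s₁ + b)) (tab N e₁ u β) (ind (strip? N s₂ v)) (ind (sum v ≟ sum s₂ + (a ∸ b))) (tab N e₂ v (zipWith _∸_ α β))))))))
    collect : ∀ u → InBox e₁ u → ∀ v → InBox e₂ v → ∑ (upTo (suc a)) (λ b → ∑ (box α) (λ β → S u v ⊗ (I b u v ⊗ t u v β))) ≡
      ind (inter? (dbl N) (mrg s₁ s₂) (mrg u v)) ⊗ (ind (sum (mrg u v) ≟ sum (mrg s₁ s₂) + a) ⊗ count (dbl N) e (mrg u v) α)
    collect u oku v okv = begin
      ∑ (upTo (suc a)) (λ b → ∑ (box α) (λ β → S u v ⊗ (I b u v ⊗ t u v β)))
        ≡⟨ ∑-cong (upTo (suc a)) (λ b → trans (∑-*ˡ (box α) (S u v) _) (cong (S u v ⊗_) (trans (∑-*ˡ (box α) (I b u v) _) (cong (I b u v ⊗_) (product-count α u v ku kv))))) ⟩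
      ∑ (upTo (suc a)) (λ b → S u v ⊗ (I b u v ⊗ c))
        ≡⟨ trans (∑-*ˡ (upTo (suc a)) (S u v) _) (cong (S u v ⊗_) (trans (∑-cong (upTo (suc a)) (λ b → ⊗-comm (I b u v) c)) (trans (∑-*ˡ (upTo (suc a)) c _) (⊗-comm c _)))) ⟩
      S u v ⊗ (∑ (upTo (suc a)) (λ b → I b u v) ⊗ c)
        ≡⟨ cong (_⊗ (∑ (upTo (suc a)) (λ b → I b u v) ⊗ c)) (ind-× (strip? N s₁ u) (strip? N s₂ v) (inter? (dbl N) (mrg s₁ s₂) (mrg u v)) (λ p q → proj₁ iff (p , q)) (proj₂ iff)) ⟩
      ind (inter? (dbl N) (mrg s₁ s₂) (mrg u v)) ⊗ (∑ (upTo (suc a)) (λ b → I b u v) ⊗ c)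
        ≡⟨ ind-*-cong (inter? (dbl N) (mrg s₁ s₂) (mrg u v)) (λ i → cong (_⊗ c) (trans
             (∑-split-content a (sum s₁) (sum u) (sum s₂) (sum v) (strip-sum N s₁ u k₁ ku (proj₁ (proj₂ iff i))) (strip-sum N s₂ v k₂ kv (proj₂ (proj₂ iff i))))
             (ind-cong (sum u + sum v ≟ (sum s₁ + sum s₂) + a) (sum (mrg u v) ≟ sum (mrg s₁ s₂) + a)
               (λ q → trans (sum-mrg u v (trans ku (sym kv))) (trans q (cong (_+ a) (sym (sum-mrg s₁ s₂ (trans k₁ (sym k₂)))))))
               (λ q → trans (sym (sum-mrg u v (trans ku (sym kv)))) (trans q (cong (_+ a) (sum-mrg s₁ s₂ (trans k₁ (sym k₂))))))))) ⟩
      ind (inter? (dbl N) (mrg s₁ s₂) (mrg u v)) ⊗ (ind (sum (mrg u v) ≟ sum (mrg s₁ s₂) + a) ⊗ c) ∎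
      where
      ku = trans (proj₁ oku) l₁
      kv = trans (proj₁ okv) l₂
      c = count (dbl N) e (mrg u v) α
      iff = inter-mrg N s₁ s₂ u v k₁ k₂ ku kv

-- Symmetries of the number of chains

count-swap : ∀ N e₁ e₂ → length e₁ ≡ N → length e₂ ≡ N → ∀ α s₁ s₂ → length s₁ ≡ N → length s₂ ≡ N →
  count (dbl N) (mrg e₁ e₂) (mrg s₁ s₂) α ≡ count (dbl N) (mrg e₂ e₁) (mrg s₂ s₁) α
count-swap N e₁ e₂ l₁ l₂ [] s₁ s₂ k₁ k₂ = ind-cong (mrg s₁ s₂ ≟ᴿ mrg e₁ e₂) (mrg s₂ s₁ ≟ᴿ mrg e₂ e₁)
  (λ q → let r = mrg-injective s₁ s₂ e₁ e₂ (trans k₁ (sym k₂)) (trans k₁ (sym l₁)) (trans l₁ (sym l₂)) q in cong₂ mrg (proj₂ r) (proj₁ r))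
  (λ q → let r = mrg-injective s₂ s₁ e₂ e₁ (trans k₂ (sym k₁)) (trans k₂ (sym l₂)) (trans l₂ (sym l₁)) q in cong₂ mrg (proj₂ r) (proj₁ r))
count-swap N e₁ e₂ l₁ l₂ (a ∷ α) s₁ s₂ k₁ k₂ = begin
  ∑ (box (mrg e₁ e₂)) (F e₁ e₂ s₁ s₂)
    ≡⟨ ∑-box-mrg e₁ e₂ (trans l₁ (sym l₂)) (F e₁ e₂ s₁ s₂) ⟩
  ∑ (box e₁) (λ u → ∑ (box e₂) (λ v → F e₁ e₂ s₁ s₂ (mrg u v)))
    ≡⟨ ∑-cong-All (Enumerates.sound (box-enumerates e₁)) (λ u oku → ∑-cong-All (Enumerates.sound (box-enumerates e₂)) (λ v okv → same u v (trans (proj₁ oku) l₁) (trans (proj₁ okv) l₂))) ⟩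
  ∑ (box e₁) (λ u → ∑ (box e₂) (λ v → F e₂ e₁ s₂ s₁ (mrg v u)))
    ≡⟨ ∑-swap (box e₁) (box e₂) _ ⟩
  ∑ (box e₂) (λ v → ∑ (box e₁) (λ u → F e₂ e₁ s₂ s₁ (mrg v u)))
    ≡⟨ sym (∑-box-mrg e₂ e₁ (trans l₂ (sym l₁)) (F e₂ e₁ s₂ s₁)) ⟩
  ∑ (box (mrg e₂ e₁)) (F e₂ e₁ s₂ s₁) ∎
  where
  open ≡-Reasoning
  F : Row → Row → Row → Row → Row → ℤ
  F e₁ e₂ s₁ s₂ u = ind (inter? (dbl N) (mrg s₁ s₂) u) ⊗ (ind (sum u ≟ sum (mrg s₁ s₂) + a) ⊗ count (dbl N) (mrg e₁ e₂) u α)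
  total : ∀ x y → length x ≡ N → length y ≡ N → sum (mrg x y) ≡ sum (mrg y x)
  total x y p q = trans (sum-mrg x y (trans p (sym q))) (trans (+-comm (sum x) (sum y)) (sym (sum-mrg y x (trans q (sym p)))))
  same : ∀ u v → length u ≡ N → length v ≡ N → F e₁ e₂ s₁ s₂ (mrg u v) ≡ F e₂ e₁ s₂ s₁ (mrg v u)
  same u v ku kv = cong₂ _⊗_
    (ind-cong (inter? (dbl N) (mrg s₁ s₂) (mrg u v)) (inter? (dbl N) (mrg s₂ s₁) (mrg v u))
      (λ h → let r = proj₂ (inter-mrg N s₁ s₂ u v k₁ k₂ ku kv) h in proj₁ (inter-mrg N s₂ s₁ v u k₂ k₁ kv ku) (proj₂ r , proj₁ r))
      (λ h → let r = proj₂ (inter-mrg N s₂ s₁ v u k₂ k₁ kv ku) h in proj₁ (inter-mrg N s₁ s₂ u v k₁ k₂ ku kv) (proj₂ r , proj₁ r)))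
    (cong₂ _⊗_ (cong₂ (λ x y → ind (x ≟ y + a)) (total u v ku kv) (total s₁ s₂ k₁ k₂)) (count-swap N e₁ e₂ l₁ l₂ α u v ku kv))

∑-box-suc : ∀ e (F : Row → ℤ) → (∀ u → length u ≡ length e → (∀ v → u ≢ map suc v) → F u ≡ + 0) → ∑ (box (map suc e)) F ≡ ∑ (box e) (λ u → F (map suc u))
∑-box-suc []      F h = refl
∑-box-suc (x ∷ e) F h = begin
  ∑ (box (suc x ∷ map suc e)) F
    ≡⟨ trans (∑-box-∷ (suc x) (map suc e) F) (∑-upTo-suc (suc x) (λ a → ∑ (box (map suc e)) (λ y → F (a ∷ y)))) ⟩
  ∑ (box (map suc e)) (λ y → F (0 ∷ y)) ⊕ ∑ (upTo (suc x)) (λ a → ∑ (box (map suc e)) (λ y → F (suc a ∷ y)))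
    ≡⟨ cong₂ _⊕_ (trans (∑-cong-All (Enumerates.sound (box-enumerates (map suc e))) (λ y ok → h (0 ∷ y) (cong suc (trans (proj₁ ok) (length-map suc e))) (λ { [] () ; (_ ∷ _) () }))) (∑-zero (box (map suc e)) (λ _ → refl)))
                 (∑-cong (upTo (suc x)) (λ a → ∑-box-suc e (λ y → F (suc a ∷ y)) (λ y ly ne → h (suc a ∷ y) (cong suc ly) (λ { [] () ; (b ∷ v) q → ne v (∷-injectiveʳ q) })))) ⟩
  + 0 ⊕ ∑ (upTo (suc x)) (λ a → ∑ (box e) (λ u → F (suc a ∷ map suc u)))
    ≡⟨ trans (ℤₚ.+-identityˡ _) (sym (∑-box-∷ x e (λ u → F (map suc u)))) ⟩
  ∑ (box (x ∷ e)) (λ u → F (map suc u)) ∎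
  where open ≡-Reasoning

at-map-suc : ∀ x {j} → j < length x → at (map suc x) j ≡ suc (at x j)
at-map-suc (x ∷ xs) {zero}  _       = refl
at-map-suc (x ∷ xs) {suc j} (s≤s l) = at-map-suc xs l

unshift : ∀ u → (∀ {j} → j < length u → 1 ≤ at u j) → ∃ λ v → u ≡ map suc v
unshift []          h = [] , refl
unshift (zero ∷ u)  h = ⊥-elim (<⇒≱ (h {0} (s≤s z≤n)) z≤n)
unshift (suc x ∷ u) h with unshift u (λ l → h (s≤s l))
... | v , q = x ∷ v , cong (suc x ∷_) q

sum-map-suc : ∀ x → sum (map suc x) ≡ length x + sum x
sum-map-suc []      = refl
sum-map-suc (x ∷ l) = cong suc (trans (cong (λ t → x + t) (sum-map-suc l)) (trans (sym (+-assoc x (length l) (sum l))) (trans (cong (_+ sum l) (+-comm x (length l))) (+-assoc (length l) x (sum l)))))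

-- Both shapes receive a full column. Entries along a chain never fall below those of its start, so
-- every intermediate row has positive entries and is itself a shifted row.
tab-shift : ∀ N e → length e ≡ N → ∀ α s → length s ≡ N → tab N (map suc e) (map suc s) α ≡ tab N e s α
tab-shift N e le [] s ls = ind-cong (map suc s ≟ᴿ map suc e) (s ≟ᴿ e) (map-injective suc-injective) (cong (map suc))
tab-shift N e le (a ∷ α) s ls = trans (∑-box-suc e _ outside) (∑-cong-All (Enumerates.sound (box-enumerates e)) (λ u ok → same u (trans (proj₁ ok) le)))
  where
  outside : ∀ u → length u ≡ length e → (∀ v → u ≢ map suc v) → ind (strip? N (map suc s) u) ⊗ (ind (sum u ≟ sum (map suc s) + a) ⊗ tab N (map suc e) u α) ≡ + 0
  outside u lu ne = ind-*-zero (strip? N (map suc s) u) (λ st → ⊥-elim (let (v , q) = unshift u (λ {j} l → positive st (subst (j <_) (trans lu le) l)) in ne v q))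
    where
    positive : Strip N (map suc s) u → ∀ {j} → j < N → 1 ≤ at u j
    positive st {j} l = ≤-trans (≤-trans (s≤s z≤n) (≤-reflexive (sym (at-map-suc s (subst (j <_) (sym ls) l))))) (proj₁ (st l))
  same : ∀ u → length u ≡ N → ind (strip? N (map suc s) (map suc u)) ⊗ (ind (sum (map suc u) ≟ sum (map suc s) + a) ⊗ tab N (map suc e) (map suc u) α) ≡
                              ind (strip? N s u) ⊗ (ind (sum u ≟ sum s + a) ⊗ tab N e u α)
  same u lu = cong₂ _⊗_ (ind-cong (strip? N (map suc s) (map suc u)) (strip? N s u) down up)
    (cong₂ _⊗_ (ind-cong (sum (map suc u) ≟ sum (map suc s) + a) (sum u ≟ sum s + a)
        (λ q → +-cancelˡ-≡ N _ _ (trans (sym su) (trans q (trans (cong (_+ a) ss) (+-assoc N (sum s) a)))))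
        (λ q → trans su (trans (cong (λ t → N + t) q) (trans (sym (+-assoc N (sum s) a)) (cong (_+ a) (sym ss))))))
      (tab-shift N e le α u lu))
    where
    su : sum (map suc u) ≡ N + sum u
    su = trans (sum-map-suc u) (cong (_+ sum u) lu)
    ss : sum (map suc s) ≡ N + sum s
    ss = trans (sum-map-suc s) (cong (_+ sum s) ls)
    at-u : ∀ {j} → j < N → at (map suc u) j ≡ suc (at u j)
    at-u {j} l = at-map-suc u (subst (j <_) (sym lu) l)
    at-s : ∀ {j} → j < N → at (map suc s) j ≡ suc (at s j)
    at-s {j} l = at-map-suc s (subst (j <_) (sym ls) l)
    down : Strip N (map suc s) (map suc u) → Strip N s u
    down st {j} l = ≤-pred (subst₂ _≤_ (at-s l) (at-u l) (proj₁ (st l))) , next (suc j <? N)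
      where
      next : Dec (suc j < N) → at u (suc j) ≤ at s j
      next (yes q) = ≤-pred (subst₂ _≤_ (at-u q) (at-s l) (proj₂ (st l)))
      next (no ¬q) = ≤-trans (≤-reflexive (at-beyond u (≤-trans (≤-reflexive lu) (≮⇒≥ ¬q)))) z≤n
    up : Strip N s u → Strip N (map suc s) (map suc u)
    up st {j} l = subst₂ _≤_ (sym (at-s l)) (sym (at-u l)) (s≤s (proj₁ (st l))) , next (suc j <? N)
      where
      next : Dec (suc j < N) → at (map suc u) (suc j) ≤ at (map suc s) j
      next (yes q) = subst₂ _≤_ (sym (at-u q)) (sym (at-s l)) (s≤s (proj₂ (st l)))
      next (no ¬q) = ≤-trans (≤-reflexive (at-beyond (map suc u) (≤-trans (≤-reflexive (trans (length-map suc u) lu)) (≮⇒≥ ¬q)))) z≤n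

∑-box-str : ∀ e (F : Row → ℤ) → ∑ (box (str e)) F ≡ ∑ (box e) (λ u → F (str u))
∑-box-str []      F = refl
∑-box-str (x ∷ e) F = begin
  ∑ (box (x ∷ 0 ∷ str e)) F
    ≡⟨ trans (∑-box-∷ x (0 ∷ str e) F) (∑-cong (upTo (suc x)) {λ a → ∑ (box (0 ∷ str e)) (λ r → F (a ∷ r))} {λ a → ∑ (box (str e)) (λ r → F (a ∷ 0 ∷ r))} (λ a → trans (∑-box-∷ 0 (str e) (λ r → F (a ∷ r))) (ℤₚ.+-identityʳ _))) ⟩
  ∑ (upTo (suc x)) (λ a → ∑ (box (str e)) (λ r → F (a ∷ 0 ∷ r)))
    ≡⟨ ∑-cong (upTo (suc x)) (λ a → ∑-box-str e (λ r → F (a ∷ 0 ∷ r))) ⟩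
  ∑ (upTo (suc x)) (λ a → ∑ (box e) (λ u → F (a ∷ 0 ∷ str u)))
    ≡⟨ sym (∑-box-∷ x e (λ u → F (str u))) ⟩
  ∑ (box (x ∷ e)) (λ u → F (str u)) ∎
  where open ≡-Reasoning

str-injective : ∀ x y → str x ≡ str y → x ≡ y
str-injective []      []      _ = refl
str-injective (x ∷ a) (y ∷ b) q = cong₂ _∷_ (∷-injectiveˡ q) (str-injective a b (∷-injectiveʳ (∷-injectiveʳ q)))

count-str : ∀ N e α s → count (dbl N) (str e) (str s) α ≡ tab N e s α
count-str N e []      s = ind-cong (str s ≟ᴿ str e) (s ≟ᴿ e) (str-injective s e) (cong str)
count-str N e (a ∷ α) s = trans (∑-box-str e _) (∑-cong (box e) (λ u → cong₂ _⊗_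
  (ind-cong (inter? (dbl N) (str s) (str u)) (strip? N s u) (down u) (up u))
  (cong₂ _⊗_ (cong₂ (λ x y → ind (x ≟ y + a)) (sum-str u) (sum-str s)) (count-str N e α u))))
  where
  down : ∀ u → Inter (dbl N) (str s) (str u) → Strip N s u
  down u h {i} l = let r = h (≤-trans (n≤1+n _) (dbl-mono l)) in
    subst₂ _≤_ (at-str-even s i) (at-str-even u i) (proj₁ r) , subst₂ _≤_ (at-str-even u (suc i)) (at-str-even s i) (proj₂ r)
  up : ∀ u → Strip N s u → Inter (dbl N) (str s) (str u)
  up u h {j} l with halves j
  ... | i , inj₁ refl = subst₂ _≤_ (sym (at-str-even s i)) (sym (at-str-even u i)) (proj₁ (h (dbl-cancel l))) ,
                        subst₂ _≤_ (sym (at-str-even u (suc i))) (sym (at-str-even s i)) (proj₂ (h (dbl-cancel l)))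
  ... | i , inj₂ refl = ≤-trans (≤-reflexive (at-str-odd s i)) z≤n , ≤-trans (≤-reflexive (at-str-odd u (suc i))) z≤n

-- Zero entries of a weight

nz : List ℕ → List ℕ
nz []          = []
nz (zero ∷ α)  = nz α
nz (suc a ∷ α) = suc a ∷ nz α

nz-zeros : ∀ α k → nz (nz α ++ replicate k 0) ≡ nz α
nz-zeros []          zero    = refl
nz-zeros []          (suc k) = nz-zeros [] k
nz-zeros (zero ∷ α)  k       = nz-zeros α k
nz-zeros (suc a ∷ α) k       = cong (suc a ∷_) (nz-zeros α k)

length-nz : ∀ α → length (nz α) ≤ sum α
length-nz []          = z≤n
length-nz (zero ∷ α)  = length-nz α
length-nz (suc a ∷ α) = s≤s (≤-trans (length-nz α) (m≤n+m (sum α) a))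

module _ {w : ℕ} (e : Row) (le : length e ≡ w) where

  count-zero : ∀ α s → InBox e s → Inter w s s → count w e s (0 ∷ α) ≡ count w e s α
  count-zero α s ok self = trans (∑-cong-All (Enumerates.sound (box-enumerates e)) step) (Enumerates.pick (box-enumerates e) s (λ u → count w e u α) ok)
    where
    ls : length s ≡ w
    ls = trans (proj₁ ok) le
    as-sum : ∀ x → length x ≡ w → sum x ≡ sumTo w (at x)
    as-sum x lx = trans (sum-sumTo x) (cong (λ k → sumTo k (at x)) lx)
    step : ∀ u → InBox e u → ind (inter? w s u) ⊗ (ind (sum u ≟ sum s + 0) ⊗ count w e u α) ≡ ind (u ≟ᴿ s) ⊗ count w e u α
    step u oku = trans (sym (⊗-assoc (ind (inter? w s u)) _ _)) (cong (_⊗ count w e u α) (ind-× (inter? w s u) (sum u ≟ sum s + 0) (u ≟ᴿ s)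
      (λ i q → sym (row-ext (trans ls (sym lu)) (λ {j} l → sumTo-squeeze w {at s} {at u} (λ l → proj₁ (i l))
        (≤-reflexive (trans (sym (as-sum u lu)) (trans q (trans (+-identityʳ (sum s)) (as-sum s ls))))) (subst (j <_) ls l))))
      (λ { refl → self , sym (+-identityʳ (sum s)) })))
      where
      lu : length u ≡ w
      lu = trans (proj₁ oku) le

  count-nz : ∀ α s → InBox e s → Inter w s s → count w e s α ≡ count w e s (nz α)
  count-nz []          s ok self = refl
  count-nz (zero ∷ α)  s ok self = trans (count-zero α s ok self) (count-nz α s ok self)
  count-nz (suc a ∷ α) s ok self = ∑-cong-All (Enumerates.sound (box-enumerates e)) (λ u oku → ind-*-cong (inter? w s u) (λ i →
    cong (ind (sum u ≟ sum s + suc a) ⊗_) (count-nz α u oku (λ l → ≤-refl , ≤-trans (proj₂ (i l)) (proj₁ (i l))))))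

  -- A letter that does not occur forces the chain to pause. So every weight with at most `m`
  -- nonzero entries can be brought to length `m`, the number of letters for which the expansion is
  -- proved.
  count-pad : ∀ α k s → InBox e s → Inter w s s → count w e s α ≡ count w e s (nz α ++ replicate k 0)
  count-pad α k s ok self = trans (count-nz α s ok self) (sym (trans (count-nz (nz α ++ replicate k 0) s ok self) (cong (count w e s) (nz-zeros α k))))

count-sum : ∀ w e α s → sum s + sum α ≢ sum e → count w e s α ≡ + 0
count-sum w e []      s ne = ind-no (s ≟ᴿ e) (λ q → ne (trans (+-identityʳ (sum s)) (cong sum q)))
count-sum w e (a ∷ α) s ne = ∑-zero (box e) (λ u → trans (cong (ind (inter? w s u) ⊗_) (ind-*-zero (sum u ≟ sum s + a) (λ q → count-sum w e α u (λ r → ne (trans (sym (+-assoc (sum s) a (sum α))) (trans (cong (_+ sum α) (sym q)) r)))))) (⊗-zeroʳ _))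

-- Schur nonnegativity

foldr-∑ : {A : Set} (g : A → ℤ) (xs : List A) → foldr ℤ._+_ (+ 0) (map g xs) ≡ ∑ xs g
foldr-∑ g []       = refl
foldr-∑ g (x ∷ xs) = cong (g x ⊕_) (foldr-∑ g xs)

schurSum : List (List ℕ × ℕ) → SymFun
schurSum L α = ∑ L (λ p → + proj₂ p ⊗ schur (proj₁ p) α)

nonneg-intro : ∀ {F : SymFun} L → All (λ p → IsPartition (proj₁ p)) L → (∀ α → F α ≡ schurSum L α) → SchurNonneg F
nonneg-intro L ps h = L , ps , λ α → trans (h α) (sym (trans (foldr-∑ _ L) (∑-cong L (λ p → sym (⊗-def (+ proj₂ p) (schur (proj₁ p) α))))))

nonneg-elim : ∀ {F : SymFun} → (nn : SchurNonneg F) → ∀ α → F α ≡ schurSum (proj₁ nn) α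
nonneg-elim (L , _ , h) α = trans (h α) (trans (foldr-∑ _ L) (∑-cong L (λ p → sym (⊗-def (+ proj₂ p) (schur (proj₁ p) α)))))

nonneg-cong : ∀ {F F′ : SymFun} → (∀ α → F α ≡ F′ α) → SchurNonneg F → SchurNonneg F′
nonneg-cong eq nn@(L , ps , _) = nonneg-intro L ps (λ α → trans (sym (eq α)) (nonneg-elim nn α))

nonneg-trans : ∀ {F G H : SymFun} → SchurNonneg (F -ˢ G) → SchurNonneg (G -ˢ H) → SchurNonneg (F -ˢ H)
nonneg-trans {F} {G} {H} p@(L , ps , _) q@(L′ , qs , _) = nonneg-intro (L ++ L′) (++⁺ ps qs) (λ α → begin
  F α ⊟ H α                         ≡⟨ telescope (F α) (G α) (H α) ⟩
  (F α ⊟ G α) ⊕ (G α ⊟ H α)         ≡⟨ cong₂ _⊕_ (nonneg-elim p α) (nonneg-elim q α) ⟩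
  schurSum L α ⊕ schurSum L′ α      ≡⟨ sym (∑-++ L L′ _) ⟩
  schurSum (L ++ L′) α              ∎)
  where
  open ≡-Reasoning
  telescope : ∀ x y z → x ⊟ z ≡ (x ⊟ y) ⊕ (y ⊟ z)
  telescope x y z = sym (trans (ℤₚ.+-assoc x (⊝ y) (y ⊟ z)) (cong (x ⊕_) (trans (sym (ℤₚ.+-assoc (⊝ y) y (⊝ z))) (trans (cong (_⊕ ⊝ z) (ℤₚ.+-inverseˡ y)) (ℤₚ.+-identityˡ (⊝ z))))))

nonneg-refl : ∀ {F G : SymFun} → (∀ α → F α ≡ G α) → SchurNonneg (F -ˢ G)
nonneg-refl {F} {G} eq = nonneg-intro [] [] (λ α → trans (cong (_⊟ G α) (eq α)) (ℤₚ.+-inverseʳ (G α)))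

IsNat : ℤ → Set
IsNat x = ∃ λ k → x ≡ + k

nat-ind : {P : Set} (d : Dec P) → IsNat (ind d)
nat-ind (yes _) = 1 , refl
nat-ind (no _)  = 0 , refl

nat-⊗ : ∀ {x y} → IsNat x → IsNat y → IsNat (x ⊗ y)
nat-⊗ (a , refl) (b , refl) = a * b , trans (⊗-def (+ a) (+ b)) (sym (ℤₚ.pos-* a b))

nat-∑ : {A : Set} (xs : List A) {f : A → ℤ} → (∀ x → IsNat (f x)) → IsNat (∑ xs f)
nat-∑ []       h = 0 , refl
nat-∑ (x ∷ xs) {f} h with h x | nat-∑ xs {f} h
... | a , p | b , q = a + b , trans (cong₂ _⊕_ p q) (sym (ℤₚ.pos-+ a b))

nat-abs : ∀ {x} → IsNat x → + ℤ.∣ x ∣ ≡ x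
nat-abs (k , refl) = refl

module _ (mult : List ℕ → ℤ) where

  -- Entries that are not partitions are dropped, where the coefficient is zero by `mult-support`;
  -- the absolute value turns a coefficient known to be a natural number into one.
  parts : List (List ℕ) → List (List ℕ × ℕ)
  parts []       = []
  parts (κ ∷ ks) = choose (isPartition? κ) ((κ , ℤ.∣ mult κ ∣) ∷ parts ks) (parts ks)

  parts-partitions : ∀ ks → All (λ p → IsPartition (proj₁ p)) (parts ks)
  parts-partitions []       = []
  parts-partitions (κ ∷ ks) with isPartition? κ
  ... | yes p = p ∷ parts-partitions ks
  ... | no _  = parts-partitions ks

-- Products for pairs of shapes with a fixed number of rows

row-cong : ∀ N {f g : ℕ → ℕ} → (∀ {j} → j < N → f j ≡ g j) → row N f ≡ row N g
row-cong N {f} {g} h = row-ext (trans (length-row N f) (sym (length-row N g)))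
  (λ {j} q → let l = subst (j <_) (length-row N f) q in trans (at-row N f l) (trans (h l) (sym (at-row N g l))))

negAt-even : ∀ f i → negAt f (dbl i) ≡ indᴺ (f (dbl i) <? f (suc (dbl i)))
negAt-even f zero    = refl
negAt-even f (suc i) = negAt-even (λ j → f (2 + j)) i

par-even : ∀ i → par (dbl i) ≡ suc (dbl i)
par-even zero    = refl
par-even (suc i) = cong (suc ∘ suc) (par-even i)

choose-max : ∀ x y → choose (indᴺ (x <? y) ≟ 1) y x ≡ x ⊔ y
choose-max x y = by (x <? y)
  where
  by : (d : Dec (x < y)) → choose (indᴺ d ≟ 1) y x ≡ x ⊔ y
  by (yes l) = sym (m≤n⇒m⊔n≡n (<⇒≤ l))
  by (no ¬l) = sym (m≥n⇒m⊔n≡m (≮⇒≥ ¬l))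

choose-min : ∀ x y → choose (indᴺ (x <? y) ≟ 1) x y ≡ x ⊓ y
choose-min x y = by (x <? y)
  where
  by : (d : Dec (x < y)) → choose (indᴺ d ≟ 1) x y ≡ x ⊓ y
  by (yes l) = sym (m≤n⇒m⊓n≡m (<⇒≤ l))
  by (no ¬l) = sym (m≥n⇒m⊓n≡n (≮⇒≥ ¬l))

zero-str : ∀ κ j → at (str (top 0 κ)) j ≡ 0
zero-str κ j with halves j
... | i , inj₁ refl = trans (at-str-even (top 0 κ) i) (at-top-≥ {0} κ z≤n)
... | i , inj₂ refl = at-str-odd (top 0 κ) i

module Rows (n : ℕ) where

  N : ℕ
  N = suc n

  -- The product of the skew Schur functions of f₁ / h₁ and f₂ / h₂, with N rows each.
  Prod : (f₁ f₂ h₁ h₂ : ℕ → ℕ) → SymFun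
  Prod f₁ f₂ h₁ h₂ = count (dbl N) (mrg (row N f₁) (row N f₂)) (mrg (row N h₁) (row N h₂))

  mrg-length : ∀ f g → length (mrg (row N f) (row N g)) ≡ dbl N
  mrg-length f g = length-mrg N (row N f) (row N g) (length-row N f) (length-row N g)

  mrg-even : ∀ f g i → at (mrg (row N f) (row N g)) (dbl i) ≡ at (row N f) i
  mrg-even f g i = proj₁ (at-mrg (row N f) (row N g) (trans (length-row N f) (sym (length-row N g))) i)

  mrg-odd : ∀ f g i → at (mrg (row N f) (row N g)) (suc (dbl i)) ≡ at (row N g) i
  mrg-odd f g i = proj₂ (at-mrg (row N f) (row N g) (trans (length-row N f) (sym (length-row N g))) i)

  Prod-cong : ∀ {f₁ f₂ h₁ h₂ f₁′ f₂′ h₁′ h₂′} → (∀ j → f₁ j ≡ f₁′ j) → (∀ j → f₂ j ≡ f₂′ j) → (∀ j → h₁ j ≡ h₁′ j) → (∀ j → h₂ j ≡ h₂′ j) →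
    ∀ α → Prod f₁ f₂ h₁ h₂ α ≡ Prod f₁′ f₂′ h₁′ h₂′ α
  Prod-cong a b c d α = cong₂ (λ e s → count (dbl N) e s α)
    (cong₂ mrg (row-cong N (λ {j} _ → a j)) (row-cong N (λ {j} _ → b j))) (cong₂ mrg (row-cong N (λ {j} _ → c j)) (row-cong N (λ {j} _ → d j)))

  Prod-swap : ∀ f₁ f₂ h₁ h₂ α → Prod f₁ f₂ h₁ h₂ α ≡ Prod f₂ f₁ h₂ h₁ α
  Prod-swap f₁ f₂ h₁ h₂ α = count-swap N (row N f₁) (row N f₂) (length-row N f₁) (length-row N f₂) α (row N h₁) (row N h₂) (length-row N h₁) (length-row N h₂)

  as-product : ∀ f₁ f₂ h₁ h₂ α → ∑ (box α) (λ β → tab N (row N f₁) (row N h₁) β ⊗ tab N (row N f₂) (row N h₂) (zipWith _∸_ α β)) ≡ Prod f₁ f₂ h₁ h₂ α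
  as-product f₁ f₂ h₁ h₂ α = product-count N (row N f₁) (row N f₂) (length-row N f₁) (length-row N f₂) α (row N h₁) (row N h₂) (length-row N h₁) (length-row N h₂)

  row-suc : ∀ N (f : ℕ → ℕ) → row N (suc ∘ f) ≡ map suc (row N f)
  row-suc zero    f = refl
  row-suc (suc N) f = cong (suc (f 0) ∷_) (row-suc N (f ∘ suc))

  Prod-suc : ∀ f₁ f₂ h₁ h₂ α → Prod f₁ (suc ∘ f₂) h₁ (suc ∘ h₂) α ≡ Prod f₁ f₂ h₁ h₂ α
  Prod-suc f₁ f₂ h₁ h₂ α = trans (sym (as-product f₁ (suc ∘ f₂) h₁ (suc ∘ h₂) α)) (trans
    (∑-cong (box α) (λ β → cong (tab N (row N f₁) (row N h₁) β ⊗_) (trans (cong₂ (λ e s → tab N e s (zipWith _∸_ α β)) (row-suc N f₂) (row-suc N h₂))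
      (tab-shift N (row N f₂) (length-row N f₂) (zipWith _∸_ α β) (row N h₂) (length-row N h₂)))))
    (as-product f₁ f₂ h₁ h₂ α))

  Prod-shift : ∀ c f₁ f₂ h₁ h₂ α → Prod f₁ (λ j → c + f₂ j) h₁ (λ j → c + h₂ j) α ≡ Prod f₁ f₂ h₁ h₂ α
  Prod-shift zero    f₁ f₂ h₁ h₂ α = refl
  Prod-shift (suc c) f₁ f₂ h₁ h₂ α = trans (Prod-suc f₁ (λ j → c + f₂ j) h₁ (λ j → c + h₂ j) α) (Prod-shift c f₁ f₂ h₁ h₂ α)

  Halved : (s t : ℕ → ℕ) → SymFun
  Halved s t = Prod (λ j → ⌈ s j /2⌉) (λ j → ⌊ s j /2⌋) (λ j → ⌈ t j /2⌉) (λ j → ⌊ t j /2⌋)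

  -- Adding one to a sum exchanges the roles of its halves: the new floor is the old ceiling and the
  -- new ceiling is the old floor plus one. The swap and the extra full column do not affect the
  -- product.
  Halved-shift : ∀ c s t α → Halved (λ j → c + s j) (λ j → c + t j) α ≡ Halved s t α
  Halved-shift zero    s t α = refl
  Halved-shift (suc c) s t α = trans (Prod-swap (λ j → suc ⌊ c + s j /2⌋) (λ j → ⌈ c + s j /2⌉) (λ j → suc ⌊ c + t j /2⌋) (λ j → ⌈ c + t j /2⌉) α)
    (trans (Prod-suc (λ j → ⌈ c + s j /2⌉) (λ j → ⌊ c + s j /2⌋) (λ j → ⌈ c + t j /2⌉) (λ j → ⌊ c + t j /2⌋) α) (Halved-shift c s t α))

  record Shapes (f₁ f₂ h₁ h₂ : ℕ → ℕ) : Set where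
    field
      dec₁ : ∀ j → h₁ (suc j) ≤ h₁ j
      dec₂ : ∀ j → h₂ (suc j) ≤ h₂ j
      sub₁ : ∀ j → h₁ j ≤ f₁ j
      sub₂ : ∀ j → h₂ j ≤ f₂ j

  shapes-sort : ∀ {f₁ f₂ h₁ h₂} → Shapes f₁ f₂ h₁ h₂ → Shapes (λ j → f₁ j ⊔ f₂ j) (λ j → f₁ j ⊓ f₂ j) (λ j → h₁ j ⊔ h₂ j) (λ j → h₁ j ⊓ h₂ j)
  shapes-sort sh = record { dec₁ = λ j → ⊔-mono-≤ (dec₁ j) (dec₂ j) ; dec₂ = λ j → ⊓-mono-≤ (dec₁ j) (dec₂ j)
                          ; sub₁ = λ j → ⊔-mono-≤ (sub₁ j) (sub₂ j) ; sub₂ = λ j → ⊓-mono-≤ (sub₁ j) (sub₂ j) }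
    where open Shapes sh

  row-≤ : ∀ {f g : ℕ → ℕ} → (∀ j → f j ≤ g j) → ∀ i → at (row N f) i ≤ at (row N g) i
  row-≤ {f} {g} h i with i <? N
  ... | yes l = subst₂ _≤_ (sym (at-row N f l)) (sym (at-row N g l)) (h i)
  ... | no ¬l = ≤-trans (≤-reflexive (at-beyond (row N f) (≤-trans (≤-reflexive (length-row N f)) (≮⇒≥ ¬l)))) z≤n

  row-dec : ∀ {f : ℕ → ℕ} → (∀ j → f (suc j) ≤ f j) → ∀ i → at (row N f) (suc i) ≤ at (row N f) i
  row-dec {f} h i with suc i <? N
  ... | yes l = subst₂ _≤_ (sym (at-row N f l)) (sym (at-row N f (<-trans (n<1+n i) l))) (h i)
  ... | no ¬l = ≤-trans (≤-reflexive (at-beyond (row N f) (≤-trans (≤-reflexive (length-row N f)) (≮⇒≥ ¬l)))) z≤n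

  shapes-box : ∀ {f₁ f₂ h₁ h₂} → Shapes f₁ f₂ h₁ h₂ → InBox (mrg (row N f₁) (row N f₂)) (mrg (row N h₁) (row N h₂))
  shapes-box {f₁} {f₂} {h₁} {h₂} sh = trans (mrg-length h₁ h₂) (sym (mrg-length f₁ f₂)) , bound
    where
    open Shapes sh
    bound : ∀ j → at (mrg (row N h₁) (row N h₂)) j ≤ at (mrg (row N f₁) (row N f₂)) j
    bound j with halves j
    ... | i , inj₁ refl = subst₂ _≤_ (sym (mrg-even h₁ h₂ i)) (sym (mrg-even f₁ f₂ i)) (row-≤ sub₁ i)
    ... | i , inj₂ refl = subst₂ _≤_ (sym (mrg-odd h₁ h₂ i)) (sym (mrg-odd f₁ f₂ i)) (row-≤ sub₂ i)

  shapes-self : ∀ {f₁ f₂ h₁ h₂} → Shapes f₁ f₂ h₁ h₂ → Inter (dbl N) (mrg (row N h₁) (row N h₂)) (mrg (row N h₁) (row N h₂))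
  shapes-self {h₁ = h₁} {h₂} sh {j} _ with halves j
  ... | i , inj₁ refl = ≤-refl , subst₂ _≤_ (sym (mrg-even h₁ h₂ (suc i))) (sym (mrg-even h₁ h₂ i)) (row-dec (Shapes.dec₁ sh) i)
  ... | i , inj₂ refl = ≤-refl , subst₂ _≤_ (sym (mrg-odd h₁ h₂ (suc i))) (sym (mrg-odd h₁ h₂ i)) (row-dec (Shapes.dec₂ sh) i)

  Prod-pad : ∀ {f₁ f₂ h₁ h₂} → Shapes f₁ f₂ h₁ h₂ → ∀ α k → Prod f₁ f₂ h₁ h₂ α ≡ Prod f₁ f₂ h₁ h₂ (nz α ++ replicate k 0)
  Prod-pad {f₁} {f₂} {h₁} {h₂} sh α k = count-pad (mrg (row N f₁) (row N f₂)) (mrg-length f₁ f₂) α k (mrg (row N h₁) (row N h₂)) (shapes-box sh) (shapes-self sh)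

  open Swap n using (swapRow; negRow; length-swapRow; at-swapRow; at-negRow; par<w)

  sorted : ∀ f g → swapRow (negRow (mrg (row N f) (row N g))) (mrg (row N f) (row N g)) ≡ mrg (row N (λ j → f j ⊔ g j)) (row N (λ j → f j ⊓ g j))
  sorted f g = row-ext (trans (length-swapRow (negRow r) r) (sym (mrg-length (λ j → f j ⊔ g j) (λ j → f j ⊓ g j)))) (λ {j} l → entry j (subst (j <_) (length-swapRow (negRow r) r) l) (halves j))
    where
    r = mrg (row N f) (row N g)
    even : ∀ {i} → i < N → at r (dbl i) ≡ f i
    even {i} l = trans (mrg-even f g i) (at-row N f l)
    odd′ : ∀ {i} → i < N → at r (suc (dbl i)) ≡ g i
    odd′ {i} l = trans (mrg-odd f g i) (at-row N g l)
    neg : ∀ {i} → i < N → negAt (at r) (dbl i) ≡ indᴺ (f i <? g i)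
    neg {i} l = trans (negAt-even (at r) i) (cong₂ (λ x y → indᴺ (x <? y)) (even l) (odd′ l))
    entry : ∀ j → j < dbl N → (∃ λ i → j ≡ dbl i ⊎ j ≡ suc (dbl i)) → at (swapRow (negRow r) r) j ≡ at (mrg (row N (λ j → f j ⊔ g j)) (row N (λ j → f j ⊓ g j))) j
    entry j l (i , inj₁ refl) = trans (at-swapRow (negRow r) r l) (trans
      (cong₂ (λ x y → choose (x ≟ 1) y (at r (dbl i))) (trans (at-negRow r l) (neg i<N)) (trans (cong (at r) (par-even i)) (odd′ i<N)))
      (trans (cong (choose (indᴺ (f i <? g i) ≟ 1) (g i)) (even i<N)) (trans (choose-max (f i) (g i)) (sym (trans (mrg-even (λ j → f j ⊔ g j) (λ j → f j ⊓ g j) i) (at-row N (λ j → f j ⊔ g j) i<N))))))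
      where i<N = dbl-cancel l
    entry j l (i , inj₂ refl) = trans (at-swapRow (negRow r) r l) (trans
      (cong₂ (λ x y → choose (x ≟ 1) y (at r (suc (dbl i)))) (trans (at-negRow r l) (trans (trans (cong (negAt (at r)) (sym (par-even i))) (negAt-par (at r) (dbl i))) (neg i<N)))
        (trans (cong (at r) (trans (cong par (sym (par-even i))) (par-par (dbl i)))) (even i<N)))
      (trans (cong (choose (indᴺ (f i <? g i) ≟ 1) (f i)) (odd′ i<N)) (trans (choose-min (f i) (g i)) (sym (trans (mrg-odd (λ j → f j ⊔ g j) (λ j → f j ⊓ g j) i) (at-row N (λ j → f j ⊓ g j) i<N))))))
      where
      i<N : i < N
      i<N = dbl-cancel (<-trans (n<1+n (dbl i)) l)

  schur-count : ∀ m κ → length κ ≡ m → ∀ α → schur κ α ≡ schurCount m κ α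
  schur-count m κ lκ α = trans (sstCount-tab m κ (≤-reflexive lκ) α [] (λ _ _ → refl)) (trans (cong₂ (λ e s → tab m e s α) full zeros) (sym (count-str m κ α (top 0 κ))))
    where
    full : pad m κ ≡ κ
    full = row-ext (trans (length-row m (at κ)) (sym lκ)) (λ {j} l → at-row m (at κ) (subst (j <_) (length-row m (at κ)) l))
    zeros : pad m [] ≡ top 0 κ
    zeros = row-ext (trans (length-row m (at [])) (sym (trans (length-top 0 κ) lκ)))
      (λ {j} l → trans (at-row m (at []) (subst (j <_) (length-row m (at [])) l)) (sym (at-top-≥ {0} κ z≤n)))

  schurCount-pad : ∀ m κ → length κ ≡ m → ∀ α k → schurCount m κ α ≡ schurCount m κ (nz α ++ replicate k 0)
  schurCount-pad m κ lκ α k = count-pad (str κ) (length-cong-str {κ} lκ) α k (str (top 0 κ))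
    (trans (length-str (top 0 κ)) (trans (cong dbl (length-top 0 κ)) (sym (length-str κ))) , λ j → ≤-trans (≤-reflexive (zero-str κ j)) z≤n)
    (λ {j} _ → ≤-refl , ≤-trans (≤-reflexive (zero-str κ (2 + j))) z≤n)

  meet-join : ∀ f₁ f₂ h₁ h₂ → Shapes f₁ f₂ h₁ h₂ →
    SchurNonneg (Prod (λ j → f₁ j ⊔ f₂ j) (λ j → f₁ j ⊓ f₂ j) (λ j → h₁ j ⊔ h₂ j) (λ j → h₁ j ⊓ h₂ j) -ˢ Prod f₁ f₂ h₁ h₂)
  meet-join f₁ f₂ h₁ h₂ sh = nonneg-intro (parts mult bx) (parts-partitions mult bx) (λ α → trans (all-weights α) (sym (parts-sum α (Enumerates.sound (box-enumerates M.E.bx)))))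
    where
    open ≡-Reasoning
    s = mrg (row N h₁) (row N h₂)
    e = mrg (row N f₁) (row N f₂)
    -- Enough letters for both pairs of shapes: a weight with more than `suc m₀` nonzero entries
    -- exceeds the size of every shape involved, so all its coefficients are zero.
    m₀ = sum e + sum (swapRow (negRow e) e)
    m = suc m₀
    module M = MeetJoin n s e (mrg-length h₁ h₂) (mrg-length f₁ f₂) m₀
    bx = box M.E.bx
    mult = M.E.mult
    F⁺ = Prod (λ j → f₁ j ⊔ f₂ j) (λ j → f₁ j ⊓ f₂ j) (λ j → h₁ j ⊔ h₂ j) (λ j → h₁ j ⊓ h₂ j)
    F⁻ = Prod f₁ f₂ h₁ h₂

    plus : ∀ α → count (dbl N) M.e⁺ M.s⁺ α ≡ F⁺ α
    plus α = cong₂ (λ e s → count (dbl N) e s α) (sorted f₁ f₂) (sorted h₁ h₂)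

    bx-length : ∀ κ → InBox M.E.bx κ → length κ ≡ m
    bx-length κ ok = trans (proj₁ ok) (length-replicate m)

    long-zero : ∀ e s α → sum e < sum α → count (dbl N) e s α ≡ + 0
    long-zero e s α l = count-sum (dbl N) e α s (λ q → <⇒≱ l (≤-trans (m≤n+m (sum α) (sum s)) (≤-reflexive q)))

    all-weights : ∀ α → F⁺ α ⊟ F⁻ α ≡ ∑ bx (λ κ → mult κ ⊗ schurCount m κ α)
    all-weights α = by (length (nz α) ≤? m)
      where
      by : Dec (length (nz α) ≤ m) → F⁺ α ⊟ F⁻ α ≡ ∑ bx (λ κ → mult κ ⊗ schurCount m κ α)
      by (yes l) = begin
        F⁺ α ⊟ F⁻ α ≡⟨ cong₂ _⊟_ (trans (Prod-pad (shapes-sort sh) α k) (sym (plus α′))) (Prod-pad sh α k) ⟩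
        count (dbl N) M.e⁺ M.s⁺ α′ ⊟ F⁻ α′ ≡⟨ M.difference α′ lα′ ⟩
        ∑ bx (λ κ → mult κ ⊗ schurCount m κ α′)
          ≡⟨ ∑-cong-All (Enumerates.sound (box-enumerates M.E.bx)) (λ κ ok → cong (mult κ ⊗_) (sym (schurCount-pad m κ (bx-length κ ok) α k))) ⟩
        ∑ bx (λ κ → mult κ ⊗ schurCount m κ α) ∎
        where
        k = m ∸ length (nz α)
        α′ = nz α ++ replicate k 0
        lα′ : length α′ ≡ m
        lα′ = trans (length-++ (nz α)) (trans (cong (λ t → length (nz α) + t) (length-replicate k)) (m+[n∸m]≡n l))
      by (no ¬l) = begin
        F⁺ α ⊟ F⁻ α ≡⟨ cong₂ _⊟_ (trans (sym (plus α)) (long-zero M.e⁺ M.s⁺ α (≤-<-trans (m≤n+m _ (sum e)) big))) (long-zero e s α (≤-<-trans (m≤m+n (sum e) _) big)) ⟩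
        + 0 ≡⟨ sym (∑-zero bx (λ _ → refl)) ⟩
        ∑ bx (λ _ → + 0) ≡⟨ ∑-cong bx (λ κ → sym (vanish κ (M.E.mult-support κ))) ⟩
        ∑ bx (λ κ → mult κ ⊗ schurCount m κ α) ∎
        where
        big : m₀ < sum α
        big = ≤-trans (≤-trans (n≤1+n m) (≰⇒> ¬l)) (length-nz α)
        vanish : ∀ κ → mult κ ≡ + 0 ⊎ (IsPartition κ × sum κ ≤ M.E.B) → mult κ ⊗ schurCount m κ α ≡ + 0
        vanish κ (inj₁ z) = trans (cong (_⊗ schurCount m κ α) z) (⊗-zeroˡ _)
        vanish κ (inj₂ (_ , l)) = trans (cong (mult κ ⊗_) (count-sum (dbl m) (str κ) α (str (top 0 κ))
          (λ q → <⇒≱ big (≤-trans (≤-trans (m≤n+m (sum α) _) (≤-reflexive (trans q (sum-str κ)))) (≤-trans l (m≤n+m _ (sum e))))))) (⊗-zeroʳ _)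

    mult-nat : ∀ κ → IsNat (mult κ)
    mult-nat κ = nat-∑ (arrays M.e⁺ m) (λ z → nat-⊗ (nat-⊗ (nat-⊗ (nat-ind (M.X.valid? z)) (nat-ind (¬? (M.separable? (M.s⁺ ∷ z))))) (nat-ind (M.X.lattice? z))) (nat-ind (M.X.wt z ≟ᴿ κ)))

    parts-sum : ∀ α {ks} → All (InBox M.E.bx) ks → schurSum (parts mult ks) α ≡ ∑ ks (λ κ → mult κ ⊗ schurCount m κ α)
    parts-sum α [] = refl
    parts-sum α {κ ∷ ks} (ok ∷ oks) = by (isPartition? κ)
      where
      by : Dec (IsPartition κ) → schurSum (parts mult (κ ∷ ks)) α ≡ ∑ (κ ∷ ks) (λ κ → mult κ ⊗ schurCount m κ α)
      by (yes p) = trans (cong (λ l → schurSum l α) (choose-yes (isPartition? κ) p)) (cong₂ _⊕_ (cong₂ _⊗_ (nat-abs (mult-nat κ)) (schur-count m κ (bx-length κ ok) α)) (parts-sum α oks))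
      by (no ¬p) = trans (cong (λ l → schurSum l α) (choose-no (isPartition? κ) ¬p)) (trans (parts-sum α oks) (sym (trans (cong (_⊕ _) (zero-term (M.E.mult-support κ))) (ℤₚ.+-identityˡ _))))
        where
        zero-term : mult κ ≡ + 0 ⊎ (IsPartition κ × sum κ ≤ M.E.B) → mult κ ⊗ schurCount m κ α ≡ + 0
        zero-term (inj₁ z)       = trans (cong (_⊗ schurCount m κ α) z) (⊗-zeroˡ _)
        zero-term (inj₂ (p , _)) = ⊥-elim (¬p p)

  private
    -- The terminal case of the halving: two numbers differing by at most one are the two halves of
    -- their sum.
    half-close : ∀ {x y} → x ≤ y → y ≤ 1 + x → ⌈ y + x /2⌉ ≡ y × ⌊ y + x /2⌋ ≡ x
    half-close {x} {y} l h with m≤n⇒m<n∨m≡n l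
    ... | inj₂ refl = sym (n≡⌈n+n/2⌉ x) , sym (n≡⌊n+n/2⌋ x)
    ... | inj₁ x<y with ≤-antisym h x<y
    ...   | refl = cong suc (sym (n≡⌊n+n/2⌋ x)) , sym (n≡⌈n+n/2⌉ x)

    ⊔≤⊓ : ∀ c x y → x ≤ c + y → y ≤ c + x → x ⊔ y ≤ c + (x ⊓ y)
    ⊔≤⊓ c x y p q with ≤-total x y
    ... | inj₁ l = subst₂ (λ a b → a ≤ c + b) (sym (m≤n⇒m⊔n≡n l)) (sym (m≤n⇒m⊓n≡m l)) q
    ... | inj₂ l = subst₂ (λ a b → a ≤ c + b) (sym (m≥n⇒m⊔n≡m l)) (sym (m≥n⇒m⊓n≡n l)) p

  -- Shifting the second shape by half of the largest difference and sorting halves that difference.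
  halving : ∀ fuel M → M ≤ fuel → ∀ f₁ f₂ h₁ h₂ → Shapes f₁ f₂ h₁ h₂ →
    (∀ j → f₂ j ≤ f₁ j × f₁ j ≤ M + f₂ j) → (∀ j → h₂ j ≤ h₁ j × h₁ j ≤ M + h₂ j) →
    SchurNonneg (Halved (λ j → f₁ j + f₂ j) (λ j → h₁ j + h₂ j) -ˢ Prod f₁ f₂ h₁ h₂)
  halving fuel zero    _ f₁ f₂ h₁ h₂ sh df dh = nonneg-refl (Prod-cong (λ j → proj₁ (c df j)) (λ j → proj₂ (c df j)) (λ j → proj₁ (c dh j)) (λ j → proj₂ (c dh j)))
    where
    c : ∀ {f₁ f₂ : ℕ → ℕ} → (∀ j → f₂ j ≤ f₁ j × f₁ j ≤ f₂ j) → ∀ j → ⌈ f₁ j + f₂ j /2⌉ ≡ f₁ j × ⌊ f₁ j + f₂ j /2⌋ ≡ f₂ j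
    c d j = half-close (proj₁ (d j)) (≤-trans (proj₂ (d j)) (n≤1+n _))
  halving fuel (suc zero) _ f₁ f₂ h₁ h₂ sh df dh = nonneg-refl (Prod-cong (λ j → proj₁ (c df j)) (λ j → proj₂ (c df j)) (λ j → proj₁ (c dh j)) (λ j → proj₂ (c dh j)))
    where
    c : ∀ {f₁ f₂ : ℕ → ℕ} → (∀ j → f₂ j ≤ f₁ j × f₁ j ≤ 1 + f₂ j) → ∀ j → ⌈ f₁ j + f₂ j /2⌉ ≡ f₁ j × ⌊ f₁ j + f₂ j /2⌋ ≡ f₂ j
    c d j = half-close (proj₁ (d j)) (proj₂ (d j))
  halving (suc fuel) (suc (suc M)) (s≤s le) f₁ f₂ h₁ h₂ sh df dh = nonneg-cong same
    (nonneg-trans {Halved (λ j → P f₁ f₂ j + Q f₁ f₂ j) (λ j → P h₁ h₂ j + Q h₁ h₂ j)} {Prod (P f₁ f₂) (Q f₁ f₂) (P h₁ h₂) (Q h₁ h₂)} {Prod f₁ (λ j → c + f₂ j) h₁ (λ j → c + h₂ j)}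
      (halving fuel c c≤ (P f₁ f₂) (Q f₁ f₂) (P h₁ h₂) (Q h₁ h₂) (shapes-sort sh′) (close df) (close dh))
      (meet-join f₁ (λ j → c + f₂ j) h₁ (λ j → c + h₂ j) sh′))
    where
    c : ℕ
    c = ⌈ 2 + M /2⌉
    -- For a difference of at least 2 the rounded-up half is strictly smaller, which is why the
    -- differences 0 and 1 are the base cases.
    c≤ : c ≤ fuel
    c≤ = ≤-trans (s≤s (⌈n/2⌉≤n M)) le
    P Q : (ℕ → ℕ) → (ℕ → ℕ) → ℕ → ℕ
    P f₁ f₂ j = f₁ j ⊔ (c + f₂ j)
    Q f₁ f₂ j = f₁ j ⊓ (c + f₂ j)
    open Shapes sh
    sh′ : Shapes f₁ (λ j → c + f₂ j) h₁ (λ j → c + h₂ j)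
    sh′ = record { dec₁ = dec₁ ; dec₂ = λ j → +-monoʳ-≤ c (dec₂ j) ; sub₁ = sub₁ ; sub₂ = λ j → +-monoʳ-≤ c (sub₂ j) }
    M≤2c : 2 + M ≤ c + c
    M≤2c = ≤-trans (≤-reflexive (sym (⌊n/2⌋+⌈n/2⌉≡n (2 + M)))) (+-monoˡ-≤ c (⌊n/2⌋≤⌈n/2⌉ (2 + M)))
    close : ∀ {f₁ f₂ : ℕ → ℕ} → (∀ j → f₂ j ≤ f₁ j × f₁ j ≤ 2 + M + f₂ j) → ∀ j → Q f₁ f₂ j ≤ P f₁ f₂ j × P f₁ f₂ j ≤ c + Q f₁ f₂ j
    close {f₁} {f₂} d j = ≤-trans (m⊓n≤m (f₁ j) _) (m≤m⊔n (f₁ j) _) ,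
      ⊔≤⊓ c (f₁ j) (c + f₂ j) (≤-trans (proj₂ (d j)) (≤-trans (+-monoˡ-≤ (f₂ j) M≤2c) (≤-reflexive (+-assoc c c (f₂ j))))) (+-monoʳ-≤ c (proj₁ (d j)))
    sums : ∀ f₁ f₂ j → P f₁ f₂ j + Q f₁ f₂ j ≡ c + (f₁ j + f₂ j)
    sums f₁ f₂ j = trans (⊔+⊓ (f₁ j) (c + f₂ j)) (trans (sym (+-assoc (f₁ j) c (f₂ j))) (trans (cong (_+ f₂ j) (+-comm (f₁ j) c)) (+-assoc c (f₁ j) (f₂ j))))
    same : ∀ α → (Halved (λ j → P f₁ f₂ j + Q f₁ f₂ j) (λ j → P h₁ h₂ j + Q h₁ h₂ j) -ˢ Prod f₁ (λ j → c + f₂ j) h₁ (λ j → c + h₂ j)) α ≡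
                 (Halved (λ j → f₁ j + f₂ j) (λ j → h₁ j + h₂ j) -ˢ Prod f₁ f₂ h₁ h₂) α
    same α = cong₂ _⊟_ (trans (Prod-cong (λ j → cong ⌈_/2⌉ (sums f₁ f₂ j)) (λ j → cong ⌊_/2⌋ (sums f₁ f₂ j)) (λ j → cong ⌈_/2⌉ (sums h₁ h₂ j)) (λ j → cong ⌊_/2⌋ (sums h₁ h₂ j)) α)
      (Halved-shift c (λ j → f₁ j + f₂ j) (λ j → h₁ j + h₂ j) α)) (Prod-shift c f₁ f₂ h₁ h₂ α)

  skew-product : ∀ la mu nu rho → length la ≤ N → Within-length N mu → length nu ≤ N → Within-length N rho →
    ∀ α → (skewSchur la mu *ˢ skewSchur nu rho) α ≡ Prod (at la) (at nu) (at mu) (at rho) α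
  skew-product la mu nu rho p q p′ q′ α = trans (foldr-∑ _ (box α)) (trans
    (∑-cong (box α) (λ β → trans (sym (⊗-def (+ sstCount la mu β) _)) (cong₂ _⊗_ (sstCount-tab N la p β mu q) (sstCount-tab N nu p′ (zipWith _∸_ α β) rho q′))))
    (as-product (at la) (at nu) (at mu) (at rho) α))

-- The shapes of the theorem as functions

at-map₀ : ∀ (f : ℕ → ℕ) → f 0 ≡ 0 → ∀ x j → at (map f x) j ≡ f (at x j)
at-map₀ f z []      j       = sym z
at-map₀ f z (x ∷ l) zero    = refl
at-map₀ f z (x ∷ l) (suc j) = at-map₀ f z l j

at-addPad : ∀ x y j → at (addPad x y) j ≡ at x j + at y j
at-addPad []      y       j       = refl
at-addPad (x ∷ a) []      j       = sym (+-identityʳ _)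
at-addPad (x ∷ a) (y ∷ b) zero    = refl
at-addPad (x ∷ a) (y ∷ b) (suc j) = at-addPad a b j

length-addPad : ∀ x y → length (addPad x y) ≤ length x + length y
length-addPad []      y       = ≤-refl
length-addPad (x ∷ a) []      = ≤-reflexive (sym (+-identityʳ _))
length-addPad (x ∷ a) (y ∷ b) = s≤s (≤-trans (length-addPad a b) (+-monoʳ-≤ (length a) (n≤1+n _)))

theorem4p1 : (la mu nu rho : List ℕ) →
    IsPartition la → IsPartition mu → IsPartition nu → IsPartition rho →
    Contained mu la → Contained rho nu →
    SchurNonneg
    ((skewSchur (floorHalf la nu) (floorHalf mu rho) *ˢ skewSchur (ceilHalf la nu) (ceilHalf mu rho))
    -ˢ (skewSchur la mu *ˢ skewSchur nu rho))
theorem4p1 la mu nu rho _ pmu _ prho cmu crho = nonneg-cong same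
  -- A first sorting makes the differences nonnegative, as `halving` assumes; the half sums do not
  -- change because maximum and minimum have the same sum as the two numbers.
  (nonneg-trans {Halved (λ j → (x j ⊔ y j) + (x j ⊓ y j)) (λ j → (s j ⊔ t j) + (s j ⊓ t j))} {Prod (λ j → x j ⊔ y j) (λ j → x j ⊓ y j) (λ j → s j ⊔ t j) (λ j → s j ⊓ t j)} {Prod x y s t}
    (halving M M ≤-refl (λ j → x j ⊔ y j) (λ j → x j ⊓ y j) (λ j → s j ⊔ t j) (λ j → s j ⊓ t j) (shapes-sort shapes)
      (λ j → ≤-trans (m⊓n≤m (x j) _) (m≤m⊔n (x j) _) , ≤-trans (bound j) (m≤m+n M _))
      (λ j → ≤-trans (m⊓n≤m (s j) _) (m≤m⊔n (s j) _) , ≤-trans (≤-trans (⊔-mono-≤ (cmu j) (crho j)) (bound j)) (m≤m+n M _)))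
    (meet-join x y s t shapes))
  where
  -- This number of rows accommodates each shape as well as the lists of half sums, whose length is
  -- bounded only through `length-addPad`.
  open Rows (length la + length nu)
  x y s t : ℕ → ℕ
  x = at la
  y = at nu
  s = at mu
  t = at rho
  M : ℕ
  M = sum la + sum nu
  shapes : Shapes x y s t
  shapes = record { dec₁ = pmu ; dec₂ = prho ; sub₁ = cmu ; sub₂ = crho }
  bound : ∀ j → x j ⊔ y j ≤ M
  bound j = ⊔-lub (≤-trans (at≤sum la j) (m≤m+n (sum la) _)) (≤-trans (at≤sum nu j) (m≤n+m (sum nu) (sum la)))
  la≤ : length la ≤ N
  la≤ = ≤-trans (m≤m+n (length la) (length nu)) (n≤1+n _)
  nu≤ : length nu ≤ N
  nu≤ = ≤-trans (m≤n+m (length nu) (length la)) (n≤1+n _)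
  mu-in : Within-length N mu
  mu-in j l = n≤0⇒n≡0 (≤-trans (cmu j) (≤-reflexive (within-longer la la≤ j l)))
  rho-in : Within-length N rho
  rho-in j l = n≤0⇒n≡0 (≤-trans (crho j) (≤-reflexive (within-longer nu nu≤ j l)))
  half-in : ∀ (f : ℕ → ℕ) → f 0 ≡ 0 → Within-length N (map f (addPad mu rho))
  half-in f z j l = trans (at-map₀ f z (addPad mu rho) j) (trans (cong f (trans (at-addPad mu rho j) (cong₂ _+_ (mu-in j l) (rho-in j l)))) z)
  half≤ : ∀ (f : ℕ → ℕ) → length (map f (addPad la nu)) ≤ N
  half≤ f = ≤-trans (≤-reflexive (length-map f (addPad la nu))) (≤-trans (length-addPad la nu) (n≤1+n _))
  half-at : ∀ (f : ℕ → ℕ) → f 0 ≡ 0 → ∀ p q j → at (map f (addPad p q)) j ≡ f (at p j + at q j)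
  half-at f z p q j = trans (at-map₀ f z (addPad p q) j) (cong f (at-addPad p q j))
  halves-eq : ∀ (f : ℕ → ℕ) → f 0 ≡ 0 → ∀ p q j → f ((at p j ⊔ at q j) + (at p j ⊓ at q j)) ≡ at (map f (addPad p q)) j
  halves-eq f z p q j = trans (cong f (⊔+⊓ (at p j) (at q j))) (sym (half-at f z p q j))
  same : ∀ α → (Halved (λ j → (x j ⊔ y j) + (x j ⊓ y j)) (λ j → (s j ⊔ t j) + (s j ⊓ t j)) -ˢ Prod x y s t) α ≡
    ((skewSchur (floorHalf la nu) (floorHalf mu rho) *ˢ skewSchur (ceilHalf la nu) (ceilHalf mu rho)) -ˢ (skewSchur la mu *ˢ skewSchur nu rho)) α
  same α = cong₂ _⊟_
    (trans (Prod-cong (halves-eq ⌈_/2⌉ refl la nu) (halves-eq ⌊_/2⌋ refl la nu) (halves-eq ⌈_/2⌉ refl mu rho) (halves-eq ⌊_/2⌋ refl mu rho) α)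
      -- `Halved` lists the ceilings first, the theorem the floors.
      (trans (Prod-swap (at (ceilHalf la nu)) (at (floorHalf la nu)) (at (ceilHalf mu rho)) (at (floorHalf mu rho)) α)
        (sym (skew-product (floorHalf la nu) (floorHalf mu rho) (ceilHalf la nu) (ceilHalf mu rho) (half≤ ⌊_/2⌋) (half-in ⌊_/2⌋ refl) (half≤ ⌈_/2⌉) (half-in ⌈_/2⌉ refl) α))))
    (sym (skew-product la mu nu rho la≤ mu-in nu≤ rho-in α))
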